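{- Let $\mathsf{D}=(D_n)_{n\ge1}$ be a minimal regular elliptic divisibility sequence associated to the elliptic curve $E/\mathbb{Q}$ and the point $P\in E(\mathbb{Q})$. \begin{itemize} \item[(a)] If $n\in\mathcal{S}(\mathsf{D})$, $p$ is a prime and $p\mid D_n$, then $(n\to np)\in\operatorname{Arr}(\mathsf{D})$. \item[(b)] If $n\in\mathcal{S}(\mathsf{D})$, $d$ is an aliquot number for $\mathsf{D}$ (i.e. $d\in\mathcal{A}(\mathsf{D})$) and $\gcd(n,d)=1$, then $(n\to nd)\in\operatorname{Arr}(\mathsf{D})$. \item[(c)] If $p\ge 7$ is a prime of good reduction for $E$ and $(n\to np)\in\operatorname{Arr}(\mathsf{D})$, then either $p\mid D_n$ or $p$ is an aliquot number for $\mathsf{D}$. \item[(d)] Suppose $\gcd(n,d)=1$, $(n\to nd)\in\operatorname{Arr}(\mathsf{D})$, and $d=p_1p_2\cdots p_\ell$ is a product of $\ell\ge2$ distinct primes of good reduction for $E$ satisfying $\min_i p_i>\bigl(2^{ -1/(2\ell)}-1\bigr)^{ -2}$. Then $d$ is an aliquot number for $\mathsf{D}$. \end{itemize}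
   Context: Let $E/\mathbb{Q}$ be an elliptic curve given by a Weierstrass equation with integer coefficients and let $P\in E(\mathbb{Q})$ be a point of infinite order. The elliptic divisibility sequence (EDS) $\mathsf{D}=(D_n)_{n\ge1}$ associated to $(E,P)$ is the sequence of positive integers obtained by writing $x([n]P)=A_n/D_n^2$ as a fraction in lowest terms. It is minimal if the Weierstrass equation is a global minimal Weierstrass equation; $\operatorname{Disc}(E)$ denotes the minimal discriminant. For a prime $p$, $E_{\mathrm{ns}}(\mathbb{F}_p)$ denotes the group of nonsingular points of the reduction of $E$ modulo $p$, and "$P\in E_{\mathrm{ns}}(\mathbb{F}_p)$" means that $P$ reduces to a nonsingular point modulo $p$. For $n\ge1$ the rank of apparition is $r_n=\min\{r\ge1: n\mid D_r\}$. Regularity: $\mathsf{D}$ is called $2$-irregular if all of the following hold: (I1) $E$ has good reduction at $2$; (I2) $\#E(\mathbb{F}_2)=4$; (I3) $r_2=4$; (I4) $D_2$ is odd; (I5) $\operatorname{ord}_2(D_4)=1$. Otherwise $\mathsf{D}$ is $2$-regular. $\mathsf{D}$ is regular if it is $2$-regular and $P\in E_{\mathrm{ns}}(\mathbb{F}_p)$ for every prime $p\mid\operatorname{Disc}(E)$. Index divisibility graph: $\mathcal{S}(\mathsf{D})=\{n\ge1: n\mid D_n\}$. The arrow set $\operatorname{Arr}(\mathsf{D})$ consists of pairs $(n\to m)$ with $n,m\in\mathcal{S}(\mathsf{D})$, $n\mid m$, $n\ne m$, such that there is no $k\in\mathcal{S}(\mathsf{D})$ with $n\mid k\mid m$ other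 than $k=n$ and $k=m$. Aliquot cycles: an aliquot cycle for $\mathsf{D}$ is a tuple $(p_1,\dots,p_\ell)$, $\ell\ge1$, of distinct primes of good reduction for $E$ with $r_{p_i}=p_{i+1}$ for all $1\le i\le\ell$, where $p_{\ell+1}=p_1$. The set of aliquot numbers is $\mathcal{A}(\mathsf{D})=\{p_1\cdots p_\ell:(p_1,\dots,p_\ell)\text{ an aliquot cycle for }\mathsf{D}\}$. -}

module Defs where

open import Data.Nat as N using (ℕ; zero; suc; _≤_; _<_; _≥_; _^_)
open import Data.Nat.Divisibility using (_∣_)
open import Data.Nat.Primality using (Prime)
open import Data.Nat.GCD using (gcd)
open import Data.Integer as Z using (ℤ; +_; ∣_∣)
open import Data.Rational as Q using (ℚ; 0ℚ; 1ℚ)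
open import Data.Rational.Properties as QP using ()
open import Data.Fin as Fin using (Fin)
open import Data.Maybe using (Maybe; just; nothing)
open import Data.Product using (_×_; _,_; Σ; ∃; ∃-syntax)
open import Data.Sum using (_⊎_)
open import Data.Bool using (Bool; true; false; if_then_else_)
open import Function.Definitions using (Injective)
open import Relation.Nullary using (¬_; yes; no; Dec)
open import Relation.Nullary.Decidable using (⌊_⌋)
open import Relation.Binary.PropositionalEquality using (_≡_; _≢_)

-- Weierstrass equations with integer coefficients
--   y² + a₁xy + a₃y = x³ + a₂x² + a₄x + a₆

record Weierstrass : Set where
  constructor mkW
  field
    a₁ a₂ a₃ a₄ a₆ : ℤ

open Weierstrass public

-- discriminant (standard formulas, Silverman III.1)
disc : Weierstrass → ℤ
disc E = Z.- (b₂ Z.* b₂ Z.* b₈) Z.- Z.+ 8 Z.* b₄ Z.* b₄ Z.* b₄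
         Z.- Z.+ 27 Z.* b₆ Z.* b₆ Z.+ Z.+ 9 Z.* b₂ Z.* b₄ Z.* b₆
  where
  open Z using (_+_; _*_; _-_)
  A1 = a₁ E ; A2 = a₂ E ; A3 = a₃ E ; A4 = a₄ E ; A6 = a₆ E
  b₂ = A1 * A1 + + 4 * A2
  b₄ = + 2 * A4 + A1 * A3
  b₆ = A3 * A3 + + 4 * A6
  b₈ = A1 * A1 * A6 + + 4 * A2 * A6 - A1 * A3 * A4 + A2 * A3 * A3 - A4 * A4

IsElliptic : Weierstrass → Set
IsElliptic E = disc E ≢ Z.0ℤ

toℚ : ℤ → ℚ
toℚ z = z Q./ 1

_^ℚ_ : ℚ → ℕ → ℚ
q ^ℚ zero = 1ℚ
q ^ℚ suc n = q Q.* (q ^ℚ n)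

infixr 8 _^ℚ_

-- total inverse (only ever used at nonzero arguments below)
inv : ℚ → ℚ
inv q with q QP.≟ 0ℚ
... | yes _ = 0ℚ
... | no q≢0 = Q.1/_ q {{Q.≢-nonZero q≢0}}

-- Points of E(ℚ): nothing = point at infinity O, just (x , y) = affine

Point : Set
Point = Maybe (ℚ × ℚ)

weierF : Weierstrass → ℚ → ℚ → ℚ
weierF E x y = y * y + A1 * x * y + A3 * y - x * x * x - A2 * x * x - A4 * x - A6
  where
  open Q using (_+_; _*_; _-_)
  A1 = toℚ (a₁ E) ; A2 = toℚ (a₂ E) ; A3 = toℚ (a₃ E)
  A4 = toℚ (a₄ E) ; A6 = toℚ (a₆ E)

OnCurve : Weierstrass → ℚ → ℚ → Set
OnCurve E x y = weierF E x y ≡ 0ℚ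

Fx : Weierstrass → ℚ → ℚ → ℚ
Fx E x y = toℚ (a₁ E) * y - toℚ (+ 3) * x * x - toℚ (+ 2) * toℚ (a₂ E) * x - toℚ (a₄ E)
  where open Q using (_*_; _-_)

Fy : Weierstrass → ℚ → ℚ → ℚ
Fy E x y = toℚ (+ 2) * y + toℚ (a₁ E) * x + toℚ (a₃ E)
  where open Q using (_*_; _+_)

-- the group law (Silverman III.2.3)
addPt : Weierstrass → Point → Point → Point
addPt E nothing Q₂ = Q₂
addPt E (just P₁) nothing = just P₁
addPt E (just (x₁ , y₁)) (just (x₂ , y₂)) with x₁ QP.≟ x₂
... | no _ = result ((y₂ - y₁) * inv (x₂ - x₁))
                    ((y₁ * x₂ - y₂ * x₁) * inv (x₂ - x₁))
  where
  open Q using (_+_; _*_; _-_; -_)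
  result : ℚ → ℚ → Point
  result λ' ν = let x₃ = λ' * λ' + toℚ (a₁ E) * λ' - toℚ (a₂ E) - x₁ - x₂
                in just (x₃ , (- (λ' + toℚ (a₁ E)) * x₃ - ν - toℚ (a₃ E)))
... | yes _ with (y₁ + y₂ + toℚ (a₁ E) * x₂ + toℚ (a₃ E)) QP.≟ 0ℚ
  where open Q using (_+_; _*_)
...   | yes _ = nothing
...   | no _ = result
          ((toℚ (+ 3) * x₁ * x₁ + toℚ (+ 2) * toℚ (a₂ E) * x₁ + toℚ (a₄ E) - toℚ (a₁ E) * y₁)
             * inv (toℚ (+ 2) * y₁ + toℚ (a₁ E) * x₁ + toℚ (a₃ E)))
          ((- (x₁ * x₁ * x₁) + toℚ (a₄ E) * x₁ + toℚ (+ 2) * toℚ (a₆ E) - toℚ (a₃ E) * y₁)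
             * inv (toℚ (+ 2) * y₁ + toℚ (a₁ E) * x₁ + toℚ (a₃ E)))
  where
  open Q using (_+_; _*_; _-_; -_)
  result : ℚ → ℚ → Point
  result λ' ν = let x₃ = λ' * λ' + toℚ (a₁ E) * λ' - toℚ (a₂ E) - x₁ - x₁
                in just (x₃ , (- (λ' + toℚ (a₁ E)) * x₃ - ν - toℚ (a₃ E)))

mulPt : Weierstrass → ℕ → Point → Point
mulPt E zero    P = nothing
mulPt E (suc n) P = addPt E P (mulPt E n P)

InfiniteOrder : Weierstrass → Point → Set
InfiniteOrder E P = ∀ n → 1 ≤ n → mulPt E n P ≢ nothing

-- Global minimality: among all integral Weierstrass equations that are
-- Q-isomorphic to E (via x = u²x' + r, y = u³y' + su²x' + t), E has
-- the smallest |Δ|.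

-- E' is obtained from E by the change of variables (u, r, s, t), u ≠ 0
-- (transformation formulas, Silverman Table 3.1)
IsoVia : Weierstrass → Weierstrass → ℚ → ℚ → ℚ → ℚ → Set
IsoVia E E' u r s t =
  (u ≢ 0ℚ) ×
  (u * A1' ≡ A1 + toℚ (+ 2) * s) ×
  (u ^ℚ 2 * A2' ≡ A2 - s * A1 + toℚ (+ 3) * r - s * s) ×
  (u ^ℚ 3 * A3' ≡ A3 + r * A1 + toℚ (+ 2) * t) ×
  (u ^ℚ 4 * A4' ≡ A4 - s * A3 + toℚ (+ 2) * r * A2 - (t + r * s) * A1
                   + toℚ (+ 3) * r * r - toℚ (+ 2) * s * t) ×
  (u ^ℚ 6 * A6' ≡ A6 + r * A4 + r * r * A2 + r * r * r - t * A3 - t * t - r * t * A1)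
  where
  open Q using (_+_; _*_; _-_)
  A1 = toℚ (a₁ E) ; A2 = toℚ (a₂ E) ; A3 = toℚ (a₃ E)
  A4 = toℚ (a₄ E) ; A6 = toℚ (a₆ E)
  A1' = toℚ (a₁ E') ; A2' = toℚ (a₂ E') ; A3' = toℚ (a₃ E')
  A4' = toℚ (a₄ E') ; A6' = toℚ (a₆ E')

IsGlobalMinimal : Weierstrass → Set
IsGlobalMinimal E = ∀ (E' : Weierstrass) (u r s t : ℚ) →
  IsoVia E E' u r s t → ∣ disc E ∣ ≤ ∣ disc E' ∣

-- good reduction at p (E minimal, so Disc(E) = disc E)
GoodReduction : Weierstrass → ℕ → Set
GoodReduction E p = ¬ (p ∣ ∣ disc E ∣)

-- p divides the rational q (q ∈ ℤ_(p) assumed): p divides its numerator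
_∣ℚ_ : ℕ → ℚ → Set
p ∣ℚ q = p ∣ ∣ ℚ.numerator q ∣

-- P reduces to a nonsingular point of E mod p.  If p divides the
-- denominator of x(P), P reduces to O (nonsingular); otherwise x, y are
-- p-integral and the reduction is singular iff both partials vanish mod p.
NonsingularMod : Weierstrass → ℕ → Point → Set
NonsingularMod E p nothing = Data.Unit.⊤
  where import Data.Unit
NonsingularMod E p (just (x , y)) =
  (p ∣ ℚ.denominatorℕ x) ⊎ ¬ ((p ∣ℚ Fx E x y) × (p ∣ℚ Fy E x y))

-- #E(F₂) for a curve with good reduction at 2: affine points of
-- {0,1}² on the equation mod 2, plus the point at infinity.
weierℤ : Weierstrass → ℤ → ℤ → ℤ
weierℤ E x y = y * y + a₁ E * x * y + a₃ E * y - x * x * x - a₂ E * x * x - a₄ E * x - a₆ E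
  where open Z using (_+_; _*_; _-_)

isZeroMod2 : ℤ → ℕ
isZeroMod2 z with ∣ z ∣ N.% 2
... | zero = 1
... | suc _ = 0

countF₂ : Weierstrass → ℕ
countF₂ E = 1 N.+ f (+ 0) (+ 0) N.+ f (+ 0) (+ 1) N.+ f (+ 1) (+ 0) N.+ f (+ 1) (+ 1)
  where f : ℤ → ℤ → ℕ
        f x y = isZeroMod2 (weierℤ E x y)

IsEDS : Weierstrass → Point → (ℕ → ℕ) → Set
IsEDS E P D = ∀ n x y → 1 ≤ n → mulPt E n P ≡ just (x , y) →
  ℚ.denominatorℕ x ≡ D n N.* D n

IsRank : (ℕ → ℕ) → ℕ → ℕ → Set
IsRank D n r = (1 ≤ r) × (n ∣ D r) × (∀ k → 1 ≤ k → k < r → ¬ (n ∣ D k))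

TwoIrregular : Weierstrass → (ℕ → ℕ) → Set
TwoIrregular E D =
  GoodReduction E 2 × (countF₂ E ≡ 4) × IsRank D 2 4 ×
  (¬ (2 ∣ D 2)) × ((2 ∣ D 4) × ¬ (4 ∣ D 4))

Regular : Weierstrass → Point → (ℕ → ℕ) → Set
Regular E P D = (¬ TwoIrregular E D) ×
  (∀ p → Prime p → p ∣ ∣ disc E ∣ → NonsingularMod E p P)

InS : (ℕ → ℕ) → ℕ → Set
InS D n = (1 ≤ n) × (n ∣ D n)

Arrow : (ℕ → ℕ) → ℕ → ℕ → Set
Arrow D n m = InS D n × InS D m × (n ∣ m) × (n ≢ m) ×
  (∀ k → InS D k → n ∣ k → k ∣ m → (k ≡ n) ⊎ (k ≡ m))

cnext : ∀ {k} → Fin (suc k) → Fin (suc k)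
cnext {k} i with Fin.toℕ i N.<? k
... | yes i<k = Fin.fromℕ< (N.s≤s i<k)
... | no _    = Fin.zero

prodFin : ∀ {ℓ} → (Fin ℓ → ℕ) → ℕ
prodFin {zero}  f = 1
prodFin {suc ℓ} f = f Fin.zero N.* prodFin (λ i → f (Fin.suc i))

AliquotCycle : Weierstrass → (ℕ → ℕ) → ∀ {k} → (Fin (suc k) → ℕ) → Set
AliquotCycle E D p = Injective _≡_ _≡_ p ×
  (∀ i → Prime (p i)) × (∀ i → GoodReduction E (p i)) ×
  (∀ i → IsRank D (p i) (p (cnext i)))

AliquotNumber : Weierstrass → (ℕ → ℕ) → ℕ → Set
AliquotNumber E D d = ∃[ k ] Σ (Fin (suc k) → ℕ) λ p →
  AliquotCycle E D p × (d ≡ prodFin p)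

-- min p_i > (2^{-1/(2ℓ)} − 1)^{-2}, for a natural p and ℓ ≥ 1.
-- Writing s = √p this is (1 − 1/s)^{2ℓ} > 1/2, i.e. s^{2ℓ} < 2(s−1)^{2ℓ};
-- as s ↦ (1 − 1/s)^{2ℓ} is continuous and increasing on s > 1, this holds
-- iff there is a rational a/b (a, b ∈ ℕ) with 1 < a/b ≤ √p and
-- (a/b)^{2ℓ} < 2(a/b − 1)^{2ℓ}.
AboveBound : ℕ → ℕ → Set
AboveBound ℓ p = ∃[ a ] ∃[ b ] (b < a) × (a N.* a ≤ p N.* (b N.* b)) ×
  (a ^ (2 N.* ℓ) < 2 N.* (a N.∸ b) ^ (2 N.* ℓ))

{-# OPTIONS --safe #-}
-- On integral coordinate vectors primitive at p, translation by P is given near each point by one of three homogeneous polynomial laws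
-- (a chord law and two tangent laws), so it respects congruence modulo p^k up to units. Hence p^k ∣ D_r makes D periodic modulo p^k,
-- without any appeal to associativity. If p^k ∣ D_n, the vectors of −nP, O and nP form an arithmetic progression modulo p^(k+1) whose terms
-- agree modulo p^k; polynomial laws preserve such progressions, so the coordinate of jnP vanishing at O is j times that of nP,
-- and p^(k+1) ∣ D_(pn). This gives (a) and (b).
-- The Hasse bound for the rank r of an odd prime p, n(r − 1) ≤ p + np + n² for all n, follows Manin: starting from the Frobenius point with x = T^p on the quadratic
-- twist of the curve over 𝔽_p(T), the heights of the points Frobenius + n(T, 1) satisfy a convexity inequality.
-- For (c) it gives r < 2p. For (d), following a prime factor of each rank yields a cycle among the p_i; the Hasse bounds multiplied along it
-- leave no room for cofactors, so it is an aliquot cycle, and by (b) and minimality of the arrow it exhausts d.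
module Submission where

open import Level using (0ℓ)
open import Algebra.Bundles using (CommutativeRing; RawRing)
import Algebra.Properties.CommutativeSemiring.Binomial as Binom
import Algebra.Properties.CommutativeSemiring.Exp as CExp
import Algebra.Properties.Ring as RingP
import Algebra.Properties.Semiring.Exp as Exp
import Algebra.Properties.Semiring.Mult as Mult
import Algebra.Properties.Semiring.Sum as Sum
import Algebra.Solver.Ring as RS
open import Algebra.Solver.Ring.AlmostCommutativeRing using (_-Raw-AlmostCommutative⟶_; fromCommutativeRing)
open import Algebra.Structures using (IsCommutativeRing)
open import Data.Empty using (⊥; ⊥-elim)
open import Data.Fin as Fin using (Fin; toℕ; fromℕ; fromℕ<)
import Data.Fin.Properties as FP
open import Data.Integer as Z using (ℤ; +_; -[1+_])
open import Data.Integer.Divisibility.Signed as ZD using (divides) renaming (_∣_ to _∣ℤ_)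
import Data.Integer.Properties as ZP
open import Data.List using (List; []; _∷_; length)
open import Data.List.Membership.Propositional using (_∈_)
open import Data.List.Relation.Unary.All as All using (All; []; _∷_)
open import Data.List.Relation.Unary.AllPairs using (AllPairs; []; _∷_)
open import Data.List.Relation.Unary.Any using (here; there)
open import Data.Maybe as Maybe using (Maybe; just; nothing; maybe′)
open import Data.Nat as N using (ℕ; zero; suc; s≤s; z≤n; _≤_; _<_)
open import Data.Nat.Combinatorics using (nCn≡1; nC1≡n; nCk+nC[k+1]≡[n+1]C[k+1]) renaming (_C_ to _choose_)
open import Data.Nat.Combinatorics.Specification using (k>n⇒nCk≡0)
import Data.Nat.Coprimality as NC
open import Data.Nat.DivMod using (_%_; _/_; m%n<n; m≡m%n+[m/n]*n)
import Data.Nat.Divisibility as ND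
open import Data.Nat.GCD using (gcd)
open import Data.Nat.ListAction using (product)
open import Data.Nat.Primality using (Prime; euclidsLemma; prime⇒irreducible; prime⇒nonTrivial; prime⇒nonZero; prime[2])
open import Data.Nat.Primality.Factorisation using (PrimeFactorisation; factorise)
import Data.Nat.Properties as NP
open import Data.Nat.Tactic.RingSolver using (solve-∀)
open import Data.Product using (_×_; _,_; ∃-syntax; Σ; proj₁; proj₂)
open import Data.Rational as Q using (ℚ; 0ℚ; 1ℚ; mkℚ)
import Data.Rational.Properties as QP
open import Data.Rational.Unnormalised as U using (mkℚᵘ; *≡*)
import Data.Rational.Unnormalised.Properties as UP
open import Data.Sum using (_⊎_; inj₁; inj₂; [_,_]′)
import Data.Vec as Vec
open import Data.Vec.N-ary using (N-ary; _$ⁿ_; curryⁿ; curryⁿ-cong; curryⁿ-cong⁻¹; Eq; Eqʰ; Eqʰ-to-Eq)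
open import Function using (_∘_)
open import Function.Definitions using (Injective)
open import Relation.Binary.Definitions using (tri<; tri≈; tri>)
open import Relation.Binary.PropositionalEquality as ≡ using (_≡_; _≢_)
open import Relation.Nullary using (¬_; Dec; yes; no)
open import Relation.Nullary.Decidable using (map′; _×-dec_)

-- Three laws are needed because each one vanishes modulo p somewhere: the chord where the two
-- points coincide, the tangent law of the chart Z = 1 at the origin, that of the chart Y = 1 where
-- Y vanishes. The choice depends only on residues, so a whole residue class shares one law and its
-- values stay primitive. Doubling degenerates exactly at a singular point, which is where
-- nonsingular reduction of P enters. Since nP is an iterated translation, the single rule P + (-(P
-- + S)) = -S is enough to start the progression at -nP. The right side of the Hasse bound is the
-- quadratic form n² + n(p - ℓ) + p, the degree of Frobenius + n on a curve with ℓ affine points.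
-- Here ℓ = r - 1 counts the nonzero multiples of P modulo p; the form bounds the heights from
-- above, and heights are nonnegative. For n = 2 this reads 2r ≤ 3p + 6, below 4p once p ≥ 7: the
-- constant of (c). For n = ⌊√p⌋ it yields r ≤ p(1 - 1/√p)^(-2), and the bound in (d) says that ℓ
-- such factors multiply to less than 2.

-- Fields with decidable zero, and a ring solver with integer coefficients

record Field : Set₁ where
  field
    commutativeRing : CommutativeRing 0ℓ 0ℓ
  open CommutativeRing commutativeRing
  field
    integral : ∀ a b → a * b ≈ 0# → a ≈ 0# ⊎ b ≈ 0#
    _≟0 : ∀ a → Dec (a ≈ 0#)
    inverse : ∀ a → ¬ a ≈ 0# → ∃[ b ] a * b ≈ 1#
    1≉0 : ¬ 1# ≈ 0#

TwoNonzero : CommutativeRing 0ℓ 0ℓ → Set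
TwoNonzero R = ¬ 1# + 1# ≈ 0#
  where open CommutativeRing R

infix 9 :-_
infixr 9 _:^_
infixl 8 _:*_
infixl 7 _:+_ _:-_
infix 4 _:=_

-- Not indexed by the number of variables: otherwise every operator would carry an implicit argument to be inferred.
data Polynomial : Set where
  con : ℤ → Polynomial
  var : ℕ → Polynomial
  _:+_ _:*_ _:-_ : Polynomial → Polynomial → Polynomial
  :-_ : Polynomial → Polynomial
  _:^_ : Polynomial → ℕ → Polynomial

_:=_ : Polynomial → Polynomial → Polynomial × Polynomial
_:=_ = _,_

vars : ∀ n → ℕ → Vec.Vec Polynomial n
vars zero k = Vec.[]
vars (suc n) k = var k Vec.∷ vars n (suc k)

module IntSolver {c ℓ} (R : CommutativeRing c ℓ) where
  open CommutativeRing R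
  open Mult semiring renaming (_×_ to _⋆_)
  open RingP ring
  open import Relation.Binary.Reasoning.Setoid setoid

  -- The separate clauses for 1 and -1 make `con (+ 1)` evaluate to `1#` itself and not to
  -- `1# + 0#`, so that solved equations match goals written with `1#`.
  fromℤ : ℤ → Carrier
  fromℤ (+ zero) = 0#
  fromℤ (+ 1) = 1#
  fromℤ (+ n) = n ⋆ 1#
  fromℤ -[1+ zero ] = - 1#
  fromℤ -[1+ n ] = - (suc n ⋆ 1#)

  fromℤ-pos : ∀ n → fromℤ (+ n) ≈ n ⋆ 1#
  fromℤ-pos zero = refl
  fromℤ-pos 1 = sym (+-identityʳ 1#)
  fromℤ-pos (suc (suc n)) = refl

  fromℤ-neg : ∀ n → fromℤ (Z.- (+ n)) ≈ - (n ⋆ 1#)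
  fromℤ-neg zero = sym -0#≈0#
  fromℤ-neg 1 = -‿cong (sym (+-identityʳ 1#))
  fromℤ-neg (suc (suc n)) = refl

  fromℤ-⊖ : ∀ m n → fromℤ (m Z.⊖ n) ≈ m ⋆ 1# + - (n ⋆ 1#)
  fromℤ-⊖ m zero = begin
    fromℤ (+ m)       ≈⟨ fromℤ-pos m ⟩
    m ⋆ 1#            ≈⟨ +-identityʳ _ ⟨
    m ⋆ 1# + 0#       ≈⟨ +-congˡ -0#≈0# ⟨
    m ⋆ 1# + - 0#     ∎
  fromℤ-⊖ zero (suc n) = trans (fromℤ-neg (suc n)) (sym (+-identityˡ _))
  fromℤ-⊖ (suc m) (suc n) = begin
    fromℤ (suc m Z.⊖ suc n)               ≡⟨ ≡.cong fromℤ (ZP.[1+m]⊖[1+n]≡m⊖n m n) ⟩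
    fromℤ (m Z.⊖ n)                       ≈⟨ fromℤ-⊖ m n ⟩
    m ⋆ 1# + - (n ⋆ 1#)                   ≈⟨ +-congʳ (+-identityˡ _) ⟨
    (0# + m ⋆ 1#) + - (n ⋆ 1#)            ≈⟨ +-congʳ (+-congʳ (-‿inverseʳ 1#)) ⟨
    ((1# + - 1#) + m ⋆ 1#) + - (n ⋆ 1#)   ≈⟨ +-congʳ (trans (+-assoc _ _ _) (trans (+-congˡ (+-comm _ _)) (sym (+-assoc _ _ _)))) ⟩
    ((1# + m ⋆ 1#) + - 1#) + - (n ⋆ 1#)   ≈⟨ +-assoc _ _ _ ⟩
    (1# + m ⋆ 1#) + (- 1# + - (n ⋆ 1#))   ≈⟨ +-congˡ (-‿+-comm _ _) ⟩
    (1# + m ⋆ 1#) + - (1# + n ⋆ 1#)       ∎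

  fromℤ-+ : ∀ i j → fromℤ (i Z.+ j) ≈ fromℤ i + fromℤ j
  fromℤ-+ (+ m) (+ n) = begin
    fromℤ (+ (m N.+ n)) ≈⟨ fromℤ-pos (m N.+ n) ⟩
    (m N.+ n) ⋆ 1# ≈⟨ ×-homo-+ 1# m n ⟩
    m ⋆ 1# + n ⋆ 1# ≈⟨ +-cong (fromℤ-pos m) (fromℤ-pos n) ⟨
    fromℤ (+ m) + fromℤ (+ n) ∎
  fromℤ-+ (+ m) -[1+ n ] = trans (fromℤ-⊖ m (suc n)) (+-cong (sym (fromℤ-pos m)) (sym (fromℤ-neg (suc n))))
  fromℤ-+ -[1+ m ] (+ n) = trans (fromℤ-⊖ n (suc m))
    (trans (+-comm _ _) (+-cong (sym (fromℤ-neg (suc m))) (sym (fromℤ-pos n))))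
  fromℤ-+ -[1+ m ] -[1+ n ] = begin
    - ((suc (suc (m N.+ n))) ⋆ 1#) ≡⟨ ≡.cong (λ k → - (suc k ⋆ 1#)) (≡.sym (NP.+-suc m n)) ⟩
    - ((suc m N.+ suc n) ⋆ 1#) ≈⟨ -‿cong (×-homo-+ 1# (suc m) (suc n)) ⟩
    - (suc m ⋆ 1# + suc n ⋆ 1#) ≈⟨ -‿+-comm _ _ ⟨
    - (suc m ⋆ 1#) + - (suc n ⋆ 1#) ≈⟨ +-cong (fromℤ-neg (suc m)) (fromℤ-neg (suc n)) ⟨
    fromℤ -[1+ m ] + fromℤ -[1+ n ] ∎

  fromℤ-‿ : ∀ i → fromℤ (Z.- i) ≈ - fromℤ i
  fromℤ-‿ (+ n) = trans (fromℤ-neg n) (-‿cong (sym (fromℤ-pos n)))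
  fromℤ-‿ -[1+ n ] = trans (fromℤ-pos (suc n)) (trans (sym (-‿involutive _)) (-‿cong (sym (fromℤ-neg (suc n)))))

  fromℤ-*-pos : ∀ m n → fromℤ (+ m Z.* + n) ≈ fromℤ (+ m) * fromℤ (+ n)
  fromℤ-*-pos m n = begin
    fromℤ (+ m Z.* + n) ≡⟨ ≡.cong fromℤ (≡.sym (ZP.pos-* m n)) ⟩
    fromℤ (+ (m N.* n)) ≈⟨ fromℤ-pos (m N.* n) ⟩
    (m N.* n) ⋆ 1# ≈⟨ ×1-homo-* m n ⟩
    (m ⋆ 1#) * (n ⋆ 1#) ≈⟨ *-cong (fromℤ-pos m) (fromℤ-pos n) ⟨
    fromℤ (+ m) * fromℤ (+ n) ∎

  fromℤ-* : ∀ i j → fromℤ (i Z.* j) ≈ fromℤ i * fromℤ j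
  fromℤ-* (+ m) (+ n) = fromℤ-*-pos m n
  fromℤ-* (+ m) -[1+ n ] = begin
    fromℤ (+ m Z.* (Z.- (+ suc n))) ≡⟨ ≡.cong fromℤ (ZP.neg-distribʳ-* (+ m) (+ suc n)) ⟨
    fromℤ (Z.- (+ m Z.* + suc n)) ≈⟨ fromℤ-‿ (+ m Z.* + suc n) ⟩
    - fromℤ (+ m Z.* + suc n) ≈⟨ -‿cong (fromℤ-*-pos m (suc n)) ⟩
    - (fromℤ (+ m) * fromℤ (+ suc n)) ≈⟨ -‿distribʳ-* _ _ ⟩
    fromℤ (+ m) * - fromℤ (+ suc n) ≈⟨ *-congˡ (fromℤ-‿ (+ suc n)) ⟨
    fromℤ (+ m) * fromℤ -[1+ n ] ∎
  fromℤ-* -[1+ m ] (+ n) = begin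
    fromℤ ((Z.- (+ suc m)) Z.* + n) ≡⟨ ≡.cong fromℤ (ZP.neg-distribˡ-* (+ suc m) (+ n)) ⟨
    fromℤ (Z.- (+ suc m Z.* + n)) ≈⟨ fromℤ-‿ (+ suc m Z.* + n) ⟩
    - fromℤ (+ suc m Z.* + n) ≈⟨ -‿cong (fromℤ-*-pos (suc m) n) ⟩
    - (fromℤ (+ suc m) * fromℤ (+ n)) ≈⟨ -‿distribˡ-* _ _ ⟩
    - fromℤ (+ suc m) * fromℤ (+ n) ≈⟨ *-congʳ (fromℤ-‿ (+ suc m)) ⟨
    fromℤ -[1+ m ] * fromℤ (+ n) ∎
  fromℤ-* -[1+ m ] -[1+ n ] = begin
    fromℤ (+ suc m Z.* + suc n) ≈⟨ fromℤ-*-pos (suc m) (suc n) ⟩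
    fromℤ (+ suc m) * fromℤ (+ suc n) ≈⟨ -‿involutive _ ⟨
    - - (fromℤ (+ suc m) * fromℤ (+ suc n)) ≈⟨ -‿cong (-‿distribˡ-* _ _) ⟩
    - (- fromℤ (+ suc m) * fromℤ (+ suc n)) ≈⟨ -‿distribʳ-* _ _ ⟩
    - fromℤ (+ suc m) * - fromℤ (+ suc n) ≈⟨ *-cong (fromℤ-‿ (+ suc m)) (fromℤ-‿ (+ suc n)) ⟨
    fromℤ -[1+ m ] * fromℤ -[1+ n ] ∎

  ℤ-raw : RawRing _ _
  ℤ-raw = CommutativeRing.rawRing ZP.+-*-commutativeRing

  homomorphism : ℤ-raw -Raw-AlmostCommutative⟶ fromCommutativeRing R
  homomorphism = record
    { ⟦_⟧ = fromℤ ; +-homo = fromℤ-+ ; *-homo = fromℤ-* ; -‿homo = fromℤ-‿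
    ; 0-homo = refl ; 1-homo = refl }

  dec : ∀ i j → Maybe (fromℤ i ≈ fromℤ j)
  dec i j with i Z.≟ j
  ... | yes ≡.refl = just refl
  ... | no _ = nothing

  private
    module I = RS ℤ-raw (fromCommutativeRing R) homomorphism dec

  -- A variable number out of range is read as the constant 0; `vars` produces none.
  indexed-var : ∀ n → ℕ → I.Polynomial n
  indexed-var n k = maybe′ I.var (I.con (+ 0)) (index n k)
    where
    index : ∀ n → ℕ → Maybe (Fin n)
    index zero _ = nothing
    index (suc n) zero = just Fin.zero
    index (suc n) (suc k) = Maybe.map Fin.suc (index n k)

  indexed : ∀ n → Polynomial → I.Polynomial n
  indexed n (con c) = I.con c
  indexed n (var k) = indexed-var n k
  indexed n (e :+ f) = indexed n e I.:+ indexed n f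
  indexed n (e :* f) = indexed n e I.:* indexed n f
  indexed n (e :- f) = indexed n e I.:- indexed n f
  indexed n (:- e) = I.:- indexed n e
  indexed n (e :^ k) = indexed n e I.:^ k

  module _ (n : ℕ) (f : N-ary n Polynomial (Polynomial × Polynomial)) where
    lhs rhs : I.Polynomial n
    lhs = indexed n (proj₁ (f $ⁿ vars n 0))
    rhs = indexed n (proj₂ (f $ⁿ vars n 0))

    solve : Eqʰ n _≈_ (curryⁿ I.⟦ lhs ⟧↓) (curryⁿ I.⟦ rhs ⟧↓) → Eq n _≈_ (curryⁿ I.⟦ lhs ⟧) (curryⁿ I.⟦ rhs ⟧)
    solve hyp = curryⁿ-cong _≈_ I.⟦ lhs ⟧ I.⟦ rhs ⟧ (λ ρ → I.prove ρ lhs rhs (curryⁿ-cong⁻¹ _≈_ I.⟦ lhs ⟧↓ I.⟦ rhs ⟧↓ (Eqʰ-to-Eq n _≈_ hyp) ρ))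

-- Binomial coefficients modulo a prime and the Frobenius endomorphism

-- Induction along Pascal's rule. With n + 1 = p prime it puts p into a product whose first factor
-- is smaller than p, so p divides every inner binomial coefficient.
absorption : ∀ n k → suc k N.* (suc n choose suc k) ≡ suc n N.* (n choose k)
absorption zero zero = ≡.refl
absorption zero (suc k) = ≡.trans (≡.cong (suc (suc k) N.*_) (k>n⇒nCk≡0 {1} {suc (suc k)} (s≤s (s≤s z≤n))))
  (≡.trans (NP.*-zeroʳ (suc (suc k))) (≡.cong (1 N.*_) (≡.sym (k>n⇒nCk≡0 {0} {suc k} (s≤s z≤n)))))
absorption (suc n) zero = ≡.trans (NP.*-identityˡ _) (≡.trans (nC1≡n (suc (suc n))) (≡.sym (NP.*-identityʳ (suc (suc n)))))
absorption (suc n) (suc k) = begin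
  suc (suc k) N.* (suc (suc n) choose suc (suc k))
    ≡⟨ ≡.cong (suc (suc k) N.*_) (nCk+nC[k+1]≡[n+1]C[k+1] (suc n) (suc k)) ⟨
  suc (suc k) N.* (b N.+ c)
    ≡⟨ split (suc k) b c ⟩
  b N.+ (suc k N.* b N.+ suc (suc k) N.* c)
    ≡⟨ ≡.cong₂ (λ u v → b N.+ (u N.+ v)) (absorption n k) (absorption n (suc k)) ⟩
  b N.+ (suc n N.* (n choose k) N.+ suc n N.* (n choose suc k))
    ≡⟨ ≡.cong (b N.+_) (NP.*-distribˡ-+ (suc n) (n choose k) (n choose suc k)) ⟨
  b N.+ suc n N.* (n choose k N.+ n choose suc k)
    ≡⟨ ≡.cong (λ u → b N.+ suc n N.* u) (nCk+nC[k+1]≡[n+1]C[k+1] n k) ⟩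
  suc (suc n) N.* b ∎
  where
  open ≡.≡-Reasoning
  b = suc n choose suc k
  c = suc n choose suc (suc k)
  split : ∀ j b c → suc j N.* (b N.+ c) ≡ b N.+ (j N.* b N.+ suc j N.* c)
  split = solve-∀

prime∣C : ∀ {p} → Prime p → ∀ k → 0 N.< k → k N.< p → p ND.∣ (p choose k)
prime∣C {suc p} pr (suc k) _ k<p with euclidsLemma (suc k) (suc p choose suc k) pr
    (ND.divides (p choose k) (≡.trans (absorption p k) (NP.*-comm (suc p) (p choose k))))
... | inj₁ p∣k = ⊥-elim (NP.<⇒≱ k<p (ND.∣⇒≤ p∣k))
... | inj₂ d = d

module Frobenius {c ℓ} (R : CommutativeRing c ℓ) where
  open CommutativeRing R
  open Mult semiring renaming (_×_ to _⋆_)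
  open Exp semiring
  open Sum semiring
  open import Relation.Binary.Reasoning.Setoid setoid

  sum-last : ∀ n (t : Fin (suc n) → Carrier) → (∀ i → toℕ i N.< n → t i ≈ 0#) → sum t ≈ t (fromℕ n)
  sum-last zero t h = +-identityʳ _
  sum-last (suc n) t h = trans (+-cong (h Fin.zero (s≤s z≤n)) (sum-last n (t ∘ Fin.suc) (λ i i<n → h (Fin.suc i) (s≤s i<n))))
    (+-identityˡ _)

  frobenius : ∀ {p} → Prime p → p ⋆ 1# ≈ 0# → ∀ x y → (x + y) ^ p ≈ x ^ p + y ^ p
  frobenius {suc p} pr char x y = begin
    (x + y) ^ suc p                        ≈⟨ Binom.theorem commutativeSemiring (suc p) x y ⟩
    sum (term (suc p))                     ≈⟨ +-cong first (sum-last p (term (suc p) ∘ Fin.suc) middle) ⟩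
    y ^ suc p + term (suc p) (Fin.suc (fromℕ p)) ≈⟨ +-congˡ last ⟩
    y ^ suc p + x ^ suc p                  ≈⟨ +-comm _ _ ⟩
    x ^ suc p + y ^ suc p                  ∎
    where
    term = Binom.binomialTerm commutativeSemiring x y
    first : term (suc p) Fin.zero ≈ y ^ suc p
    first = trans (+-identityʳ _) (*-identityˡ _)
    kill : ∀ n z → suc p ND.∣ n → n ⋆ z ≈ 0#
    kill n z (ND.divides q eq) = begin
      n ⋆ z ≡⟨ ≡.cong (_⋆ z) eq ⟩
      (q N.* suc p) ⋆ z ≈⟨ ×-assocˡ z q (suc p) ⟨
      q ⋆ (suc p ⋆ z) ≈⟨ ×-congʳ q (×-congʳ (suc p) (*-identityˡ z)) ⟨
      q ⋆ (suc p ⋆ (1# * z)) ≈⟨ ×-congʳ q (×-assoc-* (suc p) 1# z) ⟨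
      q ⋆ ((suc p ⋆ 1#) * z) ≈⟨ ×-congʳ q (trans (*-congʳ char) (zeroˡ z)) ⟩
      q ⋆ 0# ≈⟨ zz q ⟩
      0# ∎
      where
      zz : ∀ q → q ⋆ 0# ≈ 0#
      zz zero = refl
      zz (suc q) = trans (+-identityˡ _) (zz q)
    middle : ∀ i → toℕ i N.< p → term (suc p) (Fin.suc i) ≈ 0#
    middle i i<p = kill _ _ (prime∣C pr (suc (toℕ i)) (s≤s z≤n) (s≤s i<p))
    last : term (suc p) (Fin.suc (fromℕ p)) ≈ x ^ suc p
    last rewrite FP.toℕ-fromℕ p | nCn≡1 (suc p) | NP.n∸n≡0 p = trans (+-identityʳ _) (*-identityʳ _)

-- Congruences and the prime field

infix 4 _≡_[_]
-- A record and not a synonym for the divisibility, so that unification can read `a` and `b` off the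
-- type; a difference does not determine them.
record _≡_[_] (a b m : ℤ) : Set where
  constructor ∣diff
  field diff∣ : m ∣ℤ a Z.- b
open _≡_[_] public

-- ℤ/m is ℤ with a coarser equality. Reduction of an integer is then the identity map.
cong-ring : ℤ → CommutativeRing _ _
cong-ring m = record
  { Carrier = ℤ ; _≈_ = _≡_[ m ]
  ; _+_ = Z._+_ ; _*_ = Z._*_ ; -_ = Z.-_ ; 0# = + 0 ; 1# = + 1
  ; isCommutativeRing = record
    { isRing = record
      { +-isAbelianGroup = record
        { isGroup = record
          { isMonoid = record
            { isSemigroup = record
              { isMagma = record
                { isEquivalence = record { refl = rfl ≡.refl ; sym = sy ; trans = tr }
                ; ∙-cong = +c }
              ; assoc = λ a b c → rfl (ZP.+-assoc a b c) }
            ; identity = (λ a → rfl (ZP.+-identityˡ a)) , (λ a → rfl (ZP.+-identityʳ a)) }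
          ; inverse = (λ a → rfl (ZP.+-inverseˡ a)) , (λ a → rfl (ZP.+-inverseʳ a))
          ; ⁻¹-cong = ng }
        ; comm = λ a b → rfl (ZP.+-comm a b) }
      ; *-cong = *c
      ; *-assoc = λ a b c → rfl (ZP.*-assoc a b c)
      ; *-identity = (λ a → rfl (ZP.*-identityˡ a)) , (λ a → rfl (ZP.*-identityʳ a))
      ; distrib = (λ a b c → rfl (ZP.*-distribˡ-+ a b c)) , (λ a b c → rfl (ZP.*-distribʳ-+ a b c))
      }
    ; *-comm = λ a b → rfl (ZP.*-comm a b) } }
  where
  open IntSolver ZP.+-*-commutativeRing using (solve)
  rfl : ∀ {a b} → a ≡ b → a ≡ b [ m ]
  rfl {a} ≡.refl = ∣diff (divides (+ 0) (ZP.+-inverseʳ a))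
  sy : ∀ {a b} → a ≡ b [ m ] → b ≡ a [ m ]
  sy {a} {b} (∣diff d) = ∣diff (≡.subst (m ∣ℤ_) (solve 2 (λ a b → :- (a :- b) := b :- a) ≡.refl a b) (ZD.∣m⇒∣-m d))
  tr : ∀ {a b c} → a ≡ b [ m ] → b ≡ c [ m ] → a ≡ c [ m ]
  tr {a} {b} {c} (∣diff d) (∣diff e) = ∣diff (≡.subst (m ∣ℤ_)
    (solve 3 (λ a b c → (a :- b) :+ (b :- c) := a :- c) ≡.refl a b c) (ZD.∣m∣n⇒∣m+n d e))
  +c : ∀ {a b c d} → a ≡ b [ m ] → c ≡ d [ m ] → a Z.+ c ≡ b Z.+ d [ m ]
  +c {a} {b} {c} {d} (∣diff x) (∣diff y) = ∣diff (≡.subst (m ∣ℤ_)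
    (solve 4 (λ a b c d → (a :- b) :+ (c :- d) := (a :+ c) :- (b :+ d)) ≡.refl a b c d) (ZD.∣m∣n⇒∣m+n x y))
  ng : ∀ {a b} → a ≡ b [ m ] → Z.- a ≡ Z.- b [ m ]
  ng {a} {b} (∣diff d) = ∣diff (≡.subst (m ∣ℤ_)
    (solve 2 (λ a b → :- (a :- b) := (:- a) :- (:- b)) ≡.refl a b) (ZD.∣m⇒∣-m d))
  *c : ∀ {a b c d} → a ≡ b [ m ] → c ≡ d [ m ] → a Z.* c ≡ b Z.* d [ m ]
  *c {a} {b} {c} {d} (∣diff x) (∣diff y) = ∣diff (≡.subst (m ∣ℤ_)
    (solve 4 (λ a b c d → (a :- b) :* c :+ b :* (c :- d) := (a :* c) :- (b :* d)) ≡.refl a b c d)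
    (ZD.∣m∣n⇒∣m+n (ZD.∣m⇒∣m*n c x) (ZD.∣n⇒∣m*n b y)))

≡0⇒∣ : ∀ {m a} → a ≡ + 0 [ m ] → m ∣ℤ a
≡0⇒∣ {m} {a} (∣diff d) = ≡.subst (m ∣ℤ_) (ZP.+-identityʳ a) d

∣⇒≡0 : ∀ {m a} → m ∣ℤ a → a ≡ + 0 [ m ]
∣⇒≡0 {m} {a} d = ∣diff (≡.subst (m ∣ℤ_) (≡.sym (ZP.+-identityʳ a)) d)

prime-∣* : ∀ {p} → Prime p → ∀ a b → + p ∣ℤ a Z.* b → + p ∣ℤ a ⊎ + p ∣ℤ b
prime-∣* pr a b d with euclidsLemma Z.∣ a ∣ Z.∣ b ∣ pr (≡.subst (_ ND.∣_) (ZP.abs-* a b) (ZD.∣⇒∣ᵤ d))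
... | inj₁ x = inj₁ (ZD.∣ᵤ⇒∣ x)
... | inj₂ x = inj₂ (ZD.∣ᵤ⇒∣ x)

∤1 : ∀ {p} → Prime p → ¬ + p ∣ℤ + 1
∤1 {p} pr d = NP.<⇒≱ (N.nonTrivial⇒n>1 p {{prime⇒nonTrivial pr}}) (ND.∣⇒≤ (ZD.∣⇒∣ᵤ d))

module PrimeField {p : ℕ} (pr : Prime p) where
  Fₚ : CommutativeRing _ _
  Fₚ = cong-ring (+ p)
  open CommutativeRing Fₚ
  open Mult semiring renaming (_×_ to _⋆_)
  open Exp semiring
  open RingP ring using (+-cancelˡ; -‿distribʳ-*)
  open import Relation.Binary.Reasoning.Setoid setoid

  _≟0 : ∀ a → Dec (a ≈ 0#)
  a ≟0 = map′ ∣⇒≡0 ≡0⇒∣ (+ p ZD.∣? a)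

  1≉0 : ¬ 1# ≈ 0#
  1≉0 d = ∤1 pr (≡0⇒∣ d)

  integral : ∀ a b → a * b ≈ 0# → a ≈ 0# ⊎ b ≈ 0#
  integral a b d with prime-∣* pr a b (≡0⇒∣ d)
  ... | inj₁ x = inj₁ (∣⇒≡0 x)
  ... | inj₂ x = inj₂ (∣⇒≡0 x)

  ⋆1 : ∀ n → n ⋆ 1# ≡ + n
  ⋆1 zero = ≡.refl
  ⋆1 (suc n) = ≡.cong (λ u → + 1 Z.+ u) (⋆1 n)

  char : p ⋆ 1# ≈ 0#
  char = ∣⇒≡0 (≡.subst (+ p ∣ℤ_) (≡.sym (⋆1 p)) ZD.∣-refl)

  open Frobenius Fₚ public

  fermat-pos : ∀ n → (+ n) ^ p ≈ + n
  fermat-pos zero = zpow p pr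
    where
    zpow : ∀ p → Prime p → (+ 0) ^ p ≈ 0#
    zpow (suc p) _ = zeroˡ ((+ 0) ^ p)
  fermat-pos (suc n) = begin
    (+ 1 + + n) ^ p ≈⟨ frobenius pr char (+ 1) (+ n) ⟩
    1# ^ p + (+ n) ^ p ≈⟨ +-cong (onepow p) (fermat-pos n) ⟩
    + suc n ∎
    where
    onepow : ∀ p → 1# ^ p ≈ 1#
    onepow zero = refl
    onepow (suc p) = trans (*-identityˡ (1# ^ p)) (onepow p)

  fermat : ∀ x → x ^ p ≈ x
  fermat (+ n) = fermat-pos n
  -- Negative integers follow from additivity of Frobenius: (n + 1) + x = 0, so the p-th powers also
  -- add up to 0.
  fermat x@(-[1+ n ]) = +-cancelˡ (+ suc n) (x ^ p) x (begin
    + suc n + x ^ p ≈⟨ +-congʳ (fermat-pos (suc n)) ⟨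
    (+ suc n) ^ p + x ^ p ≈⟨ frobenius pr char (+ suc n) x ⟨
    (+ suc n + x) ^ p ≈⟨ ^-congˡ p (-‿inverseʳ (+ suc n)) ⟩
    0# ^ p ≈⟨ fermat-pos 0 ⟩
    0# ≈⟨ -‿inverseʳ (+ suc n) ⟨
    + suc n + x ∎)

  -- The inverse is x^(p-2): Fermat's x^p = x factors as x(x^(p-1) - 1) = 0, and the first factor is
  -- not zero.
  inverse : ∀ x → ¬ x ≈ 0# → ∃[ y ] x * y ≈ 1#
  inverse x x≉0 = go p pr (fermat x)
    where
    pick : ∀ q → x ≈ 0# ⊎ x ^ suc q + - 1# ≈ 0# → ∃[ y ] x * y ≈ 1#
    pick q (inj₁ e) = ⊥-elim (x≉0 e)
    pick q (inj₂ e) = x ^ q , ∣diff (≡0⇒∣ e)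
    go : ∀ q → Prime q → x ^ q ≈ x → ∃[ y ] x * y ≈ 1#
    go zero qr _ = ⊥-elim (N.≢-nonZero⁻¹ 0 {{prime⇒nonZero qr}} ≡.refl)
    go (suc zero) qr _ = ⊥-elim (NP.n≮n 1 (N.nonTrivial⇒n>1 1 {{prime⇒nonTrivial qr}}))
    go (suc (suc q)) _ eq = pick q (integral x (x ^ suc q + - 1#) (begin
         x * (x ^ suc q + - 1#) ≈⟨ distribˡ x (x ^ suc q) (- 1#) ⟩
         x ^ suc (suc q) + x * - 1# ≈⟨ +-cong {x ^ suc (suc q)} {x} {x * - 1#} { - (x * 1#)} eq (sym (-‿distribʳ-* x 1#)) ⟩
         x + - (x * 1#) ≈⟨ +-congˡ {x} { - (x * 1#)} { - x} (-‿cong {x * 1#} {x} (*-identityʳ x)) ⟩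
         x + - x ≈⟨ -‿inverseʳ x ⟩
         0# ∎))

-- Polynomials in one variable T over a field: division, gcd, heights

module Polynomials (𝔽 : Field) where
  open Field 𝔽 using (integral; _≟0; inverse; 1≉0) renaming (commutativeRing to K)
  open CommutativeRing K
  open import Relation.Binary.Reasoning.Setoid setoid
  private module KS = IntSolver K
  open RingP ring using (-0#≈0#; x+x≈x⇒x≈0)

  Seq : Set
  Seq = ℕ → Carrier

  tail : Seq → Seq
  tail f n = f (suc n)

  infixl 7 _⊛_
  -- The Cauchy product, by recursion on the degree through f = f(0) + T · `tail f`.
  _⊛_ : Seq → Seq → Seq
  (f ⊛ g) zero = f 0 * g 0
  (f ⊛ g) (suc n) = f 0 * g (suc n) + (tail f ⊛ g) n

  ⊛-cong : ∀ {f f′ g g′} → (∀ n → f n ≈ f′ n) → (∀ n → g n ≈ g′ n) → ∀ n → (f ⊛ g) n ≈ (f′ ⊛ g′) n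
  ⊛-cong p q zero = *-cong (p 0) (q 0)
  ⊛-cong p q (suc n) = +-cong (*-cong (p 0) (q (suc n))) (⊛-cong (λ m → p (suc m)) q n)

  ⊛-zeroˡ : ∀ {f} g → (∀ n → f n ≈ 0#) → ∀ n → (f ⊛ g) n ≈ 0#
  ⊛-zeroˡ g z zero = trans (*-congʳ (z 0)) (zeroˡ _)
  ⊛-zeroˡ g z (suc n) = trans (+-cong (trans (*-congʳ (z 0)) (zeroˡ _)) (⊛-zeroˡ g (λ m → z (suc m)) n)) (+-identityˡ 0#)

  ⊛-distribʳ : ∀ h f g n → ((λ m → f m + g m) ⊛ h) n ≈ (f ⊛ h) n + (g ⊛ h) n
  ⊛-distribʳ h f g zero = distribʳ _ _ _
  ⊛-distribʳ h f g (suc n) = trans (+-congˡ (⊛-distribʳ h (tail f) (tail g) n))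
    (KS.solve 5 (λ a b c d e → (a :+ b) :* c :+ (d :+ e) := (a :* c :+ d) :+ (b :* c :+ e)) refl _ _ _ _ _)

  ⊛-scaleˡ : ∀ c f g n → ((λ m → c * f m) ⊛ g) n ≈ c * (f ⊛ g) n
  ⊛-scaleˡ c f g zero = *-assoc _ _ _
  ⊛-scaleˡ c f g (suc n) = trans (+-cong (*-assoc _ _ _) (⊛-scaleˡ c (tail f) g n)) (sym (distribˡ _ _ _))

  ⊛-sucʳ : ∀ f g n → (f ⊛ g) (suc n) ≈ f (suc n) * g 0 + (f ⊛ tail g) n
  ⊛-sucʳ f g zero = +-comm _ _
  ⊛-sucʳ f g (suc n) = trans (+-congˡ (⊛-sucʳ (tail f) g n))
    (KS.solve 3 (λ a b c → a :+ (b :+ c) := b :+ (a :+ c)) refl _ _ _)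

  ⊛-comm : ∀ f g n → (f ⊛ g) n ≈ (g ⊛ f) n
  ⊛-comm f g zero = *-comm _ _
  ⊛-comm f g (suc n) = trans (+-cong (*-comm _ _) (⊛-comm (tail f) g n)) (sym (⊛-sucʳ g f n))

  ⊛-assoc : ∀ f g h n → ((f ⊛ g) ⊛ h) n ≈ (f ⊛ (g ⊛ h)) n
  ⊛-assoc f g h zero = *-assoc _ _ _
  ⊛-assoc f g h (suc n) = begin
    f 0 * g 0 * h (suc n) + (tail (f ⊛ g) ⊛ h) n
      ≈⟨ +-congˡ (⊛-distribʳ h (λ m → f 0 * tail g m) (tail f ⊛ g) n) ⟩
    f 0 * g 0 * h (suc n) + (((λ m → f 0 * tail g m) ⊛ h) n + ((tail f ⊛ g) ⊛ h) n)
      ≈⟨ +-congˡ (+-cong (⊛-scaleˡ (f 0) (tail g) h n) (⊛-assoc (tail f) g h n)) ⟩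
    f 0 * g 0 * h (suc n) + (f 0 * (tail g ⊛ h) n + (tail f ⊛ (g ⊛ h)) n)
      ≈⟨ KS.solve 5 (λ a b c d e → a :* b :* c :+ (a :* d :+ e) := a :* (b :* c :+ d) :+ e) refl _ _ _ _ _ ⟩
    f 0 * (g 0 * h (suc n) + (tail g ⊛ h) n) + (tail f ⊛ (g ⊛ h)) n ∎

  infix 4 _≤°_
  _≤°_ : Seq → ℕ → Set
  f ≤° d = ∀ n → d < n → f n ≈ 0#

  ≤°-weaken : ∀ {f d e} → d ≤ e → f ≤° d → f ≤° e
  ≤°-weaken d≤e h n e<n = h n (NP.≤-<-trans d≤e e<n)

  ⊛-≤° : ∀ {f g} a b → f ≤° a → g ≤° b → (f ⊛ g) ≤° (a N.+ b)
  ⊛-≤° {f} {g} zero b p q (suc n) b<n = trans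
    (+-cong (trans (*-congˡ (q (suc n) b<n)) (zeroʳ _)) (⊛-zeroˡ g (λ m → p (suc m) (s≤s z≤n)) n)) (+-identityˡ 0#)
  ⊛-≤° {f} {g} (suc a) b p q (suc n) (s≤s ab<n) = trans
    (+-cong (trans (*-congˡ (q (suc n) (NP.≤-trans (s≤s (NP.m≤n+m b a)) (NP.≤-trans ab<n (NP.n≤1+n n))))) (zeroʳ _))
      (⊛-≤° a b (λ m a<m → p (suc m) (s≤s a<m)) q n ab<n)) (+-identityˡ 0#)

  ⊛-top : ∀ {f g} a b → f ≤° a → g ≤° b → (f ⊛ g) (a N.+ b) ≈ f a * g b
  ⊛-top zero zero p q = refl
  ⊛-top {f} {g} zero (suc b) p q = trans (+-congˡ (⊛-zeroˡ g (λ m → p (suc m) (s≤s z≤n)) b)) (+-identityʳ _)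
  ⊛-top {f} {g} (suc a) b p q = trans
    (+-cong (trans (*-congˡ (q (suc (a N.+ b)) (s≤s (NP.m≤n+m b a)))) (zeroʳ _))
            (⊛-top a b (λ m a<m → p (suc m) (s≤s a<m)) q)) (+-identityˡ _)

  -- `bd` is any bound for the degree. It tells `degree?` where to start its downward search; `_≋_`
  -- does not see it.
  record Poly : Set where
    constructor poly
    field
      co : Seq
      bd : ℕ
      co≤°bd : co ≤° bd
  open Poly public

  const : Carrier → Seq
  const a zero = a
  const a (suc _) = 0#

  infix 4 _≋_
  record _≋_ (f g : Poly) : Set where
    constructor pointwise
    field at : ∀ n → co f n ≈ co g n
  open _≋_ public

  infixl 6 _+ᴾ_
  infixl 7 _*ᴾ_
  -- Sealed, so that type checking never unfolds polynomial arithmetic into coefficient sequences.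
  -- The lemmas of this block are the only access to coefficients.
  abstract
    _+ᴾ_ _*ᴾ_ : Poly → Poly → Poly
    f +ᴾ g = poly (λ n → co f n + co g n) (bd f N.+ bd g) λ n b<n →
      trans (+-cong (co≤°bd f n (NP.≤-<-trans (NP.m≤m+n _ _) b<n)) (co≤°bd g n (NP.≤-<-trans (NP.m≤n+m (bd g) (bd f)) b<n)))
            (+-identityˡ 0#)
    f *ᴾ g = poly (co f ⊛ co g) (bd f N.+ bd g) (⊛-≤° (bd f) (bd g) (co≤°bd f) (co≤°bd g))

    -ᴾ_ : Poly → Poly
    -ᴾ f = poly (λ n → - co f n) (bd f) λ n b<n → trans (-‿cong (co≤°bd f n b<n)) -0#≈0#

    0ᴾ : Poly
    0ᴾ = poly (λ _ → 0#) 0 (λ _ _ → refl)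

    C : Carrier → Poly
    C a = poly (const a) 0 λ { (suc n) _ → refl }

    T : Poly
    T = poly (λ { 1 → 1# ; _ → 0# }) 1 λ { (suc zero) (s≤s ()) ; (suc (suc n)) _ → refl }

    isCommutativeRingᴾ : IsCommutativeRing _≋_ _+ᴾ_ _*ᴾ_ -ᴾ_ 0ᴾ (C 1#)
    isCommutativeRingᴾ = record
      { isRing = record
        { +-isAbelianGroup = record
          { isGroup = record
            { isMonoid = record
              { isSemigroup = record
                { isMagma = record
                  { isEquivalence = record
                    { refl = pointwise λ n → refl
                    ; sym = λ p → pointwise λ n → sym (at p n)
                    ; trans = λ p q → pointwise λ n → trans (at p n) (at q n) }
                  ; ∙-cong = λ p q → pointwise λ n → +-cong (at p n) (at q n) }
                ; assoc = λ _ _ _ → pointwise λ n → +-assoc _ _ _ }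
              ; identity = (λ _ → pointwise λ n → +-identityˡ _) , (λ _ → pointwise λ n → +-identityʳ _) }
            ; inverse = (λ _ → pointwise λ n → -‿inverseˡ _) , (λ _ → pointwise λ n → -‿inverseʳ _)
            ; ⁻¹-cong = λ p → pointwise λ n → -‿cong (at p n) }
          ; comm = λ _ _ → pointwise λ n → +-comm _ _ }
        ; *-cong = λ p q → pointwise (⊛-cong (at p) (at q))
        ; *-assoc = λ f g h → pointwise (⊛-assoc (co f) (co g) (co h))
        ; *-identity = (λ f → pointwise (⊛-1ˡ (co f)))
                     , (λ f → pointwise λ n → trans (⊛-comm (co f) (const 1#) n) (⊛-1ˡ (co f) n))
        ; distrib = (λ h f g → pointwise λ n → trans (⊛-comm (co h) _ n) (trans (⊛-distribʳ (co h) (co f) (co g) n)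
                        (+-cong (⊛-comm (co f) (co h) n) (⊛-comm (co g) (co h) n))))
                  , (λ h f g → pointwise (⊛-distribʳ (co h) (co f) (co g)))
        }
      ; *-comm = λ f g → pointwise (⊛-comm (co f) (co g)) }
      where
      ⊛-1ˡ : ∀ f n → (const 1# ⊛ f) n ≈ f n
      ⊛-1ˡ f zero = *-identityˡ _
      ⊛-1ˡ f (suc n) = trans (+-cong (*-identityˡ _) (⊛-zeroˡ f (λ _ → refl) n)) (+-identityʳ _)

    co-+ : ∀ f g n → co (f +ᴾ g) n ≈ co f n + co g n
    co-+ f g n = refl

    co-neg : ∀ f n → co (-ᴾ f) n ≈ - co f n
    co-neg f n = refl

    co-0 : ∀ n → co 0ᴾ n ≈ 0#
    co-0 n = refl

    C-≤° : ∀ a → co (C a) ≤° 0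
    C-≤° a (suc n) _ = refl

    co-C-0 : ∀ a → co (C a) 0 ≈ a
    co-C-0 a = refl

    T-≤° : co T ≤° 1
    T-≤° (suc zero) (s≤s ())
    T-≤° (suc (suc n)) _ = refl

    co-T-1 : co T 1 ≈ 1#
    co-T-1 = refl

    C-+ : ∀ a b → C (a + b) ≋ C a +ᴾ C b
    C-+ a b = pointwise λ { zero → refl ; (suc n) → sym (+-identityˡ 0#) }

    C-* : ∀ a b → C (a * b) ≋ C a *ᴾ C b
    C-* a b = pointwise λ { zero → refl ; (suc n) → sym (trans (+-cong (zeroʳ _) (⊛-zeroˡ (const b) (λ _ → refl) n)) (+-identityˡ 0#)) }

    C-cong : ∀ {a b} → a ≈ b → C a ≋ C b
    C-cong e = pointwise λ { zero → e ; (suc n) → refl }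

    C-0 : C 0# ≋ 0ᴾ
    C-0 = pointwise λ { zero → refl ; (suc n) → refl }

    co-C* : ∀ c f n → co (C c *ᴾ f) n ≈ c * co f n
    co-C* c f zero = refl
    co-C* c f (suc n) = trans (+-congˡ (⊛-zeroˡ (co f) (λ _ → refl) n)) (+-identityʳ _)

    T*-suc : ∀ f n → co (T *ᴾ f) (suc n) ≈ co f n
    T*-suc f n = trans (+-cong (zeroˡ _) (⊛-cong {g = co f} {g′ = co f} (λ { zero → refl ; (suc m) → refl }) (λ _ → refl) n))
      (trans (+-identityˡ _) (at (IsCommutativeRing.*-identityˡ isCommutativeRingᴾ f) n))

    ≤°-* : ∀ {f g} a b → co f ≤° a → co g ≤° b → co (f *ᴾ g) ≤° (a N.+ b)
    ≤°-* = ⊛-≤°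

    co-*-top : ∀ {f g} a b → co f ≤° a → co g ≤° b → co (f *ᴾ g) (a N.+ b) ≈ co f a * co g b
    co-*-top = ⊛-top

  Poly-ring : CommutativeRing 0ℓ 0ℓ
  Poly-ring = record { isCommutativeRing = isCommutativeRingᴾ }

  private
    module P = CommutativeRing Poly-ring
    module PS = IntSolver Poly-ring
    module PP = RingP P.ring
  open Exp P.semiring using () renaming (_^_ to _^ᴾ_)

  T^-shift : ∀ k f m → co (T ^ᴾ k P.* f) (k N.+ m) ≈ co f m
  T^-shift zero f m = at (P.*-identityˡ f) m
  T^-shift (suc k) f m = trans (at (P.*-assoc T (T ^ᴾ k) f) (suc (k N.+ m)))
    (trans (T*-suc (T ^ᴾ k P.* f) (k N.+ m)) (T^-shift k f m))

  ≤°-+ : ∀ {f g d} → co f ≤° d → co g ≤° d → co (f P.+ g) ≤° d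
  ≤°-+ {f} {g} p q n d<n = trans (co-+ f g n) (trans (+-cong (p n d<n) (q n d<n)) (+-identityˡ 0#))

  ≤°-neg : ∀ {f d} → co f ≤° d → co (P.- f) ≤° d
  ≤°-neg {f} p n d<n = trans (co-neg f n) (trans (-‿cong (p n d<n)) -0#≈0#)

  ≤°-cong : ∀ {f g d} → f ≋ g → co f ≤° d → co g ≤° d
  ≤°-cong e p n d<n = trans (sym (at e n)) (p n d<n)

  ≤°-^ : ∀ {f d} k → co f ≤° d → co (f ^ᴾ k) ≤° (k N.* d)
  ≤°-^ zero p = C-≤° 1#
  ≤°-^ {f} {d} (suc k) p = ≤°-* {f} {f ^ᴾ k} d (k N.* d) p (≤°-^ k p)

  HasDegree : Poly → ℕ → Set
  HasDegree f d = co f ≤° d × ¬ co f d ≈ 0#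

  zero-or-degree : ∀ f n → (∀ m → n ≤ m → co f m ≈ 0#) → f ≋ P.0# ⊎ ∃[ d ] d < n × HasDegree f d
  zero-or-degree f zero z = inj₁ (pointwise λ m → trans (z m z≤n) (sym (co-0 m)))
  zero-or-degree f (suc n) z with co f n ≟0
  ... | no ≉ = inj₂ (n , NP.≤-refl , z , ≉)
  ... | yes ≈0 with zero-or-degree f n (λ m n≤m → below m (NP.m≤n⇒m<n∨m≡n n≤m))
    where
    below : ∀ m → n < m ⊎ n ≡ m → co f m ≈ 0#
    below m (inj₁ n<m) = z m n<m
    below m (inj₂ ≡.refl) = ≈0
  ...   | inj₁ e = inj₁ e
  ...   | inj₂ (d , d<n , h) = inj₂ (d , NP.m<n⇒m<1+n d<n , h)

  degree? : ∀ f → f ≋ P.0# ⊎ ∃[ d ] HasDegree f d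
  degree? f with zero-or-degree f (suc (bd f)) (co≤°bd f)
  ... | inj₁ e = inj₁ e
  ... | inj₂ (d , _ , h) = inj₂ (d , h)

  *≉0 : ∀ {a b} → ¬ a ≈ 0# → ¬ b ≈ 0# → ¬ a * b ≈ 0#
  *≉0 {a} {b} p q ab with integral a b ab
  ... | inj₁ x = p x
  ... | inj₂ x = q x

  degree-* : ∀ {f g a b} → HasDegree f a → HasDegree g b → HasDegree (f P.* g) (a N.+ b)
  degree-* {f} {g} {a} {b} (p , p≉) (q , q≉) = ≤°-* a b p q ,
    λ e → *≉0 p≉ q≉ (trans (sym (co-*-top a b p q)) e)

  degree≉0 : ∀ {f d} → HasDegree f d → ¬ f ≋ P.0#
  degree≉0 (_ , ≉) e = ≉ (trans (at e _) (co-0 _))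

  integralᴾ : ∀ f g → f P.* g ≋ P.0# → f ≋ P.0# ⊎ g ≋ P.0#
  integralᴾ f g fg with degree? f | degree? g
  ... | inj₁ e | _ = inj₁ e
  ... | _ | inj₁ e = inj₂ e
  ... | inj₂ (a , p) | inj₂ (b , q) = ⊥-elim (degree≉0 {f P.* g} (degree-* {f} {g} p q) fg)

  cancelᴾ : ∀ f g h → ¬ f ≋ P.0# → f P.* g ≋ f P.* h → g ≋ h
  cancelᴾ f g h f≉ e = [ (λ z → ⊥-elim (f≉ z)) , (λ z → P.trans (PS.solve 2 (λ g h → g := (g :- h) :+ h) P.refl g h) (P.trans (P.+-congʳ z) (P.+-identityˡ h))) ]′
    (integralᴾ f (g P.- h) (P.trans (PS.solve 3 (λ f g h → f :* (g :- h) := f :* g :- f :* h) P.refl f g h)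
       (P.trans (P.+-congʳ e) (P.-‿inverseʳ _))))

  divide : ∀ b {e} → HasDegree b e → ∀ n a → (∀ m → n ≤ m → co a m ≈ 0#) →
    ∃[ q ] ∃[ r ] (a ≋ q P.* b P.+ r) × (∀ m → e ≤ m → co r m ≈ 0#)
  divide b _ zero a z = P.0# , P.0# , P.trans (pointwise λ n → trans (z n z≤n) (sym (co-0 n))) (P.sym (P.trans (P.+-identityʳ _) (P.zeroˡ b))) , (λ n _ → co-0 n)
  divide b {e} hb@(b≤ , b≉) (suc n) a z with e N.≤? n
  ... | no e≰n = P.0# , a , P.sym (P.trans (P.+-congʳ (P.zeroˡ b)) (P.+-identityˡ a)) , λ m e≤m → z m (NP.≤-trans (NP.≰⇒> e≰n) e≤m)
  ... | yes e≤n with inverse (co b e) b≉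
  ...   | i , bi with divide b hb n (a P.- C (co a n * i) P.* (T ^ᴾ (n N.∸ e) P.* b)) below
    where
    k = n N.∸ e
    -- The multiple of b with the same coefficient of degree n as a; i inverts the leading
    -- coefficient of b.
    mono = C (co a n * i) P.* (T ^ᴾ k P.* b)
    coeff : ∀ m → co mono (k N.+ m) ≈ co a n * i * co b m
    coeff m = trans (co-C* (co a n * i) (T ^ᴾ k P.* b) (k N.+ m)) (*-congˡ (T^-shift k b m))
    sub : ∀ m → co (a P.- mono) m ≈ co a m + - co mono m
    sub m = trans (co-+ a (P.- mono) m) (+-congˡ (co-neg mono m))
    below : ∀ m → n ≤ m → co (a P.- mono) m ≈ 0#
    below m n≤m with NP.m≤n⇒m<n∨m≡n n≤m
    ... | inj₂ ≡.refl = trans (sub n) (begin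
          co a n + - co mono n ≡⟨ ≡.cong (λ j → co a n + - co mono j) (NP.m∸n+n≡m e≤n) ⟨
          co a n + - co mono (k N.+ e) ≈⟨ +-congˡ (-‿cong (coeff e)) ⟩
          co a n + - (co a n * i * co b e) ≈⟨ KS.solve 3 (λ a i b → a :- a :* i :* b := a :- a :* (b :* i)) refl _ _ _ ⟩
          co a n + - (co a n * (co b e * i)) ≈⟨ +-congˡ (-‿cong (trans (*-congˡ bi) (*-identityʳ _))) ⟩
          co a n + - co a n ≈⟨ -‿inverseʳ _ ⟩
          0# ∎)
    ... | inj₁ n<m = trans (sub m) (begin
          co a m + - co mono m ≡⟨ ≡.cong (λ j → co a m + - co mono j) (NP.m+[n∸m]≡n (NP.≤-trans (NP.m∸n≤m n e) n≤m)) ⟨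
          co a m + - co mono (k N.+ (m N.∸ k)) ≈⟨ +-cong (z m n<m) (-‿cong (trans (coeff (m N.∸ k))
             (trans (*-congˡ (b≤ (m N.∸ k) e<)) (zeroʳ _)))) ⟩
          0# + - 0# ≈⟨ -‿inverseʳ 0# ⟩
          0# ∎)
      where
      e< : e < m N.∸ k
      e< = ≡.subst (_< m N.∸ k) (NP.m∸[m∸n]≡n e≤n) (NP.∸-monoˡ-< n<m (NP.m∸n≤m n e))
  ...     | q , r , eq , r< = C (co a n * i) P.* T ^ᴾ (n N.∸ e) P.+ q , r ,
            P.trans (PS.solve 2 (λ a m → a := m :+ (a :- m)) P.refl a _)
              (P.trans (P.+-congˡ eq) (PS.solve 5 (λ c t b q r → c :* (t :* b) :+ (q :* b :+ r) := (c :* t :+ q) :* b :+ r) P.refl _ _ _ _ _)) , r<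

  -- Stated as a Bézout identity because `next` builds explicit factors from the two multipliers.
  Coprime : Poly → Poly → Set
  Coprime a b = ∃[ u ] ∃[ v ] (u P.* a P.+ v P.* b ≋ P.1#)

  -- Euclid's algorithm, by recursion on a degree bound for b. From b = gb′, r = gr′ and ub′ + vr′ =
  -- 1 one gets a = qb + r = g(qb′ + r′) with multipliers v and u - vq.
  reduce : ∀ n a b → (∀ m → n ≤ m → co b m ≈ 0#) → ¬ (a ≋ P.0# × b ≋ P.0#) →
    ∃[ g ] ∃[ a′ ] ∃[ b′ ] ¬ g ≋ P.0# × (a ≋ g P.* a′) × (b ≋ g P.* b′) × Coprime a′ b′
  reduce n a b b< nz with zero-or-degree b n b<
  ... | inj₁ b0 = a , P.1# , P.0# , (λ a0 → nz (a0 , b0)) , P.sym (P.*-identityʳ a) , P.trans b0 (P.sym (P.zeroʳ a)) ,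
      P.1# , P.0# , P.trans (P.+-cong (P.*-identityˡ _) (P.zeroˡ _)) (P.+-identityʳ _)
  ... | inj₂ (e , e<n , hb) with divide b hb (suc (bd a)) a (co≤°bd a)
  reduce (suc n) a b b< nz | inj₂ (e , s≤s e≤n , hb) | q , r , eq , r<
    with reduce n b r (λ m n≤m → r< m (NP.≤-trans e≤n n≤m)) (λ z → degree≉0 {b} hb (proj₁ z))
  ... | g , b′ , r′ , g≉ , eb , er , u , v , uv =
      g , q P.* b′ P.+ r′ , b′ , g≉ ,
      P.trans eq (P.trans (P.+-cong (P.*-congˡ eb) er) (PS.solve 4 (λ g q b r → q :* (g :* b) :+ g :* r := g :* (q :* b :+ r)) P.refl g q b′ r′)) ,
      eb , v , u P.- v P.* q ,
      P.trans (PS.solve 5 (λ u v q b r → v :* (q :* b :+ r) :+ (u :- v :* q) :* b := u :* b :+ v :* r) P.refl u v q b′ r′) uv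

  reduced : ∀ a b → ¬ (a ≋ P.0# × b ≋ P.0#) →
    ∃[ g ] ∃[ a′ ] ∃[ b′ ] ¬ g ≋ P.0# × (a ≋ g P.* a′) × (b ≋ g P.* b′) × Coprime a′ b′
  reduced a b = reduce (suc (bd b)) a b (co≤°bd b)

  -- For coprime a, b this is the height of the point (a : b) of the projective line over the
  -- rational function field: the larger of the two degrees.
  record HasHeight (a b : Poly) (h : ℕ) : Set where
    field
      a≤° : co a ≤° h
      b≤° : co b ≤° h
      top : ¬ (co a h ≈ 0# × co b h ≈ 0#)
  open HasHeight public

  has-height : ∀ a b → ¬ (a ≋ P.0# × b ≋ P.0#) → ∃[ h ] HasHeight a b h
  has-height a b nz with degree? a | degree? b
  ... | inj₁ a0 | inj₁ b0 = ⊥-elim (nz (a0 , b0))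
  ... | inj₁ a0 | inj₂ (d , b≤ , b≉) = d , record { a≤° = λ n _ → trans (at a0 n) (co-0 n) ; b≤° = b≤ ; top = λ t → b≉ (proj₂ t) }
  ... | inj₂ (d , a≤ , a≉) | inj₁ b0 = d , record { a≤° = a≤ ; b≤° = λ n _ → trans (at b0 n) (co-0 n) ; top = λ t → a≉ (proj₁ t) }
  ... | inj₂ (d , a≤ , a≉) | inj₂ (e , b≤ , b≉) with NP.≤-total d e
  ...   | inj₁ d≤e = e , record { a≤° = ≤°-weaken d≤e a≤ ; b≤° = b≤ ; top = λ t → b≉ (proj₂ t) }
  ...   | inj₂ e≤d = d , record { a≤° = a≤ ; b≤° = ≤°-weaken e≤d b≤ ; top = λ t → a≉ (proj₁ t) }

  -- One of the coefficients of degree γ + h in ga and gb is a product of two nonzero leading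
  -- coefficients. It measures how much a common factor g lowers the height.
  height-scale : ∀ {g γ a b h d} → HasDegree g γ → HasHeight a b h →
    co (g P.* a) ≤° d → co (g P.* b) ≤° d → γ N.+ h ≤ d
  height-scale {g} {γ} {a} {b} {h} {d} (g≤ , g≉) H pa pb with γ N.+ h N.≤? d
  ... | yes p = p
  ... | no ≰ = ⊥-elim (top H (kill a (a≤° H) (pa _ (NP.≰⇒> ≰)) , kill b (b≤° H) (pb _ (NP.≰⇒> ≰))))
    where
    kill : ∀ f → co f ≤° h → co (g P.* f) (γ N.+ h) ≈ 0# → co f h ≈ 0#
    kill f f≤ z with integral (co g γ) (co f h) (trans (sym (co-*-top γ h g≤ f≤)) z)
    ... | inj₁ x = ⊥-elim (g≉ x)
    ... | inj₂ x = x

  -- Gauss's lemma at the place t = ∞ for the product (b T − a)(b′ T − a′).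
  height-product : ∀ {a b h a′ b′ h′ d} → HasHeight a b h → HasHeight a′ b′ h′ →
    co (b P.* b′) ≤° d → co (b P.* a′ P.+ a P.* b′) ≤° d → co (a P.* a′) ≤° d → h N.+ h′ ≤ d
  height-product {a} {b} {h} {a′} {b′} {h′} {d} H H′ pb pm pa with h N.+ h′ N.≤? d
  ... | yes p = p
  ... | no ≰ = ⊥-elim contra
    where
    d< = NP.≰⇒> ≰
    aa : co a h * co a′ h′ ≈ 0#
    aa = trans (sym (co-*-top h h′ (a≤° H) (a≤° H′))) (pa _ d<)
    bb : co b h * co b′ h′ ≈ 0#
    bb = trans (sym (co-*-top h h′ (b≤° H) (b≤° H′))) (pb _ d<)
    mm : co b h * co a′ h′ + co a h * co b′ h′ ≈ 0#
    mm = trans (sym (+-cong (co-*-top h h′ (b≤° H) (a≤° H′)) (co-*-top h h′ (a≤° H) (b≤° H′)))) (trans (sym (co-+ _ _ _)) (pm _ d<))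
    dropˡ : ∀ {x y z w} → x ≈ 0# → x * y + z * w ≈ 0# → z * w ≈ 0#
    dropˡ x0 e = trans (sym (trans (+-congʳ (trans (*-congʳ x0) (zeroˡ _))) (+-identityˡ _))) e
    contra : ⊥
    contra with integral _ _ aa | integral _ _ bb
    ... | inj₁ x | inj₁ y = top H (x , y)
    ... | inj₂ x | inj₂ y = top H′ (x , y)
    ... | inj₁ x | inj₂ y with integral _ _ (trans (sym (trans (+-congˡ (trans (*-congʳ x) (zeroˡ _))) (+-identityʳ _))) mm)
    ...   | inj₁ z = top H (x , z)
    ...   | inj₂ z = top H′ (z , y)
    contra | inj₂ x | inj₁ y with integral _ _ (dropˡ y mm)
    ...   | inj₁ z = top H (z , y)
    ...   | inj₂ z = top H′ (x , z)

-- Manin's proof of the Hasse bound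

-- The form e(n) = n² + n(p - ℓ) + p has increments p + 1 + 2n - ℓ and second difference 2. A
-- sequence with second differences at most 2 that starts below e, in value and in increment, stays
-- below it. All terms with -ℓ are moved to the other side.
convex-step : ∀ p n ℓ {h h′ h″} → h′ N.+ ℓ ≤ h N.+ (suc p N.+ (n N.+ n)) → h N.+ n N.* ℓ ≤ p N.+ n N.* p N.+ n N.* n →
  h N.+ h″ ≤ suc h′ N.+ suc h′ →
  h″ N.+ ℓ ≤ h′ N.+ (suc p N.+ (suc n N.+ suc n)) × h′ N.+ suc n N.* ℓ ≤ p N.+ suc n N.* p N.+ suc n N.* suc n
convex-step p n ℓ {h} {h′} {h″} b₁ b₂ b =
  NP.+-cancelˡ-≤ h (h″ N.+ ℓ) _ (begin
    h N.+ (h″ N.+ ℓ) ≡⟨ NP.+-assoc h h″ ℓ ⟨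
    h N.+ h″ N.+ ℓ ≤⟨ NP.+-monoˡ-≤ ℓ b ⟩
    suc h′ N.+ suc h′ N.+ ℓ ≡⟨ ar₁ h′ ℓ ⟩
    h′ N.+ ℓ N.+ (2 N.+ h′) ≤⟨ NP.+-monoˡ-≤ (2 N.+ h′) b₁ ⟩
    h N.+ (suc p N.+ (n N.+ n)) N.+ (2 N.+ h′) ≡⟨ ar₂ h h′ p n ⟩
    h N.+ (h′ N.+ (suc p N.+ (suc n N.+ suc n))) ∎) ,
  (begin
    h′ N.+ (ℓ N.+ n N.* ℓ) ≡⟨ NP.+-assoc h′ ℓ (n N.* ℓ) ⟨
    h′ N.+ ℓ N.+ n N.* ℓ ≤⟨ NP.+-monoˡ-≤ (n N.* ℓ) b₁ ⟩
    h N.+ (suc p N.+ (n N.+ n)) N.+ n N.* ℓ ≡⟨ ar₃ h p n (n N.* ℓ) ⟩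
    h N.+ n N.* ℓ N.+ (suc p N.+ (n N.+ n)) ≤⟨ NP.+-monoˡ-≤ (suc p N.+ (n N.+ n)) b₂ ⟩
    p N.+ n N.* p N.+ n N.* n N.+ (suc p N.+ (n N.+ n)) ≡⟨ ar₄ p n ⟩
    p N.+ suc n N.* p N.+ suc n N.* suc n ∎)
  where
  open NP.≤-Reasoning
  ar₁ : ∀ h′ ℓ → suc h′ N.+ suc h′ N.+ ℓ ≡ h′ N.+ ℓ N.+ (2 N.+ h′)
  ar₁ = solve-∀
  ar₂ : ∀ h h′ p n → h N.+ (suc p N.+ (n N.+ n)) N.+ (2 N.+ h′) ≡ h N.+ (h′ N.+ (suc p N.+ (suc n N.+ suc n)))
  ar₂ = solve-∀
  ar₃ : ∀ h p n x → h N.+ (suc p N.+ (n N.+ n)) N.+ x ≡ h N.+ x N.+ (suc p N.+ (n N.+ n))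
  ar₃ = solve-∀
  ar₄ : ∀ p n → p N.+ n N.* p N.+ n N.* n N.+ (suc p N.+ (n N.+ n)) ≡ p N.+ suc n N.* p N.+ suc n N.* suc n
  ar₄ = solve-∀

-- The model η² = 4τ³ + b₂τ² + 2b₄τ + b₆ obtained by completing the square, with the usual relation
-- 4b₈ = b₂b₆ - b₄², and m = (p + 1)/2.
record QuarticData : Set₁ where
  field
    𝔽 : Field
  open Field 𝔽 renaming (commutativeRing to K)
  open CommutativeRing K
  field
    p m : ℕ
    p-prime : Prime p
    p+1≡m+m : suc p ≡ m N.+ m
    char : Mult._×_ semiring p 1# ≈ 0#
    fermat : ∀ a → Exp._^_ semiring a p ≈ a
    2≉0 : ¬ 1# + 1# ≈ 0#
    b₂ b₄ b₆ b₈ : Carrier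
    b-relation : b₄ * b₄ + (1# + 1#) * (1# + 1#) * b₈ ≈ b₂ * b₆

module Manin (quartic : QuarticData) where
  open QuarticData quartic
  open Field 𝔽 using (integral; _≟0; inverse; 1≉0) renaming (commutativeRing to K)
  open CommutativeRing K
  open Mult semiring renaming (_×_ to _⋆_)
  open Exp semiring

  open Polynomials 𝔽
  private
    module P = CommutativeRing Poly-ring
    module KS = IntSolver K
    module PS = IntSolver Poly-ring
  open Exp P.semiring using () renaming (_^_ to _^ᴾ_; ^-congˡ to ^ᴾ-congˡ; ^-homo-* to ^ᴾ-homo-*)
  open CExp P.commutativeSemiring using () renaming (^-distrib-* to ^ᴾ-distrib-*)
  open import Relation.Binary.Reasoning.Setoid P.setoid

  infixl 6 _⊕_ _⊖_
  infixl 7 _⊗_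
  _⊕_ _⊗_ _⊖_ : Poly → Poly → Poly
  _⊕_ = P._+_
  _⊗_ = P._*_
  _⊖_ = P._-_

  two : Poly
  two = P.1# ⊕ P.1#
  B₂ B₄ B₆ B₈ : Poly
  B₂ = C b₂
  B₄ = C b₄
  B₆ = C b₆
  B₈ = C b₈

  fᴷ : Carrier → Carrier
  fᴷ x = (1# + 1#) * (1# + 1#) * (x * x * x) + b₂ * (x * x) + (1# + 1#) * b₄ * x + b₆

  fᴾ : Poly → Poly
  fᴾ x = two ⊗ two ⊗ (x ⊗ x ⊗ x) ⊕ B₂ ⊗ (x ⊗ x) ⊕ two ⊗ B₄ ⊗ x ⊕ B₆

  -- The roots (U : W) of αU² − σUW + μW² are the x-coordinates of (X/Z, ·) ± (T, 1) on fᴾ(T)·y² = fᴾ(x).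
  α σ μ : Poly → Poly → Poly
  α X Z = X ⊗ X ⊗ P.1# ⊕ X ⊗ Z ⊗ (P.- (two ⊗ T)) ⊕ Z ⊗ Z ⊗ (T ⊗ T)
  σ X Z = X ⊗ X ⊗ (two ⊗ T) ⊕ X ⊗ Z ⊗ (two ⊗ (T ⊗ T) ⊕ B₂ ⊗ T ⊕ B₄) ⊕ Z ⊗ Z ⊗ (B₄ ⊗ T ⊕ B₆)
  μ X Z = X ⊗ X ⊗ (T ⊗ T) ⊕ X ⊗ Z ⊗ (P.- (B₄ ⊗ T ⊕ B₆)) ⊕ Z ⊗ Z ⊗ (P.- (B₆ ⊗ T ⊕ B₈))

  q : Poly → Poly → Poly → Poly → Poly
  q X Z U W = α X Z ⊗ (U ⊗ U) ⊖ σ X Z ⊗ (U ⊗ W) ⊕ μ X Z ⊗ (W ⊗ W)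

  private
    module _ (t b2 b4 b6 b8 : Polynomial) where
      :2 : Polynomial
      :2 = con (+ 1) :+ con (+ 1)
      :f : Polynomial → Polynomial
      :f x = :2 :* :2 :* (x :* x :* x) :+ b2 :* (x :* x) :+ :2 :* b4 :* x :+ b6
      :α :σ :μ : Polynomial → Polynomial → Polynomial
      :α X Z = X :* X :* con (+ 1) :+ X :* Z :* (:- (:2 :* t)) :+ Z :* Z :* (t :* t)
      :σ X Z = X :* X :* (:2 :* t) :+ X :* Z :* (:2 :* (t :* t) :+ b2 :* t :+ b4) :+ Z :* Z :* (b4 :* t :+ b6)
      :μ X Z = X :* X :* (t :* t) :+ X :* Z :* (:- (b4 :* t :+ b6)) :+ Z :* Z :* (:- (b6 :* t :+ b8))
      :q : Polynomial → Polynomial → Polynomial → Polynomial → Polynomial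
      :q X Z U W = :α X Z :* (U :* U) :- :σ X Z :* (U :* W) :+ :μ X Z :* (W :* W)

  -- Two points differ by ±(T, 1) in either order. This lets each link of the chain be read
  -- backwards when it becomes the known root of the next quadratic.
  q-sym : ∀ X Z U W → q X Z U W ≋ q U W X Z
  q-sym X Z U W = PS.solve 9 (λ t b2 b4 b6 b8 X Z U W → :q t b2 b4 b6 b8 X Z U W := :q t b2 b4 b6 b8 U W X Z) P.refl T B₂ B₄ B₆ B₈ X Z U W

  q-scale : ∀ X Z U W g → q X Z (g ⊗ U) (g ⊗ W) ≋ g ⊗ g ⊗ q X Z U W
  q-scale X Z U W g = PS.solve 6 (λ a s m U W g → a :* (g :* U :* (g :* U)) :- s :* (g :* U :* (g :* W)) :+ m :* (g :* W :* (g :* W))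
     := g :* g :* (a :* (U :* U) :- s :* (U :* W) :+ m :* (W :* W))) P.refl (α X Z) (σ X Z) (μ X Z) U W g

  q-cong : ∀ X Z {U U′ W W′} → U ≋ U′ → W ≋ W′ → q X Z U W ≋ q X Z U′ W′
  q-cong X Z u w = P.+-cong (P.+-cong (P.*-congˡ (P.*-cong u u)) (P.-‿cong (P.*-congˡ (P.*-cong u w)))) (P.*-congˡ (P.*-cong w w))

  α-square : ∀ X Z → α X Z ≋ (X ⊖ T ⊗ Z) ⊗ (X ⊖ T ⊗ Z)
  α-square X Z = PS.solve 3 (λ t X Z → :α t t t t t X Z := (X :- t :* Z) :* (X :- t :* Z)) P.refl T X Z

  1-≤° : co P.1# ≤° 0
  1-≤° = C-≤° 1#

  two-≤° : co two ≤° 0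
  two-≤° = ≤°-+ {P.1#} {P.1#} 1-≤° 1-≤°

  module _ {X Z : Poly} {h : ℕ} (X≤ : co X ≤° h) (Z≤ : co Z ≤° h) where
    private
      -- 2h + 2: the forms are quadratic in X and Z with coefficients of degree at most 2 in T. This
      -- 2 is the constant of the convexity inequality.
      k = suc h N.+ suc h
      term : ∀ {u v w} → co u ≤° h → co v ≤° h → co w ≤° 2 → co (u ⊗ v ⊗ w) ≤° k
      term {u} {v} {w} pu pv pw = ≡.subst (co (u ⊗ v ⊗ w) ≤°_) (arith h)
        (≤°-* {u ⊗ v} {w} (h N.+ h) 2 (≤°-* {u} {v} h h pu pv) pw)
        where
        arith : ∀ h → h N.+ h N.+ 2 ≡ suc h N.+ suc h
        arith = solve-∀
      three : ∀ {w₁ w₂ w₃} → co w₁ ≤° 2 → co w₂ ≤° 2 → co w₃ ≤° 2 → co (X ⊗ X ⊗ w₁ ⊕ X ⊗ Z ⊗ w₂ ⊕ Z ⊗ Z ⊗ w₃) ≤° k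
      three {w₁} {w₂} {w₃} p₁ p₂ p₃ = ≤°-+ {X ⊗ X ⊗ w₁ ⊕ X ⊗ Z ⊗ w₂} {Z ⊗ Z ⊗ w₃}
        (≤°-+ {X ⊗ X ⊗ w₁} {X ⊗ Z ⊗ w₂} (term {X} {X} {w₁} X≤ X≤ p₁) (term {X} {Z} {w₂} X≤ Z≤ p₂)) (term {Z} {Z} {w₃} Z≤ Z≤ p₃)
      C2 : ∀ c → co (C c) ≤° 2
      C2 c = ≤°-weaken {co (C c)} z≤n (C-≤° c)
      cT : ∀ c → co c ≤° 0 → co (c ⊗ T) ≤° 2
      cT c p = ≤°-weaken {co (c ⊗ T)} (s≤s z≤n) (≤°-* {c} {T} 0 1 p T-≤°)
      TT : co (T ⊗ T) ≤° 2
      TT = ≤°-* {T} {T} 1 1 T-≤° T-≤°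
      2TT : co (two ⊗ (T ⊗ T)) ≤° 2
      2TT = ≤°-* {two} {T ⊗ T} 0 2 two-≤° TT
      cTc : ∀ a b → co (C a ⊗ T ⊕ C b) ≤° 2
      cTc a b = ≤°-+ {C a ⊗ T} {C b} (cT (C a) (C-≤° a)) (C2 b)
    α-≤° : co (α X Z) ≤° k
    α-≤° = three {P.1#} {P.- (two ⊗ T)} {T ⊗ T} (C2 1#) (≤°-neg {two ⊗ T} (cT two two-≤°)) TT
    σ-≤° : co (σ X Z) ≤° k
    σ-≤° = three {two ⊗ T} {two ⊗ (T ⊗ T) ⊕ B₂ ⊗ T ⊕ B₄} {B₄ ⊗ T ⊕ B₆} (cT two two-≤°)
      (≤°-+ {two ⊗ (T ⊗ T) ⊕ B₂ ⊗ T} {B₄} (≤°-+ {two ⊗ (T ⊗ T)} {B₂ ⊗ T} 2TT (cT B₂ (C-≤° b₂))) (C2 b₄)) (cTc b₄ b₆)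
    μ-≤° : co (μ X Z) ≤° k
    μ-≤° = three {T ⊗ T} {P.- (B₄ ⊗ T ⊕ B₆)} {P.- (B₆ ⊗ T ⊕ B₈)} TT (≤°-neg {B₄ ⊗ T ⊕ B₆} (cTc b₄ b₆)) (≤°-neg {B₆ ⊗ T ⊕ B₈} (cTc b₆ b₈))

  -- If X = TZ then μ is Z² times the numerator of the duplication formula, which is monic of degree 4.
  α,μ≉0 : ∀ X Z → Coprime X Z → ¬ (α X Z ≋ P.0# × μ X Z ≋ P.0#)
  α,μ≉0 X Z (u , v , uv) (α0 , μ0) = 1≉0 (begin-K)
    where
    r : Poly
    r = P.- (two ⊗ (B₆ ⊗ T) ⊕ B₄ ⊗ (T ⊗ T) ⊕ B₈)
    w : Poly
    w = T ^ᴾ 4 ⊗ P.1# ⊕ r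
    X≋TZ : X ≋ T ⊗ Z
    X≋TZ = [ from-difference , from-difference ]′ (integralᴾ (X ⊖ T ⊗ Z) (X ⊖ T ⊗ Z) (P.trans (P.sym (α-square X Z)) α0))
      where
      from-difference : X ⊖ T ⊗ Z ≋ P.0# → X ≋ T ⊗ Z
      from-difference e = P.trans (PS.solve 2 (λ x y → x := (x :- y) :+ y) P.refl X (T ⊗ Z)) (P.trans (P.+-congʳ e) (P.+-identityˡ _))
    s : Poly
    s = u ⊗ T ⊕ v
    sZ : s ⊗ Z ≋ P.1#
    sZ = P.trans (PS.solve 4 (λ u v t z → (u :* t :+ v) :* z := u :* (t :* z) :+ v :* z) P.refl u v T Z)
      (P.trans (P.+-congʳ (P.*-congˡ (P.sym X≋TZ))) uv)
    μw : μ X Z ≋ Z ⊗ Z ⊗ w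
    μw = begin
      μ X Z ≈⟨ P.+-cong (P.+-cong (P.*-congʳ (P.*-cong X≋TZ X≋TZ)) (P.*-congʳ (P.*-congʳ X≋TZ))) P.refl ⟩
      μ (T ⊗ Z) Z ≈⟨ PS.solve 5 (λ t z b4 b6 b8 → :μ t b4 b4 b6 b8 (t :* z) z :=
           z :* z :* (t :^ 4 :* con (+ 1) :+ (:- (:2 t t t t t :* (b6 :* t) :+ b4 :* (t :* t) :+ b8)))) P.refl T Z B₄ B₆ B₈ ⟩
      Z ⊗ Z ⊗ w ∎
    w0 : w ≋ P.0#
    w0 = begin
      w ≈⟨ P.trans (P.*-congʳ (P.trans (P.*-cong sZ sZ) (P.*-identityˡ _))) (P.*-identityˡ w) ⟨
      s ⊗ Z ⊗ (s ⊗ Z) ⊗ w ≈⟨ PS.solve 3 (λ s z w → s :* z :* (s :* z) :* w := s :* s :* (z :* z :* w)) P.refl s Z w ⟩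
      s ⊗ s ⊗ (Z ⊗ Z ⊗ w) ≈⟨ P.*-congˡ (P.trans (P.sym μw) μ0) ⟩
      s ⊗ s ⊗ P.0# ≈⟨ P.zeroʳ _ ⟩
      P.0# ∎
    r≤ : co r ≤° 2
    r≤ = ≤°-neg {two ⊗ (B₆ ⊗ T) ⊕ B₄ ⊗ (T ⊗ T) ⊕ B₈} (≤°-+ {two ⊗ (B₆ ⊗ T) ⊕ B₄ ⊗ (T ⊗ T)} {B₈}
      (≤°-+ {two ⊗ (B₆ ⊗ T)} {B₄ ⊗ (T ⊗ T)}
        (≤°-weaken {co (two ⊗ (B₆ ⊗ T))} (s≤s z≤n) (≤°-* {two} {B₆ ⊗ T} 0 1 two-≤° (≤°-* {B₆} {T} 0 1 (C-≤° b₆) T-≤°)))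
        (≤°-* {B₄} {T ⊗ T} 0 2 (C-≤° b₄) (≤°-* {T} {T} 1 1 T-≤° T-≤°)))
      (≤°-weaken {co B₈} z≤n (C-≤° b₈)))
    begin-K : 1# ≈ 0#
    begin-K = trans (sym (trans (+-cong (trans (T^-shift 4 P.1# 0) (co-C-0 1#)) (r≤ 4 (s≤s (s≤s (s≤s z≤n))))) (+-identityʳ 1#)))
      (trans (sym (co-+ (T ^ᴾ 4 ⊗ P.1#) r 4)) (trans (at w0 4) (co-0 4)))

  -- Two consecutive points Frobenius + n(T, 1), known only by their x-coordinates (X₀ : Z₀) and (X₁
  -- : Z₁). No y-coordinate is needed: the following x-coordinate is the other root of a quadratic
  -- with one known root.
  record Adjacent (h₀ h₁ : ℕ) : Set where
    field
      X₀ Z₀ X₁ Z₁ : Poly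
      coprime₀ : Coprime X₀ Z₀
      coprime₁ : Coprime X₁ Z₁
      height₀ : HasHeight X₀ Z₀ h₀
      height₁ : HasHeight X₁ Z₁ h₁
      related : q X₁ Z₁ X₀ Z₀ ≋ P.0#

  -- The quadratic `q X₁ Z₁` has the root (X₀ : Z₀), hence splits, and its other root is the new
  -- point. Its coefficients have degree at most 2h₁ + 2, and heights of linear factors add up, so
  -- h₀ + h₂ is at most this number.
  next : ∀ {h₀ h₁} → Adjacent h₀ h₁ → ∃[ h₂ ] h₀ N.+ h₂ ≤ suc h₁ N.+ suc h₁ × Adjacent h₁ h₂
  next {h₀} {h₁} adj = h₂ , bound , record
    { X₀ = X₁ ; Z₀ = Z₁ ; X₁ = X₂ ; Z₁ = Z₂ ; coprime₀ = coprime₁ ; coprime₁ = coprime₂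
    ; height₀ = height₁ ; height₁ = height₂ ; related = P.trans (P.sym (q-sym X₁ Z₁ X₂ Z₂)) related₂ }
    where
    open Adjacent adj
    u = proj₁ coprime₀
    v = proj₁ (proj₂ coprime₀)
    a = α X₁ Z₁
    s = σ X₁ Z₁
    c = μ X₁ Z₁
    -- (Z₀U − X₀W)(a′U − c′W) is the factorisation of q X₁ Z₁ U W given by its root (X₀ : Z₀).
    a′ c′ : Poly
    a′ = u ⊗ u ⊗ (X₀ ⊗ s ⊖ Z₀ ⊗ c) ⊕ two ⊗ u ⊗ v ⊗ X₀ ⊗ a ⊕ v ⊗ v ⊗ Z₀ ⊗ a
    c′ = u ⊗ u ⊗ X₀ ⊗ c ⊕ two ⊗ u ⊗ v ⊗ Z₀ ⊗ c ⊕ v ⊗ v ⊗ (Z₀ ⊗ s ⊖ X₀ ⊗ a)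
    -- Equal to 1. Multiplied by e², the coefficients a, c and s differ from explicit combinations
    -- of Z₀ and X₀ only by multiples of the vanishing `q X₁ Z₁ X₀ Z₀`; the quotients are a′ and c′.
    e = u ⊗ X₀ ⊕ v ⊗ Z₀
    e² : ∀ f → f ⊗ (e ⊗ e) ≋ f
    e² f = P.trans (P.*-congˡ (P.trans (P.*-cong uv uv) (P.*-identityˡ _))) (P.*-identityʳ f)
      where uv = proj₂ (proj₂ coprime₀)
    drop : ∀ f g → f ⊕ g ⊗ q X₁ Z₁ X₀ Z₀ ≋ f
    drop f g = P.trans (P.+-congˡ (P.trans (P.*-congˡ related) (P.zeroʳ g))) (P.+-identityʳ f)
    a≋ : a ≋ Z₀ ⊗ a′
    a≋ = begin
      a ≈⟨ e² a ⟨
      a ⊗ (e ⊗ e) ≈⟨ PS.solve 7 (λ u v x z a s c → a :* ((u :* x :+ v :* z) :* (u :* x :+ v :* z)) :=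
         z :* (u :* u :* (x :* s :- z :* c) :+ (con (+ 1) :+ con (+ 1)) :* u :* v :* x :* a :+ v :* v :* z :* a) :+ u :* u :* (a :* (x :* x) :- s :* (x :* z) :+ c :* (z :* z))) P.refl u v X₀ Z₀ a s c ⟩
      Z₀ ⊗ a′ ⊕ u ⊗ u ⊗ q X₁ Z₁ X₀ Z₀ ≈⟨ drop _ _ ⟩
      Z₀ ⊗ a′ ∎
    c≋ : c ≋ X₀ ⊗ c′
    c≋ = begin
      c ≈⟨ e² c ⟨
      c ⊗ (e ⊗ e) ≈⟨ PS.solve 7 (λ u v x z a s c → c :* ((u :* x :+ v :* z) :* (u :* x :+ v :* z)) :=
         x :* (u :* u :* x :* c :+ (con (+ 1) :+ con (+ 1)) :* u :* v :* z :* c :+ v :* v :* (z :* s :- x :* a)) :+ v :* v :* (a :* (x :* x) :- s :* (x :* z) :+ c :* (z :* z))) P.refl u v X₀ Z₀ a s c ⟩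
      X₀ ⊗ c′ ⊕ v ⊗ v ⊗ q X₁ Z₁ X₀ Z₀ ≈⟨ drop _ _ ⟩
      X₀ ⊗ c′ ∎
    s≋ : s ≋ Z₀ ⊗ c′ ⊕ X₀ ⊗ a′
    s≋ = begin
      s ≈⟨ e² s ⟨
      s ⊗ (e ⊗ e) ≈⟨ PS.solve 7 (λ u v x z a s c → s :* ((u :* x :+ v :* z) :* (u :* x :+ v :* z)) :=
         z :* (u :* u :* x :* c :+ (con (+ 1) :+ con (+ 1)) :* u :* v :* z :* c :+ v :* v :* (z :* s :- x :* a)) :+
         x :* (u :* u :* (x :* s :- z :* c) :+ (con (+ 1) :+ con (+ 1)) :* u :* v :* x :* a :+ v :* v :* z :* a) :+
         (:- ((con (+ 1) :+ con (+ 1)) :* u :* v)) :* (a :* (x :* x) :- s :* (x :* z) :+ c :* (z :* z))) P.refl u v X₀ Z₀ a s c ⟩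
      Z₀ ⊗ c′ ⊕ X₀ ⊗ a′ ⊕ (P.- (two ⊗ u ⊗ v)) ⊗ q X₁ Z₁ X₀ Z₀ ≈⟨ drop _ _ ⟩
      Z₀ ⊗ c′ ⊕ X₀ ⊗ a′ ∎
    nz : ¬ (c′ ≋ P.0# × a′ ≋ P.0#)
    nz (c0 , a0) = α,μ≉0 X₁ Z₁ coprime₁ (P.trans a≋ (P.trans (P.*-congˡ a0) (P.zeroʳ _)) , P.trans c≋ (P.trans (P.*-congˡ c0) (P.zeroʳ _)))
    red = reduced c′ a′ nz
    g = proj₁ red
    X₂ = proj₁ (proj₂ red)
    Z₂ = proj₁ (proj₂ (proj₂ red))
    g≉0 = proj₁ (proj₂ (proj₂ (proj₂ red)))
    c′≋ = proj₁ (proj₂ (proj₂ (proj₂ (proj₂ red))))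
    a′≋ = proj₁ (proj₂ (proj₂ (proj₂ (proj₂ (proj₂ red)))))
    coprime₂ = proj₂ (proj₂ (proj₂ (proj₂ (proj₂ (proj₂ red)))))
    related₂ : q X₁ Z₁ X₂ Z₂ ≋ P.0#
    related₂ = begin
      q X₁ Z₁ X₂ Z₂ ≈⟨ P.+-cong (P.+-cong (P.*-congʳ a≋) (P.-‿cong (P.*-congʳ s≋))) (P.*-congʳ c≋) ⟩
      Z₀ ⊗ a′ ⊗ (X₂ ⊗ X₂) ⊖ (Z₀ ⊗ c′ ⊕ X₀ ⊗ a′) ⊗ (X₂ ⊗ Z₂) ⊕ X₀ ⊗ c′ ⊗ (Z₂ ⊗ Z₂)
        ≈⟨ PS.solve 6 (λ x z a c X Z → z :* a :* (X :* X) :- (z :* c :+ x :* a) :* (X :* Z) :+ x :* c :* (Z :* Z) := (z :* X :- x :* Z) :* (a :* X :- c :* Z)) P.refl X₀ Z₀ a′ c′ X₂ Z₂ ⟩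
      (Z₀ ⊗ X₂ ⊖ X₀ ⊗ Z₂) ⊗ (a′ ⊗ X₂ ⊖ c′ ⊗ Z₂) ≈⟨ P.*-congˡ (P.+-cong (P.*-congʳ a′≋) (P.-‿cong (P.*-congʳ c′≋))) ⟩
      (Z₀ ⊗ X₂ ⊖ X₀ ⊗ Z₂) ⊗ (g ⊗ Z₂ ⊗ X₂ ⊖ g ⊗ X₂ ⊗ Z₂) ≈⟨ PS.solve 4 (λ k g X Z → k :* (g :* Z :* X :- g :* X :* Z) := con (+ 0)) P.refl _ g X₂ Z₂ ⟩
      P.0# ∎
    nz₂ : ¬ (X₂ ≋ P.0# × Z₂ ≋ P.0#)
    nz₂ (x0 , z0) = nz (P.trans c′≋ (P.trans (P.*-congˡ x0) (P.zeroʳ _)) , P.trans a′≋ (P.trans (P.*-congˡ z0) (P.zeroʳ _)))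
    h₂ = proj₁ (has-height X₂ Z₂ nz₂)
    height₂ = proj₂ (has-height X₂ Z₂ nz₂)
    H = has-height c′ a′ nz
    deg-g : ∃[ γ ] HasDegree g γ
    deg-g = [ (λ z → ⊥-elim (g≉0 z)) , (λ d → d) ]′ (degree? g)
    bound : h₀ N.+ h₂ ≤ suc h₁ N.+ suc h₁
    bound = NP.≤-trans
      (NP.+-monoʳ-≤ h₀ (NP.≤-trans (NP.m≤n+m h₂ (proj₁ deg-g))
        (height-scale {g} {a = X₂} {b = Z₂} (proj₂ deg-g) height₂ (≤°-cong c′≋ (a≤° (proj₂ H))) (≤°-cong a′≋ (b≤° (proj₂ H))))))
      (height-product {X₀} {Z₀} {a′ = c′} {b′ = a′} height₀ (proj₂ H)
        (≤°-cong a≋ (α-≤° {X₁} {Z₁} (a≤° height₁) (b≤° height₁)))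
        (≤°-cong s≋ (σ-≤° {X₁} {Z₁} (a≤° height₁) (b≤° height₁)))
        (≤°-cong c≋ (μ-≤° {X₁} {Z₁} (a≤° height₁) (b≤° height₁))))

  Xₚ : Poly
  Xₚ = T ^ᴾ p

  f : Poly
  f = fᴾ T

  Frob : Poly → Poly → Set
  Frob a a′ = a ^ᴾ p ≋ a′

  charᴾ : Mult._×_ P.semiring p P.1# ≋ P.0#
  charᴾ = P.trans (⋆-C p) (P.trans (C-cong char) C-0)
    where
    ⋆-C : ∀ n → Mult._×_ P.semiring n P.1# ≋ C (n ⋆ 1#)
    ⋆-C zero = P.sym C-0
    ⋆-C (suc n) = P.trans (P.+-congˡ (⋆-C n)) (P.sym (C-+ 1# (n ⋆ 1#)))

  Frob-+ : ∀ {a a′ b b′} → Frob a a′ → Frob b b′ → Frob (a ⊕ b) (a′ ⊕ b′)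
  Frob-+ {a} {a′} {b} {b′} x y = P.trans (Frobenius.frobenius Poly-ring p-prime charᴾ a b) (P.+-cong x y)

  Frob-* : ∀ {a a′ b b′} → Frob a a′ → Frob b b′ → Frob (a ⊗ b) (a′ ⊗ b′)
  Frob-* {a} {a′} {b} {b′} x y = P.trans (^ᴾ-distrib-* a b p) (P.*-cong x y)

  Frob-C : ∀ c → Frob (C c) (C c)
  Frob-C c = P.trans (pow p) (C-cong (fermat c))
    where
    pow : ∀ n → C c ^ᴾ n ≋ C (c ^ n)
    pow zero = P.refl
    pow (suc n) = P.trans (P.*-congˡ (pow n)) (P.sym (C-* c (c ^ n)))

  -- Constants are fixed by the p-th power, so f(T)^p = f(T^p); this is read off the syntax of f.
  Frob-f : Frob f (fᴾ Xₚ)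
  Frob-f = Frob-+ (Frob-+ (Frob-+ (Frob-* (Frob-* 2F 2F) (Frob-* (Frob-* TF TF) TF))
      (Frob-* (Frob-C b₂) (Frob-* TF TF))) (Frob-* (Frob-* 2F (Frob-C b₄)) TF)) (Frob-C b₆)
    where
    TF : Frob T Xₚ
    TF = P.refl
    2F : Frob two two
    2F = Frob-+ (Frob-C 1#) (Frob-C 1#)

  -- The Frobenius point on f(T)y² = f(x) is (T^p, f^((p-1)/2)). `F` is f times its y-coordinate,
  -- the quantity that enters the addition formula.
  F : Poly
  F = f ^ᴾ m

  F² : F ⊗ F ≋ f ⊗ fᴾ Xₚ
  F² = begin
    F ⊗ F ≈⟨ ^ᴾ-homo-* f m m ⟨
    f ^ᴾ (m N.+ m) ≡⟨ ≡.cong (f ^ᴾ_) p+1≡m+m ⟨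
    f ⊗ f ^ᴾ p ≈⟨ P.*-congˡ Frob-f ⟩
    f ⊗ fᴾ Xₚ ∎

  A₀ S₀ M₀ : Poly
  A₀ = α Xₚ P.1#
  S₀ = σ Xₚ P.1#
  M₀ = μ Xₚ P.1#

  b-relationᴾ : B₄ ⊗ B₄ ⊕ two ⊗ two ⊗ B₈ ≋ B₂ ⊗ B₆
  b-relationᴾ = begin
    B₄ ⊗ B₄ ⊕ two ⊗ two ⊗ B₈ ≈⟨ P.+-cong (C-* b₄ b₄) (P.trans (C-* _ b₈) (P.*-congʳ (P.trans (C-* _ _) (P.*-cong 2C 2C)))) ⟨
    C (b₄ * b₄) ⊕ C ((1# + 1#) * (1# + 1#) * b₈) ≈⟨ C-+ _ _ ⟨
    C (b₄ * b₄ + (1# + 1#) * (1# + 1#) * b₈) ≈⟨ C-cong b-relation ⟩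
    C (b₂ * b₆) ≈⟨ C-* b₂ b₆ ⟩
    B₂ ⊗ B₆ ∎
    where
    2C : C (1# + 1#) ≋ two
    2C = C-+ 1# 1#

  -- σ² - 4αμ equals f(T)f(X), up to a multiple of b₄² + 4b₈ - b₂b₆ = 0. At X = T^p this is the
  -- square of `F`, so the first quadratic splits.
  discriminant : S₀ ⊗ S₀ ≋ two ⊗ two ⊗ (A₀ ⊗ M₀) ⊕ F ⊗ F
  discriminant = begin
    S₀ ⊗ S₀ ≈⟨ PS.solve 6 (λ t X b2 b4 b6 b8 → :σ t b2 b4 b6 b8 X (con (+ 1)) :* :σ t b2 b4 b6 b8 X (con (+ 1)) :=
         :2 t t t t t :* :2 t t t t t :* (:α t b2 b4 b6 b8 X (con (+ 1)) :* :μ t b2 b4 b6 b8 X (con (+ 1)))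
         :+ :f t b2 b4 b6 b8 t :* :f t b2 b4 b6 b8 X
         :+ (X :- t) :* (X :- t) :* ((b4 :* b4 :+ :2 t t t t t :* :2 t t t t t :* b8) :- b2 :* b6)) P.refl T Xₚ B₂ B₄ B₆ B₈ ⟩
    two ⊗ two ⊗ (A₀ ⊗ M₀) ⊕ f ⊗ fᴾ Xₚ ⊕ (Xₚ ⊖ T) ⊗ (Xₚ ⊖ T) ⊗ ((B₄ ⊗ B₄ ⊕ two ⊗ two ⊗ B₈) ⊖ B₂ ⊗ B₆)
      ≈⟨ P.+-congˡ (P.trans (P.*-congˡ (P.trans (P.+-congʳ b-relationᴾ) (P.-‿inverseʳ _))) (P.zeroʳ _)) ⟩
    two ⊗ two ⊗ (A₀ ⊗ M₀) ⊕ f ⊗ fᴾ Xₚ ⊕ P.0# ≈⟨ P.+-identityʳ _ ⟩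
    two ⊗ two ⊗ (A₀ ⊗ M₀) ⊕ f ⊗ fᴾ Xₚ ≈⟨ P.+-congˡ F² ⟨
    two ⊗ two ⊗ (A₀ ⊗ M₀) ⊕ F ⊗ F ∎

  -- One of the two roots (σ ± F)/(2α). The sign is the one for which the numerator vanishes at the
  -- first coordinate τ of every rational point: there `S₀` and `F` both take the value f(τ).
  U₀ W₀ : Poly
  U₀ = S₀ ⊖ F
  W₀ = two ⊗ A₀

  related₀ : q Xₚ P.1# U₀ W₀ ≋ P.0#
  related₀ = begin
    q Xₚ P.1# U₀ W₀ ≈⟨ PS.solve 4 (λ a s m F → a :* ((s :- F) :* (s :- F)) :- s :* ((s :- F) :* ((con (+ 1) :+ con (+ 1)) :* a)) :+ m :* ((con (+ 1) :+ con (+ 1)) :* a :* ((con (+ 1) :+ con (+ 1)) :* a))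
       := a :* (((con (+ 1) :+ con (+ 1)) :* (con (+ 1) :+ con (+ 1)) :* (a :* m) :+ F :* F) :- s :* s)) P.refl A₀ S₀ M₀ F ⟩
    A₀ ⊗ ((two ⊗ two ⊗ (A₀ ⊗ M₀) ⊕ F ⊗ F) ⊖ S₀ ⊗ S₀) ≈⟨ P.*-congˡ (P.trans (P.+-congʳ (P.sym discriminant)) (P.-‿inverseʳ _)) ⟩
    A₀ ⊗ P.0# ≈⟨ P.zeroʳ _ ⟩
    P.0# ∎

  infix 4 _∣ᴾ_
  _∣ᴾ_ : Poly → Poly → Set
  g ∣ᴾ a = ∃[ b ] a ≋ g ⊗ b

  lin : Carrier → Poly
  lin τ = T ⊖ C τ

  lin-cong : ∀ {τ τ′} → τ ≈ τ′ → lin τ ≋ lin τ′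
  lin-cong e = P.+-congˡ (P.-‿cong (C-cong e))

  lin-degree : ∀ τ → HasDegree (lin τ) 1
  lin-degree τ = ≤°-+ {T} {P.- C τ} T-≤° (≤°-weaken {co (P.- C τ)} z≤n (≤°-neg {C τ} (C-≤° τ))) ,
    λ e → 1≉0 (trans (sym (trans (co-+ T (P.- C τ) 1) (trans (+-cong co-T-1 (≤°-neg {C τ} (C-≤° τ) 1 (s≤s z≤n))) (+-identityʳ 1#)))) e)

  lin≉0 : ∀ τ → ¬ lin τ ≋ P.0#
  lin≉0 τ = degree≉0 {lin τ} (lin-degree τ)

  module At (τ : Carrier) where
    -- a(τ) = c expressed as a ≡ c modulo T - τ, so that vanishing at τ is divisibility at once.
    Value : Poly → Carrier → Set
    Value a c = ∃[ w ] a ≋ C c ⊕ lin τ ⊗ w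

    value-C : ∀ c → Value (C c) c
    value-C c = P.0# , P.sym (P.trans (P.+-congˡ (P.zeroʳ _)) (P.+-identityʳ _))

    value-T : Value T τ
    value-T = P.1# , PS.solve 2 (λ t c → t := c :+ (t :- c) :* con (+ 1)) P.refl T (C τ)

    value-+ : ∀ {a b c d} → Value a c → Value b d → Value (a ⊕ b) (c + d)
    value-+ {a} {b} {c} {d} (u , eu) (v , ev) = u ⊕ v , (begin
      a ⊕ b ≈⟨ P.+-cong eu ev ⟩
      (C c ⊕ lin τ ⊗ u) ⊕ (C d ⊕ lin τ ⊗ v) ≈⟨ PS.solve 5 (λ c d l u v → (c :+ l :* u) :+ (d :+ l :* v) := (c :+ d) :+ l :* (u :+ v)) P.refl (C c) (C d) (lin τ) u v ⟩
      (C c ⊕ C d) ⊕ lin τ ⊗ (u ⊕ v) ≈⟨ P.+-congʳ (C-+ c d) ⟨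
      C (c + d) ⊕ lin τ ⊗ (u ⊕ v) ∎)

    value-* : ∀ {a b c d} → Value a c → Value b d → Value (a ⊗ b) (c * d)
    value-* {a} {b} {c} {d} (u , eu) (v , ev) = C c ⊗ v ⊕ u ⊗ C d ⊕ lin τ ⊗ u ⊗ v , (begin
      a ⊗ b ≈⟨ P.*-cong eu ev ⟩
      (C c ⊕ lin τ ⊗ u) ⊗ (C d ⊕ lin τ ⊗ v) ≈⟨ PS.solve 5 (λ c d l u v → (c :+ l :* u) :* (d :+ l :* v) := (c :* d) :+ l :* (c :* v :+ u :* d :+ l :* u :* v)) P.refl (C c) (C d) (lin τ) u v ⟩
      (C c ⊗ C d) ⊕ lin τ ⊗ (C c ⊗ v ⊕ u ⊗ C d ⊕ lin τ ⊗ u ⊗ v) ≈⟨ P.+-congʳ (C-* c d) ⟨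
      C (c * d) ⊕ lin τ ⊗ (C c ⊗ v ⊕ u ⊗ C d ⊕ lin τ ⊗ u ⊗ v) ∎)

    value-cong : ∀ {a c d} → c ≈ d → Value a c → Value a d
    value-cong e (w , ew) = w , P.trans ew (P.+-congʳ (C-cong e))

    value-neg : ∀ {a c} → Value a c → Value (P.- a) (- c)
    value-neg {a} {c} (w , ew) = P.- w , P.trans (P.-‿cong ew)
      (P.trans (PS.solve 3 (λ c l w → :- (c :+ l :* w) := :- c :+ l :* (:- w)) P.refl (C c) (lin τ) w) (P.+-congʳ C-neg))
      where
      C-neg : P.- C c ≋ C (- c)
      C-neg = P.trans (P.sym (P.+-identityʳ _)) (P.trans (P.+-congˡ (P.sym (P.trans (P.sym (C-+ c (- c))) (P.trans (C-cong (-‿inverseʳ c)) C-0))))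
        (PS.solve 2 (λ c d → :- c :+ (c :+ d) := d) P.refl (C c) (C (- c))))

    value-^ : ∀ {a c} n → Value a c → Value (a ^ᴾ n) (c ^ n)
    value-^ zero v = value-C 1#
    value-^ (suc n) v = value-* v (value-^ n v)

    value-0 : ∀ {a c} → c ≈ 0# → Value a c → lin τ ∣ᴾ a
    value-0 c0 (w , ew) = w , P.trans ew (P.trans (P.+-congʳ (P.trans (C-cong c0) C-0)) (P.+-identityˡ _))

    coprime-cancel : ∀ {a c b} → Value a c → ¬ c ≈ 0# → lin τ ∣ᴾ a ⊗ b → lin τ ∣ᴾ b
    coprime-cancel {a} {c} {b} (w , ew) c≉ (k , ek) with inverse c c≉
    ... | i , ci = C i ⊗ (k ⊖ w ⊗ b) , (begin
      b ≈⟨ P.trans (P.*-congʳ (P.trans (P.sym (C-* i c)) (C-cong (trans (*-comm i c) ci)))) (P.*-identityˡ b) ⟨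
      C i ⊗ C c ⊗ b ≈⟨ PS.solve 5 (λ i c b l w → i :* c :* b := i :* ((c :+ l :* w) :* b :- l :* w :* b)) P.refl (C i) (C c) b (lin τ) w ⟩
      C i ⊗ ((C c ⊕ lin τ ⊗ w) ⊗ b ⊖ lin τ ⊗ w ⊗ b) ≈⟨ P.*-congˡ (P.+-congʳ (P.trans (P.*-congʳ (P.sym ew)) ek)) ⟩
      C i ⊗ (lin τ ⊗ k ⊖ lin τ ⊗ w ⊗ b) ≈⟨ PS.solve 5 (λ i l k w b → i :* (l :* k :- l :* w :* b) := l :* (i :* (k :- w :* b))) P.refl (C i) (lin τ) k w b ⟩
      lin τ ⊗ (C i ⊗ (k ⊖ w ⊗ b)) ∎)

    coprime-cancel² : ∀ {a c b} → Value a c → ¬ c ≈ 0# → lin τ ⊗ lin τ ∣ᴾ a ⊗ b → lin τ ⊗ lin τ ∣ᴾ b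
    coprime-cancel² {a} {c} {b} va c≉ (k , ek) = proj₁ second , P.trans (proj₂ first) (P.trans (P.*-congˡ (proj₂ second)) (P.sym (P.*-assoc _ _ _)))
      where
      first : lin τ ∣ᴾ b
      first = coprime-cancel va c≉ (lin τ ⊗ k , P.trans ek (P.*-assoc _ _ _))
      b′ = proj₁ first
      second : lin τ ∣ᴾ b′
      second = coprime-cancel {b = b′} va c≉ (k , cancelᴾ (lin τ) (a ⊗ b′) (lin τ ⊗ k) (lin≉0 τ) (begin
          lin τ ⊗ (a ⊗ b′) ≈⟨ PS.solve 3 (λ l a b → l :* (a :* b) := a :* (l :* b)) P.refl (lin τ) a b′ ⟩
          a ⊗ (lin τ ⊗ b′) ≈⟨ P.*-congˡ (proj₂ first) ⟨
          a ⊗ b ≈⟨ ek ⟩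
          lin τ ⊗ lin τ ⊗ k ≈⟨ P.*-assoc _ _ _ ⟩
          lin τ ⊗ (lin τ ⊗ k) ∎))

    value-2 : Value two (1# + 1#)
    value-2 = value-+ (value-C 1#) (value-C 1#)

    value-f : Value f (fᴷ τ)
    value-f = value-+ (value-+ (value-+ (value-* (value-* value-2 value-2) (value-* (value-* value-T value-T) value-T))
      (value-* (value-C b₂) (value-* value-T value-T))) (value-* (value-* value-2 (value-C b₄)) value-T)) (value-C b₆)

    value-Xₚ : Value Xₚ τ
    value-Xₚ = value-cong (fermat τ) (value-^ p value-T)

    value-S₀ : Value S₀ (fᴷ τ)
    value-S₀ = value-cong (KS.solve 4 (λ t b2 b4 b6 →
        t :* t :* (two′ :* t) :+ t :* con (+ 1) :* (two′ :* (t :* t) :+ b2 :* t :+ b4) :+ con (+ 1) :* con (+ 1) :* (b4 :* t :+ b6)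
        := two′ :* two′ :* (t :* t :* t) :+ b2 :* (t :* t) :+ two′ :* b4 :* t :+ b6) refl τ b₂ b₄ b₆)
      (value-+ (value-+ (value-* (value-* value-Xₚ value-Xₚ) (value-* value-2 value-T))
        (value-* (value-* value-Xₚ (value-C 1#)) (value-+ (value-+ (value-* value-2 (value-* value-T value-T)) (value-* (value-C b₂) value-T)) (value-C b₄))))
        (value-* (value-* (value-C 1#) (value-C 1#)) (value-+ (value-* (value-C b₄) value-T) (value-C b₆))))
      where
      two′ : Polynomial
      two′ = con (+ 1) :+ con (+ 1)

    -- `A₀` is (T^p - T)², and by Fermat every τ is a root of T^p - T.
    lin²∣A₀ : lin τ ⊗ lin τ ∣ᴾ A₀
    lin²∣A₀ = w ⊗ w , (begin
      A₀ ≈⟨ α-square Xₚ P.1# ⟩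
      (Xₚ ⊖ T ⊗ P.1#) ⊗ (Xₚ ⊖ T ⊗ P.1#) ≈⟨ P.*-cong e e ⟩
      lin τ ⊗ w ⊗ (lin τ ⊗ w) ≈⟨ PS.solve 2 (λ l w → l :* w :* (l :* w) := l :* l :* (w :* w)) P.refl (lin τ) w ⟩
      lin τ ⊗ lin τ ⊗ (w ⊗ w) ∎)
      where
      lin∣ : lin τ ∣ᴾ Xₚ ⊖ T
      lin∣ = value-0 (-‿inverseʳ τ) (value-+ value-Xₚ (value-neg value-T))
      w = proj₁ lin∣
      e : Xₚ ⊖ T ⊗ P.1# ≋ lin τ ⊗ w
      e = P.trans (P.+-congˡ (P.-‿cong (P.*-identityʳ T))) (proj₂ lin∣)

    module _ (η : Carrier) (on : η * η ≈ fᴷ τ) where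
      -- Since f(τ) = η², f(τ)^m = η^(p+1) = η² by Fermat.
      value-F : Value F (fᴷ τ)
      value-F = value-cong e (value-^ m value-f)
        where
        open CExp commutativeSemiring using (^-distrib-*)
        e : fᴷ τ ^ m ≈ fᴷ τ
        e = trans (^-congˡ m (sym on)) (trans (^-distrib-* η η m) (trans (sym (^-homo-* η m m))
              (trans (reflexive (≡.cong (η ^_) (≡.sym p+1≡m+m))) (trans (*-congˡ (fermat η)) on))))

      lin∣U₀ : lin τ ∣ᴾ U₀
      lin∣U₀ = value-0 (-‿inverseʳ (fᴷ τ)) (value-+ value-S₀ (value-neg value-F))

      -- (S₀ + F)(S₀ - F) = 4A₀M₀ has a double zero at τ, and S₀ + F takes the value 2f(τ) = 2η² ≠ 0
      -- there, so the double zero belongs to S₀ - F.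
      lin²∣U₀ : ¬ η ≈ 0# → lin τ ⊗ lin τ ∣ᴾ U₀
      lin²∣U₀ η≉ = coprime-cancel² {S₀ ⊕ F} (value-+ value-S₀ value-F) c≉ (two ⊗ two ⊗ (w ⊗ M₀) , (begin
        (S₀ ⊕ F) ⊗ U₀ ≈⟨ PS.solve 2 (λ s F → (s :+ F) :* (s :- F) := s :* s :- F :* F) P.refl S₀ F ⟩
        S₀ ⊗ S₀ ⊖ F ⊗ F ≈⟨ P.+-congʳ discriminant ⟩
        (two ⊗ two ⊗ (A₀ ⊗ M₀) ⊕ F ⊗ F) ⊖ F ⊗ F ≈⟨ PS.solve 3 (λ t x y → (t :* x :+ y) :- y := t :* x) P.refl (two ⊗ two) (A₀ ⊗ M₀) (F ⊗ F) ⟩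
        two ⊗ two ⊗ (A₀ ⊗ M₀) ≈⟨ P.*-congˡ (P.*-congʳ (proj₂ lin²∣A₀)) ⟩
        two ⊗ two ⊗ (lin τ ⊗ lin τ ⊗ w ⊗ M₀) ≈⟨ PS.solve 4 (λ t l w m → t :* (l :* w :* m) := l :* (t :* (w :* m))) P.refl (two ⊗ two) (lin τ ⊗ lin τ) w M₀ ⟩
        lin τ ⊗ lin τ ⊗ (two ⊗ two ⊗ (w ⊗ M₀)) ∎))
        where
        w = proj₁ lin²∣A₀
        c≉ : ¬ fᴷ τ + fᴷ τ ≈ 0#
        c≉ e with integral (1# + 1#) (η * η) (trans (*-congˡ on) (trans (KS.solve 1 (λ x → (con (+ 1) :+ con (+ 1)) :* x := x :+ x) refl (fᴷ τ)) e))
        ... | inj₁ z = 2≉0 z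
        ... | inj₂ z = *≉0 η≉ η≉ z

  Point : Set
  Point = Carrier × Carrier

  OnQuartic : Point → Set
  OnQuartic (τ , η) = η * η ≈ fᴷ τ

  Apart : Point → Point → Set
  Apart (τ , η) (τ′ , η′) = ¬ (τ ≈ τ′ × η ≈ η′)

  -- The order of vanishing at τ must reach the number of listed points over τ, which is at most
  -- two: η and -η.
  Vanishes : Poly → List Point → Set
  Vanishes U L = (∀ {P} → P ∈ L → lin (proj₁ P) ∣ᴾ U) ×
    (∀ {P Q} → P ∈ L → Q ∈ L → proj₁ P ≈ proj₁ Q → ¬ proj₂ P ≈ proj₂ Q → lin (proj₁ P) ⊗ lin (proj₁ P) ∣ᴾ U)

  ∏lin : List Point → Poly
  ∏lin [] = P.1#
  ∏lin ((τ , _) ∷ L) = lin τ ⊗ ∏lin L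

  ∏lin-degree : ∀ L → HasDegree (∏lin L) (length L)
  ∏lin-degree [] = 1-≤° , λ e → 1≉0 (trans (sym (co-C-0 1#)) e)
  ∏lin-degree ((τ , _) ∷ L) = degree-* {lin τ} {∏lin L} (lin-degree τ) (∏lin-degree L)

  opposite : ∀ {x y} → x * x ≈ y * y → ¬ x ≈ y → y ≈ - x
  opposite {x} {y} e x≉y = [ (λ z → ⊥-elim (x≉y (trans (KS.solve 2 (λ x y → x := (x :- y) :+ y) refl x y) (trans (+-congʳ z) (+-identityˡ y))))) ,
    (λ z → trans (KS.solve 2 (λ x y → y := (x :+ y) :- x) refl x y) (trans (+-congʳ z) (+-identityˡ _))) ]′
    (integral (x - y) (x + y) (trans (KS.solve 2 (λ x y → (x :- y) :* (x :+ y) := x :* x :- y :* y) refl x y) (trans (+-congʳ e) (-‿inverseʳ _))))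

  fᴷ-cong : ∀ {x y} → x ≈ y → fᴷ x ≈ fᴷ y
  fᴷ-cong e = +-congʳ (+-cong (+-cong (*-congˡ (*-cong (*-cong e e) e)) (*-congˡ (*-cong e e))) (*-congˡ e))

  -- Dividing U by the factor of the first point keeps the condition for the rest: factors at other
  -- τ are coprime to it, and a second point over the same τ drops from a double zero to a simple
  -- one.
  ∏lin-divides : ∀ L → AllPairs Apart L → All OnQuartic L → ∀ U → Vanishes U L → ∏lin L ∣ᴾ U
  ∏lin-divides [] _ _ U _ = U , P.sym (P.*-identityˡ U)
  ∏lin-divides ((τ , η) ∷ L) (apart ∷ aparts) (on ∷ ons) U (simple , double) =
    proj₁ rest , P.trans eU (P.trans (P.*-congˡ (proj₂ rest)) (P.sym (P.*-assoc _ _ _)))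
    where
    U′ = proj₁ (simple (here ≡.refl))
    eU : U ≋ lin τ ⊗ U′
    eU = proj₂ (simple (here ≡.refl))
    value-lin : ∀ ς → At.Value ς (lin τ) (ς - τ)
    value-lin ς = At.value-+ ς (At.value-T ς) (At.value-neg ς (At.value-C ς τ))
    diff≉ : ∀ {ς} → ¬ τ ≈ ς → ¬ ς - τ ≈ 0#
    diff≉ {ς} τ≉ς e = τ≉ς (trans (KS.solve 2 (λ s t → t := s :- (s :- t)) refl ς τ) (trans (+-congˡ (-‿cong e)) (KS.solve 1 (λ s → s :- con (+ 0) := s) refl ς)))
    eq? : ∀ ς → Dec (τ ≈ ς)
    eq? ς with (τ - ς) ≟0
    ... | yes e = yes (trans (KS.solve 2 (λ s t → t := (t :- s) :+ s) refl ς τ) (trans (+-congʳ e) (+-identityˡ ς)))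
    ... | no ne = no λ e → ne (trans (+-congʳ e) (-‿inverseʳ ς))
    move : ∀ {g} → g ∣ᴾ U → g ∣ᴾ lin τ ⊗ U′
    move (k , ek) = k , P.trans (P.sym eU) ek
    strip : ∀ {ς} → τ ≈ ς → lin τ ⊗ lin τ ∣ᴾ U → lin ς ∣ᴾ U′
    strip τ≈ς (k , ek) = k , P.trans (cancelᴾ (lin τ) U′ (lin τ ⊗ k) (lin≉0 τ) (P.trans (P.sym eU) (P.trans ek (P.*-assoc _ _ _)))) (P.*-congʳ (lin-cong τ≈ς))
    simple′ : ∀ {P} → P ∈ L → lin (proj₁ P) ∣ᴾ U′
    simple′ {ς , θ} P∈ with eq? ς
    ... | no τ≉ς = At.coprime-cancel ς {lin τ} (value-lin ς) (diff≉ τ≉ς) (move (simple (there P∈)))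
    ... | yes τ≈ς = strip τ≈ς (double (here ≡.refl) (there P∈) τ≈ς (λ η≈θ → All.lookup apart P∈ (τ≈ς , η≈θ)))
    double′ : ∀ {P Q} → P ∈ L → Q ∈ L → proj₁ P ≈ proj₁ Q → ¬ proj₂ P ≈ proj₂ Q → lin (proj₁ P) ⊗ lin (proj₁ P) ∣ᴾ U′
    double′ {ς , θ} {ς′ , θ′} P∈ Q∈ ς≈ θ≉ with eq? ς
    ... | no τ≉ς = At.coprime-cancel² ς {lin τ} (value-lin ς) (diff≉ τ≉ς) (move (double (there P∈) (there Q∈) ς≈ θ≉))
    -- No third point lies over τ: both remaining ones would have second coordinate -η.
    ... | yes τ≈ς = ⊥-elim (θ≉ (trans
        (opposite (trans on (trans (fᴷ-cong τ≈ς) (sym (All.lookup ons P∈)))) (λ η≈ → All.lookup apart P∈ (τ≈ς , η≈)))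
        (sym (opposite (trans on (trans (fᴷ-cong (trans τ≈ς ς≈)) (sym (All.lookup ons Q∈)))) (λ η≈ → All.lookup apart Q∈ (trans τ≈ς ς≈ , η≈))))))
    rest : ∏lin L ∣ᴾ U′
    rest = ∏lin-divides L aparts ons U′ (simple′ , double′)

  module _ (L : List Point) (aparts : AllPairs Apart L) (ons : All OnQuartic L) where
    ℓ = length L

    divides-U₀ : ∏lin L ∣ᴾ U₀
    divides-U₀ = ∏lin-divides L aparts ons U₀ ((λ {P} P∈ → At.lin∣U₀ (proj₁ P) (proj₂ P) (All.lookup ons P∈)) , dbl)
      where
      dbl : ∀ {P Q} → P ∈ L → Q ∈ L → proj₁ P ≈ proj₁ Q → ¬ proj₂ P ≈ proj₂ Q → lin (proj₁ P) ⊗ lin (proj₁ P) ∣ᴾ U₀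
      dbl {τ , η} {τ′ , η′} P∈ Q∈ τ≈ η≉ = At.lin²∣U₀ τ η (All.lookup ons P∈) λ η0 → η≉ (trans η0 (sym (η′0 η0)))
        where
        η′0 : η ≈ 0# → η′ ≈ 0#
        η′0 η0 = [ (λ z → z) , (λ z → z) ]′ (integral η′ η′ (trans (All.lookup ons Q∈) (trans (fᴷ-cong (sym τ≈)) (trans (sym (All.lookup ons P∈)) (trans (*-congʳ η0) (zeroˡ η))))))

    divides-W₀ : ∏lin L ∣ᴾ W₀
    divides-W₀ = two ⊗ proj₁ div , P.trans (P.*-congˡ (proj₂ div)) (PS.solve 3 (λ t g k → t :* (g :* k) := g :* (t :* k)) P.refl two (∏lin L) (proj₁ div))
      where
      div : ∏lin L ∣ᴾ A₀
      div = ∏lin-divides L aparts ons A₀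
        ((λ {P} _ → lin (proj₁ P) ⊗ proj₁ (At.lin²∣A₀ (proj₁ P)) , P.trans (proj₂ (At.lin²∣A₀ (proj₁ P))) (P.*-assoc _ _ _)) ,
         (λ {P} _ _ _ _ → At.lin²∣A₀ (proj₁ P)))

    1<p : 1 < p
    1<p = N.nonTrivial⇒n>1 p {{prime⇒nonTrivial p-prime}}

    Xₚ-degree : HasDegree Xₚ p
    Xₚ-degree = ≡.subst (co Xₚ ≤°_) (NP.*-identityʳ p) (≤°-^ {T} p T-≤°) ,
      λ e → 1≉0 (trans (sym (trans (reflexive (≡.cong (co Xₚ) (≡.sym (NP.+-identityʳ p))))
        (trans (at (P.sym (P.*-identityʳ Xₚ)) (p N.+ 0)) (trans (T^-shift p P.1# 0) (co-C-0 1#))))) e)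

    -- The points enter here and nowhere else: `U₀` and `W₀` have degree at most 2p + 1 and share a
    -- factor of degree ℓ, which cancels in the height.
    initial : ∃[ h ] h N.+ ℓ ≤ p N.+ suc p × Adjacent p h
    initial = h , bound , record
      { X₀ = Xₚ ; Z₀ = P.1# ; X₁ = X ; Z₁ = Z
      ; coprime₀ = P.0# , P.1# , P.trans (P.+-cong (P.zeroˡ _) (P.*-identityˡ _)) (P.+-identityˡ _)
      ; coprime₁ = cop
      ; height₀ = record { a≤° = proj₁ Xₚ-degree ; b≤° = ≤°-weaken {co P.1#} z≤n 1-≤° ; top = λ t → proj₂ Xₚ-degree (proj₁ t) }
      ; height₁ = H
      ; related = P.trans (q-sym X Z Xₚ P.1#) rel }
      where
      G = ∏lin L
      U′ = proj₁ divides-U₀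
      W′ = proj₁ divides-W₀
      Xₚ-T≉0 : ¬ Xₚ ⊖ T ⊗ P.1# ≋ P.0#
      Xₚ-T≉0 e = proj₂ Xₚ-degree (trans (at (P.trans (PS.solve 2 (λ x t → x := (x :- t :* con (+ 1)) :+ t) P.refl Xₚ T) (P.trans (P.+-congʳ e) (P.+-identityˡ T))) p)
        (T-≤° p 1<p))
      A₀≉0 : ¬ A₀ ≋ P.0#
      A₀≉0 z = [ Xₚ-T≉0 , Xₚ-T≉0 ]′ (integralᴾ (Xₚ ⊖ T ⊗ P.1#) (Xₚ ⊖ T ⊗ P.1#) (P.trans (P.sym (α-square Xₚ P.1#)) z))
      two≉0 : ¬ two ≋ P.0#
      two≉0 e = 2≉0 (trans (sym (trans (co-+ P.1# P.1# 0) (+-cong (co-C-0 1#) (co-C-0 1#)))) (trans (at e 0) (co-0 0)))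
      nz : ¬ (U′ ≋ P.0# × W′ ≋ P.0#)
      nz (_ , w0) = [ two≉0 , A₀≉0 ]′ (integralᴾ two A₀ (P.trans (proj₂ divides-W₀) (P.trans (P.*-congˡ w0) (P.zeroʳ G))))
      red = reduced U′ W′ nz
      g = proj₁ red
      X = proj₁ (proj₂ red)
      Z = proj₁ (proj₂ (proj₂ red))
      g≉0 = proj₁ (proj₂ (proj₂ (proj₂ red)))
      eX = proj₁ (proj₂ (proj₂ (proj₂ (proj₂ red))))
      eZ = proj₁ (proj₂ (proj₂ (proj₂ (proj₂ (proj₂ red)))))
      cop = proj₂ (proj₂ (proj₂ (proj₂ (proj₂ (proj₂ red)))))
      nz₁ : ¬ (X ≋ P.0# × Z ≋ P.0#)
      nz₁ (x0 , z0) = nz (P.trans eX (P.trans (P.*-congˡ x0) (P.zeroʳ _)) , P.trans eZ (P.trans (P.*-congˡ z0) (P.zeroʳ _)))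
      h = proj₁ (has-height X Z nz₁)
      H = proj₂ (has-height X Z nz₁)
      U≋ : U₀ ≋ G ⊗ g ⊗ X
      U≋ = P.trans (proj₂ divides-U₀) (P.trans (P.*-congˡ eX) (P.sym (P.*-assoc _ _ _)))
      W≋ : W₀ ≋ G ⊗ g ⊗ Z
      W≋ = P.trans (proj₂ divides-W₀) (P.trans (P.*-congˡ eZ) (P.sym (P.*-assoc _ _ _)))
      deg-g : ∃[ γ ] HasDegree g γ
      deg-g = [ (λ z → ⊥-elim (g≉0 z)) , (λ d → d) ]′ (degree? g)
      deg-Gg : HasDegree (G ⊗ g) (ℓ N.+ proj₁ deg-g)
      deg-Gg = degree-* {G} {g} (∏lin-degree L) (proj₂ deg-g)
      rel : q Xₚ P.1# X Z ≋ P.0#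
      rel = [ (λ e → ⊥-elim (degree≉0 {(G ⊗ g) ⊗ (G ⊗ g)} (degree-* {G ⊗ g} {G ⊗ g} deg-Gg deg-Gg) e)) , (λ e → e) ]′
        (integralᴾ ((G ⊗ g) ⊗ (G ⊗ g)) (q Xₚ P.1# X Z) (P.trans (P.sym (q-scale Xₚ P.1# X Z (G ⊗ g)))
          (P.trans (q-cong Xₚ P.1# (P.sym U≋) (P.sym W≋)) related₀)))
      d = p N.+ suc p
      Xₚ≤ = proj₁ Xₚ-degree
      XX≤ : co (Xₚ ⊗ Xₚ) ≤° p N.+ p
      XX≤ = ≤°-* {Xₚ} {Xₚ} p p Xₚ≤ Xₚ≤
      p+1≤ : ∀ {k} → k ≤ 2 → p N.+ 0 N.+ k ≤ d
      p+1≤ {k} k≤2 = NP.≤-trans (NP.≤-reflexive (≡.cong (N._+ k) (NP.+-identityʳ p))) (NP.+-monoʳ-≤ p (NP.≤-trans k≤2 (NP.≤-trans (1<p) (NP.n≤1+n p))))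
      2T : co (two ⊗ T) ≤° 1
      2T = ≤°-* {two} {T} 0 1 two-≤° T-≤°
      TT : co (T ⊗ T) ≤° 2
      TT = ≤°-* {T} {T} 1 1 T-≤° T-≤°
      cT : ∀ c → co (C c ⊗ T) ≤° 1
      cT c = ≤°-* {C c} {T} 0 1 (C-≤° c) T-≤°
      three : ∀ {w₁ w₂ w₃} → co w₁ ≤° 1 → co w₂ ≤° 2 → co w₃ ≤° 2 → co (Xₚ ⊗ Xₚ ⊗ w₁ ⊕ Xₚ ⊗ P.1# ⊗ w₂ ⊕ P.1# ⊗ P.1# ⊗ w₃) ≤° d
      three {w₁} {w₂} {w₃} p₁ p₂ p₃ = ≤°-+ {Xₚ ⊗ Xₚ ⊗ w₁ ⊕ Xₚ ⊗ P.1# ⊗ w₂} {P.1# ⊗ P.1# ⊗ w₃}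
        (≤°-+ {Xₚ ⊗ Xₚ ⊗ w₁} {Xₚ ⊗ P.1# ⊗ w₂}
          (≤°-weaken {co (Xₚ ⊗ Xₚ ⊗ w₁)} (NP.≤-reflexive (≡.trans (NP.+-assoc p p 1) (≡.cong (p N.+_) (NP.+-comm p 1)))) (≤°-* {Xₚ ⊗ Xₚ} {w₁} (p N.+ p) 1 XX≤ p₁))
          (≤°-weaken {co (Xₚ ⊗ P.1# ⊗ w₂)} (p+1≤ (NP.≤-refl)) (≤°-* {Xₚ ⊗ P.1#} {w₂} (p N.+ 0) 2 (≤°-* {Xₚ} {P.1#} p 0 Xₚ≤ 1-≤°) p₂)))
        (≤°-weaken {co (P.1# ⊗ P.1# ⊗ w₃)} (NP.≤-trans (NP.m≤n+m 2 (p N.+ 0)) (p+1≤ NP.≤-refl)) (≤°-* {P.1# ⊗ P.1#} {w₃} 0 2 (≤°-* {P.1#} {P.1#} 0 0 1-≤° 1-≤°) p₃))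
      w1 : ∀ {g} → co g ≤° 1 → co g ≤° 2
      w1 {g} = ≤°-weaken {co g} (s≤s z≤n)
      w0 : ∀ {g} k → co g ≤° 0 → co g ≤° k
      w0 {g} k = ≤°-weaken {co g} {0} {k} z≤n
      S≤ : co S₀ ≤° d
      S≤ = three {two ⊗ T} {two ⊗ (T ⊗ T) ⊕ B₂ ⊗ T ⊕ B₄} {B₄ ⊗ T ⊕ B₆} 2T
        (≤°-+ {two ⊗ (T ⊗ T) ⊕ B₂ ⊗ T} {B₄} (≤°-+ {two ⊗ (T ⊗ T)} {B₂ ⊗ T} (≤°-* {two} {T ⊗ T} 0 2 two-≤° TT) (w1 {B₂ ⊗ T} (cT b₂))) (w0 {B₄} 2 (C-≤° b₄)))
        (≤°-+ {B₄ ⊗ T} {B₆} (w1 {B₄ ⊗ T} (cT b₄)) (w0 {B₆} 2 (C-≤° b₆)))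
      A≤ : co A₀ ≤° d
      A≤ = three {P.1#} {P.- (two ⊗ T)} {T ⊗ T} (w0 {P.1#} 1 1-≤°) (≤°-neg {two ⊗ T} (w1 {two ⊗ T} 2T)) TT
      f≤ : co f ≤° 3
      f≤ = ≤°-+ {two ⊗ two ⊗ (T ⊗ T ⊗ T) ⊕ B₂ ⊗ (T ⊗ T) ⊕ two ⊗ B₄ ⊗ T} {B₆}
        (≤°-+ {two ⊗ two ⊗ (T ⊗ T ⊗ T) ⊕ B₂ ⊗ (T ⊗ T)} {two ⊗ B₄ ⊗ T}
          (≤°-+ {two ⊗ two ⊗ (T ⊗ T ⊗ T)} {B₂ ⊗ (T ⊗ T)}
            (≤°-* {two ⊗ two} {T ⊗ T ⊗ T} 0 3 (≤°-* {two} {two} 0 0 two-≤° two-≤°) (≤°-* {T ⊗ T} {T} 2 1 TT T-≤°))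
            (≤°-weaken {co (B₂ ⊗ (T ⊗ T))} (s≤s (s≤s z≤n)) (≤°-* {B₂} {T ⊗ T} 0 2 (C-≤° b₂) TT)))
          (≤°-weaken {co (two ⊗ B₄ ⊗ T)} (s≤s z≤n) (≤°-* {two ⊗ B₄} {T} 0 1 (≤°-* {two} {B₄} 0 0 two-≤° (C-≤° b₄)) T-≤°)))
        (w0 {B₆} 3 (C-≤° b₆))
      -- The degree of `F` is at most 3(p + 1)/2; with m = k + 1 and p = 2k + 1 this is 3k + 3 ≤ 4k
      -- + 3.
      3m≤ : m N.* 3 ≤ d
      3m≤ = ≤d m (≡.sym p+1≡m+m)
        where
        arith : ∀ k → suc k N.* 3 N.+ k ≡ (k N.+ suc k) N.+ (suc k N.+ suc k)
        arith = solve-∀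
        ≤d : ∀ m → m N.+ m ≡ suc p → m N.* 3 ≤ p N.+ suc p
        ≤d (suc k) e = NP.≤-trans (NP.m≤m+n (suc k N.* 3) k) (NP.≤-reflexive (≡.trans (arith k) (≡.cong₂ N._+_ (NP.suc-injective e) e)))
      U≤ : co U₀ ≤° d
      U≤ = ≤°-+ {S₀} {P.- F} S≤ (≤°-neg {F} (≤°-weaken {co F} 3m≤ (≤°-^ {f} m f≤)))
      W≤ : co W₀ ≤° d
      W≤ = ≤°-* {two} {A₀} 0 d two-≤° A≤
      bound : h N.+ ℓ ≤ d
      bound = NP.≤-trans (NP.≤-reflexive (NP.+-comm h ℓ)) (NP.≤-trans (NP.+-monoˡ-≤ h (NP.m≤m+n ℓ (proj₁ deg-g)))
        (height-scale {G ⊗ g} {a = X} {b = Z} deg-Gg H (≤°-cong U≋ U≤) (≤°-cong W≋ W≤)))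

    -- The increment h′ - h is at most p + 1 + 2n - ℓ and the height h is at most n² + n(p - ℓ) + p,
    -- both written without subtraction.
    Heights : ℕ → Set
    Heights n = ∃[ h ] ∃[ h′ ] h′ N.+ ℓ ≤ h N.+ (suc p N.+ (n N.+ n)) × h N.+ n N.* ℓ ≤ p N.+ n N.* p N.+ n N.* n × Adjacent h h′

    heights-suc : ∀ n → Heights n → Heights (suc n)
    heights-suc n (h , h′ , b₁ , b₂ , adj) = extend (next adj)
      where
      extend : ∃[ h″ ] h N.+ h″ ≤ suc h′ N.+ suc h′ × Adjacent h′ h″ → Heights (suc n)
      extend (h″ , b , adj′) = h′ , h″ , proj₁ (convex-step p n ℓ b₁ b₂ b) , proj₂ (convex-step p n ℓ b₁ b₂ b) , adj′

    heights : ∀ n → Heights n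
    heights zero = begin₀ initial
      where
      begin₀ : ∃[ h ] h N.+ ℓ ≤ p N.+ suc p × Adjacent p h → Heights 0
      begin₀ (h , b , adj) = p , h , ≡.subst (h N.+ ℓ ≤_) (≡.cong (p N.+_) (≡.sym (NP.+-identityʳ (suc p)))) b ,
        NP.≤-reflexive (≡.sym (NP.+-identityʳ (p N.+ 0))) , adj
    heights (suc n) = heights-suc n (heights n)

    point-count : ∀ n → n N.* ℓ ≤ p N.+ n N.* p N.+ n N.* n
    point-count n = NP.≤-trans (NP.m≤n+m (n N.* ℓ) (proj₁ (heights n))) (proj₁ (proj₂ (proj₂ (proj₂ (heights n)))))

-- The homogeneous Weierstrass cubic and the polynomial laws for translation

record V3 (C : Set) : Set where
  constructor vec
  field X Y Z : C
open V3 public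

-- Over bare operations, without axioms: the same text is instantiated at field elements, at solver
-- polynomials and at the syntax `Expr`, and the instances agree by computation.
module Formulas {C : Set} (_+_ _*_ : C → C → C) (-_ : C → C) (1# : C) (a₁ a₂ a₃ a₄ a₆ : C) where
  private
    infixl 6 _⊕_ _⊖_
    infixl 7 _⊗_
    _⊕_ _⊗_ _⊖_ : C → C → C
    _⊕_ = _+_
    _⊗_ = _*_
    u ⊖ v = u + (- v)
    2# 3# : C
    2# = 1# ⊕ 1#
    3# = 1# ⊕ (1# ⊕ 1#)

  F FX FY FZ : V3 C → C
  F (vec x y z) = y ⊗ y ⊗ z ⊕ a₁ ⊗ (x ⊗ y ⊗ z) ⊕ a₃ ⊗ (y ⊗ z ⊗ z) ⊖ x ⊗ x ⊗ x ⊖ a₂ ⊗ (x ⊗ x ⊗ z) ⊖ a₄ ⊗ (x ⊗ z ⊗ z) ⊖ a₆ ⊗ (z ⊗ z ⊗ z)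
  FX (vec x y z) = a₁ ⊗ (y ⊗ z) ⊖ 3# ⊗ (x ⊗ x) ⊖ 2# ⊗ (a₂ ⊗ (x ⊗ z)) ⊖ a₄ ⊗ (z ⊗ z)
  FY (vec x y z) = 2# ⊗ (y ⊗ z) ⊕ a₁ ⊗ (x ⊗ z) ⊕ a₃ ⊗ (z ⊗ z)
  FZ (vec x y z) = y ⊗ y ⊕ a₁ ⊗ (x ⊗ y) ⊕ 2# ⊗ (a₃ ⊗ (y ⊗ z)) ⊖ a₂ ⊗ (x ⊗ x) ⊖ 2# ⊗ (a₄ ⊗ (x ⊗ z)) ⊖ 3# ⊗ (a₆ ⊗ (z ⊗ z))

  -- The polar form of the cubic: L(u, v) is the coefficient of α²β in F(αu + βv).
  L : V3 C → V3 C → C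
  L u v = FX u ⊗ X v ⊕ FY u ⊗ Y v ⊕ FZ u ⊗ Z v

  negate : V3 C → V3 C
  negate (vec x y z) = vec x (- (y ⊕ (a₁ ⊗ x ⊕ a₃ ⊗ z))) z

  -- The third point of the line through A and S.
  chord : V3 C → V3 C → V3 C
  chord A S = vec (l ⊗ X A ⊖ k ⊗ X S) (l ⊗ Y A ⊖ k ⊗ Y S) (l ⊗ Z A ⊖ k ⊗ Z S)
    where
    l = L S A
    k = L A S

  -- In the affine chart c = const, F(u₂,v₂) − F(u₁,v₁) = (u₂ − u₁)G + (v₂ − v₁)H, so (H, −G) is
  -- a direction vector of the line through A and S that does not degenerate when S tends to A.
  tangentZ : V3 C → V3 C → V3 C
  tangentZ A S = vec (c₃ ⊗ (2# ⊗ (α ⊗ X A) ⊖ Z A ⊗ X S) ⊖ α ⊗ c₂ ⊗ H)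
                     (c₃ ⊗ (2# ⊗ (α ⊗ Y A) ⊖ Z A ⊗ Y S) ⊕ α ⊗ c₂ ⊗ G)
                     (c₃ ⊗ (α ⊗ Z A))
    module TZ where
    α = Z S
    u₁ = Z S ⊗ X A
    v₁ = Z S ⊗ Y A
    u₂ = Z A ⊗ X S
    v₂ = Z A ⊗ Y S
    ζ = Z A ⊗ Z S
    H = ζ ⊗ (v₁ ⊕ v₂ ⊕ a₁ ⊗ u₂ ⊕ a₃ ⊗ ζ)
    G = a₁ ⊗ (v₁ ⊗ ζ) ⊖ (u₁ ⊗ u₁ ⊕ u₁ ⊗ u₂ ⊕ u₂ ⊗ u₂) ⊖ a₂ ⊗ ((u₁ ⊕ u₂) ⊗ ζ) ⊖ a₄ ⊗ (ζ ⊗ ζ)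
    -- `c₃` and `c₂` are F(e) and L(e, A) for the direction e = (H, -G, 0), written out.
    c₃ = - (H ⊗ H ⊗ H)
    c₂ = (G ⊗ G ⊖ a₁ ⊗ (H ⊗ G) ⊖ a₂ ⊗ (H ⊗ H)) ⊗ Z A ⊖ 3# ⊗ (H ⊗ H) ⊗ X A

  -- The same construction in the chart Y = 1, which contains the origin (0 : 1 : 0). It serves when
  -- P itself reduces to the origin.
  tangentY : V3 C → V3 C → V3 C
  tangentY A S = vec (c₃ ⊗ (2# ⊗ (α ⊗ X A) ⊖ Y A ⊗ X S) ⊖ α ⊗ c₂ ⊗ H)
                     (c₃ ⊗ (α ⊗ Y A))
                     (c₃ ⊗ (2# ⊗ (α ⊗ Z A) ⊖ Y A ⊗ Z S) ⊕ α ⊗ c₂ ⊗ G)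
    module TY where
    α = Y S
    u₁ = Y S ⊗ X A
    w₁ = Y S ⊗ Z A
    u₂ = Y A ⊗ X S
    w₂ = Y A ⊗ Z S
    ζ = Y A ⊗ Y S
    H = ζ ⊗ ζ ⊕ a₁ ⊗ (u₂ ⊗ ζ) ⊕ a₃ ⊗ (ζ ⊗ (w₁ ⊕ w₂)) ⊖ a₂ ⊗ (u₂ ⊗ u₂) ⊖ a₄ ⊗ (u₂ ⊗ (w₁ ⊕ w₂)) ⊖ a₆ ⊗ (w₁ ⊗ w₁ ⊕ w₁ ⊗ w₂ ⊕ w₂ ⊗ w₂)
    G = a₁ ⊗ (ζ ⊗ w₁) ⊖ (u₁ ⊗ u₁ ⊕ u₁ ⊗ u₂ ⊕ u₂ ⊗ u₂) ⊖ a₂ ⊗ ((u₁ ⊕ u₂) ⊗ w₁) ⊖ a₄ ⊗ (w₁ ⊗ w₁)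
    c₃ = a₂ ⊗ (H ⊗ H ⊗ G) ⊖ H ⊗ H ⊗ H ⊖ a₄ ⊗ (H ⊗ G ⊗ G) ⊕ a₆ ⊗ (G ⊗ G ⊗ G)
    c₂ = (2# ⊗ (a₂ ⊗ (H ⊗ G)) ⊖ 3# ⊗ (H ⊗ H) ⊖ a₄ ⊗ (G ⊗ G)) ⊗ X A ⊕ (a₃ ⊗ (G ⊗ G) ⊖ a₁ ⊗ (H ⊗ G)) ⊗ Y A
         ⊕ (2# ⊗ (a₄ ⊗ (H ⊗ G)) ⊖ a₂ ⊗ (H ⊗ H) ⊖ 3# ⊗ (a₆ ⊗ (G ⊗ G))) ⊗ Z A

private
  module :F (b₁ b₂ b₃ b₄ b₆ : Polynomial) = Formulas _:+_ _:*_ :-_ (con (+ 1)) b₁ b₂ b₃ b₄ b₆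
  :s : Polynomial → V3 Polynomial → V3 Polynomial
  :s c v = vec (c :* X v) (c :* Y v) (c :* Z v)
  infixl 6 _:v-_ _:v+_
  _:v-_ _:v+_ : V3 Polynomial → V3 Polynomial → V3 Polynomial
  u :v- v = vec (X u :- X v) (Y u :- Y v) (Z u :- Z v)
  u :v+ v = vec (X u :+ X v) (Y u :+ Y v) (Z u :+ Z v)
  :3 : Polynomial
  :3 = con (+ 1) :+ (con (+ 1) :+ con (+ 1))
  :2 : Polynomial
  :2 = con (+ 1) :+ con (+ 1)

module OverField (𝔽 : Field) where
  open Field 𝔽 using (integral; _≟0; inverse; 1≉0) renaming (commutativeRing to R)
  open CommutativeRing R
  open import Relation.Binary.Reasoning.Setoid setoid
  private
    module S = IntSolver R

  module Cubic (a₁ a₂ a₃ a₄ a₆ : Carrier) where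
    open Formulas _+_ _*_ -_ 1# a₁ a₂ a₃ a₄ a₆ public

    2# 3# : Carrier
    2# = 1# + 1#
    3# = 1# + (1# + 1#)

    Vec : Set
    Vec = V3 Carrier

    infixr 7 _•_
    _•_ : Carrier → Vec → Vec
    c • v = vec (c * X v) (c * Y v) (c * Z v)

    infixl 6 _⊟_
    _⊟_ : Vec → Vec → Vec
    u ⊟ v = vec (X u - X v) (Y u - Y v) (Z u - Z v)

    infix 4 _≈ᵛ_
    record _≈ᵛ_ (u v : Vec) : Set where
      constructor veq
      field
        ≈X : X u ≈ X v
        ≈Y : Y u ≈ Y v
        ≈Z : Z u ≈ Z v
    open _≈ᵛ_ public

    ≈ᵛ-sym : ∀ {u v} → u ≈ᵛ v → v ≈ᵛ u
    ≈ᵛ-sym (veq a b c) = veq (sym a) (sym b) (sym c)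

    ≈ᵛ-trans : ∀ {u v w} → u ≈ᵛ v → v ≈ᵛ w → u ≈ᵛ w
    ≈ᵛ-trans (veq a b c) (veq a′ b′ c′) = veq (trans a a′) (trans b b′) (trans c c′)

    0ᵛ : Vec
    0ᵛ = vec 0# 0# 0#

    FX-cong : ∀ {u v} → u ≈ᵛ v → FX u ≈ FX v
    FX-cong (veq x y z) = +-cong (+-cong (+-cong (*-congˡ (*-cong y z)) (-‿cong (*-congˡ (*-cong x x)))) (-‿cong (*-congˡ (*-congˡ (*-cong x z))))) (-‿cong (*-congˡ (*-cong z z)))

    FY-cong : ∀ {u v} → u ≈ᵛ v → FY u ≈ FY v
    FY-cong (veq x y z) = +-cong (+-cong (*-congˡ (*-cong y z)) (*-congˡ (*-cong x z))) (*-congˡ (*-cong z z))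

    FZ-cong : ∀ {u v} → u ≈ᵛ v → FZ u ≈ FZ v
    FZ-cong (veq x y z) = +-cong (+-cong (+-cong (+-cong (+-cong (*-cong y y) (*-congˡ (*-cong x y))) (*-congˡ (*-congˡ (*-cong y z)))) (-‿cong (*-congˡ (*-cong x x)))) (-‿cong (*-congˡ (*-congˡ (*-cong x z))))) (-‿cong (*-congˡ (*-congˡ (*-cong z z))))

    F-cong : ∀ {u v} → u ≈ᵛ v → F u ≈ F v
    F-cong (veq x y z) = +-cong (+-cong (+-cong (+-cong (+-cong (+-cong (*-cong (*-cong y y) z) (*-congˡ (*-cong (*-cong x y) z))) (*-congˡ (*-cong (*-cong y z) z)))
      (-‿cong (*-cong (*-cong x x) x))) (-‿cong (*-congˡ (*-cong (*-cong x x) z)))) (-‿cong (*-congˡ (*-cong (*-cong x z) z)))) (-‿cong (*-congˡ (*-cong (*-cong z z) z)))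

    L-cong : ∀ {u u′ v v′} → u ≈ᵛ u′ → v ≈ᵛ v′ → L u v ≈ L u′ v′
    L-cong p (veq x y z) = +-cong (+-cong (*-cong (FX-cong p) x) (*-cong (FY-cong p) y)) (*-cong (FZ-cong p) z)

    F-scale : ∀ c v → F (c • v) ≈ c * c * c * F v
    F-scale c (vec x y z) = S.solve 9 (λ b₁ b₂ b₃ b₄ b₆ c x y z → let open :F b₁ b₂ b₃ b₄ b₆ using () renaming (F to F′; L to L′; module TZ to TZ′; module TY to TY′) in
      F′ (:s c (vec x y z)) := c :* c :* c :* F′ (vec x y z)) refl a₁ a₂ a₃ a₄ a₆ c x y z

    L-scale : ∀ c d u v → L (c • u) (d • v) ≈ c * c * d * L u v
    L-scale c d (vec x y z) (vec x′ y′ z′) = S.solve 13 (λ b₁ b₂ b₃ b₄ b₆ c d x y z x′ y′ z′ → let open :F b₁ b₂ b₃ b₄ b₆ using () renaming (F to F′; L to L′; module TZ to TZ′; module TY to TY′) in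
      L′ (:s c (vec x y z)) (:s d (vec x′ y′ z′)) := c :* c :* d :* L′ (vec x y z) (vec x′ y′ z′)) refl a₁ a₂ a₃ a₄ a₆ c d x y z x′ y′ z′

    F-line : ∀ α β u v → F (vec (α * X u + β * X v) (α * Y u + β * Y v) (α * Z u + β * Z v)) ≈
      α * α * α * F u + α * α * β * L u v + α * β * β * L v u + β * β * β * F v
    F-line α β (vec x y z) (vec x′ y′ z′) = S.solve 13 (λ b₁ b₂ b₃ b₄ b₆ α β x y z x′ y′ z′ → let open :F b₁ b₂ b₃ b₄ b₆ using () renaming (F to F′; L to L′; module TZ to TZ′; module TY to TY′); u = vec x y z; v = vec x′ y′ z′ in
      F′ (:s α u :v+ :s β v) := α :* α :* α :* F′ u :+ α :* α :* β :* L′ u v :+ α :* β :* β :* L′ v u :+ β :* β :* β :* F′ v) refl a₁ a₂ a₃ a₄ a₆ α β x y z x′ y′ z′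

    L-lineˡ : ∀ α β u v → L (vec (α * X u + β * X v) (α * Y u + β * Y v) (α * Z u + β * Z v)) u ≈
      3# * (α * α * F u) + 2# * (α * β * L u v) + β * β * L v u
    L-lineˡ α β (vec x y z) (vec x′ y′ z′) = S.solve 13 (λ b₁ b₂ b₃ b₄ b₆ α β x y z x′ y′ z′ → let open :F b₁ b₂ b₃ b₄ b₆ using () renaming (F to F′; L to L′; module TZ to TZ′; module TY to TY′); u = vec x y z; v = vec x′ y′ z′ in
      L′ (:s α u :v+ :s β v) u := :3 :* (α :* α :* F′ u) :+ :2 :* (α :* β :* L′ u v) :+ β :* β :* L′ v u) refl a₁ a₂ a₃ a₄ a₆ α β x y z x′ y′ z′

    L-lineʳ : ∀ α β u v → L u (vec (α * X u + β * X v) (α * Y u + β * Y v) (α * Z u + β * Z v)) ≈ 3# * (α * F u) + β * L u v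
    L-lineʳ α β (vec x y z) (vec x′ y′ z′) = S.solve 13 (λ b₁ b₂ b₃ b₄ b₆ α β x y z x′ y′ z′ → let open :F b₁ b₂ b₃ b₄ b₆ using () renaming (F to F′; L to L′; module TZ to TZ′; module TY to TY′); u = vec x y z; v = vec x′ y′ z′ in
      L′ u (:s α u :v+ :s β v) := :3 :* (α :* F′ u) :+ β :* L′ u v) refl a₁ a₂ a₃ a₄ a₆ α β x y z x′ y′ z′

    -- With φS = αA + se, the equation F(S) = 0 becomes the relation `cubic` among c₁ = L(A, e), c₂
    -- = L(e, A) and c₃ = F(e). Everything about the line through A and S follows by eliminating c₁.
    module Secant (A S : Vec) (FA : F A ≈ 0#) (FS : F S ≈ 0#) (φ α s : Carrier) (e : Vec)
      (eX : φ * X S ≈ α * X A + s * X e) (eY : φ * Y S ≈ α * Y A + s * Y e) (eZ : φ * Z S ≈ α * Z A + s * Z e) where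
      private
        c₁ = L A e
        c₂ = L e A
        c₃ = F e
        w = vec (α * X A + s * X e) (α * Y A + s * Y e) (α * Z A + s * Z e)
        e≈ : φ • S ≈ᵛ w
        e≈ = veq eX eY eZ
        A≈ : A ≈ᵛ 1# • A
        A≈ = veq (sym (*-identityˡ _)) (sym (*-identityˡ _)) (sym (*-identityˡ _))
      LAS : φ * L A S ≈ s * c₁
      LAS = begin
        φ * L A S ≈⟨ S.solve 2 (λ p l → con (+ 1) :* con (+ 1) :* p :* l := p :* l) refl φ (L A S) ⟨
        1# * 1# * φ * L A S ≈⟨ L-scale 1# φ A S ⟨
        L (1# • A) (φ • S) ≈⟨ L-cong (≈ᵛ-sym A≈) e≈ ⟩
        L A w ≈⟨ L-lineʳ α s A e ⟩
        3# * (α * F A) + s * c₁ ≈⟨ +-congʳ (*-congˡ (*-congˡ FA)) ⟩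
        3# * (α * 0#) + s * c₁ ≈⟨ S.solve 3 (λ a s c → :3 :* (a :* con (+ 0)) :+ s :* c := s :* c) refl α s c₁ ⟩
        s * c₁ ∎
      LSA : φ * φ * L S A ≈ 2# * (α * s * c₁) + s * s * c₂
      LSA = begin
        φ * φ * L S A ≈⟨ S.solve 2 (λ p l → p :* p :* con (+ 1) :* l := p :* p :* l) refl φ (L S A) ⟨
        φ * φ * 1# * L S A ≈⟨ L-scale φ 1# S A ⟨
        L (φ • S) (1# • A) ≈⟨ L-cong e≈ (≈ᵛ-sym A≈) ⟩
        L w A ≈⟨ L-lineˡ α s A e ⟩
        3# * (α * α * F A) + 2# * (α * s * c₁) + s * s * c₂ ≈⟨ +-congʳ (+-congʳ (*-congˡ (*-congˡ FA))) ⟩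
        3# * (α * α * 0#) + 2# * (α * s * c₁) + s * s * c₂ ≈⟨ S.solve 4 (λ a s c d → :3 :* (a :* a :* con (+ 0)) :+ :2 :* (a :* s :* c) :+ s :* s :* d := :2 :* (a :* s :* c) :+ s :* s :* d) refl α s c₁ c₂ ⟩
        2# * (α * s * c₁) + s * s * c₂ ∎
      cubic : α * α * s * c₁ + α * s * s * c₂ + s * s * s * c₃ ≈ 0#
      cubic = begin
        α * α * s * c₁ + α * s * s * c₂ + s * s * s * c₃ ≈⟨ S.solve 5 (λ a s c d e → a :* a :* a :* con (+ 0) :+ a :* a :* s :* c :+ a :* s :* s :* d :+ s :* s :* s :* e := a :* a :* s :* c :+ a :* s :* s :* d :+ s :* s :* s :* e) refl α s c₁ c₂ c₃ ⟨
        α * α * α * 0# + α * α * s * c₁ + α * s * s * c₂ + s * s * s * c₃ ≈⟨ +-congʳ (+-congʳ (+-congʳ (*-congˡ FA))) ⟨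
        α * α * α * F A + α * α * s * c₁ + α * s * s * c₂ + s * s * s * c₃ ≈⟨ F-line α s A e ⟨
        F w ≈⟨ F-cong e≈ ⟨
        F (φ • S) ≈⟨ F-scale φ S ⟩
        φ * φ * φ * F S ≈⟨ trans (*-congˡ FS) (zeroʳ _) ⟩
        0# ∎
      chord-comp : ∀ Aᵢ Sᵢ eᵢ → φ * Sᵢ ≈ α * Aᵢ + s * eᵢ → φ * φ * (L S A * Aᵢ - L A S * Sᵢ) ≈ (α * s * c₁ + s * s * c₂) * Aᵢ - s * c₁ * (s * eᵢ)
      chord-comp Aᵢ Sᵢ eᵢ h = begin
        φ * φ * (L S A * Aᵢ - L A S * Sᵢ) ≈⟨ S.solve 5 (λ p l k a b → p :* p :* (l :* a :- k :* b) := p :* p :* l :* a :- p :* k :* (p :* b)) refl φ (L S A) (L A S) Aᵢ Sᵢ ⟩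
        φ * φ * L S A * Aᵢ - φ * L A S * (φ * Sᵢ) ≈⟨ +-cong (*-congʳ LSA) (-‿cong (*-cong LAS h)) ⟩
        (2# * (α * s * c₁) + s * s * c₂) * Aᵢ - s * c₁ * (α * Aᵢ + s * eᵢ) ≈⟨ S.solve 6 (λ a s c d A e → (:2 :* (a :* s :* c) :+ s :* s :* d) :* A :- s :* c :* (a :* A :+ s :* e) := (a :* s :* c :+ s :* s :* d) :* A :- s :* c :* (s :* e)) refl α s c₁ c₂ Aᵢ eᵢ ⟩
        (α * s * c₁ + s * s * c₂) * Aᵢ - s * c₁ * (s * eᵢ) ∎
      -- Eliminating c₁ by `cubic` exposes the factor s³ that makes the chord vanish as S tends to
      -- A. What remains is the tangent law, which makes sense at s = 0.
      tangent-comp : ∀ Aᵢ Sᵢ eᵢ → φ * Sᵢ ≈ α * Aᵢ + s * eᵢ →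
        α * α * (φ * φ) * (L S A * Aᵢ - L A S * Sᵢ) ≈ - (s * s * s) * (c₃ * (2# * (α * Aᵢ) - φ * Sᵢ) - α * c₂ * eᵢ)
      tangent-comp Aᵢ Sᵢ eᵢ h = begin
        α * α * (φ * φ) * (L S A * Aᵢ - L A S * Sᵢ) ≈⟨ *-assoc _ _ _ ⟩
        α * α * (φ * φ * (L S A * Aᵢ - L A S * Sᵢ)) ≈⟨ *-congˡ (chord-comp Aᵢ Sᵢ eᵢ h) ⟩
        α * α * ((α * s * c₁ + s * s * c₂) * Aᵢ - s * c₁ * (s * eᵢ)) ≈⟨ S.solve 7 (λ a s c d f A e →
             a :* a :* ((a :* s :* c :+ s :* s :* d) :* A :- s :* c :* (s :* e)) :=
             (a :* a :* s :* c :+ a :* s :* s :* d :+ s :* s :* s :* f) :* (a :* A :- s :* e) :+ (:- (s :* s :* s)) :* (f :* (:2 :* (a :* A) :- (a :* A :+ s :* e)) :- a :* d :* e)) refl α s c₁ c₂ c₃ Aᵢ eᵢ ⟩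
        (α * α * s * c₁ + α * s * s * c₂ + s * s * s * c₃) * (α * Aᵢ - s * eᵢ) + - (s * s * s) * (c₃ * (2# * (α * Aᵢ) - (α * Aᵢ + s * eᵢ)) - α * c₂ * eᵢ) ≈⟨ +-cong (trans (*-congʳ cubic) (zeroˡ _)) (*-congˡ (+-congʳ (*-congˡ (+-congˡ (-‿cong (sym h)))))) ⟩
        0# + - (s * s * s) * (c₃ * (2# * (α * Aᵢ) - φ * Sᵢ) - α * c₂ * eᵢ) ≈⟨ +-identityˡ _ ⟩
        - (s * s * s) * (c₃ * (2# * (α * Aᵢ) - φ * Sᵢ) - α * c₂ * eᵢ) ∎

    module DirZ (A S : Vec) where
      open TZ A S public
      eZ : Vec
      eZ = vec H (- G) 0#
      -- The difference of the two dehomogenised equations; it makes (u₂ - u₁, v₂ - v₁) proportional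
      -- to (H, -G).
      relation : F A ≈ 0# → F S ≈ 0# → (u₂ - u₁) * G + (v₂ - v₁) * H ≈ 0#
      relation FA FS = begin
        (u₂ - u₁) * G + (v₂ - v₁) * H ≈⟨ S.solve 11 (λ b₁ b₂ b₃ b₄ b₆ x y z x′ y′ z′ → let open :F b₁ b₂ b₃ b₄ b₆ using () renaming (F to F′; L to L′; module TZ to TZ′; module TY to TY′) in let open TZ′ (vec x y z) (vec x′ y′ z′) using () renaming (u₁ to p₁; u₂ to p₂; v₁ to q₁; v₂ to q₂; H to h; G to g) in
           (p₂ :- p₁) :* g :+ (q₂ :- q₁) :* h := z :* z :* z :* F′ (vec x′ y′ z′) :- z′ :* z′ :* z′ :* F′ (vec x y z)) refl a₁ a₂ a₃ a₄ a₆ (X A) (Y A) (Z A) (X S) (Y S) (Z S) ⟩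
        Z A * Z A * Z A * F S - Z S * Z S * Z S * F A ≈⟨ +-cong (trans (*-congˡ FS) (zeroʳ _)) (-‿cong (trans (*-congˡ FA) (zeroʳ _))) ⟩
        0# - 0# ≈⟨ -‿inverseʳ 0# ⟩
        0# ∎
      c₃≈ : F eZ ≈ c₃
      c₃≈ = S.solve 7 (λ b₁ b₂ b₃ b₄ b₆ h g → let open :F b₁ b₂ b₃ b₄ b₆ using () renaming (F to F′; L to L′; module TZ to TZ′; module TY to TY′) in F′ (vec h (:- g) (con (+ 0))) := :- (h :* h :* h)) refl a₁ a₂ a₃ a₄ a₆ H G
      c₂≈ : L eZ A ≈ c₂
      c₂≈ = S.solve 10 (λ b₁ b₂ b₃ b₄ b₆ h g x y z → let open :F b₁ b₂ b₃ b₄ b₆ using () renaming (F to F′; L to L′; module TZ to TZ′; module TY to TY′) in L′ (vec h (:- g) (con (+ 0))) (vec x y z) :=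
        (g :* g :- b₁ :* (h :* g) :- b₂ :* (h :* h)) :* z :- :3 :* (h :* h) :* x) refl a₁ a₂ a₃ a₄ a₆ H G (X A) (Y A) (Z A)

    module DirY (A S : Vec) where
      open TY A S public
      eY : Vec
      eY = vec H 0# (- G)
      relation : F A ≈ 0# → F S ≈ 0# → (u₂ - u₁) * G + (w₂ - w₁) * H ≈ 0#
      relation FA FS = begin
        (u₂ - u₁) * G + (w₂ - w₁) * H ≈⟨ S.solve 11 (λ b₁ b₂ b₃ b₄ b₆ x y z x′ y′ z′ → let open :F b₁ b₂ b₃ b₄ b₆ using () renaming (F to F′; L to L′; module TZ to TZ′; module TY to TY′) in let open TY′ (vec x y z) (vec x′ y′ z′) using () renaming (u₁ to p₁; u₂ to p₂; w₁ to q₁; w₂ to q₂; H to h; G to g) in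
           (p₂ :- p₁) :* g :+ (q₂ :- q₁) :* h := y :* y :* y :* F′ (vec x′ y′ z′) :- y′ :* y′ :* y′ :* F′ (vec x y z)) refl a₁ a₂ a₃ a₄ a₆ (X A) (Y A) (Z A) (X S) (Y S) (Z S) ⟩
        Y A * Y A * Y A * F S - Y S * Y S * Y S * F A ≈⟨ +-cong (trans (*-congˡ FS) (zeroʳ _)) (-‿cong (trans (*-congˡ FA) (zeroʳ _))) ⟩
        0# - 0# ≈⟨ -‿inverseʳ 0# ⟩
        0# ∎
      c₃≈ : F eY ≈ c₃
      c₃≈ = S.solve 7 (λ b₁ b₂ b₃ b₄ b₆ h g → let open :F b₁ b₂ b₃ b₄ b₆ using () renaming (F to F′; L to L′; module TZ to TZ′; module TY to TY′) in F′ (vec h (con (+ 0)) (:- g)) :=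
        b₂ :* (h :* h :* g) :- h :* h :* h :- b₄ :* (h :* g :* g) :+ b₆ :* (g :* g :* g)) refl a₁ a₂ a₃ a₄ a₆ H G
      c₂≈ : L eY A ≈ c₂
      c₂≈ = S.solve 10 (λ b₁ b₂ b₃ b₄ b₆ h g x y z → let open :F b₁ b₂ b₃ b₄ b₆ using () renaming (F to F′; L to L′; module TZ to TZ′; module TY to TY′) in L′ (vec h (con (+ 0)) (:- g)) (vec x y z) :=
        (:2 :* (b₂ :* (h :* g)) :- :3 :* (h :* h) :- b₄ :* (g :* g)) :* x :+ (b₃ :* (g :* g) :- b₁ :* (h :* g)) :* y
           :+ (:2 :* (b₄ :* (h :* g)) :- b₂ :* (h :* h) :- :3 :* (b₆ :* (g :* g))) :* z) refl a₁ a₂ a₃ a₄ a₆ H G (X A) (Y A) (Z A)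

    cancel-≉ : ∀ {a b} → ¬ a ≈ 0# → a * b ≈ 0# → b ≈ 0#
    cancel-≉ {a} {b} a≉ e = [ (λ z → ⊥-elim (a≉ z)) , (λ z → z) ]′ (integral a b e)

    cancel-≉ʳ : ∀ {a b} → ¬ b ≈ 0# → a * b ≈ 0# → a ≈ 0#
    cancel-≉ʳ {a} {b} b≉ e = [ (λ z → z) , (λ z → ⊥-elim (b≉ z)) ]′ (integral a b e)

    square-0 : ∀ {a} → a * a ≈ 0# → a ≈ 0#
    square-0 {a} e = [ (λ z → z) , (λ z → z) ]′ (integral a a e)

    cube-0 : ∀ {a} → a * a * a ≈ 0# → a ≈ 0#
    cube-0 {a} e = [ square-0 , (λ z → z) ]′ (integral (a * a) a e)

    *-≉0 : ∀ {a b} → ¬ a ≈ 0# → ¬ b ≈ 0# → ¬ a * b ≈ 0#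
    *-≉0 {a} {b} p q e = q (cancel-≉ p e)

    neg-0 : ∀ {a} → - a ≈ 0# → a ≈ 0#
    neg-0 {a} e = trans (S.solve 1 (λ a → a := :- (:- a)) refl a) (trans (-‿cong e) (S.solve 0 (:- (con (+ 0)) := con (+ 0)) refl))

    sub-0 : ∀ {a b} → a - b ≈ 0# → a ≈ b
    sub-0 {a} {b} e = trans (S.solve 2 (λ a b → a := (a :- b) :+ b) refl a b) (trans (+-congʳ e) (+-identityˡ b))

    F-∞ : ∀ x y → F (vec x y 0#) ≈ - (x * x * x)
    F-∞ x y = S.solve 7 (λ b₁ b₂ b₃ b₄ b₆ x y → let open :F b₁ b₂ b₃ b₄ b₆ using () renaming (F to F′) in F′ (vec x y (con (+ 0))) := :- (x :* x :* x)) refl a₁ a₂ a₃ a₄ a₆ x y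

    L-∞ : ∀ x y A → L (vec x y 0#) A ≈ (y * y + a₁ * (x * y) - a₂ * (x * x)) * Z A - 3# * (x * x) * X A
    L-∞ x y (vec u v w) = S.solve 10 (λ b₁ b₂ b₃ b₄ b₆ x y u v w → let open :F b₁ b₂ b₃ b₄ b₆ using () renaming (L to L′) in
      L′ (vec x y (con (+ 0))) (vec u v w) := (y :* y :+ b₁ :* (x :* y) :- b₂ :* (x :* x)) :* w :- :3 :* (x :* x) :* u) refl a₁ a₂ a₃ a₄ a₆ x y u v w

    L-∞₀ : ∀ {x} y A → x ≈ 0# → L (vec x y 0#) A ≈ y * y * Z A
    L-∞₀ {x} y A x0 = trans (L-∞ x y A) (trans (+-cong (*-congʳ (+-cong (+-congˡ (*-congˡ (*-congʳ x0))) (-‿cong (*-congˡ (*-congʳ x0))))) (-‿cong (*-congʳ (*-congˡ (*-congʳ x0)))))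
      (S.solve 6 (λ b₁ b₂ x y z u → (y :* y :+ b₁ :* (con (+ 0) :* y) :- b₂ :* (con (+ 0) :* x)) :* z :- :3 :* (con (+ 0) :* x) :* u := y :* y :* z) refl a₁ a₂ x y (Z A) (X A)))

    Parallel : Vec → Vec → Set
    Parallel A S = Z A * X S ≈ Z S * X A × Z A * Y S ≈ Z S * Y A

    -- Let e be the direction with Z = 0. The Z-coordinate of the chord kills the coefficient of A;
    -- then `cubic` gives F(e) = -dX³ = 0, so e is vertical. The Y-coordinate gives c₁ · dY = 0, and
    -- c₁ = 0 implies c₂ = dY² · Z(A) = 0, so dY = 0 in both cases.
    chord-0 : ∀ A S → F A ≈ 0# → F S ≈ 0# → ¬ Z A ≈ 0# → chord A S ≈ᵛ 0ᵛ → Parallel A S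
    chord-0 A S FA FS ZA≉ (veq rX rY rZ) = sub-0 dX≈0 , sub-0 dY≈0
      where
      dX = Z A * X S - Z S * X A
      dY = Z A * Y S - Z S * Y A
      e = vec dX dY 0#
      split : ∀ u v → u ≈ v + 1# * (u - v)
      split u v = S.solve 2 (λ u v → u := v :+ con (+ 1) :* (u :- v)) refl u v
      hZ : Z A * Z S ≈ Z S * Z A + 1# * 0#
      hZ = S.solve 2 (λ u v → u :* v := v :* u :+ con (+ 1) :* con (+ 0)) refl (Z A) (Z S)
      open Secant A S FA FS (Z A) (Z S) 1# e (split _ _) (split _ _) hZ
      c₁ = L A e
      c₂ = L e A
      k = Z S * 1# * c₁ + 1# * 1# * c₂
      zeroed : ∀ {r} → r ≈ 0# → Z A * Z A * r ≈ 0#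
      zeroed r0 = trans (*-congˡ r0) (zeroʳ _)
      k≈0 : k ≈ 0#
      k≈0 = cancel-≉ʳ ZA≉ (begin
        k * Z A ≈⟨ S.solve 3 (λ k z c → k :* z := k :* z :- con (+ 1) :* c :* (con (+ 1) :* con (+ 0))) refl k (Z A) c₁ ⟩
        k * Z A - 1# * c₁ * (1# * 0#) ≈⟨ chord-comp (Z A) (Z S) 0# hZ ⟨
        Z A * Z A * (L S A * Z A - L A S * Z S) ≈⟨ zeroed rZ ⟩
        0# ∎)
      c₃≈0 : F e ≈ 0#
      c₃≈0 = begin
        F e ≈⟨ S.solve 4 (λ a c d f → f := (a :* a :* con (+ 1) :* c :+ a :* con (+ 1) :* con (+ 1) :* d :+ con (+ 1) :* con (+ 1) :* con (+ 1) :* f) :- a :* (a :* con (+ 1) :* c :+ con (+ 1) :* con (+ 1) :* d)) refl (Z S) c₁ c₂ (F e) ⟩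
        (Z S * Z S * 1# * c₁ + Z S * 1# * 1# * c₂ + 1# * 1# * 1# * F e) - Z S * k ≈⟨ +-cong cubic (-‿cong (trans (*-congˡ k≈0) (zeroʳ _))) ⟩
        0# - 0# ≈⟨ -‿inverseʳ 0# ⟩
        0# ∎
      dX≈0 : dX ≈ 0#
      dX≈0 = cube-0 (neg-0 (trans (sym (F-∞ dX dY)) c₃≈0))
      c₁dY : c₁ * dY ≈ 0#
      c₁dY = neg-0 (begin
        - (c₁ * dY) ≈⟨ S.solve 3 (λ c d a → :- (c :* d) := con (+ 0) :* a :- con (+ 1) :* c :* (con (+ 1) :* d)) refl c₁ dY (Y A) ⟩
        0# * Y A - 1# * c₁ * (1# * dY) ≈⟨ +-congʳ (*-congʳ k≈0) ⟨
        k * Y A - 1# * c₁ * (1# * dY) ≈⟨ chord-comp (Y A) (Y S) dY (split _ _) ⟨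
        Z A * Z A * (L S A * Y A - L A S * Y S) ≈⟨ zeroed rY ⟩
        0# ∎)
      fromc₁ : c₁ ≈ 0# → dY ≈ 0#
      fromc₁ c0 = square-0 (cancel-≉ʳ ZA≉ (begin
        dY * dY * Z A ≈⟨ L-∞₀ dY A dX≈0 ⟨
        c₂ ≈⟨ S.solve 3 (λ a c d → d := (a :* con (+ 1) :* c :+ con (+ 1) :* con (+ 1) :* d) :- a :* con (+ 1) :* c) refl (Z S) c₁ c₂ ⟩
        k - Z S * 1# * c₁ ≈⟨ +-cong k≈0 (-‿cong (trans (*-congˡ c0) (zeroʳ _))) ⟩
        0# - 0# ≈⟨ -‿inverseʳ 0# ⟩
        0# ∎))
      dY≈0 : dY ≈ 0#
      dY≈0 = [ fromc₁ , (λ z → z) ]′ (integral c₁ dY c₁dY)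

    module _ (A S : Vec) (ZA≉ : ¬ Z A ≈ 0#) (ZS≉ : ¬ Z S ≈ 0#) (par : Parallel A S) where
      open DirZ A S
      private
        ζ≉ : ¬ ζ ≈ 0#
        ζ≉ = *-≉0 ZA≉ ZS≉
        uu = proj₁ par
        vv = proj₂ par
      HZ-parallel : Z A * H ≈ ζ * Z S * FY A
      HZ-parallel = trans (*-congˡ (*-congˡ (+-congʳ (+-cong (+-congˡ vv) (*-congˡ uu)))))
        (S.solve 8 (λ b₁ b₂ b₃ b₄ b₆ x y z → z :* (z :* b₂ :* (b₂ :* y :+ b₂ :* y :+ b₁ :* (b₂ :* x) :+ b₃ :* (z :* b₂))) :=
          z :* b₂ :* b₂ :* (:2 :* (y :* z) :+ b₁ :* (x :* z) :+ b₃ :* (z :* z))) refl a₁ (Z S) a₃ a₄ a₆ (X A) (Y A) (Z A))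
      GZ-parallel : G ≈ Z S * Z S * FX A
      GZ-parallel = trans (+-congʳ (+-cong (+-congˡ (-‿cong (+-cong (+-congˡ (*-congˡ uu)) (*-cong uu uu)))) (-‿cong (*-congˡ (*-congʳ (+-congˡ uu))))))
        (S.solve 8 (λ b₁ b₂ w b₄ b₆ x y z → b₁ :* (w :* y :* (z :* w)) :- (w :* x :* (w :* x) :+ w :* x :* (w :* x) :+ w :* x :* (w :* x)) :- b₂ :* ((w :* x :+ w :* x) :* (z :* w)) :- b₄ :* (z :* w :* (z :* w))
          := w :* w :* (b₁ :* (y :* z) :- :3 :* (x :* x) :- :2 :* (b₂ :* (x :* z)) :- b₄ :* (z :* z))) refl a₁ a₂ (Z S) a₄ a₆ (X A) (Y A) (Z A))
      -- At proportional vectors H and G become nonzero multiples of the partial derivatives by Y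
      -- and X at A, so the law degenerates only at a singular point.
      tangentZ-0 : tangentZ A S ≈ᵛ 0ᵛ → FX A ≈ 0# × FY A ≈ 0#
      tangentZ-0 (veq rX rY rZ) = cancel-≉ (*-≉0 ZS≉ ZS≉) (trans (sym GZ-parallel) G≈0) , cancel-≉ (*-≉0 ζ≉ ZS≉) (trans (sym HZ-parallel) (trans (*-congˡ H≈0) (zeroʳ _)))
        where
        c₃≈0 : c₃ ≈ 0#
        c₃≈0 = cancel-≉ʳ (*-≉0 ZS≉ ZA≉) rZ
        H≈0 : H ≈ 0#
        H≈0 = cube-0 (neg-0 c₃≈0)
        c₂≈′ : c₂ ≈ G * G * Z A
        c₂≈′ = trans (+-cong (*-congʳ (+-cong (+-congˡ (-‿cong (*-congˡ (*-congʳ H≈0)))) (-‿cong (*-congˡ (*-congʳ H≈0))))) (-‿cong (*-congʳ (*-congˡ (*-congʳ H≈0)))))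
          (S.solve 6 (λ b₁ b₂ h g z x → (g :* g :- b₁ :* (con (+ 0) :* g) :- b₂ :* (con (+ 0) :* h)) :* z :- :3 :* (con (+ 0) :* h) :* x := g :* g :* z) refl a₁ a₂ H G (Z A) (X A))
        G≈0 : G ≈ 0#
        G≈0 = cube-0 (cancel-≉ (*-≉0 ZS≉ ZA≉) (begin
          Z S * Z A * (G * G * G) ≈⟨ S.solve 4 (λ w z g k → w :* z :* (g :* g :* g) := con (+ 0) :* k :+ w :* (g :* g :* z) :* g) refl (Z S) (Z A) G (2# * (Z S * Y A) - Z A * Y S) ⟩
          0# * (2# * (Z S * Y A) - Z A * Y S) + Z S * (G * G * Z A) * G ≈⟨ +-cong (*-congʳ c₃≈0) (*-congʳ (*-congˡ c₂≈′)) ⟨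
          c₃ * (2# * (Z S * Y A) - Z A * Y S) + Z S * c₂ * G ≈⟨ rY ⟩
          0# ∎))

    module _ (A S : Vec) (XA : X A ≈ 0#) (ZA : Z A ≈ 0#) (XS : X S ≈ 0#) (ZS : Z S ≈ 0#) where
      open DirY A S
      private
        z* : ∀ {a b} → b ≈ 0# → a * b ≈ 0#
        z* b0 = trans (*-congˡ b0) (zeroʳ _)
        *z : ∀ {a b} → a ≈ 0# → a * b ≈ 0#
        *z a0 = trans (*-congʳ a0) (zeroˡ _)
        z+ : ∀ {a b} → a ≈ 0# → b ≈ 0# → a + b ≈ 0#
        z+ p q = trans (+-cong p q) (+-identityˡ 0#)
        z- : ∀ {a b} → a ≈ 0# → b ≈ 0# → a - b ≈ 0#
        z- p q = trans (+-cong p (-‿cong q)) (-‿inverseʳ 0#)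
        d- : ∀ {a b c} → a ≈ c → b ≈ 0# → a - b ≈ c
        d- {a} {b} {c} p q = trans (+-cong p (-‿cong q)) (S.solve 1 (λ c → c :- con (+ 0) := c) refl c)
        d+ : ∀ {a b c} → a ≈ c → b ≈ 0# → a + b ≈ c
        d+ p q = trans (+-cong p q) (+-identityʳ _)
        u1 : u₁ ≈ 0#
        u1 = z* XA
        w1 : w₁ ≈ 0#
        w1 = z* ZA
        u2 : u₂ ≈ 0#
        u2 = z* XS
        w2 : w₂ ≈ 0#
        w2 = z* ZS
        H≈ : H ≈ ζ * ζ
        H≈ = d- (d- (d- (d+ (d+ refl (z* (*z u2))) (z* (z* (z+ w1 w2)))) (z* (*z u2))) (z* (*z u2))) (z* (z+ (z+ (*z w1) (*z w1)) (*z w2)))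
        G≈ : G ≈ 0#
        G≈ = z- (z- (z- (z* (z* w1)) (z+ (z+ (*z u1) (*z u1)) (*z u2))) (z* (z* w1))) (z* (*z w1))
        c₂0 : c₂ ≈ 0#
        c₂0 = z+ (z+ (z* XA) (*z (z- (z* (z* G≈)) (z* (z* G≈))))) (z* ZA)
        c₃′ : c₃ ≈ - (ζ * ζ * (ζ * ζ) * (ζ * ζ))
        c₃′ = trans (d+ (d- (trans (+-congʳ (z* (z* G≈))) (+-identityˡ _)) (z* (z* G≈))) (z* (z* G≈))) (-‿cong (*-cong (*-cong H≈ H≈) H≈))
      -- At two vectors of the origin only ζ = Y(A)Y(S) survives: H = ζ², G = 0, c₂ = 0 and c₃ =
      -- -ζ⁶. Hence the law again gives a nonzero vector with Z = 0.
      tangentY-Z : Z (tangentY A S) ≈ 0#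
      tangentY-Z = z+ (z* (z- (z* (z* ZA)) (z* ZS))) (*z (z* c₂0))
      tangentY-Y : ¬ Y A ≈ 0# → ¬ Y S ≈ 0# → ¬ Y (tangentY A S) ≈ 0#
      tangentY-Y YA≉ YS≉ e = *-≉0 (*-≉0 (*-≉0 ζζ ζζ) ζζ) (*-≉0 YS≉ YA≉) (neg-0 (trans (S.solve 2 (λ a b → :- (a :* b) := (:- a) :* b) refl _ _) (trans (*-congʳ (sym c₃′)) e)))
        where
        ζ≉ : ¬ ζ ≈ 0#
        ζ≉ = *-≉0 YA≉ YS≉
        ζζ : ¬ ζ * ζ ≈ 0#
        ζζ = *-≉0 ζ≉ ζ≉

    negate-0 : ∀ V → negate V ≈ᵛ 0ᵛ → V ≈ᵛ 0ᵛ
    negate-0 (vec x y z) (veq x0 y0 z0) = veq x0 (trans (S.solve 5 (λ b₁ b₃ x y z → y := :- (:- (y :+ (b₁ :* x :+ b₃ :* z))) :- (b₁ :* x :+ b₃ :* z)) refl a₁ a₃ x y z)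
      (trans (+-cong (-‿cong y0) (-‿cong (+-cong (*-congˡ x0) (*-congˡ z0)))) (S.solve 2 (λ b₁ b₃ → (:- (con (+ 0))) :- (b₁ :* con (+ 0) :+ b₃ :* con (+ 0)) := con (+ 0)) refl a₁ a₃))) z0

    Z≈0⇒X≈0 : ∀ V → F V ≈ 0# → Z V ≈ 0# → X V ≈ 0#
    Z≈0⇒X≈0 (vec x y z) FV z0 = cube-0 (neg-0 (trans (sym (F-∞ x y)) (trans (F-cong (veq refl refl (sym z0))) FV)))

    negate-cong : ∀ {u v} → u ≈ᵛ v → negate u ≈ᵛ negate v
    negate-cong (veq x y z) = veq x (-‿cong (+-cong y (+-cong (*-congˡ x) (*-congˡ z)))) z

    negate-scale : ∀ c v → negate (c • v) ≈ᵛ c • negate v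
    negate-scale c (vec x y z) = veq refl (S.solve 6 (λ b₁ b₃ c x y z → :- (c :* y :+ (b₁ :* (c :* x) :+ b₃ :* (c :* z))) := c :* (:- (y :+ (b₁ :* x :+ b₃ :* z)))) refl a₁ a₃ c x y z) refl

    negate-negate : ∀ v → negate (negate v) ≈ᵛ v
    negate-negate (vec x y z) = veq refl (S.solve 5 (λ b₁ b₃ x y z → :- (:- (y :+ (b₁ :* x :+ b₃ :* z)) :+ (b₁ :* x :+ b₃ :* z)) := y) refl a₁ a₃ x y z) refl

    F-negate : ∀ v → F (negate v) ≈ F v
    F-negate (vec x y z) = S.solve 8 (λ b₁ b₂ b₃ b₄ b₆ x y z → let open :F b₁ b₂ b₃ b₄ b₆ using () renaming (F to F′; negate to n′) in
      F′ (n′ (vec x y z)) := F′ (vec x y z)) refl a₁ a₂ a₃ a₄ a₆ x y z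

    chord-cong : ∀ {A A′ S S′} → A ≈ᵛ A′ → S ≈ᵛ S′ → chord A S ≈ᵛ chord A′ S′
    chord-cong p q = veq (+-cong (*-cong l (≈X p)) (-‿cong (*-cong k (≈X q)))) (+-cong (*-cong l (≈Y p)) (-‿cong (*-cong k (≈Y q)))) (+-cong (*-cong l (≈Z p)) (-‿cong (*-cong k (≈Z q))))
      where
      l = L-cong q p
      k = L-cong p q

    chord-scale : ∀ z w A S → chord (z • A) (w • S) ≈ᵛ (z * z * (w * w)) • chord A S
    chord-scale z w A S = veq (comp (X A) (X S)) (comp (Y A) (Y S)) (comp (Z A) (Z S))
      where
      comp : ∀ a s → L (w • S) (z • A) * (z * a) - L (z • A) (w • S) * (w * s) ≈ z * z * (w * w) * (L S A * a - L A S * s)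
      comp a s = trans (+-cong (*-congʳ (L-scale w z S A)) (-‿cong (*-congʳ (L-scale z w A S))))
        (S.solve 6 (λ z w l k a s → w :* w :* z :* l :* (z :* a) :- z :* z :* w :* k :* (w :* s) := z :* z :* (w :* w) :* (l :* a :- k :* s)) refl z w (L S A) (L A S) a s)

    F-chord : ∀ A S → F A ≈ 0# → F S ≈ 0# → F (chord A S) ≈ 0#
    F-chord A S FA FS = begin
      F (chord A S) ≈⟨ F-cong (veq (c (X A) (X S)) (c (Y A) (Y S)) (c (Z A) (Z S))) ⟩
      F (vec (l * X A + - k * X S) (l * Y A + - k * Y S) (l * Z A + - k * Z S)) ≈⟨ F-line l (- k) A S ⟩
      l * l * l * F A + l * l * - k * k + l * - k * - k * l + - k * - k * - k * F S ≈⟨ +-cong (+-congʳ (+-congʳ (*-congˡ FA))) (*-congˡ FS) ⟩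
      l * l * l * 0# + l * l * - k * k + l * - k * - k * l + - k * - k * - k * 0# ≈⟨ S.solve 2 (λ l k → l :* l :* l :* con (+ 0) :+ l :* l :* (:- k) :* k :+ l :* (:- k) :* (:- k) :* l :+ (:- k) :* (:- k) :* (:- k) :* con (+ 0) := con (+ 0)) refl l k ⟩
      0# ∎
      where
      l = L S A
      k = L A S
      c : ∀ a s → l * a - k * s ≈ l * a + - k * s
      c a s = S.solve 4 (λ l k a s → l :* a :- k :* s := l :* a :+ (:- k) :* s) refl l k a s

    chord-∞ : ∀ x y w → negate (chord (vec x y 1#) (vec 0# w 0#)) ≈ᵛ (w * w) • vec x y 1#
    chord-∞ x y w = veq
      (S.solve 8 (λ b₁ b₂ b₃ b₄ b₆ x y w → let open :F b₁ b₂ b₃ b₄ b₆ using () renaming (chord to c′; negate to n′) in X (n′ (c′ (vec x y (con (+ 1))) (vec (con (+ 0)) w (con (+ 0))))) := w :* w :* x) refl a₁ a₂ a₃ a₄ a₆ x y w)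
      (S.solve 8 (λ b₁ b₂ b₃ b₄ b₆ x y w → let open :F b₁ b₂ b₃ b₄ b₆ using () renaming (chord to c′; negate to n′) in Y (n′ (c′ (vec x y (con (+ 1))) (vec (con (+ 0)) w (con (+ 0))))) := w :* w :* y) refl a₁ a₂ a₃ a₄ a₆ x y w)
      (S.solve 8 (λ b₁ b₂ b₃ b₄ b₆ x y w → let open :F b₁ b₂ b₃ b₄ b₆ using () renaming (chord to c′; negate to n′) in Z (n′ (c′ (vec x y (con (+ 1))) (vec (con (+ 0)) w (con (+ 0))))) := w :* w :* con (+ 1)) refl a₁ a₂ a₃ a₄ a₆ x y w)

    module AffineSecant (x y x′ y′ : Carrier) (FA : F (vec x y 1#) ≈ 0#) (FS : F (vec x′ y′ 1#) ≈ 0#) where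
      A S : Vec
      A = vec x y 1#
      S = vec x′ y′ 1#
      e : Vec
      e = vec (x′ - x) (y′ - y) 0#
      private
        h : ∀ u v → 1# * v ≈ 1# * u + 1# * (v - u)
        h u v = S.solve 2 (λ u v → con (+ 1) :* v := con (+ 1) :* u :+ con (+ 1) :* (v :- u)) refl u v
        hZ : 1# * 1# ≈ 1# * 1# + 1# * 0#
        hZ = S.solve 0 (con (+ 1) :* con (+ 1) := con (+ 1) :* con (+ 1) :+ con (+ 1) :* con (+ 0)) refl
      open Secant A S FA FS 1# 1# 1# e (h _ _) (h _ _) hZ
      -- c₁ is eliminated by `cubic` at φ = α = s = 1. Only F(e) and L(e, A) remain, which are
      -- explicit in x′ - x and the slope.
      basis : ∀ a s d → 1# * s ≈ 1# * a + 1# * d → L S A * a - L A S * s ≈ - F e * a + (L e A + F e) * d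
      basis a s d hh = begin
        L S A * a - L A S * s ≈⟨ S.solve 1 (λ r → r := con (+ 1) :* con (+ 1) :* r) refl _ ⟩
        1# * 1# * (L S A * a - L A S * s) ≈⟨ chord-comp a s d hh ⟩
        (1# * 1# * L A e + 1# * 1# * L e A) * a - 1# * L A e * (1# * d) ≈⟨ S.solve 5 (λ c₁ c₂ c₃ a d → (con (+ 1) :* con (+ 1) :* c₁ :+ con (+ 1) :* con (+ 1) :* c₂) :* a :- con (+ 1) :* c₁ :* (con (+ 1) :* d)
            := (con (+ 1) :* con (+ 1) :* con (+ 1) :* c₁ :+ con (+ 1) :* con (+ 1) :* con (+ 1) :* c₂ :+ con (+ 1) :* con (+ 1) :* con (+ 1) :* c₃) :* (a :- d) :+ (:- c₃ :* a :+ (c₂ :+ c₃) :* d)) refl (L A e) (L e A) (F e) a d ⟩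
        (1# * 1# * 1# * L A e + 1# * 1# * 1# * L e A + 1# * 1# * 1# * F e) * (a - d) + (- F e * a + (L e A + F e) * d) ≈⟨ trans (+-congʳ (trans (*-congʳ cubic) (zeroˡ _))) (+-identityˡ _) ⟩
        - F e * a + (L e A + F e) * d ∎

      module _ (lam ν : Carrier) (hλ : lam * (x′ - x) ≈ y′ - y) (hν : ν ≈ y - lam * x) where
        private δ = x′ - x
        x₃ y₃ : Carrier
        x₃ = lam * lam + a₁ * lam - a₂ - x - x′
        y₃ = - (lam + a₁) * x₃ - ν - a₃
        private
          c₃≈ : F e ≈ - (δ * δ * δ)
          c₃≈ = F-∞ δ (y′ - y)
          c₂≈ : L e A ≈ (lam * δ * (lam * δ) + a₁ * (δ * (lam * δ)) - a₂ * (δ * δ)) * 1# - 3# * (δ * δ) * x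
          c₂≈ = trans (L-∞ δ (y′ - y) A) (+-congʳ (*-congʳ (+-congʳ (+-cong (*-cong (sym hλ) (sym hλ)) (*-congˡ (*-congˡ (sym hλ)))))))
          sumc : ∀ a d → - F e * a + (L e A + F e) * d ≈ - (- (δ * δ * δ)) * a + ((lam * δ * (lam * δ) + a₁ * (δ * (lam * δ)) - a₂ * (δ * δ)) * 1# - 3# * (δ * δ) * x + - (δ * δ * δ)) * d
          sumc a d = +-cong (*-congʳ (-‿cong c₃≈)) (*-congʳ (+-cong c₂≈ c₃≈))
          cX : X (chord A S) ≈ δ * δ * δ * x₃
          cX = trans (basis x x′ δ (h _ _)) (trans (sumc x δ) (S.solve 5 (λ l x x′ b₁ b₂ → let d = x′ :- x in
             :- (:- (d :* d :* d)) :* x :+ ((l :* d :* (l :* d) :+ b₁ :* (d :* (l :* d)) :- b₂ :* (d :* d)) :* con (+ 1) :- :3 :* (d :* d) :* x :+ (:- (d :* d :* d))) :* d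
               := d :* d :* d :* (l :* l :+ b₁ :* l :- b₂ :- x :- x′)) refl lam x x′ a₁ a₂))
          cY : Y (chord A S) ≈ δ * δ * δ * (y + lam * (x₃ - x))
          cY = trans (basis y y′ (y′ - y) (h _ _)) (trans (sumc y (y′ - y)) (trans (+-congˡ (*-congˡ (sym hλ))) (S.solve 6 (λ l x x′ b₁ b₂ y → let d = x′ :- x in
             :- (:- (d :* d :* d)) :* y :+ ((l :* d :* (l :* d) :+ b₁ :* (d :* (l :* d)) :- b₂ :* (d :* d)) :* con (+ 1) :- :3 :* (d :* d) :* x :+ (:- (d :* d :* d))) :* (l :* d)
               := d :* d :* d :* (y :+ l :* ((l :* l :+ b₁ :* l :- b₂ :- x :- x′) :- x))) refl lam x x′ a₁ a₂ y)))
          cZ : Z (chord A S) ≈ δ * δ * δ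
          cZ = trans (basis 1# 1# 0# hZ) (trans (+-congʳ (*-congʳ (-‿cong c₃≈))) (S.solve 2 (λ d k → :- (:- (d :* d :* d)) :* con (+ 1) :+ k :* con (+ 0) := d :* d :* d) refl δ (L e A + F e)))
        secant : negate (chord A S) ≈ᵛ (δ * δ * δ) • vec x₃ y₃ 1#
        secant = veq cX
          (trans (-‿cong (+-cong cY (+-cong (*-congˡ cX) (*-congˡ cZ))))
            (trans (S.solve 7 (λ d l x₃ x y b₁ b₃ → :- (d :* (y :+ l :* (x₃ :- x)) :+ (b₁ :* (d :* x₃) :+ b₃ :* d)) := d :* (:- (l :+ b₁) :* x₃ :- (y :- l :* x) :- b₃)) refl (δ * δ * δ) lam x₃ x y a₁ a₃)
              (*-congˡ (+-congʳ (+-congˡ (-‿cong (sym hν)))))))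
          (trans cZ (sym (*-identityʳ _)))

      vertical : x ≈ x′ → chord A S ≈ᵛ vec 0# ((y′ - y) * (y′ - y) * (y′ - y)) 0#
      vertical x≈ = veq (trans (basis x x′ (x′ - x) (h _ _)) (comp x (x′ - x) (trans (*-congˡ δ0) (zeroʳ _))))
        (trans (basis y y′ (y′ - y) (h _ _)) (trans (+-cong (trans (*-congʳ (trans (-‿cong c₃0) neg0)) (zeroˡ _)) (*-congʳ (trans (+-cong c₂≈ c₃0) (+-identityʳ _)))) (+-identityˡ _)))
        (trans (basis 1# 1# 0# hZ) (comp 1# 0# (zeroʳ _)))
        where
        neg0 : - 0# ≈ 0#
        neg0 = S.solve 0 (:- (con (+ 0)) := con (+ 0)) refl
        δ0 : x′ - x ≈ 0#
        δ0 = trans (+-congʳ (sym x≈)) (-‿inverseʳ x)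
        c₃0 : F e ≈ 0#
        c₃0 = trans (F-∞ _ _) (trans (-‿cong (trans (*-congˡ δ0) (zeroʳ _))) neg0)
        c₂≈ : L e A ≈ (y′ - y) * (y′ - y)
        c₂≈ = trans (L-∞₀ (y′ - y) A δ0) (*-identityʳ _)
        comp : ∀ a d → (L e A + F e) * d ≈ 0# → - F e * a + (L e A + F e) * d ≈ 0#
        comp a d p = trans (+-cong (trans (*-congʳ (trans (-‿cong c₃0) neg0)) (zeroˡ _)) p) (+-identityˡ 0#)

      same-x : x ≈ x′ → (y′ - y) * (y + y′ + a₁ * x′ + a₃) ≈ 0#
      same-x x≈ = begin
        (y′ - y) * (y + y′ + a₁ * x′ + a₃) ≈⟨ S.solve 8 (λ b₁ b₂ b₃ b₄ b₆ x y y′ → let open :F b₁ b₂ b₃ b₄ b₆ using () renaming (F to F′) in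
            (y′ :- y) :* (y :+ y′ :+ b₁ :* x :+ b₃) := F′ (vec x y′ (con (+ 1))) :- F′ (vec x y (con (+ 1)))) refl a₁ a₂ a₃ a₄ a₆ x′ y y′ ⟩
        F (vec x′ y′ 1#) - F (vec x′ y 1#) ≈⟨ +-cong FS (-‿cong (trans (F-cong (veq (sym x≈) refl refl)) FA)) ⟩
        0# - 0# ≈⟨ -‿inverseʳ 0# ⟩
        0# ∎

    -- If L(A, e) = 0, then F(αA + βe) = β²(αL(e, A) + βF(e)), which vanishes at α = F(e), β = -L(e,
    -- A): the third point of the tangent line at A with direction e.
    third : Vec → Vec → Vec
    third A e = vec (F e * X A - L e A * X e) (F e * Y A - L e A * Y e) (F e * Z A - L e A * Z e)

    third-scale : ∀ z A e → third (z • A) e ≈ᵛ z • third A e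
    third-scale z A e = veq (c (X A) (X e)) (c (Y A) (Y e)) (c (Z A) (Z e))
      where
      Lz : L e (z • A) ≈ z * L e A
      Lz = trans (L-cong (veq (sym (*-identityˡ _)) (sym (*-identityˡ _)) (sym (*-identityˡ _))) (veq refl refl refl)) (trans (L-scale 1# z e A) (S.solve 2 (λ z l → con (+ 1) :* con (+ 1) :* z :* l := z :* l) refl z (L e A)))
      c : ∀ a b → F e * (z * a) - L e (z • A) * b ≈ z * (F e * a - L e A * b)
      c a b = trans (+-congˡ (-‿cong (*-congʳ Lz))) (S.solve 5 (λ f z l a b → f :* (z :* a) :- z :* l :* b := z :* (f :* a :- l :* b)) refl (F e) z (L e A) a b)

    F-third : ∀ A e → F A ≈ 0# → L A e ≈ 0# → F (third A e) ≈ 0#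
    F-third A e FA c₁0 = begin
      F (third A e) ≈⟨ F-cong (veq (c (X A) (X e)) (c (Y A) (Y e)) (c (Z A) (Z e))) ⟩
      F (vec (f * X A + - l * X e) (f * Y A + - l * Y e) (f * Z A + - l * Z e)) ≈⟨ F-line f (- l) A e ⟩
      f * f * f * F A + f * f * - l * L A e + f * - l * - l * l + - l * - l * - l * f ≈⟨ +-congʳ (+-congʳ (+-cong (*-congˡ FA) (*-congˡ c₁0))) ⟩
      f * f * f * 0# + f * f * - l * 0# + f * - l * - l * l + - l * - l * - l * f ≈⟨ S.solve 2 (λ f l → f :* f :* f :* con (+ 0) :+ f :* f :* (:- l) :* con (+ 0) :+ f :* (:- l) :* (:- l) :* l :+ (:- l) :* (:- l) :* (:- l) :* f := con (+ 0)) refl f l ⟩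
      0# ∎
      where
      f = F e
      l = L e A
      c : ∀ a s → f * a - l * s ≈ f * a + - l * s
      c a s = S.solve 4 (λ l k a s → l :* a :- k :* s := l :* a :+ (:- k) :* s) refl f l a s

    module AffineTangent (x y : Carrier) (FA : F (vec x y 1#) ≈ 0#) (e : Vec) (c₁0 : L (vec x y 1#) e ≈ 0#) where
      A : Vec
      A = vec x y 1#
      -- Only e modulo A matters for the tangent line; e′ = e - κA is the representative with Z = 0.
      u v κ : Carrier
      κ = Z e
      u = X e - κ * x
      v = Y e - κ * y
      e′ : Vec
      e′ = vec u v 0#
      private
        e≈ : e ≈ᵛ vec (κ * X A + 1# * X e′) (κ * Y A + 1# * Y e′) (κ * Z A + 1# * Z e′)
        e≈ = veq (c _ _) (c _ _) (S.solve 1 (λ k → k := k :* con (+ 1) :+ con (+ 1) :* con (+ 0)) refl κ)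
          where
          c : ∀ p q → p ≈ q + 1# * (p - q)
          c p q = S.solve 2 (λ p q → p := q :+ con (+ 1) :* (p :- q)) refl p q
        c₁′ : L A e′ ≈ 0#
        c₁′ = begin
          L A e′ ≈⟨ S.solve 2 (λ k l → l := :3 :* (k :* con (+ 0)) :+ con (+ 1) :* l) refl κ (L A e′) ⟩
          3# * (κ * 0#) + 1# * L A e′ ≈⟨ +-congʳ (*-congˡ (*-congˡ FA)) ⟨
          3# * (κ * F A) + 1# * L A e′ ≈⟨ L-lineʳ κ 1# A e′ ⟨
          L A (vec (κ * X A + 1# * X e′) (κ * Y A + 1# * Y e′) (κ * Z A + 1# * Z e′)) ≈⟨ L-cong (veq refl refl refl) e≈ ⟨
          L A e ≈⟨ c₁0 ⟩
          0# ∎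
        f = F e′
        l = L e′ A
        c₃ : F e ≈ κ * l + f
        c₃ = begin
          F e ≈⟨ F-cong e≈ ⟩
          F (vec (κ * X A + 1# * X e′) (κ * Y A + 1# * Y e′) (κ * Z A + 1# * Z e′)) ≈⟨ F-line κ 1# A e′ ⟩
          κ * κ * κ * F A + κ * κ * 1# * L A e′ + κ * 1# * 1# * l + 1# * 1# * 1# * f ≈⟨ +-congʳ (+-congʳ (+-cong (*-congˡ FA) (*-congˡ c₁′))) ⟩
          κ * κ * κ * 0# + κ * κ * 1# * 0# + κ * 1# * 1# * l + 1# * 1# * 1# * f ≈⟨ S.solve 3 (λ k l f → k :* k :* k :* con (+ 0) :+ k :* k :* con (+ 1) :* con (+ 0) :+ k :* con (+ 1) :* con (+ 1) :* l :+ con (+ 1) :* con (+ 1) :* con (+ 1) :* f := k :* l :+ f) refl κ l f ⟩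
          κ * l + f ∎
        c₂ : L e A ≈ l
        c₂ = begin
          L e A ≈⟨ L-cong e≈ (veq refl refl refl) ⟩
          L (vec (κ * X A + 1# * X e′) (κ * Y A + 1# * Y e′) (κ * Z A + 1# * Z e′)) A ≈⟨ L-lineˡ κ 1# A e′ ⟩
          3# * (κ * κ * F A) + 2# * (κ * 1# * L A e′) + 1# * 1# * l ≈⟨ +-congʳ (+-cong (*-congˡ (*-congˡ FA)) (*-congˡ (*-congˡ c₁′))) ⟩
          3# * (κ * κ * 0#) + 2# * (κ * 1# * 0#) + 1# * 1# * l ≈⟨ S.solve 2 (λ k l → :3 :* (k :* k :* con (+ 0)) :+ :2 :* (k :* con (+ 1) :* con (+ 0)) :+ con (+ 1) :* con (+ 1) :* l := l) refl κ l ⟩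
          l ∎
        comp : ∀ a d b → b ≈ κ * a + 1# * d → F e * a - L e A * b ≈ f * a - l * d
        comp a d b h = trans (+-cong (*-congʳ c₃) (-‿cong (*-cong c₂ h))) (S.solve 5 (λ k l f a d → (k :* l :+ f) :* a :- l :* (k :* a :+ con (+ 1) :* d) := f :* a :- l :* d) refl κ l f a d)
        f≈ : f ≈ - (u * u * u)
        f≈ = F-∞ u v
        tX : X (third A e) ≈ f * x - l * u
        tX = comp x u (X e) (≈X e≈)
        tY : Y (third A e) ≈ f * y - l * v
        tY = comp y v (Y e) (≈Y e≈)
        tZ : Z (third A e) ≈ f
        tZ = trans (comp 1# 0# (Z e) (≈Z e≈)) (S.solve 2 (λ f l → f :* con (+ 1) :- l :* con (+ 0) := f) refl f l)

      gradient : FX A * u + FY A * v ≈ 0#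
      gradient = trans (S.solve 5 (λ p q r u v → p :* u :+ q :* v := p :* u :+ q :* v :+ r :* con (+ 0)) refl (FX A) (FY A) (FZ A) u v) c₁′

      flat : u ≈ 0# → third A e ≈ᵛ vec 0# (- (v * v * v)) 0#
      flat u0 = veq (trans tX (trans (+-cong (*-congʳ f0) (-‿cong (*-congˡ u0))) (S.solve 2 (λ x l → con (+ 0) :* x :- l :* con (+ 0) := con (+ 0)) refl x l)))
        (trans tY (trans (+-cong (*-congʳ f0) (-‿cong (*-congʳ l≈))) (S.solve 2 (λ y v → con (+ 0) :* y :- v :* v :* con (+ 1) :* v := :- (v :* v :* v)) refl y v)))
        (trans tZ f0)
        where
        f0 : f ≈ 0#
        f0 = trans f≈ (trans (-‿cong (trans (*-congˡ u0) (zeroʳ _))) (S.solve 0 (:- (con (+ 0)) := con (+ 0)) refl))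
        l≈ : l ≈ v * v * 1#
        l≈ = L-∞₀ v A u0

      module _ (lam ν : Carrier) (hλ : v ≈ lam * u) (hν : ν ≈ y - lam * x) where
        x₃ y₃ : Carrier
        x₃ = lam * lam + a₁ * lam - a₂ - x - x
        y₃ = - (lam + a₁) * x₃ - ν - a₃
        private
          l≈ : l ≈ (lam * u * (lam * u) + a₁ * (u * (lam * u)) - a₂ * (u * u)) * 1# - 3# * (u * u) * x
          l≈ = trans (L-∞ u v A) (+-congʳ (*-congʳ (+-congʳ (+-cong (*-cong hλ hλ) (*-congˡ (*-congˡ hλ))))))
          cX : X (third A e) ≈ - (u * u * u) * x₃
          cX = trans tX (trans (+-cong (*-congʳ f≈) (-‿cong (*-congʳ l≈))) (S.solve 5 (λ l u x b₁ b₂ →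
            (:- (u :* u :* u)) :* x :- ((l :* u :* (l :* u) :+ b₁ :* (u :* (l :* u)) :- b₂ :* (u :* u)) :* con (+ 1) :- :3 :* (u :* u) :* x) :* u
            := (:- (u :* u :* u)) :* (l :* l :+ b₁ :* l :- b₂ :- x :- x)) refl lam u x a₁ a₂))
          cY : Y (third A e) ≈ - (u * u * u) * (y + lam * (x₃ - x))
          cY = trans tY (trans (+-cong (*-congʳ f≈) (-‿cong (*-cong l≈ hλ))) (S.solve 6 (λ l u x b₁ b₂ y →
            (:- (u :* u :* u)) :* y :- ((l :* u :* (l :* u) :+ b₁ :* (u :* (l :* u)) :- b₂ :* (u :* u)) :* con (+ 1) :- :3 :* (u :* u) :* x) :* (l :* u)
            := (:- (u :* u :* u)) :* (y :+ l :* ((l :* l :+ b₁ :* l :- b₂ :- x :- x) :- x))) refl lam u x a₁ a₂ y))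
          cZ : Z (third A e) ≈ - (u * u * u)
          cZ = trans tZ f≈
        sloped : negate (third A e) ≈ᵛ (- (u * u * u)) • vec x₃ y₃ 1#
        sloped = veq cX
          (trans (-‿cong (+-cong cY (+-cong (*-congˡ cX) (*-congˡ cZ))))
            (trans (S.solve 7 (λ d l x₃ x y b₁ b₃ → :- (d :* (y :+ l :* (x₃ :- x)) :+ (b₁ :* (d :* x₃) :+ b₃ :* d)) := d :* (:- (l :+ b₁) :* x₃ :- (y :- l :* x) :- b₃)) refl (- (u * u * u)) lam x₃ x y a₁ a₃)
              (*-congˡ (+-congʳ (+-congˡ (-‿cong (sym hν)))))))
          (trans cZ (sym (*-identityʳ _)))

    -- The intercept in the duplication formula agrees with y - λx only on the curve: the two sides
    -- differ by 2F.
    tangent-slope : ∀ x y lam → F (vec x y 1#) ≈ 0# → lam * (2# * y + a₁ * x + a₃) ≈ 3# * x * x + 2# * a₂ * x + a₄ - a₁ * y →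
      (y - lam * x) * (2# * y + a₁ * x + a₃) ≈ - (x * x * x) + a₄ * x + 2# * a₆ - a₃ * y
    tangent-slope x y lam FA hl = begin
      (y - lam * x) * g ≈⟨ S.solve 4 (λ x y l g → (y :- l :* x) :* g := y :* g :- x :* (l :* g)) refl x y lam g ⟩
      y * g - x * (lam * g) ≈⟨ +-congˡ (-‿cong (*-congˡ hl)) ⟩
      y * g - x * (3# * x * x + 2# * a₂ * x + a₄ - a₁ * y) ≈⟨ S.solve 7 (λ b₁ b₂ b₃ b₄ b₆ x y → let open :F b₁ b₂ b₃ b₄ b₆ using () renaming (F to F′) in
         y :* (:2 :* y :+ b₁ :* x :+ b₃) :- x :* (:3 :* x :* x :+ :2 :* b₂ :* x :+ b₄ :- b₁ :* y) := :2 :* F′ (vec x y (con (+ 1))) :+ (:- (x :* x :* x) :+ b₄ :* x :+ :2 :* b₆ :- b₃ :* y)) refl a₁ a₂ a₃ a₄ a₆ x y ⟩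
      2# * F (vec x y 1#) + (- (x * x * x) + a₄ * x + 2# * a₆ - a₃ * y) ≈⟨ +-congʳ (trans (*-congˡ FA) (zeroʳ _)) ⟩
      0# + (- (x * x * x) + a₄ * x + 2# * a₆ - a₃ * y) ≈⟨ +-identityˡ _ ⟩
      - (x * x * x) + a₄ * x + 2# * a₆ - a₃ * y ∎
      where g = 2# * y + a₁ * x + a₃

    FX-affine : ∀ x y → FX (vec x y 1#) ≈ - (3# * x * x + 2# * a₂ * x + a₄ - a₁ * y)
    FX-affine x y = S.solve 7 (λ b₁ b₂ b₃ b₄ b₆ x y → b₁ :* (y :* con (+ 1)) :- :3 :* (x :* x) :- :2 :* (b₂ :* (x :* con (+ 1))) :- b₄ :* (con (+ 1) :* con (+ 1)) := :- (:3 :* x :* x :+ :2 :* b₂ :* x :+ b₄ :- b₁ :* y)) refl a₁ a₂ a₃ a₄ a₆ x y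

    FY-affine : ∀ x y → FY (vec x y 1#) ≈ 2# * y + a₁ * x + a₃
    FY-affine x y = S.solve 7 (λ b₁ b₂ b₃ b₄ b₆ x y → :2 :* (y :* con (+ 1)) :+ b₁ :* (x :* con (+ 1)) :+ b₃ :* (con (+ 1) :* con (+ 1)) := :2 :* y :+ b₁ :* x :+ b₃) refl a₁ a₂ a₃ a₄ a₆ x y

    module _ (A S : Vec) (FA : F A ≈ 0#) (FS : F S ≈ 0#) where
      private
        split : ∀ {p q r} → p - q ≈ r → p ≈ q + r
        split {p} {q} h = trans (S.solve 2 (λ p q → p := q :+ (p :- q)) refl p q) (+-congˡ h)
      tangentZ-chord : ∀ s → let open DirZ A S in u₂ - u₁ ≈ s * H → v₂ - v₁ ≈ s * - G →
        (Z S * Z S * (Z A * Z A)) • chord A S ≈ᵛ (- (s * s * s)) • tangentZ A S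
      tangentZ-chord s hu hv = veq
        (trans (tangent-comp (X A) (X S) H (split hu)) (*-congˡ (+-cong (*-congʳ c₃≈) (-‿cong (*-congʳ (*-congˡ c₂≈))))))
        (trans (tangent-comp (Y A) (Y S) (- G) (split hv)) (*-congˡ (trans (+-cong (*-congʳ c₃≈) (-‿cong (*-congʳ (*-congˡ c₂≈)))) (+-congˡ (S.solve 3 (λ a c g → :- (a :* c :* (:- g)) := a :* c :* g) refl (Z S) c₂ G)))))
        (trans (tangent-comp (Z A) (Z S) 0# hZ) (*-congˡ (trans (+-congʳ (*-congʳ c₃≈)) (S.solve 4 (λ c z w k → c :* (:2 :* (w :* z) :- z :* w) :- w :* k :* con (+ 0) := c :* (w :* z)) refl c₃ (Z A) (Z S) (L eZ A)))))
        where
        open DirZ A S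
        hZ : Z A * Z S ≈ Z S * Z A + s * 0#
        hZ = S.solve 3 (λ u v s → u :* v := v :* u :+ s :* con (+ 0)) refl (Z A) (Z S) s
        open Secant A S FA FS (Z A) (Z S) s eZ (split hu) (split hv) hZ

      tangentY-chord : ∀ s → let open DirY A S in u₂ - u₁ ≈ s * H → w₂ - w₁ ≈ s * - G →
        (Y S * Y S * (Y A * Y A)) • chord A S ≈ᵛ (- (s * s * s)) • tangentY A S
      tangentY-chord s hu hw = veq
        (trans (tangent-comp (X A) (X S) H (split hu)) (*-congˡ (+-cong (*-congʳ c₃≈) (-‿cong (*-congʳ (*-congˡ c₂≈))))))
        (trans (tangent-comp (Y A) (Y S) 0# hY) (*-congˡ (trans (+-congʳ (*-congʳ c₃≈)) (S.solve 4 (λ c z w k → c :* (:2 :* (w :* z) :- z :* w) :- w :* k :* con (+ 0) := c :* (w :* z)) refl c₃ (Y A) (Y S) (L eY A)))))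
        (trans (tangent-comp (Z A) (Z S) (- G) (split hw)) (*-congˡ (trans (+-cong (*-congʳ c₃≈) (-‿cong (*-congʳ (*-congˡ c₂≈)))) (+-congˡ (S.solve 3 (λ a c g → :- (a :* c :* (:- g)) := a :* c :* g) refl (Y S) c₂ G)))))
        where
        open DirY A S
        hY : Y A * Y S ≈ Y S * Y A + s * 0#
        hY = S.solve 3 (λ u v s → u :* v := v :* u :+ s :* con (+ 0)) refl (Y A) (Y S) s
        open Secant A S FA FS (Y A) (Y S) s eY (split hu) hY (split hw)

    -- When S = A the direction vectors become tangent vectors.
    tangentZ-third : ∀ A S → Parallel A S → let open DirZ A S in tangentZ A S ≈ᵛ Z S • third A eZ
    tangentZ-third A S (uu , vv) = veq
      (trans (+-congʳ (*-cong (sym c₃≈) (+-congˡ (-‿cong uu)))) (trans (+-congˡ (-‿cong (*-congʳ (*-congˡ (sym c₂≈))))) (fin (F eZ) (Z S) (X A) (L eZ A) H)))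
      (trans (+-cong (*-cong (sym c₃≈) (+-congˡ (-‿cong vv))) (*-congʳ (*-congˡ (sym c₂≈)))) (S.solve 5 (λ f w a l h → f :* (:2 :* (w :* a) :- w :* a) :+ w :* l :* h := w :* (f :* a :- l :* (:- h))) refl (F eZ) (Z S) (Y A) (L eZ A) G))
      (trans (*-congʳ (sym c₃≈)) (S.solve 4 (λ f w a l → f :* (w :* a) := w :* (f :* a :- l :* con (+ 0))) refl (F eZ) (Z S) (Z A) (L eZ A)))
      where
      open DirZ A S
      fin : ∀ f w a l h → f * (2# * (w * a) - w * a) - w * l * h ≈ w * (f * a - l * h)
      fin f w a l h = S.solve 5 (λ f w a l h → f :* (:2 :* (w :* a) :- w :* a) :- w :* l :* h := w :* (f :* a :- l :* h)) refl f w a l h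

    tangentY-third : ∀ A S → Y A * X S ≈ Y S * X A → Y A * Z S ≈ Y S * Z A → let open DirY A S in tangentY A S ≈ᵛ Y S • third A eY
    tangentY-third A S uu ww = veq
      (trans (+-congʳ (*-cong (sym c₃≈) (+-congˡ (-‿cong uu)))) (trans (+-congˡ (-‿cong (*-congʳ (*-congˡ (sym c₂≈))))) (fin (F eY) (Y S) (X A) (L eY A) H)))
      (trans (*-congʳ (sym c₃≈)) (S.solve 4 (λ f w a l → f :* (w :* a) := w :* (f :* a :- l :* con (+ 0))) refl (F eY) (Y S) (Y A) (L eY A)))
      (trans (+-cong (*-cong (sym c₃≈) (+-congˡ (-‿cong ww))) (*-congʳ (*-congˡ (sym c₂≈)))) (S.solve 5 (λ f w a l h → f :* (:2 :* (w :* a) :- w :* a) :+ w :* l :* h := w :* (f :* a :- l :* (:- h))) refl (F eY) (Y S) (Z A) (L eY A) G))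
      where
      open DirY A S
      fin : ∀ f w a l h → f * (2# * (w * a) - w * a) - w * l * h ≈ w * (f * a - l * h)
      fin f w a l h = S.solve 5 (λ f w a l h → f :* (:2 :* (w :* a) :- w :* a) :- w :* l :* h := w :* (f :* a :- l :* h)) refl f w a l h

    -- Correctness of the polynomial laws against the affine group law

    data Rep (v : Vec) : Maybe (Carrier × Carrier) → Set where
      at∞ : X v ≈ 0# → Z v ≈ 0# → ¬ Y v ≈ 0# → Rep v nothing
      affine : ∀ {x y} → ¬ Z v ≈ 0# → X v ≈ Z v * x → Y v ≈ Z v * y → Rep v (just (x , y))

    affine-parts : ∀ {v x y} → Rep v (just (x , y)) → ¬ Z v ≈ 0# × X v ≈ Z v * x × Y v ≈ Z v * y
    affine-parts (affine z≉ hx hy) = z≉ , hx , hy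

    _≟_ : ∀ a b → Dec (a ≈ b)
    a ≟ b with (a - b) ≟0
    ... | yes e = yes (sub-0 e)
    ... | no ne = no λ e → ne (trans (+-congʳ e) (-‿inverseʳ b))

    cancel-* : ∀ {c a b} → ¬ c ≈ 0# → c * a ≈ c * b → a ≈ b
    cancel-* {c} {a} {b} c≉ e = sub-0 (cancel-≉ c≉ (trans (S.solve 3 (λ c a b → c :* (a :- b) := c :* a :- c :* b) refl c a b) (trans (+-congʳ e) (-‿inverseʳ _))))

    private
      z* : ∀ {a b} → b ≈ 0# → a * b ≈ 0#
      z* b0 = trans (*-congˡ b0) (zeroʳ _)

    rep-proportional : ∀ {v w s} κ μ → ¬ κ ≈ 0# → ¬ μ ≈ 0# → κ • w ≈ᵛ μ • v → Rep w s → Rep v s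
    rep-proportional κ μ κ≉ μ≉ (veq eX eY eZ) (at∞ x0 z0 y≉) =
      at∞ (cancel-≉ μ≉ (trans (sym eX) (z* x0))) (cancel-≉ μ≉ (trans (sym eZ) (z* z0))) (λ y0 → *-≉0 κ≉ y≉ (trans eY (z* y0)))
    rep-proportional {v} {w} κ μ κ≉ μ≉ (veq eX eY eZ) (affine {x} {y} z≉ hx hy) =
      affine (λ z0 → *-≉0 κ≉ z≉ (trans eZ (z* z0))) (cancel-* μ≉ (comp eX hx)) (cancel-* μ≉ (comp eY hy))
      where
      comp : ∀ {a b c} → κ * a ≈ μ * b → a ≈ Z w * c → μ * b ≈ μ * (Z v * c)
      comp {a} {b} {c} e h = begin
        μ * b ≈⟨ e ⟨
        κ * a ≈⟨ *-congˡ h ⟩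
        κ * (Z w * c) ≈⟨ *-assoc _ _ _ ⟨
        κ * Z w * c ≈⟨ *-congʳ eZ ⟩
        μ * Z v * c ≈⟨ *-assoc _ _ _ ⟩
        μ * (Z v * c) ∎

    1•≈ : ∀ v → 1# • v ≈ᵛ v
    1•≈ v = veq (*-identityˡ _) (*-identityˡ _) (*-identityˡ _)

    rep-scale : ∀ {v w s} c → ¬ c ≈ 0# → v ≈ᵛ c • w → Rep w s → Rep v s
    rep-scale {v} c c≉ e = rep-proportional c 1# c≉ 1≉0 (≈ᵛ-trans (≈ᵛ-sym e) (≈ᵛ-sym (1•≈ v)))

    F-proportional : ∀ {v w} κ μ → ¬ μ ≈ 0# → κ • w ≈ᵛ μ • v → F w ≈ 0# → F v ≈ 0#
    F-proportional {v} {w} κ μ μ≉ e Fw = cancel-≉ (*-≉0 (*-≉0 μ≉ μ≉) μ≉) (begin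
      μ * μ * μ * F v ≈⟨ F-scale μ v ⟨
      F (μ • v) ≈⟨ F-cong e ⟨
      F (κ • w) ≈⟨ F-scale κ w ⟩
      κ * κ * κ * F w ≈⟨ z* Fw ⟩
      0# ∎)

    infix 8 ⊖_
    ⊖_ : Maybe (Carrier × Carrier) → Maybe (Carrier × Carrier)
    ⊖ nothing = nothing
    ⊖ just (x , y) = just (x , - (y + (a₁ * x + a₃)))

    rep-negate : ∀ {v s} → Rep v s → Rep (negate v) (⊖ s)
    rep-negate {v} (at∞ x0 z0 y≉) = at∞ x0 z0 (λ y0 → y≉ (≈Y (negate-0 v (veq x0 y0 z0))))
    rep-negate {v} (affine {x} {y} z≉ hx hy) = affine z≉ hx (trans (-‿cong (+-cong hy (+-congʳ (*-congˡ hx))))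
      (S.solve 5 (λ b₁ b₃ x y z → :- (z :* y :+ (b₁ :* (z :* x) :+ b₃ :* z)) := z :* (:- (y :+ (b₁ :* x :+ b₃)))) refl a₁ a₃ x y (Z v)))

    normal : ∀ {v x y} → X v ≈ Z v * x → Y v ≈ Z v * y → v ≈ᵛ Z v • vec x y 1#
    normal hx hy = veq hx hy (sym (*-identityʳ _))

    F-normal : ∀ {v x y} → ¬ Z v ≈ 0# → X v ≈ Z v * x → Y v ≈ Z v * y → F v ≈ 0# → F (vec x y 1#) ≈ 0#
    F-normal {v} {x} {y} z≉ hx hy Fv = cancel-≉ (*-≉0 (*-≉0 z≉ z≉) z≉) (trans (sym (F-scale (Z v) (vec x y 1#))) (trans (F-cong (≈ᵛ-sym (normal hx hy))) Fv))

    infix 4 _Represents_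
    record _Represents_ (v : Vec) (s : Maybe (Carrier × Carrier)) : Set where
      constructor represents
      field
        rep : Rep v s
        onCurve : F v ≈ 0#
    open _Represents_ public

    SecantLaw DoublingLaw : Carrier → Carrier → (Maybe (Carrier × Carrier) → Maybe (Carrier × Carrier)) → Set
    SecantLaw x y add = ∀ x′ y′ → ¬ x ≈ x′ → ∃[ lam ] ∃[ ν ] lam * (x′ - x) ≈ y′ - y × ν ≈ y - lam * x ×
      add (just (x′ , y′)) ≡ just (lam * lam + a₁ * lam - a₂ - x - x′ , - (lam + a₁) * (lam * lam + a₁ * lam - a₂ - x - x′) - ν - a₃)
    DoublingLaw x y add = ∀ x′ y′ → x ≈ x′ → y ≈ y′ → ¬ 2# * y + a₁ * x + a₃ ≈ 0# → ∃[ lam ] ∃[ ν ]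
      lam * (2# * y + a₁ * x + a₃) ≈ 3# * x * x + 2# * a₂ * x + a₄ - a₁ * y ×
      ν * (2# * y + a₁ * x + a₃) ≈ - (x * x * x) + a₄ * x + 2# * a₆ - a₃ * y ×
      add (just (x′ , y′)) ≡ just (lam * lam + a₁ * lam - a₂ - x - x , - (lam + a₁) * (lam * lam + a₁ * lam - a₂ - x - x) - ν - a₃)

    -- What translation by (x , y) returns in each case, with slope and intercept characterised by
    -- equations. The case analysis and the divisions of `addPt` stay outside.
    record Addition (x y : Carrier) (A : Vec) : Set where
      field
        add : Maybe (Carrier × Carrier) → Maybe (Carrier × Carrier)
        add-∞ : add nothing ≡ just (x , y)
        add-secant : SecantLaw x y add
        add-opposite : ∀ x′ y′ → x ≈ x′ → y + y′ + a₁ * x′ + a₃ ≈ 0# → add (just (x′ , y′)) ≡ nothing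
        add-double : DoublingLaw x y add
        A-rep : A Represents just (x , y)
        smooth : ¬ (FX (vec x y 1#) ≈ 0# × FY (vec x y 1#) ≈ 0#)

    module AddPoint (x y : Carrier) (A : Vec) (addition : Addition x y A) where
      open Addition addition

      private
        FA = onCurve A-rep
        n = vec x y 1#
        z = Z A
        parts = affine-parts (rep A-rep)
        z≉ : ¬ Z A ≈ 0#
        z≉ = proj₁ parts
        hx : X A ≈ Z A * x
        hx = proj₁ (proj₂ parts)
        hy : Y A ≈ Z A * y
        hy = proj₂ (proj₂ parts)
        A≈ : A ≈ᵛ z • n
        A≈ = normal hx hy
        Fn : F n ≈ 0#
        Fn = F-normal z≉ hx hy FA

      ¬0-scale : ∀ {c v} → ¬ c • v ≈ᵛ 0ᵛ → ¬ v ≈ᵛ 0ᵛ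
      ¬0-scale h (veq p q r) = h (veq (z* p) (z* q) (z* r))

      rep-chord : ∀ {S s} → Rep S s → F S ≈ 0# → ¬ chord A S ≈ᵛ 0ᵛ → Rep (negate (chord A S)) (add s)
      rep-chord {S} (at∞ x0 z0 y≉) FS c≉ = ≡.subst (Rep _) (≡.sym add-∞) (rep-scale (z * z * (1# * 1#) * (Y S * Y S)) (*-≉0 (*-≉0 (*-≉0 z≉ z≉) (*-≉0 1≉0 1≉0)) (*-≉0 y≉ y≉)) e
          (affine 1≉0 (sym (*-identityˡ _)) (sym (*-identityˡ _))))
        where
        S≈ : S ≈ᵛ 1# • vec 0# (Y S) 0#
        S≈ = veq (trans x0 (sym (*-identityˡ _))) (sym (*-identityˡ _)) (trans z0 (sym (*-identityˡ _)))
        k = z * z * (1# * 1#)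
        e : negate (chord A S) ≈ᵛ (k * (Y S * Y S)) • n
        e = ≈ᵛ-trans (negate-cong (≈ᵛ-trans (chord-cong A≈ S≈) (chord-scale z 1# n _))) (≈ᵛ-trans (negate-scale k _)
           (veq (trans (*-congˡ (≈X (chord-∞ x y (Y S)))) (sym (*-assoc _ _ _))) (trans (*-congˡ (≈Y (chord-∞ x y (Y S)))) (sym (*-assoc _ _ _))) (trans (*-congˡ (≈Z (chord-∞ x y (Y S)))) (sym (*-assoc _ _ _)))))
      rep-chord {S} (affine {x′} {y′} w≉ hx′ hy′) FS c≉ = cases (x ≟ x′)
        where
        w = Z S
        k = z * z * (w * w)
        k≉ : ¬ k ≈ 0#
        k≉ = *-≉0 (*-≉0 z≉ z≉) (*-≉0 w≉ w≉)
        S≈ : S ≈ᵛ w • vec x′ y′ 1#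
        S≈ = normal hx′ hy′
        Fn′ : F (vec x′ y′ 1#) ≈ 0#
        Fn′ = F-normal w≉ hx′ hy′ FS
        c≈ : chord A S ≈ᵛ k • chord n (vec x′ y′ 1#)
        c≈ = ≈ᵛ-trans (chord-cong A≈ S≈) (chord-scale z w n _)
        nc≈ : negate (chord A S) ≈ᵛ k • negate (chord n (vec x′ y′ 1#))
        nc≈ = ≈ᵛ-trans (negate-cong c≈) (negate-scale k _)
        module AS = AffineSecant x y x′ y′ Fn Fn′
        c′≉ : ¬ chord n (vec x′ y′ 1#) ≈ᵛ 0ᵛ
        c′≉ = ¬0-scale (λ e → c≉ (≈ᵛ-trans c≈ e))
        same : x ≈ x′ → Dec (y + y′ + a₁ * x′ + a₃ ≈ 0#) → Rep (negate (chord A S)) (add (just (x′ , y′)))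
        same x≈ (yes op) = ≡.subst (Rep _) (≡.sym (add-opposite x′ y′ x≈ op)) (rep-scale k k≉ nc≈ (rep-negate
            (at∞ (≈X (AS.vertical x≈)) (≈Z (AS.vertical x≈)) (λ y0 → c′≉ (veq (≈X (AS.vertical x≈)) y0 (≈Z (AS.vertical x≈)))))))
        -- Equal x without being opposite means that the points coincide, and there the chord
        -- vanishes.
        same x≈ (no op) = ⊥-elim (c′≉ (≈ᵛ-trans (AS.vertical x≈) (veq refl (z* y≈) refl)))
          where
          y≈ : y′ - y ≈ 0#
          y≈ = cancel-≉ʳ op (AS.same-x x≈)
        different : ¬ x ≈ x′ → (∃[ lam ] ∃[ ν ] lam * (x′ - x) ≈ y′ - y × ν ≈ y - lam * x ×
          add (just (x′ , y′)) ≡ just (lam * lam + a₁ * lam - a₂ - x - x′ , - (lam + a₁) * (lam * lam + a₁ * lam - a₂ - x - x′) - ν - a₃)) → Rep (negate (chord A S)) (add (just (x′ , y′)))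
        different x≉ (lam , ν , hl , hν , eq) = ≡.subst (Rep _) (≡.sym eq) (rep-scale k k≉ nc≈ (rep-scale (δ * δ * δ) (*-≉0 (*-≉0 δ≉ δ≉) δ≉) (AS.secant lam ν hl hν) (affine 1≉0 (sym (*-identityˡ _)) (sym (*-identityˡ _)))))
          where
          δ = x′ - x
          δ≉ : ¬ δ ≈ 0#
          δ≉ e = x≉ (sym (sub-0 e))
        cases : Dec (x ≈ x′) → Rep (negate (chord A S)) (add (just (x′ , y′)))
        cases (yes x≈) = same x≈ (_ ≟0)
        cases (no x≉) = different x≉ (add-secant x′ y′ x≉)

      sum-chord : ∀ {S s} → S Represents s → ¬ chord A S ≈ᵛ 0ᵛ → negate (chord A S) Represents add s
      sum-chord {S} (represents r FS) c≉ = represents (rep-chord r FS c≉) (trans (F-negate _) (F-chord A S FA FS))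

      sum-third : ∀ {x′ y′} → x ≈ x′ → y ≈ y′ → ∀ e → L A e ≈ 0# → ¬ third A e ≈ᵛ 0ᵛ → negate (third A e) Represents add (just (x′ , y′))
      sum-third {x′} {y′} x≈ y≈ e c₁ t≉ = represents (cases ((2# * y + a₁ * x + a₃) ≟0)) (trans (F-negate _) (F-third A e FA c₁))
        where
        c₁n : L n e ≈ 0#
        c₁n = cancel-≉ (*-≉0 z≉ z≉) (begin
          z * z * L n e ≈⟨ S.solve 2 (λ z l → z :* z :* l := z :* z :* con (+ 1) :* l) refl z (L n e) ⟩
          z * z * 1# * L n e ≈⟨ L-scale z 1# n e ⟨
          L (z • n) (1# • e) ≈⟨ L-cong (≈ᵛ-sym A≈) (1•≈ e) ⟩
          L A e ≈⟨ c₁ ⟩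
          0# ∎)
        t≈ : third A e ≈ᵛ z • third n e
        t≈ = ≈ᵛ-trans (veq (+-cong (*-congˡ (≈X A≈)) (-‿cong (*-congʳ l≈))) (+-cong (*-congˡ (≈Y A≈)) (-‿cong (*-congʳ l≈))) (+-cong (*-congˡ (≈Z A≈)) (-‿cong (*-congʳ l≈)))) (third-scale z n e)
          where
          l≈ : L e A ≈ L e (z • n)
          l≈ = L-cong (veq refl refl refl) A≈
        nt≈ : negate (third A e) ≈ᵛ z • negate (third n e)
        nt≈ = ≈ᵛ-trans (negate-cong t≈) (negate-scale z _)
        t′≉ : ¬ third n e ≈ᵛ 0ᵛ
        t′≉ = ¬0-scale (λ h → t≉ (≈ᵛ-trans t≈ h))
        module AT = AffineTangent x y Fn e c₁n
        g = 2# * y + a₁ * x + a₃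
        zero³ : ∀ {a} → a ≈ 0# → - (a * a * a) ≈ 0#
        zero³ a0 = trans (-‿cong (z* a0)) (S.solve 0 (:- (con (+ 0)) := con (+ 0)) refl)
        vert : g ≈ 0# → Rep (negate (third A e)) nothing
        vert g0 = rep-scale z z≉ nt≈ (rep-negate (at∞ (≈X fl) (≈Z fl) (λ y0 → t′≉ (veq (≈X fl) y0 (≈Z fl)))))
          where
          FY0 : FY n ≈ 0#
          FY0 = trans (FY-affine x y) g0
          -- Here ∂F/∂Y vanishes, so smoothness makes ∂F/∂X nonzero and every tangent direction is
          -- vertical.
          u0 : AT.u ≈ 0#
          u0 = cancel-≉ (λ fx0 → smooth (fx0 , FY0)) (trans (sym (trans (+-congˡ (trans (*-congʳ FY0) (zeroˡ _))) (+-identityʳ _))) AT.gradient)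
          fl = AT.flat u0
        slope : ¬ g ≈ 0# → (∃[ lam ] ∃[ ν ]
          lam * g ≈ 3# * x * x + 2# * a₂ * x + a₄ - a₁ * y × ν * g ≈ - (x * x * x) + a₄ * x + 2# * a₆ - a₃ * y ×
          add (just (x′ , y′)) ≡ just (lam * lam + a₁ * lam - a₂ - x - x , - (lam + a₁) * (lam * lam + a₁ * lam - a₂ - x - x) - ν - a₃)) → Rep (negate (third A e)) (add (just (x′ , y′)))
        slope g≉ (lam , ν , hl , hν , eq) = ≡.subst (Rep _) (≡.sym eq) (rep-scale z z≉ nt≈ (rep-scale (- (AT.u * AT.u * AT.u)) (λ h → u≉ (cube-0 (neg-0 h))) (AT.sloped lam ν v≈ ν≈) (affine 1≉0 (sym (*-identityˡ _)) (sym (*-identityˡ _)))))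
          where
          ν≈ : ν ≈ y - lam * x
          ν≈ = cancel-* g≉ (trans (*-comm _ _) (trans hν (trans (sym (tangent-slope x y lam Fn hl)) (*-comm _ _))))
          v≈ : AT.v ≈ lam * AT.u
          v≈ = cancel-* g≉ (begin
            g * AT.v ≈⟨ *-congʳ (FY-affine x y) ⟨
            FY n * AT.v ≈⟨ S.solve 4 (λ p u q v → q :* v := (p :* u :+ q :* v) :- p :* u) refl (FX n) AT.u (FY n) AT.v ⟩
            (FX n * AT.u + FY n * AT.v) - FX n * AT.u ≈⟨ +-cong AT.gradient (-‿cong (*-congʳ (trans (FX-affine x y) (-‿cong (sym hl))))) ⟩
            0# - - (lam * g) * AT.u ≈⟨ S.solve 3 (λ l g u → con (+ 0) :- (:- (l :* g)) :* u := g :* (l :* u)) refl lam g AT.u ⟩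
            g * (lam * AT.u) ∎)
          u≉ : ¬ AT.u ≈ 0#
          u≉ u0 = t′≉ (≈ᵛ-trans (AT.flat u0) (veq refl (zero³ (trans v≈ (z* u0))) refl))
        cases : Dec (g ≈ 0#) → Rep (negate (third A e)) (add (just (x′ , y′)))
        cases (yes g0) = ≡.subst (Rep _) (≡.sym (add-opposite x′ y′ x≈ (trans (+-congʳ (+-cong (+-congˡ (sym y≈)) (*-congˡ (sym x≈)))) (trans (S.solve 4 (λ y b x c → y :+ y :+ b :* x :+ c := (con (+ 1) :+ con (+ 1)) :* y :+ b :* x :+ c) refl y a₁ x a₃) g0)))) (vert g0)
        cases (no g≉) = slope g≉ (add-double x′ y′ x≈ y≈ g≉)

      parallel-affine : ∀ {S x′ y′} → ¬ Z S ≈ 0# → X S ≈ Z S * x′ → Y S ≈ Z S * y′ → Parallel A S → x ≈ x′ × y ≈ y′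
      parallel-affine {S} w≉ hx′ hy′ (pX , pY) = comp pX hx′ hx , comp pY hy′ hy
        where
        comp : ∀ {s c a b} → z * s ≈ Z S * a → s ≈ Z S * c → a ≈ z * b → b ≈ c
        comp {s} {c} {a} {b} e h k = cancel-* (*-≉0 z≉ w≉) (begin
          z * Z S * b ≈⟨ S.solve 3 (λ z w b → z :* w :* b := w :* (z :* b)) refl z (Z S) b ⟩
          Z S * (z * b) ≈⟨ *-congˡ k ⟨
          Z S * a ≈⟨ e ⟨
          z * s ≈⟨ *-congˡ h ⟩
          z * (Z S * c) ≈⟨ *-assoc _ _ _ ⟨
          z * Z S * c ∎)

      parallel? : ∀ S → Dec (Parallel A S)
      parallel? S with (z * X S) ≟ (Z S * X A) | (z * Y S) ≟ (Z S * Y A)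
      ... | yes p | yes q = yes (p , q)
      ... | no p | _ = no λ h → p (proj₁ h)
      ... | _ | no q = no λ h → q (proj₂ h)

      private
        ratio : ∀ {d₁ d₂ H G} → d₁ * G + d₂ * H ≈ 0# → ¬ (H ≈ 0# × G ≈ 0#) → ∃[ s ] d₁ ≈ s * H × d₂ ≈ s * - G
        ratio {d₁} {d₂} {H} {G} e HG with H ≟0
        ... | no H≉ = byH (inverse H H≉)
          where
          byH : (∃[ i ] H * i ≈ 1#) → ∃[ s ] d₁ ≈ s * H × d₂ ≈ s * - G
          byH (i , Hi) = d₁ * i , h₁ , cancel-* H≉ (begin
            H * d₂ ≈⟨ S.solve 4 (λ a b h g → h :* b := (a :* g :+ b :* h) :+ a :* (:- g)) refl d₁ d₂ H G ⟩
            (d₁ * G + d₂ * H) + d₁ * - G ≈⟨ trans (+-congʳ e) (+-identityˡ _) ⟩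
            d₁ * - G ≈⟨ *-congʳ h₁ ⟩
            d₁ * i * H * - G ≈⟨ S.solve 4 (λ a i h g → a :* i :* h :* g := h :* (a :* i :* g)) refl d₁ i H (- G) ⟩
            H * (d₁ * i * - G) ∎)
            where
            h₁ : d₁ ≈ d₁ * i * H
            h₁ = trans (sym (*-identityʳ d₁)) (trans (*-congˡ (sym Hi)) (S.solve 3 (λ a h i → a :* (h :* i) := a :* i :* h) refl d₁ H i))
        ... | yes H0 with G ≟0
        ...   | yes G0 = ⊥-elim (HG (H0 , G0))
        ...   | no G≉ = byG (inverse G G≉)
          where
          byG : (∃[ i ] G * i ≈ 1#) → ∃[ s ] d₁ ≈ s * H × d₂ ≈ s * - G
          byG (i , Gi) = - (d₂ * i) , trans d₁0 (sym (z* H0)) , trans (sym (*-identityʳ d₂)) (trans (*-congˡ (sym Gi)) (S.solve 3 (λ a g i → a :* (g :* i) := :- (a :* i) :* (:- g)) refl d₂ G i))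
            where
            d₁0 : d₁ ≈ 0#
            d₁0 = cancel-≉ʳ G≉ (trans (sym (trans (+-congˡ (z* H0)) (+-identityʳ _))) e)

      via-chord : ∀ {S s v} κ t → S Represents s → ¬ chord A S ≈ᵛ 0ᵛ → ¬ κ ≈ 0# → κ • chord A S ≈ᵛ (- (t * t * t)) • v → negate v Represents add s
      via-chord {S} {s} {v} κ t S-rep c≉ κ≉ e = represents (rep-proportional κ μ κ≉ μ≉ e′ (rep nc)) (F-proportional κ μ μ≉ e′ (onCurve nc))
        where
        μ = - (t * t * t)
        nc = sum-chord S-rep c≉
        e′ : κ • negate (chord A S) ≈ᵛ μ • negate v
        e′ = ≈ᵛ-trans (≈ᵛ-sym (negate-scale κ _)) (≈ᵛ-trans (negate-cong e) (negate-scale μ v))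
        μ≉ : ¬ μ ≈ 0#
        μ≉ m0 = c≉ (veq (c (≈X e)) (c (≈Y e)) (c (≈Z e)))
          where
          c : ∀ {a b} → κ * a ≈ μ * b → a ≈ 0#
          c h = cancel-≉ κ≉ (trans h (trans (*-congʳ m0) (zeroˡ _)))

      -- For S ≠ A the law is a nonzero multiple of the chord, for S = A it is the tangent
      -- construction. Both cases are required over ℚ: the residue class of A modulo p contains A
      -- and other points.
      sum-tangentZ : ∀ {S s} → S Represents s → ¬ Z S ≈ 0# → ¬ tangentZ A S ≈ᵛ 0ᵛ → negate (tangentZ A S) Represents add s
      sum-tangentZ (represents (at∞ _ z0 _) _) w≉ t≉ = ⊥-elim (w≉ z0)
      sum-tangentZ {S} S-rep@(represents (affine {x′} {y′} _ hx′ hy′) FS) w≉ t≉ with parallel? S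
      ... | yes par = represents (rep-scale w w≉ e (rep th)) (F-proportional w 1# 1≉0 (≈ᵛ-trans (≈ᵛ-sym e) (≈ᵛ-sym (1•≈ _))) (onCurve th))
        where
        open DirZ A S
        w = Z S
        same = parallel-affine w≉ hx′ hy′ par
        t≈ = tangentZ-third A S par
        c₁ : L A eZ ≈ 0#
        c₁ = cancel-≉ z≉ (begin
          z * (FX A * H + FY A * - G + FZ A * 0#) ≈⟨ S.solve 6 (λ z p q r h g → z :* (p :* h :+ q :* (:- g) :+ r :* con (+ 0)) := p :* (z :* h) :- z :* q :* g) refl z (FX A) (FY A) (FZ A) H G ⟩
          FX A * (z * H) - z * FY A * G ≈⟨ +-cong (*-congˡ (HZ-parallel A S z≉ w≉ par)) (-‿cong (*-congˡ (GZ-parallel A S z≉ w≉ par))) ⟩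
          FX A * (z * w * w * FY A) - z * FY A * (w * w * FX A) ≈⟨ S.solve 4 (λ z w p q → p :* (z :* w :* w :* q) :- z :* q :* (w :* w :* p) := con (+ 0)) refl z w (FX A) (FY A) ⟩
          0# ∎)
        th = sum-third (proj₁ same) (proj₂ same) eZ c₁ (¬0-scale (λ h → t≉ (≈ᵛ-trans t≈ h)))
        e : negate (tangentZ A S) ≈ᵛ w • negate (third A eZ)
        e = ≈ᵛ-trans (negate-cong t≈) (negate-scale w _)
      ... | no ¬par = via-chord (Z S * Z S * (Z A * Z A)) (proj₁ r) S-rep (λ c0 → ¬par (chord-0 A S FA FS z≉ c0)) (*-≉0 (*-≉0 w≉ w≉) (*-≉0 z≉ z≉))
          (tangentZ-chord A S FA FS (proj₁ r) (proj₁ (proj₂ r)) (proj₂ (proj₂ r)))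
        where
        open DirZ A S
        HG : ¬ (H ≈ 0# × G ≈ 0#)
        HG (H0 , G0) = t≉ (veq (k0 (trans (+-cong (c3 _) (-‿cong (z* H0))) (-‿inverseʳ 0#))) (trans (+-cong (c3 _) (z* G0)) (+-identityˡ 0#)) (c3 _))
          where
          k0 : ∀ {a} → a ≈ 0# → a ≈ 0#
          k0 h = h
          c3 : ∀ b → c₃ * b ≈ 0#
          c3 b = trans (*-congʳ (trans (-‿cong (z* H0)) (S.solve 0 (:- (con (+ 0)) := con (+ 0)) refl))) (zeroˡ b)
        r = ratio (relation FA FS) HG

      sum-tangentY : ∀ {S s} → S Represents s → ¬ Y A ≈ 0# → ¬ Y S ≈ 0# → ¬ tangentY A S ≈ᵛ 0ᵛ → negate (tangentY A S) Represents add s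
      sum-tangentY {S} {s} S-rep yA≉ yS≉ t≉ with parallel? S
      sum-tangentY {S} (represents (at∞ x0 z0 _) _) yA≉ yS≉ t≉ | yes par = ⊥-elim (yS≉ (cancel-≉ z≉ (trans (proj₂ par) (trans (*-congʳ z0) (zeroˡ _)))))
      sum-tangentY {S} S-rep@(represents (affine {x′} {y′} w≉ hx′ hy′) FS) yA≉ yS≉ t≉ | yes par =
          represents (rep-scale (Y S) yS≉ e (rep th)) (F-proportional (Y S) 1# 1≉0 (≈ᵛ-trans (≈ᵛ-sym e) (≈ᵛ-sym (1•≈ _))) (onCurve th))
        where
        open DirY A S
        w = Y S
        same = parallel-affine w≉ hx′ hy′ par
        ww : Y A * Z S ≈ Y S * Z A
        ww = trans (*-comm _ _) (trans (sym (proj₂ par)) (*-comm _ _))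
        uu : Y A * X S ≈ Y S * X A
        uu = cancel-* z≉ (begin
          z * (Y A * X S) ≈⟨ S.solve 3 (λ z a b → z :* (a :* b) := a :* (z :* b)) refl z (Y A) (X S) ⟩
          Y A * (z * X S) ≈⟨ *-congˡ (proj₁ par) ⟩
          Y A * (Z S * X A) ≈⟨ *-assoc _ _ _ ⟨
          Y A * Z S * X A ≈⟨ *-congʳ ww ⟩
          Y S * Z A * X A ≈⟨ S.solve 3 (λ a z b → a :* z :* b := z :* (a :* b)) refl (Y S) z (X A) ⟩
          z * (Y S * X A) ∎)
        t≈ = tangentY-third A S uu ww
        H≈ : H ≈ w * w * FZ A
        H≈ = trans (+-cong (+-cong (+-cong (+-cong (+-congˡ (*-congˡ (*-congʳ uu))) (*-congˡ (*-congˡ (+-congˡ ww)))) (-‿cong (*-congˡ (*-cong uu uu)))) (-‿cong (*-congˡ (*-cong uu (+-congˡ ww))))) (-‿cong (*-congˡ (+-cong (+-congˡ (*-congˡ ww)) (*-cong ww ww)))))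
          (S.solve 9 (λ b₁ b₂ b₃ b₄ b₆ w x y z → y :* w :* (y :* w) :+ b₁ :* (w :* x :* (y :* w)) :+ b₃ :* (y :* w :* (w :* z :+ w :* z)) :- b₂ :* (w :* x :* (w :* x)) :- b₄ :* (w :* x :* (w :* z :+ w :* z)) :- b₆ :* (w :* z :* (w :* z) :+ w :* z :* (w :* z) :+ w :* z :* (w :* z))
             := w :* w :* (y :* y :+ b₁ :* (x :* y) :+ (con (+ 1) :+ con (+ 1)) :* (b₃ :* (y :* z)) :- b₂ :* (x :* x) :- (con (+ 1) :+ con (+ 1)) :* (b₄ :* (x :* z)) :- (con (+ 1) :+ (con (+ 1) :+ con (+ 1))) :* (b₆ :* (z :* z)))) refl a₁ a₂ a₃ a₄ a₆ w (X A) (Y A) (Z A))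
        G≈ : G ≈ w * w * FX A
        G≈ = trans (+-congʳ (+-cong (+-congˡ (-‿cong (+-cong (+-congˡ (*-congˡ uu)) (*-cong uu uu)))) (-‿cong (*-congˡ (*-congʳ (+-congˡ uu))))))
          (S.solve 8 (λ b₁ b₂ w b₄ b₆ x y z → b₁ :* (y :* w :* (w :* z)) :- (w :* x :* (w :* x) :+ w :* x :* (w :* x) :+ w :* x :* (w :* x)) :- b₂ :* ((w :* x :+ w :* x) :* (w :* z)) :- b₄ :* (w :* z :* (w :* z))
             := w :* w :* (b₁ :* (y :* z) :- (con (+ 1) :+ (con (+ 1) :+ con (+ 1))) :* (x :* x) :- (con (+ 1) :+ con (+ 1)) :* (b₂ :* (x :* z)) :- b₄ :* (z :* z))) refl a₁ a₂ w a₄ a₆ (X A) (Y A) (Z A))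
        c₁ : L A eY ≈ 0#
        c₁ = trans (+-cong (+-congʳ (*-congˡ H≈)) (*-congˡ (-‿cong G≈))) (S.solve 4 (λ w p q r → p :* (w :* w :* r) :+ q :* con (+ 0) :+ r :* (:- (w :* w :* p)) := con (+ 0)) refl w (FX A) (FY A) (FZ A))
        th = sum-third (proj₁ same) (proj₂ same) eY c₁ (¬0-scale (λ h → t≉ (≈ᵛ-trans t≈ h)))
        e : negate (tangentY A S) ≈ᵛ w • negate (third A eY)
        e = ≈ᵛ-trans (negate-cong t≈) (negate-scale w _)
      sum-tangentY {S} S-rep@(represents _ FS) yA≉ yS≉ t≉ | no ¬par = via-chord (Y S * Y S * (Y A * Y A)) (proj₁ r) S-rep (λ c0 → ¬par (chord-0 A S FA FS z≉ c0)) (*-≉0 (*-≉0 yS≉ yS≉) (*-≉0 yA≉ yA≉))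
          (tangentY-chord A S FA FS (proj₁ r) (proj₁ (proj₂ r)) (proj₂ (proj₂ r)))
        where
        open DirY A S
        HG : ¬ (H ≈ 0# × G ≈ 0#)
        HG (H0 , G0) = t≉ (veq (trans (+-cong (c3 _) (-‿cong (z* H0))) (-‿inverseʳ 0#)) (c3 _) (trans (+-cong (c3 _) (z* G0)) (+-identityˡ 0#)))
          where
          c3 : ∀ b → c₃ * b ≈ 0#
          c3 b = trans (*-congʳ (trans (+-cong (+-cong (+-cong (z* (z* G0)) (-‿cong (z* H0))) (-‿cong (z* (z* G0)))) (z* (z* G0))) (S.solve 0 (con (+ 0) :- con (+ 0) :- con (+ 0) :+ con (+ 0) := con (+ 0)) refl))) (zeroˡ b)
        r = ratio (relation FA FS) HG

      private
        represents-proportional : ∀ {v w s} κ μ → ¬ κ ≈ 0# → ¬ μ ≈ 0# → κ • w ≈ᵛ μ • v → w Represents s → v Represents s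
        represents-proportional κ μ κ≉ μ≉ e (represents r Fw) = represents (rep-proportional κ μ κ≉ μ≉ e r) (F-proportional κ μ μ≉ e Fw)

        represents-negate : ∀ {v s} → v Represents s → negate v Represents ⊖ s
        represents-negate (represents r Fv) = represents (rep-negate r) (trans (F-negate _) Fv)

        negate-proportional : ∀ {v w} κ μ → κ • w ≈ᵛ μ • v → κ • negate w ≈ᵛ μ • negate v
        negate-proportional {v} {w} κ μ e = ≈ᵛ-trans (≈ᵛ-sym (negate-scale κ w)) (≈ᵛ-trans (negate-cong e) (negate-scale μ v))

        ⊖-negated : ∀ {v s} → negate v Represents s → v Represents ⊖ s
        ⊖-negated {v} h = represents-proportional 1# 1# 1≉0 1≉0 (veq (*-congˡ (≈X nn)) (*-congˡ (≈Y nn)) (*-congˡ (≈Z nn))) (represents-negate h)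
          where nn = negate-negate v

        represents≉0 : ∀ {v s} → v Represents s → ¬ v ≈ᵛ 0ᵛ
        represents≉0 (represents (at∞ _ _ y≉) _) e = y≉ (≈Y e)
        represents≉0 (represents (affine z≉ _ _) _) e = z≉ (≈Z e)

        -- R ∝ A: the point represented by R is (x , y) itself.
        sum-third′ : ∀ {R t} c → R ≈ᵛ c • A → R Represents t → ∀ e → L A e ≈ 0# → ¬ third A e ≈ᵛ 0ᵛ → negate (third A e) Represents add t
        sum-third′ {R} c R≈ R-rep@(represents (at∞ _ z0 _) _) e c₁ t≉ = ⊥-elim (represents≉0 R-rep (≈ᵛ-trans R≈ (veq (l _) (l _) (l _))))
          where
          c0 : c ≈ 0#
          c0 = cancel-≉ʳ z≉ (trans (sym (≈Z R≈)) z0)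
          l : ∀ a → c * a ≈ 0#
          l a = trans (*-congʳ c0) (zeroˡ a)
        sum-third′ {R} c R≈ (represents (affine w≉ hx′ hy′) _) e c₁ t≉ = sum-third (proj₁ same) (proj₂ same) e c₁ t≉
          where
          par : ∀ {a r} → r ≈ c * a → z * r ≈ Z R * a
          par {a} {r} h = trans (*-congˡ h) (trans (S.solve 3 (λ z c a → z :* (c :* a) := c :* z :* a) refl z c a) (*-congʳ (sym (≈Z R≈))))
          same = parallel-affine w≉ hx′ hy′ (par (≈X R≈) , par (≈Y R≈))

        line : ∀ α β u v → Vec
        line α β u v = vec (α * X u + β * X v) (α * Y u + β * Y v) (α * Z u + β * Z v)

        L-A-line : ∀ α β e → L A (line α β A e) ≈ β * L A e
        L-A-line α β e = trans (L-lineʳ α β A e) (trans (+-congʳ (*-congˡ (*-congˡ FA))) (S.solve 2 (λ a l → (con (+ 1) :+ (con (+ 1) :+ con (+ 1))) :* (a :* con (+ 0)) :+ l := l) refl α (β * L A e)))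

        L-line-A : ∀ α β e → L (line α β A e) A ≈ 2# * (α * β * L A e) + β * β * L e A
        L-line-A α β e = trans (L-lineˡ α β A e) (+-congʳ (trans (+-congʳ (*-congˡ (*-congˡ FA))) (S.solve 2 (λ a l → (con (+ 1) :+ (con (+ 1) :+ con (+ 1))) :* (a :* a :* con (+ 0)) :+ l := l) refl α (2# * (α * β * L A e)))))

        comb : ∀ l k a s → l * a - k * s ≈ l * a + - k * s
        comb l k a s = S.solve 4 (λ l k a s → l :* a :- k :* s := l :* a :+ (:- k) :* s) refl l k a s

        chord-line : ∀ S → chord A S ≈ᵛ line (L S A) (- L A S) A S
        chord-line S = veq (comb _ _ _ _) (comb _ _ _ _) (comb _ _ _ _)

        third-line : ∀ e → third A e ≈ᵛ line (F e) (- L e A) A e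
        third-line e = veq (comb _ _ _ _) (comb _ _ _ _) (comb _ _ _ _)

        refl-v : ∀ {v} → v ≈ᵛ v
        refl-v = veq refl refl refl

        -- The line through A and the third point meets the cubic again in S.
        chord-chord : ∀ S → chord A (chord A S) ≈ᵛ (- (L A S * L A S * L A S)) • S
        chord-chord S = ≈ᵛ-trans (chord-cong refl-v (chord-line S)) (veq (c (X A) (X S)) (c (Y A) (Y S)) (c (Z A) (Z S)))
          where
          l = L S A
          k = L A S
          W = line l (- k) A S
          c : ∀ a s → L W A * a - L A W * (l * a + - k * s) ≈ - (k * k * k) * s
          c a s = trans (+-cong (*-congʳ (L-line-A l (- k) S)) (-‿cong (*-congʳ (L-A-line l (- k) S))))
            (S.solve 4 (λ l k a s → ((con (+ 1) :+ con (+ 1)) :* (l :* (:- k) :* k) :+ (:- k) :* (:- k) :* l) :* a :- (:- k) :* k :* (l :* a :+ (:- k) :* s) := :- (k :* k :* k) :* s) refl l k a s)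

        chord-third : ∀ e → L A e ≈ 0# → chord A (third A e) ≈ᵛ (L e A * L e A * L e A) • A
        chord-third e c₁ = ≈ᵛ-trans (chord-cong refl-v (third-line e)) (veq (c (X A) (X e)) (c (Y A) (Y e)) (c (Z A) (Z e)))
          where
          f = F e
          l = L e A
          W = line f (- l) A e
          c : ∀ a s → L W A * a - L A W * (f * a + - l * s) ≈ l * l * l * a
          c a s = trans (+-cong (*-congʳ (trans (L-line-A f (- l) e) (+-congʳ (*-congˡ (*-congˡ c₁))))) (-‿cong (*-congʳ (trans (L-A-line f (- l) e) (*-congˡ c₁)))))
            (S.solve 4 (λ f l a s → ((con (+ 1) :+ con (+ 1)) :* (f :* (:- l) :* con (+ 0)) :+ (:- l) :* (:- l) :* l) :* a :- (:- l) :* con (+ 0) :* (f :* a :+ (:- l) :* s) := l :* l :* l :* a) refl f l a s)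

        e₀ : Vec
        e₀ = vec (FY A) (- FX A) 0#

        c₁₀ : L A e₀ ≈ 0#
        c₁₀ = S.solve 3 (λ p q r → p :* q :+ q :* (:- p) :+ r :* con (+ 0) := con (+ 0)) refl (FX A) (FY A) (FZ A)

        third₀≉ : ¬ third A e₀ ≈ᵛ 0ᵛ
        third₀≉ (veq rX rY rZ) = smooth (cancel-≉ (*-≉0 z≉ z≉) (trans (sym FX≈) FX0) , cancel-≉ (*-≉0 z≉ z≉) (trans (sym FY≈) FY0))
          where
          FX≈ : FX A ≈ z * z * FX n
          FX≈ = trans (FX-cong A≈) (S.solve 7 (λ b₁ b₂ b₄ z x y o → b₁ :* (z :* y :* (z :* o)) :- (con (+ 1) :+ (con (+ 1) :+ con (+ 1))) :* (z :* x :* (z :* x)) :- (con (+ 1) :+ con (+ 1)) :* (b₂ :* (z :* x :* (z :* o))) :- b₄ :* (z :* o :* (z :* o))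
            := z :* z :* (b₁ :* (y :* o) :- (con (+ 1) :+ (con (+ 1) :+ con (+ 1))) :* (x :* x) :- (con (+ 1) :+ con (+ 1)) :* (b₂ :* (x :* o)) :- b₄ :* (o :* o))) refl a₁ a₂ a₄ z x y 1#)
          FY≈ : FY A ≈ z * z * FY n
          FY≈ = trans (FY-cong A≈) (S.solve 6 (λ b₁ b₃ z x y o → (con (+ 1) :+ con (+ 1)) :* (z :* y :* (z :* o)) :+ b₁ :* (z :* x :* (z :* o)) :+ b₃ :* (z :* o :* (z :* o))
            := z :* z :* ((con (+ 1) :+ con (+ 1)) :* (y :* o) :+ b₁ :* (x :* o) :+ b₃ :* (o :* o))) refl a₁ a₃ z x y 1#)
          f0 : F e₀ ≈ 0#
          f0 = cancel-≉ʳ z≉ (trans (S.solve 3 (λ f z l → f :* z := f :* z :- l :* con (+ 0)) refl (F e₀) z (L e₀ A)) rZ)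
          FY0 : FY A ≈ 0#
          FY0 = cube-0 (neg-0 (trans (sym (F-∞ _ _)) f0))
          FX0 : FX A ≈ 0#
          FX0 = cube-0 (cancel-≉ʳ z≉ (begin
            FX A * FX A * FX A * z ≈⟨ S.solve 3 (λ p z y → p :* p :* p :* z := con (+ 0) :* y :- (:- p) :* (:- p) :* z :* (:- p)) refl (FX A) z (Y A) ⟩
            0# * Y A - - FX A * - FX A * z * - FX A ≈⟨ +-cong (*-congʳ f0) (-‿cong (*-congʳ (L-∞₀ (- FX A) A FY0))) ⟨
            F e₀ * Y A - L e₀ A * - FX A ≈⟨ rY ⟩
            0# ∎))

      -- The one associativity-like rule of the proof. Let Q be the third point on the line of A and
      -- S; then Q represents -(A + S), and the third point on the line of A and Q is S. The cases
      -- are: generic; line tangent at A, where Q = A; S = A; and A an inflection point, where S = A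
      -- = Q. A common vector is returned because points over a field with setoid equality need not
      -- be equal.
      cancellation : ∀ {S s} → S Represents s → ∃[ v ] v Represents add (⊖ add s) × v Represents ⊖ s
      cancellation {S} {s} S-rep with parallel? S
      cancellation {S} {s} S-rep | no ¬par with L A S ≟0
      ... | no k≉ = negate (chord A Q) , sum-chord (⊖-negated sum) c≉ ,
          represents-proportional K 1# K≉ 1≉0 (negate-proportional K 1# (≈ᵛ-trans (≈ᵛ-sym (chord-chord S)) (≈ᵛ-sym (1•≈ _)))) (represents-negate S-rep)
        where
        Q = chord A S
        Q≉ : ¬ Q ≈ᵛ 0ᵛ
        Q≉ c0 = ¬par (chord-0 A S FA (onCurve S-rep) z≉ c0)
        sum = sum-chord S-rep Q≉
        k = L A S
        K = - (k * k * k)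
        K≉ : ¬ K ≈ 0#
        K≉ h = k≉ (cube-0 (neg-0 h))
        c≉ : ¬ chord A Q ≈ᵛ 0ᵛ
        c≉ h = represents≉0 S-rep (veq (d (≈X e)) (d (≈Y e)) (d (≈Z e)))
          where
          e = ≈ᵛ-trans (≈ᵛ-sym (chord-chord S)) h
          d : ∀ {a} → K * a ≈ 0# → a ≈ 0#
          d = cancel-≉ K≉
      ... | yes k0 = negate (third A S) , sum-third′ (L S A) Q≈ (⊖-negated sum) S k0 t≉ ,
          represents-proportional (- l) 1# (λ h → l≉ (neg-0 h)) 1≉0 (negate-proportional (- l) 1# (≈ᵛ-trans (≈ᵛ-sym t≈) (≈ᵛ-sym (1•≈ _)))) (represents-negate S-rep)
        where
        Q = chord A S
        l = L S A
        Q≉ : ¬ Q ≈ᵛ 0ᵛ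
        Q≉ c0 = ¬par (chord-0 A S FA (onCurve S-rep) z≉ c0)
        sum = sum-chord S-rep Q≉
        Q≈ : Q ≈ᵛ l • A
        Q≈ = veq (c _ _) (c _ _) (c _ _)
          where
          c : ∀ a b → l * a - L A S * b ≈ l * a
          c a b = trans (+-congˡ (-‿cong (trans (*-congʳ k0) (zeroˡ b)))) (S.solve 1 (λ x → x :- con (+ 0) := x) refl (l * a))
        l≉ : ¬ l ≈ 0#
        l≉ l0 = Q≉ (≈ᵛ-trans Q≈ (veq (d _) (d _) (d _)))
          where
          d : ∀ a → l * a ≈ 0#
          d a = trans (*-congʳ l0) (zeroˡ a)
        t≈ : third A S ≈ᵛ (- l) • S
        t≈ = veq (c _ _) (c _ _) (c _ _)
          where
          c : ∀ a b → F S * a - l * b ≈ - l * b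
          c a b = trans (+-congʳ (trans (*-congʳ (onCurve S-rep)) (zeroˡ a))) (S.solve 2 (λ l b → con (+ 0) :- l :* b := :- l :* b) refl l b)
        t≉ : ¬ third A S ≈ᵛ 0ᵛ
        t≉ h = represents≉0 S-rep (veq (d (≈X e)) (d (≈Y e)) (d (≈Z e)))
          where
          e = ≈ᵛ-trans (≈ᵛ-sym t≈) h
          d : ∀ {a} → - l * a ≈ 0# → a ≈ 0#
          d = cancel-≉ (λ h → l≉ (neg-0 h))
      cancellation {S} {s} S-rep | yes par = tangent (L e₀ A ≟0)
        where
        Q = third A e₀
        S∝A : z • S ≈ᵛ Z S • A
        S∝A = veq (proj₁ par) (proj₂ par) (*-comm _ _)
        w≉ : ¬ Z S ≈ 0#
        w≉ w0 = represents≉0 S-rep (veq (d (≈X S∝A)) (d (≈Y S∝A)) w0)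
          where
          d : ∀ {a b} → z * a ≈ Z S * b → a ≈ 0#
          d h = cancel-≉ z≉ (trans h (trans (*-congʳ w0) (zeroˡ _)))
        A-s : A Represents s
        A-s = represents-proportional z (Z S) z≉ w≉ S∝A S-rep
        sum : negate Q Represents add s
        sum = sum-third′ (1#) (veq (sym (*-identityˡ _)) (sym (*-identityˡ _)) (sym (*-identityˡ _))) A-s e₀ c₁₀ third₀≉
        f = F e₀
        l = L e₀ A
        finish : ∀ c v → ¬ c ≈ 0# → v ≈ᵛ c • A → negate v Represents ⊖ s
        finish c v c≉ e = represents-proportional c 1# c≉ 1≉0 (negate-proportional c 1# (≈ᵛ-trans (≈ᵛ-sym e) (≈ᵛ-sym (1•≈ _)))) (represents-negate A-s)
        tangent : Dec (l ≈ 0#) → ∃[ v ] v Represents add (⊖ add s) × v Represents ⊖ s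
        tangent (no l≉) = negate (chord A Q) , sum-chord (⊖-negated sum) c≉ , finish (l * l * l) (chord A Q) l³≉ (chord-third e₀ c₁₀)
          where
          l³≉ : ¬ l * l * l ≈ 0#
          l³≉ h = l≉ (cube-0 h)
          c≉ : ¬ chord A Q ≈ᵛ 0ᵛ
          c≉ h = z≉ (cancel-≉ l³≉ (trans (sym (≈Z (chord-third e₀ c₁₀))) (≈Z h)))
        tangent (yes l0) = negate Q , sum-third′ f Q≈ (⊖-negated sum) e₀ c₁₀ third₀≉ , finish f Q f≉ Q≈
          where
          Q≈ : Q ≈ᵛ f • A
          Q≈ = veq (c _ _) (c _ _) (c _ _)
            where
            c : ∀ a b → f * a - l * b ≈ f * a
            c a b = trans (+-congˡ (-‿cong (trans (*-congʳ l0) (zeroˡ b)))) (S.solve 1 (λ x → x :- con (+ 0) := x) refl (f * a))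
          f≉ : ¬ f ≈ 0#
          f≉ f0 = third₀≉ (≈ᵛ-trans Q≈ (veq (d _) (d _) (d _)))
            where
            d : ∀ a → f * a ≈ 0#
            d a = trans (*-congʳ f0) (zeroˡ a)

-- A singular point makes the discriminant vanish

module Discriminant (𝔽 : Field) (a₁ a₂ a₃ a₄ a₆ : CommutativeRing.Carrier (Field.commutativeRing 𝔽)) where
  open Field 𝔽 using () renaming (commutativeRing to R)
  open CommutativeRing R
  open OverField.Cubic 𝔽 a₁ a₂ a₃ a₄ a₆ using (F; FX; FY)
  open import Relation.Binary.Reasoning.Setoid setoid
  private module S = IntSolver R

  private
    n# : ℤ → Carrier
    n# = S.fromℤ

  b₂ b₄ b₆ b₈ : Carrier
  b₂ = a₁ * a₁ + n# (+ 4) * a₂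
  b₄ = n# (+ 2) * a₄ + a₁ * a₃
  b₆ = a₃ * a₃ + n# (+ 4) * a₆
  b₈ = a₁ * a₁ * a₆ + n# (+ 4) * a₂ * a₆ - a₁ * a₃ * a₄ + a₂ * a₃ * a₃ - a₄ * a₄

  D : Carrier → Carrier → Carrier → Carrier → Carrier
  D b₂ b₄ b₆ b₈ = - (b₂ * b₂ * b₈) - n# (+ 8) * b₄ * b₄ * b₄ - n# (+ 27) * b₆ * b₆ + n# (+ 9) * b₂ * b₄ * b₆

  private
    :D : ∀ (b₂ b₄ b₆ b₈ : Polynomial) → Polynomial
    :D b₂ b₄ b₆ b₈ = :- (b₂ :* b₂ :* b₈) :- con (+ 8) :* b₄ :* b₄ :* b₄ :- con (+ 27) :* b₆ :* b₆ :+ con (+ 9) :* b₂ :* b₄ :* b₆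

  -- The b-invariants after translating x to the origin.
  D-translate : ∀ x → D b₂ b₄ b₆ b₈ ≈ D (b₂ + n# (+ 12) * x) (b₄ + x * b₂ + n# (+ 6) * x * x) (b₆ + n# (+ 2) * x * b₄ + x * x * b₂ + n# (+ 4) * x * x * x)
    (b₈ + n# (+ 3) * x * b₆ + n# (+ 3) * x * x * b₄ + x * x * x * b₂ + n# (+ 3) * x * x * x * x)
  D-translate x = S.solve 6 (λ a₁ a₂ a₃ a₄ a₆ x → let
      b₂ = a₁ :* a₁ :+ con (+ 4) :* a₂
      b₄ = con (+ 2) :* a₄ :+ a₁ :* a₃
      b₆ = a₃ :* a₃ :+ con (+ 4) :* a₆
      b₈ = a₁ :* a₁ :* a₆ :+ con (+ 4) :* a₂ :* a₆ :- a₁ :* a₃ :* a₄ :+ a₂ :* a₃ :* a₃ :- a₄ :* a₄ in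
      :D b₂ b₄ b₆ b₈ := :D (b₂ :+ con (+ 12) :* x) (b₄ :+ x :* b₂ :+ con (+ 6) :* x :* x) (b₆ :+ con (+ 2) :* x :* b₄ :+ x :* x :* b₂ :+ con (+ 4) :* x :* x :* x)
        (b₈ :+ con (+ 3) :* x :* b₆ :+ con (+ 3) :* x :* x :* b₄ :+ x :* x :* x :* b₂ :+ con (+ 3) :* x :* x :* x :* x)) refl a₁ a₂ a₃ a₄ a₆ x

  -- With the singular point moved to x = 0, the new b₄, b₆ and b₈ are combinations of F and its
  -- partial derivatives there, and each term of the discriminant contains one of them.
  singular⇒D≈0 : ∀ x y → F (vec x y 1#) ≈ 0# → FX (vec x y 1#) ≈ 0# → FY (vec x y 1#) ≈ 0# → D b₂ b₄ b₆ b₈ ≈ 0#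
  singular⇒D≈0 x y F0 FX0 FY0 = begin
    D b₂ b₄ b₆ b₈ ≈⟨ D-translate x ⟩
    D (b₂ + n# (+ 12) * x) _ _ _ ≈⟨ +-cong (+-cong (+-cong (-‿cong (*-congˡ b₈0)) (-‿cong (*-congˡ b₄0))) (-‿cong (*-congˡ b₆0))) (*-congˡ b₆0) ⟩
    - (t * t * 0#) - n# (+ 8) * b₄′ * b₄′ * 0# - n# (+ 27) * b₆′ * 0# + n# (+ 9) * t * b₄′ * 0#
      ≈⟨ S.solve 3 (λ t u v → :- (t :* t :* con (+ 0)) :- con (+ 8) :* u :* u :* con (+ 0) :- con (+ 27) :* v :* con (+ 0) :+ con (+ 9) :* t :* u :* con (+ 0) := con (+ 0)) refl t b₄′ b₆′ ⟩
    0# ∎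
    where
    t = b₂ + n# (+ 12) * x
    b₄′ = b₄ + x * b₂ + n# (+ 6) * x * x
    b₆′ = b₆ + n# (+ 2) * x * b₄ + x * x * b₂ + n# (+ 4) * x * x * x
    b₈′ = b₈ + n# (+ 3) * x * b₆ + n# (+ 3) * x * x * b₄ + x * x * x * b₂ + n# (+ 3) * x * x * x * x
    p = vec x y 1#
    b₄0 : b₄′ ≈ 0#
    b₄0 = begin
      b₄′ ≈⟨ S.solve 7 (λ a₁ a₂ a₃ a₄ a₆ x y → let open :F a₁ a₂ a₃ a₄ a₆ using () renaming (FX to FX′; FY to FY′) ; p = vec x y (con (+ 1)) in
          (con (+ 2) :* a₄ :+ a₁ :* a₃) :+ x :* (a₁ :* a₁ :+ con (+ 4) :* a₂) :+ con (+ 6) :* x :* x := a₁ :* FY′ p :- con (+ 2) :* FX′ p) refl a₁ a₂ a₃ a₄ a₆ x y ⟩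
      a₁ * FY p - n# (+ 2) * FX p ≈⟨ +-cong (*-congˡ FY0) (-‿cong (*-congˡ FX0)) ⟩
      a₁ * 0# - n# (+ 2) * 0# ≈⟨ S.solve 1 (λ a → a :* con (+ 0) :- con (+ 2) :* con (+ 0) := con (+ 0)) refl a₁ ⟩
      0# ∎
    b₆0 : b₆′ ≈ 0#
    b₆0 = begin
      b₆′ ≈⟨ S.solve 7 (λ a₁ a₂ a₃ a₄ a₆ x y → let open :F a₁ a₂ a₃ a₄ a₆ using () renaming (F to F′; FY to FY′) ; p = vec x y (con (+ 1)) ; b₂ = a₁ :* a₁ :+ con (+ 4) :* a₂ ; b₄ = con (+ 2) :* a₄ :+ a₁ :* a₃ in
          (a₃ :* a₃ :+ con (+ 4) :* a₆) :+ con (+ 2) :* x :* b₄ :+ x :* x :* b₂ :+ con (+ 4) :* x :* x :* x := FY′ p :* FY′ p :- con (+ 4) :* F′ p) refl a₁ a₂ a₃ a₄ a₆ x y ⟩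
      FY p * FY p - n# (+ 4) * F p ≈⟨ +-cong (*-congˡ FY0) (-‿cong (*-congˡ F0)) ⟩
      FY p * 0# - n# (+ 4) * 0# ≈⟨ S.solve 1 (λ a → a :* con (+ 0) :- con (+ 4) :* con (+ 0) := con (+ 0)) refl (FY p) ⟩
      0# ∎
    b₈0 : b₈′ ≈ 0#
    b₈0 = begin
      b₈′ ≈⟨ S.solve 7 (λ a₁ a₂ a₃ a₄ a₆ x y → let
          open :F a₁ a₂ a₃ a₄ a₆ using () renaming (F to F′; FX to FX′; FY to FY′)
          p = vec x y (con (+ 1))
          b₂ = a₁ :* a₁ :+ con (+ 4) :* a₂
          b₄ = con (+ 2) :* a₄ :+ a₁ :* a₃
          b₆ = a₃ :* a₃ :+ con (+ 4) :* a₆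
          b₈ = a₁ :* a₁ :* a₆ :+ con (+ 4) :* a₂ :* a₆ :- a₁ :* a₃ :* a₄ :+ a₂ :* a₃ :* a₃ :- a₄ :* a₄
          in b₈ :+ con (+ 3) :* x :* b₆ :+ con (+ 3) :* x :* x :* b₄ :+ x :* x :* x :* b₂ :+ con (+ 3) :* x :* x :* x :* x
            := (:- (a₁ :* a₁) :- con (+ 4) :* (a₂ :+ con (+ 3) :* x)) :* F′ p :+ (a₁ :* FX′ p :+ (a₂ :+ con (+ 3) :* x) :* FY′ p) :* FY′ p :- FX′ p :* FX′ p) refl a₁ a₂ a₃ a₄ a₆ x y ⟩
      (- (a₁ * a₁) - n# (+ 4) * (a₂ + n# (+ 3) * x)) * F p + (a₁ * FX p + (a₂ + n# (+ 3) * x) * FY p) * FY p - FX p * FX p ≈⟨ +-cong (+-cong (*-congˡ F0) (*-congˡ FY0)) (-‿cong (*-congˡ FX0)) ⟩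
      (- (a₁ * a₁) - n# (+ 4) * (a₂ + n# (+ 3) * x)) * 0# + (a₁ * FX p + (a₂ + n# (+ 3) * x) * FY p) * 0# - FX p * 0# ≈⟨ S.solve 3 (λ u v w → u :* con (+ 0) :+ v :* con (+ 0) :- w :* con (+ 0) := con (+ 0)) refl _ _ _ ⟩
      0# ∎

-- Polynomial maps on integer vectors: congruence, homogeneity, progressions

-- Polynomials as syntax: one law can be evaluated over ℤ, ℚ and the residue field, and its
-- compatibility with congruences, scaling and progressions is proved by induction on the syntax.
data Expr : Set where
  par : ℤ → Expr
  one : Expr
  varX varY varZ : Expr
  add mul : Expr → Expr → Expr
  neg : Expr → Expr

module Evaluation (R : CommutativeRing 0ℓ 0ℓ) (κ : ℤ → CommutativeRing.Carrier R) where
  open CommutativeRing R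
  eval : Expr → V3 Carrier → Carrier
  eval (par c) v = κ c
  eval one v = 1#
  eval varX v = X v
  eval varY v = Y v
  eval varZ v = Z v
  eval (add e f) v = eval e v + eval f v
  eval (mul e f) v = eval e v * eval f v
  eval (neg e) v = - eval e v

  eval-cong : ∀ e {u v} → X u ≈ X v → Y u ≈ Y v → Z u ≈ Z v → eval e u ≈ eval e v
  eval-cong (par c) p q r = refl
  eval-cong one p q r = refl
  eval-cong varX p q r = p
  eval-cong varY p q r = q
  eval-cong varZ p q r = r
  eval-cong (add e f) p q r = +-cong (eval-cong e p q r) (eval-cong f p q r)
  eval-cong (mul e f) p q r = *-cong (eval-cong e p q r) (eval-cong f p q r)
  eval-cong (neg e) p q r = -‿cong (eval-cong e p q r)

open Evaluation ZP.+-*-commutativeRing (λ c → c) using () renaming (eval to evalℤ) public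

eval³ : V3 Expr → V3 ℤ → V3 ℤ
eval³ (vec e f g) v = vec (evalℤ e v) (evalℤ f v) (evalℤ g v)

eval-mod : ∀ m e {u v} → X u ≡ X v [ m ] → Y u ≡ Y v [ m ] → Z u ≡ Z v [ m ] → evalℤ e u ≡ evalℤ e v [ m ]
eval-mod m (par c) p q r = CommutativeRing.refl (cong-ring m)
eval-mod m one p q r = CommutativeRing.refl (cong-ring m)
eval-mod m varX p q r = p
eval-mod m varY p q r = q
eval-mod m varZ p q r = r
eval-mod m (add e f) p q r = CommutativeRing.+-cong (cong-ring m) (eval-mod m e p q r) (eval-mod m f p q r)
eval-mod m (mul e f) p q r = CommutativeRing.*-cong (cong-ring m) (eval-mod m e p q r) (eval-mod m f p q r)
eval-mod m (neg e) p q r = CommutativeRing.-‿cong (cong-ring m) (eval-mod m e p q r)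

-- Homogeneity is decided by computation, so the degrees 2, 7 and 7 of the three laws are verified
-- by `refl`.
degree : Expr → Maybe ℕ
degree (par _) = just 0
degree one = just 0
degree varX = just 1
degree varY = just 1
degree varZ = just 1
degree (add e f) with degree e | degree f
... | just m | just n with m N.≟ n
...   | yes _ = just m
...   | no _ = nothing
degree (add e f) | _ | _ = nothing
degree (mul e f) with degree e | degree f
... | just m | just n = just (m N.+ n)
... | _ | _ = nothing
degree (neg e) = degree e

_∙_ : ℤ → V3 ℤ → V3 ℤ
s ∙ vec x y z = vec (s Z.* x) (s Z.* y) (s Z.* z)

homogeneous : ∀ e n → degree e ≡ just n → ∀ s v → evalℤ e (s ∙ v) ≡ s Z.^ n Z.* evalℤ e v
homogeneous (par c) n ≡.refl s v = ≡.sym (ZP.*-identityˡ c)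
homogeneous one n ≡.refl s v = ≡.refl
homogeneous varX n ≡.refl s (vec x y z) = ≡.cong (Z._* x) (≡.sym (ZP.*-identityʳ s))
homogeneous varY n ≡.refl s (vec x y z) = ≡.cong (Z._* y) (≡.sym (ZP.*-identityʳ s))
homogeneous varZ n ≡.refl s (vec x y z) = ≡.cong (Z._* z) (≡.sym (ZP.*-identityʳ s))
homogeneous (add e f) n eq s v with degree e in eqe | degree f in eqf
... | just m | just k with m N.≟ k
homogeneous (add e f) n ≡.refl s v | just m | just m | yes ≡.refl =
  ≡.trans (≡.cong₂ Z._+_ (homogeneous e m eqe s v) (homogeneous f m eqf s v)) (≡.sym (ZP.*-distribˡ-+ (s Z.^ m) _ _))
homogeneous (mul e f) n eq s v with degree e in eqe | degree f in eqf
homogeneous (mul e f) n ≡.refl s v | just m | just k =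
  ≡.trans (≡.cong₂ Z._*_ (homogeneous e m eqe s v) (homogeneous f k eqf s v))
    (≡.trans (solve 4 (λ a x b y → a :* x :* (b :* y) := a :* b :* (x :* y)) ≡.refl (s Z.^ m) _ (s Z.^ k) _)
      (≡.cong (Z._* (evalℤ e v Z.* evalℤ f v)) (≡.sym (ZP.^-distribˡ-+-* s m k))))
  where open IntSolver ZP.+-*-commutativeRing using (solve)
homogeneous (neg e) n eq s v = ≡.trans (≡.cong Z.-_ (homogeneous e n eq s v)) (ZP.neg-distribʳ-* (s Z.^ n) _)

-- Arithmetic progressions a, b, c modulo m whose terms agree modulo k; they form a subring of ℤ³ when m divides k².
record Progression (k m a b c : ℤ) : Set where
  constructor progression
  field
    first : k ∣ℤ b Z.- a
    second : k ∣ℤ c Z.- b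
    second-difference : m ∣ℤ (c Z.- b) Z.- (b Z.- a)
open Progression public

module _ {k m : ℤ} (m∣k² : m ∣ℤ k Z.* k) where
  open IntSolver ZP.+-*-commutativeRing using (solve)

  private
    by : ∀ {i a b} → a ≡ b → i ∣ℤ a → i ∣ℤ b
    by ≡.refl d = d

  k²∣ : ∀ {a b} → k ∣ℤ a → k ∣ℤ b → m ∣ℤ a Z.* b
  k²∣ (divides q e) (divides r f) = ZD.∣-trans m∣k² (divides (q Z.* r) (≡.trans (≡.cong₂ Z._*_ e f)
    (solve 3 (λ q r k → q :* k :* (r :* k) := q :* r :* (k :* k)) ≡.refl q r k)))

  constant : ∀ c → Progression k m c c c
  constant c = progression (by (≡.sym (ZP.+-inverseʳ c)) (k ∣0)) (by (≡.sym (ZP.+-inverseʳ c)) (k ∣0)) (by (≡.sym (ZP.+-inverseʳ (c Z.- c))) (m ∣0))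
    where
    _∣0 : ∀ i → i ∣ℤ + 0
    i ∣0 = divides (+ 0) ≡.refl

  eval-progression : ∀ e {u v w} → Progression k m (X u) (X v) (X w) → Progression k m (Y u) (Y v) (Y w) → Progression k m (Z u) (Z v) (Z w) →
    Progression k m (evalℤ e u) (evalℤ e v) (evalℤ e w)
  eval-progression (par c) p q r = constant c
  eval-progression one p q r = constant (+ 1)
  eval-progression varX p q r = p
  eval-progression varY p q r = q
  eval-progression varZ p q r = r
  eval-progression (add e f) {u} {v} {w} p q r = progression
    (by (solve 4 (λ a b a′ b′ → (b :- a) :+ (b′ :- a′) := (b :+ b′) :- (a :+ a′)) ≡.refl a b a′ b′) (ZD.∣m∣n⇒∣m+n (first P) (first Q)))
    (by (solve 4 (λ a b a′ b′ → (b :- a) :+ (b′ :- a′) := (b :+ b′) :- (a :+ a′)) ≡.refl b c b′ c′) (ZD.∣m∣n⇒∣m+n (second P) (second Q)))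
    (by (solve 6 (λ a b c a′ b′ c′ → ((c :- b) :- (b :- a)) :+ ((c′ :- b′) :- (b′ :- a′)) := ((c :+ c′) :- (b :+ b′)) :- ((b :+ b′) :- (a :+ a′))) ≡.refl a b c a′ b′ c′) (ZD.∣m∣n⇒∣m+n (second-difference P) (second-difference Q)))
    where
    P = eval-progression e p q r
    Q = eval-progression f p q r
    a = evalℤ e u
    b = evalℤ e v
    c = evalℤ e w
    a′ = evalℤ f u
    b′ = evalℤ f v
    c′ = evalℤ f w
  eval-progression (mul e f) {u} {v} {w} p q r = progression
    (by (solve 4 (λ a b a′ b′ → (b :- a) :* b′ :+ a :* (b′ :- a′) := b :* b′ :- a :* a′) ≡.refl a b a′ b′) (ZD.∣m∣n⇒∣m+n (ZD.∣m⇒∣m*n b′ (first P)) (ZD.∣n⇒∣m*n a (first Q))))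
    (by (solve 4 (λ a b a′ b′ → (b :- a) :* b′ :+ a :* (b′ :- a′) := b :* b′ :- a :* a′) ≡.refl b c b′ c′) (ZD.∣m∣n⇒∣m+n (ZD.∣m⇒∣m*n c′ (second P)) (ZD.∣n⇒∣m*n b (second Q))))
    -- The Leibniz rule for second differences. The two products of first differences are multiples
    -- of k², hence of m.
    (by (solve 6 (λ a b c a′ b′ c′ → (b :* ((c′ :- b′) :- (b′ :- a′)) :+ b′ :* ((c :- b) :- (b :- a))) :+ ((b :- a) :* (b′ :- a′) :+ (c :- b) :* (c′ :- b′)) := (c :* c′ :- b :* b′) :- (b :* b′ :- a :* a′)) ≡.refl a b c a′ b′ c′)
      (ZD.∣m∣n⇒∣m+n (ZD.∣m∣n⇒∣m+n (ZD.∣n⇒∣m*n b (second-difference Q)) (ZD.∣n⇒∣m*n b′ (second-difference P)))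
        (ZD.∣m∣n⇒∣m+n (k²∣ (first P) (first Q)) (k²∣ (second P) (second Q)))))
    where
    P = eval-progression e p q r
    Q = eval-progression f p q r
    a = evalℤ e u
    b = evalℤ e v
    c = evalℤ e w
    a′ = evalℤ f u
    b′ = evalℤ f v
    c′ = evalℤ f w
  eval-progression (neg e) {u} {v} {w} p q r = progression
    (by (solve 2 (λ a b → :- (b :- a) := (:- b) :- (:- a)) ≡.refl a b) (ZD.∣m⇒∣-m (first P)))
    (by (solve 2 (λ a b → :- (b :- a) := (:- b) :- (:- a)) ≡.refl b c) (ZD.∣m⇒∣-m (second P)))
    (by (solve 3 (λ a b c → :- ((c :- b) :- (b :- a)) := ((:- c) :- (:- b)) :- ((:- b) :- (:- a))) ≡.refl a b c) (ZD.∣m⇒∣-m (second-difference P)))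
    where
    P = eval-progression e p q r
    a = evalℤ e u
    b = evalℤ e v
    c = evalℤ e w

open import Defs

-- The field of rational numbers and the group law on the rational points

toℚᵘ-toℚ : ∀ i → Q.toℚᵘ (toℚ i) U.≃ mkℚᵘ i 0
toℚᵘ-toℚ i = QP.toℚᵘ-fromℚᵘ (mkℚᵘ i 0)

toℚ-+ : ∀ i j → toℚ (i Z.+ j) ≡ toℚ i Q.+ toℚ j
toℚ-+ i j = QP.toℚᵘ-injective (UP.≃-trans (toℚᵘ-toℚ (i Z.+ j)) (UP.≃-sym (UP.≃-trans (QP.toℚᵘ-homo-+ (toℚ i) (toℚ j))
  (UP.≃-trans (UP.+-cong (toℚᵘ-toℚ i) (toℚᵘ-toℚ j)) (*≡* (solve 2 (λ i j → (i :* con (+ 1) :+ j :* con (+ 1)) :* con (+ 1) := (i :+ j) :* con (+ 1)) ≡.refl i j))))))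
  where open IntSolver ZP.+-*-commutativeRing using (solve)

toℚ-* : ∀ i j → toℚ (i Z.* j) ≡ toℚ i Q.* toℚ j
toℚ-* i j = QP.toℚᵘ-injective (UP.≃-trans (toℚᵘ-toℚ (i Z.* j)) (UP.≃-sym (UP.≃-trans (QP.toℚᵘ-homo-* (toℚ i) (toℚ j))
  (UP.≃-trans (UP.*-cong (toℚᵘ-toℚ i) (toℚᵘ-toℚ j)) (*≡* ≡.refl)))))

toℚ-neg : ∀ i → toℚ (Z.- i) ≡ Q.- toℚ i
toℚ-neg i = QP.toℚᵘ-injective (UP.≃-trans (toℚᵘ-toℚ (Z.- i)) (UP.≃-sym (UP.≃-trans (QP.toℚᵘ-homo‿- (toℚ i))
  (UP.≃-trans (UP.-‿cong (toℚᵘ-toℚ i)) (*≡* ≡.refl)))))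

toℚ-injective : ∀ {i j} → toℚ i ≡ toℚ j → i ≡ j
toℚ-injective {i} {j} e with UP.≃-trans (UP.≃-sym (toℚᵘ-toℚ i)) (UP.≃-trans (UP.≃-reflexive (≡.cong Q.toℚᵘ e)) (toℚᵘ-toℚ j))
... | *≡* eq = ≡.trans (≡.sym (ZP.*-identityʳ i)) (≡.trans eq (ZP.*-identityʳ j))

num-den : ∀ q → q Q.* toℚ (ℚ.denominator q) ≡ toℚ (ℚ.numerator q)
num-den q@(mkℚ n d _) = QP.toℚᵘ-injective (UP.≃-trans (QP.toℚᵘ-homo-* q (toℚ (+ suc d))) (UP.≃-sym (UP.≃-trans (toℚᵘ-toℚ n)
  (UP.≃-sym (UP.≃-trans (UP.*-congˡ {Q.toℚᵘ q} (toℚᵘ-toℚ (+ suc d))) (*≡* (≡.trans (ZP.*-assoc n (+ suc d) (+ 1))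
    (≡.cong (n Z.*_) (≡.trans (ZP.*-identityʳ (+ suc d)) (≡.cong +_ (≡.sym (NP.*-identityʳ (suc d)))))))))))))

ℚ-ring : CommutativeRing 0ℓ 0ℓ
ℚ-ring = QP.+-*-commutativeRing

inv-inverse : ∀ q → q ≢ 0ℚ → q Q.* inv q ≡ 1ℚ
inv-inverse q q≢0 with q QP.≟ 0ℚ
... | yes e = ⊥-elim (q≢0 e)
... | no ne = QP.*-inverseʳ q {{Q.≢-nonZero ne}}

inverseℚ : ∀ q → ¬ q ≡ 0ℚ → ∃[ r ] q Q.* r ≡ 1ℚ
inverseℚ q q≢0 = inv q , inv-inverse q q≢0

integralℚ : ∀ p q → p Q.* q ≡ 0ℚ → p ≡ 0ℚ ⊎ q ≡ 0ℚ
integralℚ p q e with p QP.≟ 0ℚ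
... | yes p0 = inj₁ p0
... | no p≢0 = inj₂ (≡.trans (≡.sym (QP.*-identityˡ q)) (≡.trans (≡.cong (Q._* q) (≡.trans (≡.sym (inv-inverse p p≢0)) (QP.*-comm p (inv p))))
    (≡.trans (QP.*-assoc (inv p) p q) (≡.trans (≡.cong (inv p Q.*_) e) (QP.*-zeroʳ (inv p))))))

1≢0 : ¬ 1ℚ ≡ 0ℚ
1≢0 ()

module _ (E : Weierstrass) where
  private
    A₁ = toℚ (a₁ E)
    A₂ = toℚ (a₂ E)
    A₃ = toℚ (a₃ E)
    A₄ = toℚ (a₄ E)
    A₆ = toℚ (a₆ E)
  open Q using (_+_; _*_; _-_; -_)

  addPt-secant : ∀ x y x′ y′ → ¬ x ≡ x′ →
    let lam = (y′ - y) * inv (x′ - x); x₃ = lam * lam + A₁ * lam - A₂ - x - x′ in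
    addPt E (just (x , y)) (just (x′ , y′)) ≡ just (x₃ , - (lam + A₁) * x₃ - (y * x′ - y′ * x) * inv (x′ - x) - A₃)
  addPt-secant x y x′ y′ ne with x QP.≟ x′
  ... | yes e = ⊥-elim (ne e)
  ... | no _ = ≡.refl

  addPt-opposite : ∀ x y x′ y′ → x ≡ x′ → y + y′ + A₁ * x′ + A₃ ≡ 0ℚ → addPt E (just (x , y)) (just (x′ , y′)) ≡ nothing
  addPt-opposite x y x′ y′ e o with x QP.≟ x′
  ... | no ne = ⊥-elim (ne e)
  ... | yes _ with (y + y′ + A₁ * x′ + A₃) QP.≟ 0ℚ
  ...   | yes _ = ≡.refl
  ...   | no no′ = ⊥-elim (no′ o)

  -- Abstract in the numerals 2 and 3, so that `toℚ (+ 2)` is exchanged for `1ℚ + 1ℚ` by congruence.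
  doubled : ℚ → ℚ → ℚ → ℚ → Point
  doubled two three x y = just (x₃ , - (lam + A₁) * x₃ - (- (x * x * x) + A₄ * x + two * A₆ - A₃ * y) * i - A₃)
    where
    i = inv (two * y + A₁ * x + A₃)
    lam = (three * x * x + two * A₂ * x + A₄ - A₁ * y) * i
    x₃ = lam * lam + A₁ * lam - A₂ - x - x

  addPt-double : ∀ x y x′ y′ → x ≡ x′ → ¬ y + y′ + A₁ * x′ + A₃ ≡ 0ℚ →
    addPt E (just (x , y)) (just (x′ , y′)) ≡ doubled (1ℚ + 1ℚ) (1ℚ + (1ℚ + 1ℚ)) x y
  addPt-double x y x′ y′ e o = ≡.trans (unfold e o) (≡.cong₂ (λ t u → doubled t u x y) 2≡ 3≡)
    where
    2≡ : toℚ (+ 2) ≡ 1ℚ + 1ℚ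
    2≡ = ≡.refl
    3≡ : toℚ (+ 3) ≡ 1ℚ + (1ℚ + 1ℚ)
    3≡ = ≡.refl
    unfold : x ≡ x′ → ¬ y + y′ + A₁ * x′ + A₃ ≡ 0ℚ → addPt E (just (x , y)) (just (x′ , y′)) ≡ doubled (toℚ (+ 2)) (toℚ (+ 3)) x y
    unfold e o with x QP.≟ x′
    ... | no ne = ⊥-elim (ne e)
    ... | yes _ with (y + y′ + A₁ * x′ + A₃) QP.≟ 0ℚ
    ...   | yes o′ = ⊥-elim (o o′)
    ...   | no _ = ≡.refl

ℚ-field : Field
ℚ-field = record { commutativeRing = ℚ-ring ; integral = integralℚ ; _≟0 = λ q → q QP.≟ 0ℚ ; inverse = inverseℚ ; 1≉0 = 1≢0 }

module Slopes (𝔽 : Field) (a₁ a₂ a₃ a₄ a₆ : CommutativeRing.Carrier (Field.commutativeRing 𝔽)) where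
  open Field 𝔽 using () renaming (commutativeRing to R)
  open CommutativeRing R
  open OverField.Cubic 𝔽 a₁ a₂ a₃ a₄ a₆ using (F; 2#)
  private module S = IntSolver R

  slope : ∀ {d i} e → d * i ≈ 1# → e * i * d ≈ e
  slope {d} {i} e h = trans (S.solve 3 (λ e i d → e :* i :* d := e :* (d :* i)) refl e i d) (trans (*-congˡ h) (*-identityʳ e))

  intercept : ∀ {x y x′ y′ i} → (x′ - x) * i ≈ 1# → (y * x′ - y′ * x) * i ≈ y - (y′ - y) * i * x
  intercept {x} {y} {x′} {y′} {i} h = trans (S.solve 5 (λ x y x′ y′ i → (y :* x′ :- y′ :* x) :* i := y :* ((x′ :- x) :* i) :- (y′ :- y) :* i :* x) refl x y x′ y′ i)
    (+-congʳ (trans (*-congˡ h) (*-identityʳ y)))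

  affine-equation : ∀ x y → y * y + a₁ * x * y + a₃ * y - x * x * x - a₂ * x * x - a₄ * x - a₆ ≈ F (vec x y 1#)
  affine-equation x y = S.solve 7 (λ b₁ b₂ b₃ b₄ b₆ x y → let open Formulas _:+_ _:*_ :-_ (con (+ 1)) b₁ b₂ b₃ b₄ b₆ using () renaming (F to F′) in
    y :* y :+ b₁ :* x :* y :+ b₃ :* y :- x :* x :* x :- b₂ :* x :* x :- b₄ :* x :- b₆ := F′ (vec x y (con (+ 1)))) refl a₁ a₂ a₃ a₄ a₆ x y

  double-y : ∀ x y x′ y′ → x ≈ x′ → y ≈ y′ → y + y′ + a₁ * x′ + a₃ ≈ 2# * y + a₁ * x + a₃
  double-y x y x′ y′ x≈ y≈ = +-congʳ (+-cong (trans (+-congˡ (sym y≈)) (S.solve 1 (λ y → y :+ y := (con (+ 1) :+ con (+ 1)) :* y) refl y)) (*-congˡ (sym x≈)))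

open Evaluation ℚ-ring toℚ using () renaming (eval to evalℚ) public

toℚ³ : V3 ℤ → V3 ℚ
toℚ³ (vec x y z) = vec (toℚ x) (toℚ y) (toℚ z)

toℚ-eval : ∀ e v → toℚ (evalℤ e v) ≡ evalℚ e (toℚ³ v)
toℚ-eval (par c) v = ≡.refl
toℚ-eval one v = ≡.refl
toℚ-eval varX v = ≡.refl
toℚ-eval varY v = ≡.refl
toℚ-eval varZ v = ≡.refl
toℚ-eval (add e f) v = ≡.trans (toℚ-+ (evalℤ e v) (evalℤ f v)) (≡.cong₂ Q._+_ (toℚ-eval e v) (toℚ-eval f v))
toℚ-eval (mul e f) v = ≡.trans (toℚ-* (evalℤ e v) (evalℤ f v)) (≡.cong₂ Q._*_ (toℚ-eval e v) (toℚ-eval f v))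
toℚ-eval (neg e) v = ≡.trans (toℚ-neg (evalℤ e v)) (≡.cong Q.-_ (toℚ-eval e v))

module RationalCurve (E : Weierstrass) where
  A₁ A₂ A₃ A₄ A₆ : ℚ
  A₁ = toℚ (a₁ E)
  A₂ = toℚ (a₂ E)
  A₃ = toℚ (a₃ E)
  A₄ = toℚ (a₄ E)
  A₆ = toℚ (a₆ E)

  module Cℚ = OverField.Cubic ℚ-field A₁ A₂ A₃ A₄ A₆
  open Cℚ public using (Rep; affine-parts; _≟_; cancel-*; rep-proportional; 1•≈; rep-scale; F-proportional; ⊖_; rep-negate; normal; F-normal; _Represents_; SecantLaw; DoublingLaw; Addition; module AddPoint; at∞; affine; represents; rep; onCurve)
  private
    module Sl = Slopes ℚ-field A₁ A₂ A₃ A₄ A₆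
    module Dℚ = Discriminant ℚ-field A₁ A₂ A₃ A₄ A₆

  -- The discriminant without variables: `toℚ-eval` and `π-eval` give its image in ℚ and in the
  -- residue field.
  disc-expr : Expr
  disc-expr = add (add (add (neg (mul (mul b₂ b₂) b₈)) (neg (mul (mul (mul (par (+ 8)) b₄) b₄) b₄))) (neg (mul (mul (par (+ 27)) b₆) b₆))) (mul (mul (mul (par (+ 9)) b₂) b₄) b₆)
    where
    p₁ = par (a₁ E)
    p₂ = par (a₂ E)
    p₃ = par (a₃ E)
    p₄ = par (a₄ E)
    p₆ = par (a₆ E)
    b₂ = add (mul p₁ p₁) (mul (par (+ 4)) p₂)
    b₄ = add (mul (par (+ 2)) p₄) (mul p₁ p₃)
    b₆ = add (mul p₃ p₃) (mul (par (+ 4)) p₆)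
    b₈ = add (add (add (add (mul (mul p₁ p₁) p₆) (mul (mul (par (+ 4)) p₂) p₆)) (neg (mul (mul p₁ p₃) p₄))) (mul (mul p₂ p₃) p₃)) (neg (mul p₄ p₄))

  toℚ-disc : toℚ (disc E) ≡ Dℚ.D Dℚ.b₂ Dℚ.b₄ Dℚ.b₆ Dℚ.b₈
  toℚ-disc = toℚ-eval disc-expr (vec (+ 0) (+ 0) (+ 0))

  smoothℚ : IsElliptic E → ∀ x y → Cℚ.F (vec x y 1ℚ) ≡ 0ℚ → ¬ (Cℚ.FX (vec x y 1ℚ) ≡ 0ℚ × Cℚ.FY (vec x y 1ℚ) ≡ 0ℚ)
  smoothℚ ell x y F0 (FX0 , FY0) = ell (toℚ-injective (≡.trans toℚ-disc (Dℚ.singular⇒D≈0 x y F0 FX0 FY0)))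

  rep-unique : ∀ {v s t} → Rep v s → Rep v t → s ≡ t
  rep-unique (at∞ _ _ _) (at∞ _ _ _) = ≡.refl
  rep-unique (at∞ _ z0 _) (affine z≢ _ _) = ⊥-elim (z≢ z0)
  rep-unique (affine z≢ _ _) (at∞ _ z0 _) = ⊥-elim (z≢ z0)
  rep-unique (affine z≢ hx hy) (affine _ hx′ hy′) = ≡.cong₂ (λ a b → just (a , b)) (cancel-* z≢ (≡.trans (≡.sym hx) hx′)) (cancel-* z≢ (≡.trans (≡.sym hy) hy′))

  affine-F : ∀ {x y} → OnCurve E x y → Cℚ.F (vec x y 1ℚ) ≡ 0ℚ
  affine-F {x} {y} on = ≡.trans (≡.sym (Sl.affine-equation x y)) on

  module AddPt (ell : IsElliptic E) (x y : ℚ) (on : OnCurve E x y) (A : V3 ℚ) (A-rep : A Represents just (x , y)) where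
    private
      secant : SecantLaw x y (addPt E (just (x , y)))
      secant x′ y′ ne = (y′ Q.- y) Q.* inv (x′ Q.- x) , (y Q.* x′ Q.- y′ Q.* x) Q.* inv (x′ Q.- x) ,
        Sl.slope {x′ Q.- x} {inv (x′ Q.- x)} (y′ Q.- y) δi , Sl.intercept {x} {y} {x′} {y′} {inv (x′ Q.- x)} δi , addPt-secant E x y x′ y′ ne
        where
        δi : (x′ Q.- x) Q.* inv (x′ Q.- x) ≡ 1ℚ
        δi = inv-inverse (x′ Q.- x) (λ e → ne (≡.sym (Cℚ.sub-0 {x′} {x} e)))
      double : DoublingLaw x y (addPt E (just (x , y)))
      double x′ y′ x≡ y≡ g≢ = (Cℚ.3# Q.* x Q.* x Q.+ Cℚ.2# Q.* A₂ Q.* x Q.+ A₄ Q.- A₁ Q.* y) Q.* i ,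
          (Q.- (x Q.* x Q.* x) Q.+ A₄ Q.* x Q.+ Cℚ.2# Q.* A₆ Q.- A₃ Q.* y) Q.* i ,
          Sl.slope {g} {i} (Cℚ.3# Q.* x Q.* x Q.+ Cℚ.2# Q.* A₂ Q.* x Q.+ A₄ Q.- A₁ Q.* y) gi ,
          Sl.slope {g} {i} (Q.- (x Q.* x Q.* x) Q.+ A₄ Q.* x Q.+ Cℚ.2# Q.* A₆ Q.- A₃ Q.* y) gi , addPt-double E x y x′ y′ x≡ (λ e → g≢ (≡.trans (≡.sym (Sl.double-y x y x′ y′ x≡ y≡)) e))
        where
        g = Cℚ.2# Q.* y Q.+ A₁ Q.* x Q.+ A₃
        i = inv g
        gi : g Q.* i ≡ 1ℚ
        gi = inv-inverse g g≢
      addition : Addition x y A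
      addition = record { add = addPt E (just (x , y)) ; add-∞ = ≡.refl ; add-secant = secant ; add-opposite = addPt-opposite E x y
        ; add-double = double ; A-rep = A-rep ; smooth = smoothℚ ell x y (affine-F {x} {y} on) }
    open AddPoint x y A addition public

-- Vectors primitive at p, and a law for each residue class

module PrimePowers {p : ℕ} (pr : Prime p) where
  ∤* : ∀ {a b} → ¬ + p ∣ℤ a → ¬ + p ∣ℤ b → ¬ + p ∣ℤ a Z.* b
  ∤* {a} {b} na nb d = [ na , nb ]′ (prime-∣* pr a b d)

  ∤^ : ∀ {a} n → ¬ + p ∣ℤ a → ¬ + p ∣ℤ a Z.^ n
  ∤^ zero na = ∤1 pr
  ∤^ (suc n) na = ∤* na (∤^ n na)

  p^suc : ∀ k → + (p N.^ suc k) ≡ + p Z.* + (p N.^ k)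
  p^suc k = ZP.pos-* p (p N.^ k)

  p∣p^suc : ∀ k → + p ∣ℤ + (p N.^ suc k)
  p∣p^suc k = divides (+ (p N.^ k)) (≡.trans (p^suc k) (ZP.*-comm (+ p) _))

  private
    instance
      p≢0 : Z.NonZero (+ p)
      p≢0 = prime⇒nonZero pr

  unit-cancel : ∀ k {u v} → ¬ + p ∣ℤ u → + (p N.^ k) ∣ℤ u Z.* v → + (p N.^ k) ∣ℤ v
  unit-cancel zero {u} {v} _ _ = divides v (≡.sym (ZP.*-identityʳ v))
  unit-cancel (suc k) {u} {v} nu d = step ([ (λ x → ⊥-elim (nu x)) , (λ x → x) ]′ (prime-∣* pr u v (ZD.∣-trans (p∣p^suc k) d)))
    where
    step : + p ∣ℤ v → + (p N.^ suc k) ∣ℤ v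
    step (divides w v≡) = ≡.subst₂ _∣ℤ_ (≡.sym (p^suc k)) (≡.trans (ZP.*-comm (+ p) w) (≡.sym v≡)) (ZD.*-monoʳ-∣ (+ p) (unit-cancel k nu
      (ZD.*-cancelˡ-∣ (+ p) (≡.subst₂ _∣ℤ_ (p^suc k) (≡.trans (≡.cong (u Z.*_) v≡) (≡.trans (≡.sym (ZP.*-assoc u w (+ p))) (ZP.*-comm _ (+ p)))) d))))

  square-root : ∀ k {v} → + (p N.^ k) Z.* + (p N.^ k) ∣ℤ v Z.* v → + (p N.^ k) ∣ℤ v
  square-root zero {v} _ = divides v (≡.sym (ZP.*-identityʳ v))
  square-root (suc k) {v} d = step ([ (λ x → x) , (λ x → x) ]′ (prime-∣* pr v v (ZD.∣-trans (ZD.∣-trans (p∣p^suc k) (ZD.∣m⇒∣m*n _ ZD.∣-refl)) d)))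
    where
    open IntSolver ZP.+-*-commutativeRing using (solve)
    step : + p ∣ℤ v → + (p N.^ suc k) ∣ℤ v
    step (divides w v≡) = ≡.subst₂ _∣ℤ_ (≡.sym (p^suc k)) (≡.trans (ZP.*-comm (+ p) w) (≡.sym v≡)) (ZD.*-monoʳ-∣ (+ p) (square-root k
      (ZD.*-cancelˡ-∣ (+ p) (ZD.*-cancelˡ-∣ (+ p) (≡.subst₂ _∣ℤ_
        (≡.trans (≡.cong₂ Z._*_ (p^suc k) (p^suc k)) (solve 2 (λ p q → p :* q :* (p :* q) := p :* (p :* (q :* q))) ≡.refl (+ p) (+ (p N.^ k))))
        (≡.trans (≡.cong₂ Z._*_ v≡ v≡) (solve 2 (λ p w → w :* p :* (w :* p) := p :* (p :* (w :* w))) ≡.refl (+ p) w)) d)))))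

module DomainSim (𝔽 : Field) (a₁ a₂ a₃ a₄ a₆ : CommutativeRing.Carrier (Field.commutativeRing 𝔽)) where
  open Field 𝔽 using () renaming (commutativeRing to R)
  open CommutativeRing R
  open OverField.Cubic 𝔽 a₁ a₂ a₃ a₄ a₆ using (cancel-≉; sub-0; Parallel)
  open import Relation.Binary.Reasoning.Setoid setoid
  private module S = IntSolver R

  parallel-sim : ∀ A {S T} u v → ¬ u ≈ 0# → u * X T ≈ v * X S → u * Y T ≈ v * Y S → u * Z T ≈ v * Z S → Parallel A S → Parallel A T
  parallel-sim A {S} {T} u v u≉ eX eY eZ (pX , pY) = comp eX pX , comp eY pY
    where
    comp : ∀ {t s a} → u * t ≈ v * s → Z A * s ≈ Z S * a → Z A * t ≈ Z T * a
    comp {t} {s} {a} e h = sub-0 (cancel-≉ u≉ (begin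
      u * (Z A * t - Z T * a) ≈⟨ S.solve 5 (λ u z t w a → u :* (z :* t :- w :* a) := z :* (u :* t) :- u :* w :* a) refl u (Z A) t (Z T) a ⟩
      Z A * (u * t) - u * Z T * a ≈⟨ +-cong (*-congˡ e) (-‿cong (*-congʳ eZ)) ⟩
      Z A * (v * s) - v * Z S * a ≈⟨ S.solve 5 (λ v z s w a → z :* (v :* s) :- v :* w :* a := v :* (z :* s :- w :* a)) refl v (Z A) s (Z S) a ⟩
      v * (Z A * s - Z S * a) ≈⟨ *-congˡ (trans (+-congʳ h) (-‿inverseʳ _)) ⟩
      v * 0# ≈⟨ zeroʳ v ⟩
      0# ∎))

module Laws (E : Weierstrass) (A : V3 ℤ) where
  module Fᴱ = Formulas add mul neg one (par (a₁ E)) (par (a₂ E)) (par (a₃ E)) (par (a₄ E)) (par (a₆ E))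

  Aᴱ Sᴱ : V3 Expr
  Aᴱ = vec (par (X A)) (par (Y A)) (par (Z A))
  Sᴱ = vec varX varY varZ

  lawC lawZ lawY : V3 Expr
  lawC = Fᴱ.negate (Fᴱ.chord Aᴱ Sᴱ)
  lawZ = Fᴱ.negate (Fᴱ.tangentZ Aᴱ Sᴱ)
  lawY = Fᴱ.negate (Fᴱ.tangentY Aᴱ Sᴱ)

  module LawValues (R : CommutativeRing 0ℓ 0ℓ) (κ : ℤ → CommutativeRing.Carrier R) where
    open CommutativeRing R
    open Evaluation R κ
    module F = Formulas _+_ _*_ -_ 1# (κ (a₁ E)) (κ (a₂ E)) (κ (a₃ E)) (κ (a₄ E)) (κ (a₆ E))
    κ³ : V3 Carrier
    κ³ = vec (κ (X A)) (κ (Y A)) (κ (Z A))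

    values : V3 Expr → V3 Carrier → V3 Carrier
    values (vec e f g) v = vec (eval e v) (eval f v) (eval g v)

    value-F : ∀ v → eval (Fᴱ.F Sᴱ) v ≡ F.F v
    value-F v = ≡.refl

    value-C : ∀ v → values lawC v ≡ F.negate (F.chord κ³ v)
    value-C v = ≡.refl

    value-Z : ∀ v → values lawZ v ≡ F.negate (F.tangentZ κ³ v)
    value-Z v = ≡.refl

    value-Y : ∀ v → values lawY v ≡ F.negate (F.tangentY κ³ v)
    value-Y v = ≡.refl

-- The prime field with its reduction map, as an interface: working against it keeps the curve
-- modulo p from unfolding into integer arithmetic.
record Residue (p : ℕ) : Set₁ where
  field
    𝔽 : Field
  open Field 𝔽 public renaming (commutativeRing to ring)
  open CommutativeRing ring public hiding (ring)
  field
    char : Mult._×_ semiring p 1# ≈ 0#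
    fermat : ∀ a → Exp._^_ semiring a p ≈ a
    π : ℤ → Carrier
    π-+ : ∀ a b → π (a Z.+ b) ≈ π a + π b
    π-* : ∀ a b → π (a Z.* b) ≈ π a * π b
    π-neg : ∀ a → π (Z.- a) ≈ - π a
    π-1 : π (+ 1) ≈ 1#
    π-0 : ∀ {a} → π a ≈ 0# → + p ∣ℤ a
    π-∣ : ∀ {a} → + p ∣ℤ a → π a ≈ 0#
    π-cong : ∀ {a b} → a ≡ b [ + p ] → π a ≈ π b
    π-inj : ∀ {a b} → π a ≈ π b → a ≡ b [ + p ]

  π³ : V3 ℤ → V3 Carrier
  π³ (vec a b c) = vec (π a) (π b) (π c)

  open Evaluation ring π

  π-eval : ∀ e v → π (evalℤ e v) ≈ eval e (π³ v)
  π-eval (par c) v = refl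
  π-eval one v = π-1
  π-eval varX v = refl
  π-eval varY v = refl
  π-eval varZ v = refl
  π-eval (add e f) v = trans (π-+ (evalℤ e v) (evalℤ f v)) (+-cong (π-eval e v) (π-eval f v))
  π-eval (mul e f) v = trans (π-* (evalℤ e v) (evalℤ f v)) (*-cong (π-eval e v) (π-eval f v))
  π-eval (neg e) v = trans (π-neg (evalℤ e v)) (-‿cong (π-eval e v))

residue-field : ∀ {p} → Prime p → Residue p
residue-field {p} pr = record
  { 𝔽 = record { commutativeRing = Fₚ ; integral = integral ; _≟0 = _≟0 ; inverse = inverse ; 1≉0 = 1≉0 } ; char = char ; fermat = fermat ; π = λ c → c
  ; π-+ = λ a b → refl ; π-* = λ a b → refl ; π-neg = λ a → refl ; π-1 = refl
  ; π-0 = ≡0⇒∣ ; π-∣ = ∣⇒≡0 ; π-cong = λ e → e ; π-inj = λ e → e }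
  where
  open PrimeField pr
  open CommutativeRing Fₚ using (refl)

SmoothMod : (E : Weierstrass) → ∀ {p} → Residue p → V3 ℤ → Set
SmoothMod E res A = ¬ (FX (π³ A) ≈ 0# × FY (π³ A) ≈ 0#)
  where
  open Residue res
  open OverField.Cubic 𝔽 (π (a₁ E)) (π (a₂ E)) (π (a₃ E)) (π (a₄ E)) (π (a₆ E)) using (FX; FY)

record LocalData : Set₁ where
  field
    E : Weierstrass
    ell : IsElliptic E
    x y : ℚ
    on : OnCurve E x y
    {p} : ℕ
    pr : Prime p
    res : Residue p
    A : V3 ℤ
    A-prim : ¬ (+ p ∣ℤ X A × + p ∣ℤ Y A × + p ∣ℤ Z A)
    A-rep : RationalCurve._Represents_ E (toℚ³ A) (just (x , y))
    smoothₚ : ¬ + p ∣ℤ Z A → SmoothMod E res A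

module Local (local : LocalData) where
  open LocalData local
  private
    module Fp = Residue res
    module Cₚ = OverField.Cubic Fp.𝔽 (Fp.π (a₁ E)) (Fp.π (a₂ E)) (Fp.π (a₃ E)) (Fp.π (a₄ E)) (Fp.π (a₆ E)) using (F; negate; chord; tangentZ; tangentY; _≈ᵛ_; ≈ᵛ-sym; ≈ᵛ-trans; 0ᵛ; Parallel; chord-0; negate-0; Z≈0⇒X≈0; veq; ≈Y; ≈Z; tangentZ-0; tangentY-Z; tangentY-Y)
  open PrimePowers pr public
  open RationalCurve E using (A₁; A₂; A₃; A₄; A₆; module Cℚ; module AddPt; _Represents_; at∞; represents; onCurve)
  open Fp using (π; π³; _≈_)
  module Add = AddPt ell x y on (toℚ³ A) A-rep
  private module DSₚ = DomainSim Fp.𝔽 (π (a₁ E)) (π (a₂ E)) (π (a₃ E)) (π (a₄ E)) (π (a₆ E))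
  open Laws E A
  private
    module LVₚ = LawValues Fp.ring π
    module LVℚ = LawValues ℚ-ring toℚ

  P : Point
  P = just (x , y)

  infixl 6 P+_
  P+_ : Point → Point
  P+ s = addPt E P s

  toℚ-zero : ∀ {i} → toℚ i ≡ 0ℚ → i ≡ + 0
  toℚ-zero = toℚ-injective

  F≡0 : ∀ {V s} → toℚ³ V Represents s → evalℤ (Fᴱ.F Sᴱ) V ≡ + 0
  F≡0 {V} r = toℚ-zero (≡.trans (toℚ-eval (Fᴱ.F Sᴱ) V) (≡.trans (LVℚ.value-F (toℚ³ V)) (onCurve r)))

  -- If P reduces to the origin, so do all points met below. `near` carries this along, and it is
  -- what makes `lawY` applicable.
  record LocalRep (s : Point) : Set where
    field
      V : V3 ℤ
      prim : ¬ (+ p ∣ℤ X V × + p ∣ℤ Y V × + p ∣ℤ Z V)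
      isRep : toℚ³ V Represents s
      near : + p ∣ℤ Z A → + p ∣ℤ Z V
  open LocalRep public

  F≈0 : ∀ {V s} → toℚ³ V Represents s → Cₚ.F (π³ V) ≈ Fp.0#
  F≈0 {V} r = Fp.trans (Fp.sym (Fp.π-eval (Fᴱ.F Sᴱ) V)) (Fp.π-∣ (≡.subst (+ p ∣ℤ_) (≡.sym (F≡0 {V} r)) (divides (+ 0) ≡.refl)))

  -- Equality of projective points modulo m. A multiplier on each side, both prime to p, avoids
  -- inverting units in ℤ.
  Sim : ℤ → V3 ℤ → V3 ℤ → Set
  Sim m U V = ∃[ u ] ∃[ v ] ¬ + p ∣ℤ u × ¬ + p ∣ℤ v × (u Z.* X U ≡ v Z.* X V [ m ]) × (u Z.* Y U ≡ v Z.* Y V [ m ]) × (u Z.* Z U ≡ v Z.* Z V [ m ])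

  sim-refl : ∀ {m} V → Sim m V V
  sim-refl {m} V = + 1 , + 1 , ∤1 pr , ∤1 pr , r , r , r
    where r = λ {a} → CommutativeRing.refl (cong-ring m) {a}

  sim-sym : ∀ {m U V} → Sim m U V → Sim m V U
  sim-sym {m} (u , v , nu , nv , a , b , c) = v , u , nv , nu , s a , s b , s c
    where s = λ {a b} → CommutativeRing.sym (cong-ring m) {a} {b}

  sim-weaken : ∀ {m m′ U V} → m′ ∣ℤ m → Sim m U V → Sim m′ U V
  sim-weaken d (u , v , nu , nv , ∣diff a , ∣diff b , ∣diff c) = u , v , nu , nv , ∣diff (ZD.∣-trans d a) , ∣diff (ZD.∣-trans d b) , ∣diff (ZD.∣-trans d c)

  -- One triple of polynomials for the whole residue class of S modulo p. That congruent vectors are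
  -- translated by the same polynomials is what carries finer congruences and progressions through a
  -- translation.
  record Law (S : V3 ℤ) : Set where
    field
      Φ : V3 Expr
      n : ℕ
      homX : degree (X Φ) ≡ just n
      homY : degree (Y Φ) ≡ just n
      homZ : degree (Z Φ) ≡ just n
      sound : ∀ {t} (T : LocalRep t) → Sim (+ p) (V T) S → Σ (LocalRep (P+ t)) λ T⁺ → V T⁺ ≡ eval³ Φ (V T)

  Primitive : V3 ℤ → Set
  Primitive W = ¬ (+ p ∣ℤ X W × + p ∣ℤ Y W × + p ∣ℤ Z W)

  nonzero⇒Primitive : ∀ W → ¬ Cₚ._≈ᵛ_ (π³ W) Cₚ.0ᵛ → Primitive W
  nonzero⇒Primitive W n (a , b , c) = n (Cₚ.veq (Fp.π-∣ a) (Fp.π-∣ b) (Fp.π-∣ c))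

  Primitive⇒≢0 : ∀ {W} → Primitive W → ¬ Cℚ._≈ᵛ_ (toℚ³ W) Cℚ.0ᵛ
  Primitive⇒≢0 pm (Cℚ.veq a b c) = pm (z a , z b , z c)
    where
    z : ∀ {i} → toℚ i ≡ 0ℚ → + p ∣ℤ i
    z e = ≡.subst (+ p ∣ℤ_) (≡.sym (toℚ-zero e)) (divides (+ 0) ≡.refl)

  toℚ³-eval : ∀ Φ W → toℚ³ (eval³ Φ W) ≡ LVℚ.values Φ (toℚ³ W)
  toℚ³-eval (vec e f g) W = ≡.cong₂ (λ a (b , c) → vec a b c) (toℚ-eval e W) (≡.cong₂ _,_ (toℚ-eval f W) (toℚ-eval g W))

  toℚ-chord : ∀ W → toℚ³ (eval³ lawC W) ≡ Cℚ.negate (Cℚ.chord (toℚ³ A) (toℚ³ W))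
  toℚ-chord W = ≡.trans (toℚ³-eval lawC W) (LVℚ.value-C (toℚ³ W))

  toℚ-tangentZ : ∀ W → toℚ³ (eval³ lawZ W) ≡ Cℚ.negate (Cℚ.tangentZ (toℚ³ A) (toℚ³ W))
  toℚ-tangentZ W = ≡.trans (toℚ³-eval lawZ W) (LVℚ.value-Z (toℚ³ W))

  toℚ-tangentY : ∀ W → toℚ³ (eval³ lawY W) ≡ Cℚ.negate (Cℚ.tangentY (toℚ³ A) (toℚ³ W))
  toℚ-tangentY W = ≡.trans (toℚ³-eval lawY W) (LVℚ.value-Y (toℚ³ W))

  π³-eval : ∀ Φ W → Cₚ._≈ᵛ_ (π³ (eval³ Φ W)) (LVₚ.values Φ (π³ W))
  π³-eval (vec e f g) W = Cₚ.veq (Fp.π-eval e W) (Fp.π-eval f W) (Fp.π-eval g W)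

  divides? : ∀ a → Dec (+ p ∣ℤ a)
  divides? a = + p ZD.∣? a

  private
    ≉ : ∀ {a} → ¬ + p ∣ℤ a → ¬ π a ≈ Fp.0#
    ≉ n e = n (Fp.π-0 e)

    π* : ∀ {a b c d} → a Z.* b ≡ c Z.* d [ + p ] → π a Fp.* π b ≈ π c Fp.* π d
    π* {a} {b} {c} {d} e = Fp.trans (Fp.sym (Fp.π-* a b)) (Fp.trans (Fp.π-cong e) (Fp.π-* c d))

    negated : ∀ U W → Cₚ._≈ᵛ_ (π³ U) (Cₚ.negate W) → ¬ Cₚ._≈ᵛ_ W Cₚ.0ᵛ → Primitive U
    negated U W e n = nonzero⇒Primitive U (λ z → n (Cₚ.negate-0 W (Cₚ.≈ᵛ-trans (Cₚ.≈ᵛ-sym e) z)))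

    rational≢0 : ∀ Φ (W : V3 ℤ) (w : V3 ℚ) → toℚ³ (eval³ Φ W) ≡ Cℚ.negate w → Primitive (eval³ Φ W) → ¬ Cℚ._≈ᵛ_ w Cℚ.0ᵛ
    rational≢0 Φ W w e pm w0 = Primitive⇒≢0 pm (≡.subst (λ u → Cℚ._≈ᵛ_ u Cℚ.0ᵛ) (≡.sym e) (neg0 w w0))
      where
      neg0 : ∀ w → Cℚ._≈ᵛ_ w Cℚ.0ᵛ → Cℚ._≈ᵛ_ (Cℚ.negate w) Cℚ.0ᵛ
      neg0 (vec _ _ _) (Cℚ.veq ≡.refl ≡.refl ≡.refl) = Cℚ.veq ≡.refl neg00 ≡.refl
        where
        neg00 : Q.- (0ℚ Q.+ (A₁ Q.* 0ℚ Q.+ A₃ Q.* 0ℚ)) ≡ 0ℚ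
        neg00 = ≡.cong (λ u → Q.- u) (≡.trans (QP.+-identityˡ _) (≡.trans (≡.cong₂ Q._+_ (QP.*-zeroʳ A₁) (QP.*-zeroʳ A₃)) (QP.+-identityˡ 0ℚ)))

    built : ∀ {t} (W : V3 ℤ) (w : V3 ℚ) → toℚ³ W ≡ w → Primitive W → w Represents t → (+ p ∣ℤ Z A → + p ∣ℤ Z W) → Σ (LocalRep t) λ T → V T ≡ W
    built W w ≡.refl pm r nr = record { V = W ; prim = pm ; isRep = r ; near = nr } , ≡.refl

  chord-law : ∀ S → ¬ + p ∣ℤ Z A → ¬ Cₚ.Parallel (π³ A) (π³ S) → Law S
  chord-law S ZA ¬par = record { Φ = lawC ; n = 2 ; homX = ≡.refl ; homY = ≡.refl ; homZ = ≡.refl ; sound = sound′ }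
    where
    sound′ : ∀ {t} (T : LocalRep t) → Sim (+ p) (V T) S → Σ (LocalRep (P+ t)) λ T⁺ → V T⁺ ≡ eval³ lawC (V T)
    sound′ {t} T (u , v , nu , nv , eX , eY , eZ) = built (eval³ lawC W) (Cℚ.negate (Cℚ.chord (toℚ³ A) (toℚ³ W))) (toℚ-chord W) pm
        (Add.sum-chord (isRep T) (rational≢0 lawC W (Cℚ.chord (toℚ³ A) (toℚ³ W)) (toℚ-chord W) pm)) (λ d → ⊥-elim (ZA d))
      where
      W = V T
      ¬parT : ¬ Cₚ.Parallel (π³ A) (π³ W)
      ¬parT ∥ = ¬par (DSₚ.parallel-sim (π³ A) {π³ W} {π³ S} (π v) (π u) (≉ nv) (Fp.sym (π* eX)) (Fp.sym (π* eY)) (Fp.sym (π* eZ)) ∥)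
      pm : Primitive (eval³ lawC W)
      pm = negated (eval³ lawC W) (Cₚ.chord (π³ A) (π³ W)) (π³-eval lawC W) (λ c0 → ¬parT (Cₚ.chord-0 (π³ A) (π³ W) (F≈0 {A} A-rep) (F≈0 {W} (isRep T)) (≉ ZA) c0))

  tangentZ-law : ∀ S → ¬ + p ∣ℤ Z A → ¬ + p ∣ℤ Z S → Cₚ.Parallel (π³ A) (π³ S) → Law S
  tangentZ-law S ZA ZS ∥ = record { Φ = lawZ ; n = 7 ; homX = ≡.refl ; homY = ≡.refl ; homZ = ≡.refl ; sound = sound′ }
    where
    sound′ : ∀ {t} (T : LocalRep t) → Sim (+ p) (V T) S → Σ (LocalRep (P+ t)) λ T⁺ → V T⁺ ≡ eval³ lawZ (V T)
    sound′ {t} T (u , v , nu , nv , eX , eY , eZ) = built (eval³ lawZ W) (Cℚ.negate (Cℚ.tangentZ (toℚ³ A) (toℚ³ W))) (toℚ-tangentZ W) pm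
        (Add.sum-tangentZ (isRep T) ZT≢0 (rational≢0 lawZ W (Cℚ.tangentZ (toℚ³ A) (toℚ³ W)) (toℚ-tangentZ W) pm)) (λ d → ⊥-elim (ZA d))
      where
      W = V T
      parT : Cₚ.Parallel (π³ A) (π³ W)
      parT = DSₚ.parallel-sim (π³ A) {π³ S} {π³ W} (π u) (π v) (≉ nu) (π* eX) (π* eY) (π* eZ) ∥
      ZT : ¬ + p ∣ℤ Z W
      ZT d = ∤* nv ZS (Fp.π-0 (Fp.trans (Fp.sym (Fp.π-cong eZ)) (Fp.π-∣ (ZD.∣n⇒∣m*n u d))))
      ZT≢0 : ¬ toℚ (Z W) ≡ 0ℚ
      ZT≢0 e = ZT (≡.subst (+ p ∣ℤ_) (≡.sym (toℚ-zero e)) (divides (+ 0) ≡.refl))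
      pm : Primitive (eval³ lawZ W)
      pm = negated (eval³ lawZ W) (Cₚ.tangentZ (π³ A) (π³ W)) (π³-eval lawZ W) (λ t0 → let s = Cₚ.tangentZ-0 (π³ A) (π³ W) (≉ ZA) (≉ ZT) parT t0 in
        smoothₚ ZA s)

  infinite : ∀ {t} (T : LocalRep t) → + p ∣ℤ Z (V T) → + p ∣ℤ X (V T) × ¬ + p ∣ℤ Y (V T)
  infinite T d = xd , λ yd → prim T (xd , yd , d)
    where
    xd = Fp.π-0 (Cₚ.Z≈0⇒X≈0 (π³ (V T)) (F≈0 {V T} (isRep T)) (Fp.π-∣ d))

  A-local : LocalRep P
  A-local = record { V = A ; prim = A-prim ; isRep = A-rep ; near = λ d → d }

  tangentY-law : ∀ S → + p ∣ℤ Z A → Law S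
  tangentY-law S ZA = record { Φ = lawY ; n = 7 ; homX = ≡.refl ; homY = ≡.refl ; homZ = ≡.refl ; sound = sound′ }
    where
    sound′ : ∀ {t} (T : LocalRep t) → Sim (+ p) (V T) S → Σ (LocalRep (P+ t)) λ T⁺ → V T⁺ ≡ eval³ lawY (V T)
    sound′ {t} T _ = built (eval³ lawY W) (Cℚ.negate (Cℚ.tangentY (toℚ³ A) (toℚ³ W))) (toℚ-tangentY W) pm
        (Add.sum-tangentY (isRep T) (≢0 YA) (≢0 YT) (rational≢0 lawY W (Cℚ.tangentY (toℚ³ A) (toℚ³ W)) (toℚ-tangentY W) pm)) (λ _ → Z∣)
      where
      W = V T
      YA = proj₂ (infinite A-local ZA)
      YT = proj₂ (infinite T (near T ZA))
      XA0 = Fp.π-∣ (proj₁ (infinite A-local ZA))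
      XT0 = Fp.π-∣ (proj₁ (infinite T (near T ZA)))
      Z∣ : + p ∣ℤ Z (eval³ lawY W)
      Z∣ = Fp.π-0 (Fp.trans (Cₚ.≈Z (π³-eval lawY W)) (Cₚ.tangentY-Z (π³ A) (π³ W) XA0 (Fp.π-∣ ZA) XT0 (Fp.π-∣ (near T ZA))))
      ≢0 : ∀ {i} → ¬ + p ∣ℤ i → ¬ toℚ i ≡ 0ℚ
      ≢0 n e = n (≡.subst (+ p ∣ℤ_) (≡.sym (toℚ-zero e)) (divides (+ 0) ≡.refl))
      pm : Primitive (eval³ lawY W)
      pm = negated (eval³ lawY W) (Cₚ.tangentY (π³ A) (π³ W)) (π³-eval lawY W) (λ t0 → Cₚ.tangentY-Y (π³ A) (π³ W) XA0 (Fp.π-∣ ZA) XT0 (Fp.π-∣ (near T ZA)) (≉ YA) (≉ YT) (Cₚ.≈Y t0))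

  -- Decided by residues: `lawY` if P reduces to the origin, otherwise the chord if S and P reduce
  -- to different points and `lawZ` if they reduce to the same one. In the last case Z(S) is a unit,
  -- since Z(A)Y(S) ≡ Z(S)Y(A).
  law : ∀ {s} (S : LocalRep s) → Law (V S)
  law S with divides? (Z A)
  ... | yes ZA = tangentY-law (V S) ZA
  ... | no ZA with parallel? (V S)
    where
    eq? : ∀ a b c d → Dec (π a Fp.* π b ≈ π c Fp.* π d)
    eq? a b c d with + p ZD.∣? (a Z.* b Z.- c Z.* d)
    ... | yes e = yes (π* (∣diff e))
    ... | no n = no λ e → n (diff∣ (Fp.π-inj (Fp.trans (Fp.π-* a b) (Fp.trans e (Fp.sym (Fp.π-* c d))))))
    parallel? : ∀ W → Dec (Cₚ.Parallel (π³ A) (π³ W))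
    parallel? W with eq? (Z A) (X W) (Z W) (X A) | eq? (Z A) (Y W) (Z W) (Y A)
    ... | yes a | yes b = yes (a , b)
    ... | no a | _ = no λ h → a (proj₁ h)
    ... | _ | no b = no λ h → b (proj₂ h)
  ...   | no ¬par = chord-law (V S) ZA ¬par
  ...   | yes ∥ = tangentZ-law (V S) ZA ZS ∥
    where
    ZS : ¬ + p ∣ℤ Z (V S)
    ZS d = ∤* ZA (proj₂ (infinite S d)) (Fp.π-0 (Fp.trans (Fp.π-* (Z A) (Y (V S))) (Fp.trans (proj₂ ∥) (Fp.trans (Fp.*-congʳ (Fp.π-∣ d)) (Fp.zeroˡ _)))))

  origin : LocalRep nothing
  origin = record { V = vec (+ 0) (+ 1) (+ 0) ; prim = λ t → ∤1 pr (proj₁ (proj₂ t)) ; isRep = represents (at∞ ≡.refl ≡.refl 1≢0) (F-origin ℚ-ring A₁ A₂ A₃ A₄ A₆) ; near = λ _ → divides (+ 0) ≡.refl }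
    where
    F-origin : ∀ (R : CommutativeRing 0ℓ 0ℓ) (let open CommutativeRing R using (_+_; _*_; -_; 1#; 0#) renaming (_≈_ to _≃_)) b₁ b₂ b₃ b₄ b₆ → Formulas.F _+_ _*_ -_ 1# b₁ b₂ b₃ b₄ b₆ (vec 0# 1# 0#) ≃ 0#
    F-origin R b₁ b₂ b₃ b₄ b₆ = solve 5 (λ b₁ b₂ b₃ b₄ b₆ → let open Formulas _:+_ _:*_ :-_ (con (+ 1)) b₁ b₂ b₃ b₄ b₆ using () renaming (F to F′) in
      F′ (vec (con (+ 0)) (con (+ 1)) (con (+ 0))) := con (+ 0)) refl b₁ b₂ b₃ b₄ b₆
      where
      open CommutativeRing R using (refl)
      open IntSolver R using (solve)

module _ where
  open IntSolver ZP.+-*-commutativeRing using (solve)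

  progression-Y : ∀ {k m} x y₀ y₁ y₂ j → m ∣ℤ k Z.* k → k ∣ℤ x → Progression k m y₀ y₁ y₂ → m ∣ℤ x Z.* ((j Z.+ + 2) Z.* y₂ Z.- + 2 Z.* (j Z.+ + 1) Z.* y₁ Z.+ j Z.* y₀)
  progression-Y {k} {m} x y₀ y₁ y₂ j mk (divides q e) P = ZD.∣-trans mk (≡.subst (k Z.* k ∣ℤ_)
    (≡.cong (x Z.*_) (solve 4 (λ j a b c → (j :+ con (+ 2)) :* (c :- b) :- j :* (b :- a) := (j :+ con (+ 2)) :* c :- con (+ 2) :* (j :+ con (+ 1)) :* b :+ j :* a) ≡.refl j y₀ y₁ y₂))
    (mul∣ (divides q e) (ZD.∣m∣n⇒∣m-n (ZD.∣n⇒∣m*n (j Z.+ + 2) (second P)) (ZD.∣n⇒∣m*n j (first P)))))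
    where
    mul∣ : ∀ {a b} → k ∣ℤ a → k ∣ℤ b → k Z.* k ∣ℤ a Z.* b
    mul∣ (divides q e) (divides r f) = divides (q Z.* r) (≡.trans (≡.cong₂ Z._*_ e f) (solve 3 (λ q r k → q :* k :* (r :* k) := q :* r :* (k :* k)) ≡.refl q r k))

  -- The relation yX ≡ jxY propagates because both sides have second difference 0 modulo m: on the
  -- left X is a progression, on the right x and the differences of Y are multiples of k.
  progression-next : ∀ {k m} x y X₀ X₁ X₂ Y₀ Y₁ Y₂ j → m ∣ℤ k Z.* k → k ∣ℤ x → Progression k m X₀ X₁ X₂ → Progression k m Y₀ Y₁ Y₂ →
    m ∣ℤ y Z.* X₀ Z.- j Z.* x Z.* Y₀ → m ∣ℤ y Z.* X₁ Z.- (j Z.+ + 1) Z.* x Z.* Y₁ → m ∣ℤ y Z.* X₂ Z.- (j Z.+ + 2) Z.* x Z.* Y₂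
  progression-next {k} {m} x y X₀ X₁ X₂ Y₀ Y₁ Y₂ j mk kx PX PY d₀ d₁ = ≡.subst (m ∣ℤ_)
    (solve 9 (λ x y X₀ X₁ X₂ Y₀ Y₁ Y₂ j →
      ((y :* ((X₂ :- X₁) :- (X₁ :- X₀))) :+ (con (+ 2) :* (y :* X₁ :- (j :+ con (+ 1)) :* x :* Y₁) :- (y :* X₀ :- j :* x :* Y₀))) :-
        x :* ((j :+ con (+ 2)) :* Y₂ :- con (+ 2) :* (j :+ con (+ 1)) :* Y₁ :+ j :* Y₀)
      := y :* X₂ :- (j :+ con (+ 2)) :* x :* Y₂) ≡.refl x y X₀ X₁ X₂ Y₀ Y₁ Y₂ j)
    (ZD.∣m∣n⇒∣m-n (ZD.∣m∣n⇒∣m+n (ZD.∣n⇒∣m*n y (second-difference PX)) (ZD.∣m∣n⇒∣m-n (ZD.∣n⇒∣m*n (+ 2) d₁) d₀)) (progression-Y x Y₀ Y₁ Y₂ j mk kx PY))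

module CurveEquation (R : CommutativeRing 0ℓ 0ℓ) (a₁ a₂ a₃ a₄ a₆ : CommutativeRing.Carrier R) where
  open CommutativeRing R
  open Formulas _+_ _*_ -_ 1# a₁ a₂ a₃ a₄ a₆
  open IntSolver R using (solve)
  -- The curve is Z · `cofactor` = X³, and the cofactor is Y² plus multiples of X and Z: a unit near
  -- the origin.
  cofactor : V3 Carrier → Carrier
  cofactor (vec x y z) = y * y + (x * (a₁ * y - a₂ * x - a₄ * z) + z * (a₃ * y - a₆ * z))
  F-split : ∀ v → F v ≈ Z v * cofactor v - X v * X v * X v
  F-split (vec x y z) = solve 8 (λ b₁ b₂ b₃ b₄ b₆ x y z → let open Formulas _:+_ _:*_ :-_ (con (+ 1)) b₁ b₂ b₃ b₄ b₆ using () renaming (F to F′) in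
    F′ (vec x y z) := z :* (y :* y :+ (x :* (b₁ :* y :- b₂ :* x :- b₄ :* z) :+ z :* (b₃ :* y :- b₆ :* z))) :- x :* x :* x) refl a₁ a₂ a₃ a₄ a₆ x y z

-- Repeated translation by P

module Iteration (local : LocalData) where
  open LocalData local
  private
    module Fp = Residue res
  open Local local
  open RationalCurve E using (rep-unique; Rep; affine-parts; ⊖_; _Represents_; at∞; affine; represents; rep)
  open Laws E A using (module Fᴱ; Sᴱ; module LawValues)

  step : ∀ {s} → LocalRep s → LocalRep (P+ s)
  step S = proj₁ (Law.sound (law S) S (sim-refl (V S)))

  Congruent : ℤ → Point → Point → Set
  Congruent m s t = Σ (LocalRep s) λ S → Σ (LocalRep t) λ T → Sim m (V S) (V T)

  congruent-step : ∀ {m s t} → + p ∣ℤ m → Congruent m s t → Congruent m (P+ s) (P+ t)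
  congruent-step {m} {s} {t} p∣m (S , T , sim@(u , v , nu , nv , eX , eY , eZ)) = proj₁ S⁺ , proj₁ T⁺ ,
    ≡.subst₂ (Sim m) (≡.sym (proj₂ S⁺)) (≡.sym (proj₂ T⁺))
      (u Z.^ n , v Z.^ n , ∤^ n nu , ∤^ n nv , comp (X Φ) homX , comp (Y Φ) homY , comp (Z Φ) homZ)
    where
    open Law (law S)
    S⁺ = sound S (sim-refl (V S))
    T⁺ = sound T (sim-weaken {m} {+ p} {V T} {V S} p∣m (sim-sym {m} {V S} {V T} sim))
    comp : ∀ e → degree e ≡ just n → (u Z.^ n) Z.* evalℤ e (V S) ≡ (v Z.^ n) Z.* evalℤ e (V T) [ m ]
    comp e h = ≡.subst₂ (λ a b → a ≡ b [ m ]) (homogeneous e n h u (V S)) (homogeneous e n h v (V T)) (eval-mod m e eX eY eZ)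

  mul-rep : ∀ n → LocalRep (mulPt E n P)
  mul-rep zero = origin
  mul-rep (suc n) = step (mul-rep n)

  congruent-mul : ∀ {m i j} → + p ∣ℤ m → Congruent m (mulPt E i P) (mulPt E j P) → ∀ n → Congruent m (mulPt E (n N.+ i) P) (mulPt E (n N.+ j) P)
  congruent-mul p∣m c zero = c
  congruent-mul p∣m c (suc n) = congruent-step p∣m (congruent-mul p∣m c n)

  -- Projective vectors have no preferred scale, so a progression is asked for only after rescaling
  -- by units; homogeneity of the laws carries these units along.
  Progressions : ℕ → Point → Point → Point → Set
  Progressions k s₀ s₁ s₂ = Σ (LocalRep s₀) λ S₀ → Σ (LocalRep s₁) λ S₁ → Σ (LocalRep s₂) λ S₂ →
    ∃[ u₀ ] ∃[ u₁ ] ∃[ u₂ ] ¬ + p ∣ℤ u₀ × ¬ + p ∣ℤ u₁ × ¬ + p ∣ℤ u₂ ×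
    Prog (u₀ Z.* X (V S₀)) (u₁ Z.* X (V S₁)) (u₂ Z.* X (V S₂)) ×
    Prog (u₀ Z.* Y (V S₀)) (u₁ Z.* Y (V S₁)) (u₂ Z.* Y (V S₂)) ×
    Prog (u₀ Z.* Z (V S₀)) (u₁ Z.* Z (V S₁)) (u₂ Z.* Z (V S₂))
    where Prog = Progression (+ (p N.^ suc k)) (+ (p N.^ suc (suc k)))

  p^∣square : ∀ k → + (p N.^ suc (suc k)) ∣ℤ + (p N.^ suc k) Z.* + (p N.^ suc k)
  p^∣square k = divides q (≡.trans (≡.cong (Z._* q′) (p^suc k)) (≡.trans (solve 3 (λ p q q′ → p :* q :* q′ := q :* (p :* q′)) ≡.refl (+ p) q q′) (≡.cong (q Z.*_) (≡.sym (p^suc (suc k))))))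
    where
    open IntSolver ZP.+-*-commutativeRing using (solve)
    q = + (p N.^ k)
    q′ = + (p N.^ suc k)

  progressions-step : ∀ {k s₀ s₁ s₂} → Progressions k s₀ s₁ s₂ → Progressions k (P+ s₀) (P+ s₁) (P+ s₂)
  progressions-step {k} (S₀ , S₁ , S₂ , u₀ , u₁ , u₂ , n₀ , n₁ , n₂ , pX , pY , pZ) =
    proj₁ T₀ , proj₁ T₁ , proj₁ T₂ , u₀ Z.^ n , u₁ Z.^ n , u₂ Z.^ n , ∤^ n n₀ , ∤^ n n₁ , ∤^ n n₂ ,
    sub X (comp (X Φ) homX) , sub Y (comp (Y Φ) homY) , sub Z (comp (Z Φ) homZ)
    where
    -- The law of the middle vector serves all three, since they agree modulo p up to units.
    open Law (law S₁)
    M = + (p N.^ suc k)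
    Prog = Progression (+ (p N.^ suc k)) (+ (p N.^ suc (suc k)))
    back : ∀ {a b c} → Prog a b c → a ≡ b [ + p ]
    back {a} {b} P = CommutativeRing.sym (cong-ring (+ p)) {b} {a} (∣diff (ZD.∣-trans (p∣p^suc k) (first P)))
    forth : ∀ {a b c} → Prog a b c → c ≡ b [ + p ]
    forth P = ∣diff (ZD.∣-trans (p∣p^suc k) (second P))
    T₀ = sound S₀ (u₀ , u₁ , n₀ , n₁ , back pX , back pY , back pZ)
    T₁ = sound S₁ (sim-refl (V S₁))
    T₂ = sound S₂ (u₂ , u₁ , n₂ , n₁ , forth pX , forth pY , forth pZ)
    comp : ∀ e → degree e ≡ just n → Prog (u₀ Z.^ n Z.* evalℤ e (V S₀)) (u₁ Z.^ n Z.* evalℤ e (V S₁)) (u₂ Z.^ n Z.* evalℤ e (V S₂))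
    comp e h = ≡.subst (λ (a , b , c) → Prog a b c) (≡.cong₂ _,_ (homogeneous e n h u₀ (V S₀)) (≡.cong₂ _,_ (homogeneous e n h u₁ (V S₁)) (homogeneous e n h u₂ (V S₂))))
      (eval-progression (p^∣square k) e {u₀ ∙ V S₀} {u₁ ∙ V S₁} {u₂ ∙ V S₂} pX pY pZ)
    sub : ∀ (c : V3 ℤ → ℤ) → Prog (u₀ Z.^ n Z.* c (eval³ Φ (V S₀))) (u₁ Z.^ n Z.* c (eval³ Φ (V S₁))) (u₂ Z.^ n Z.* c (eval³ Φ (V S₂))) →
      Prog (u₀ Z.^ n Z.* c (V (proj₁ T₀))) (u₁ Z.^ n Z.* c (V (proj₁ T₁))) (u₂ Z.^ n Z.* c (V (proj₁ T₂)))
    sub c = ≡.subst (λ (a , b , d) → Prog (u₀ Z.^ n Z.* c a) (u₁ Z.^ n Z.* c b) (u₂ Z.^ n Z.* c d)) (≡.cong₂ _,_ (≡.sym (proj₂ T₀)) (≡.cong₂ _,_ (≡.sym (proj₂ T₁)) (≡.sym (proj₂ T₂))))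

  iter : ℕ → Point → Point
  iter zero s = s
  iter (suc n) s = iter n (P+ s)

  progressions-iter : ∀ n {k s₀ s₁ s₂} → Progressions k s₀ s₁ s₂ → Progressions k (iter n s₀) (iter n s₁) (iter n s₂)
  progressions-iter zero a = a
  progressions-iter (suc n) {k} {s₀} {s₁} {s₂} a = progressions-iter n {k} {P+ s₀} {P+ s₁} {P+ s₂} (progressions-step {k} {s₀} {s₁} {s₂} a)

  iter-mul : ∀ n i → iter n (mulPt E i P) ≡ mulPt E (n N.+ i) P
  iter-mul zero i = ≡.refl
  iter-mul (suc n) i = ≡.trans (iter-mul n (suc i)) (≡.cong (λ k → mulPt E k P) (NP.+-suc n i))

  P+⊖ : ∀ {s} → LocalRep s → P+ (⊖ (P+ s)) ≡ ⊖ s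
  P+⊖ S = let (v , r , r′) = Add.cancellation (isRep S) in rep-unique (rep r) (rep r′)

  -- Each translation removes one P from the negated multiple by P + (-(P + S)) = -S.
  iter-⊖ : ∀ n → iter n (⊖ mulPt E n P) ≡ nothing
  iter-⊖ zero = ≡.refl
  iter-⊖ (suc n) = ≡.trans (≡.cong (iter n) (P+⊖ (mul-rep n))) (iter-⊖ n)

  -- Closeness to the origin is measured by X, because X/Y is a local parameter there; the same
  -- power of p in Z is implied by the curve equation and kept for convenience.
  Near : ℕ → V3 ℤ → Set
  Near k W = + (p N.^ suc k) ∣ℤ X W × + (p N.^ suc k) ∣ℤ Z W

  near-p : ∀ {k W} → Near k W → + p ∣ℤ X W × + p ∣ℤ Z W
  near-p {k} (a , b) = ZD.∣-trans (p∣p^suc k) a , ZD.∣-trans (p∣p^suc k) b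

  near-sim : ∀ {k U W} → Sim (+ (p N.^ suc k)) U W → Near k W → Near k U
  near-sim {k} {U} {W} (u , v , nu , nv , eX , _ , eZ) (dX , dZ) = c eX dX , c eZ dZ
    where
    c : ∀ {a b} → u Z.* a ≡ v Z.* b [ + (p N.^ suc k) ] → + (p N.^ suc k) ∣ℤ b → + (p N.^ suc k) ∣ℤ a
    c {a} {b} (∣diff e) d = unit-cancel (suc k) nu (ZD.∣m+n∣n⇒∣m {m = u Z.* a} e (ZD.∣m⇒∣-m (ZD.∣n⇒∣m*n v d)))

  sim-origin : ∀ {k s} (S : LocalRep s) → Near k (V S) → Sim (+ (p N.^ suc k)) (V S) (V origin)
  sim-origin {k} S nr@(dX , dZ) = + 1 , Y (V S) , ∤1 pr , (λ d → prim S (proj₁ (near-p {k} {V S} nr) , d , proj₂ (near-p {k} {V S} nr))) , c dX , r , c dZ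
    where
    open IntSolver ZP.+-*-commutativeRing using (solve)
    M = + (p N.^ suc k)
    c : ∀ {a} → M ∣ℤ a → + 1 Z.* a ≡ Y (V S) Z.* + 0 [ M ]
    c {a} d = ∣diff (≡.subst (M ∣ℤ_) (solve 2 (λ a y → a := con (+ 1) :* a :- y :* con (+ 0)) ≡.refl a (Y (V S))) d)
    r : + 1 Z.* Y (V S) ≡ Y (V S) Z.* + 1 [ M ]
    r = CommutativeRing.reflexive (cong-ring M) (ZP.*-comm (+ 1) (Y (V S)))

  origin-near : ∀ k (S : LocalRep nothing) → Near k (V S)
  origin-near k S = zeros (isRep S)
    where
    zeros : toℚ³ (V S) Represents nothing → Near k (V S)
    zeros (represents (at∞ x0 z0 _) _) = d x0 , d z0
      where
      d : ∀ {i} → toℚ i ≡ 0ℚ → + (p N.^ suc k) ∣ℤ i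
      d e = ≡.subst (_ ∣ℤ_) (≡.sym (toℚ-zero e)) (divides (+ 0) ≡.refl)

  cross : ∀ {s} (S S′ : LocalRep s) → X (V S) Z.* Y (V S′) ≡ X (V S′) Z.* Y (V S)
  cross S S′ = toℚ-injective (≡.trans (toℚ-* (X (V S)) (Y (V S′))) (≡.trans (go (rep (isRep S)) (rep (isRep S′))) (≡.sym (toℚ-* (X (V S′)) (Y (V S))))))
    where
    go : ∀ {s v w} → Rep v s → Rep w s → X v Q.* Y w ≡ X w Q.* Y v
    go {v = v} {w} (at∞ x0 _ _) (at∞ x0′ _ _) = ≡.trans (≡.cong (Q._* Y w) x0) (≡.trans (QP.*-zeroˡ (Y w)) (≡.sym (≡.trans (≡.cong (Q._* Y v) x0′) (QP.*-zeroˡ (Y v)))))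
    go {v = v} {w} (affine {a} {b} _ hx hy) (affine _ hx′ hy′) = ≡.trans (≡.cong₂ Q._*_ hx hy′) (≡.trans (swap ℚ-ring (Z v) a (Z w) b) (≡.sym (≡.cong₂ Q._*_ hx′ hy)))
      where
      swap : ∀ (R : CommutativeRing 0ℓ 0ℓ) (let open CommutativeRing R renaming (_*_ to _⊗_; _≈_ to _≃_)) z a w b → (z ⊗ a) ⊗ (w ⊗ b) ≃ (w ⊗ a) ⊗ (z ⊗ b)
      swap R z a w b = solve 4 (λ z a w b → (z :* a) :* (w :* b) := (w :* a) :* (z :* b)) (CommutativeRing.refl R) z a w b
        where open IntSolver R using (solve)

  -- Near the origin x′ = X/Z and Zκ = X³ give x′ = κ/X², that is, denominator · κ = numerator · X².
  -- With κ and the numerator prime to p, d and X contain the same power of p.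
  module Denominator {x′ y′ : ℚ} (S : LocalRep (just (x′ , y′))) (d : ℕ) (den : ℚ.denominatorℕ x′ ≡ d N.* d) where
    open IntSolver ZP.+-*-commutativeRing using (solve)
    private
      module CE = CurveEquation ZP.+-*-commutativeRing (a₁ E) (a₂ E) (a₃ E) (a₄ E) (a₆ E)
      W = V S
      ν = ℚ.numerator x′
      δ = + (d N.* d)
      aff = affine-parts (rep (isRep S))
      Z≢0 : Z W ≢ + 0
      Z≢0 e = proj₁ aff (≡.cong toℚ e)
      κ = CE.cofactor W
      eq₁ : Z W Z.* κ ≡ X W Z.* X W Z.* X W
      eq₁ = ≡.trans (solve 2 (λ a b → a := (a :- b) :+ b) ≡.refl (Z W Z.* κ) (X W Z.* X W Z.* X W))
        (≡.trans (≡.cong (Z._+ (X W Z.* X W Z.* X W)) (≡.trans (≡.sym (CE.F-split W)) (≡.trans (≡.sym (LawValues.value-F ZP.+-*-commutativeRing (λ c → c) W)) (F≡0 {W} (isRep S))))) (ZP.+-identityˡ _))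
      eq₂ : ν Z.* Z W ≡ X W Z.* δ
      eq₂ = toℚ-injective (≡.trans (toℚ-* ν (Z W)) (≡.trans (≡.cong (Q._* toℚ (Z W)) (≡.sym (≡.trans (≡.cong (λ n → x′ Q.* toℚ (+ n)) (≡.sym den)) (num-den x′))))
        (≡.trans (shuffle ℚ-ring x′ (toℚ δ) (toℚ (Z W))) (≡.trans (≡.cong (Q._* toℚ δ) (≡.sym (proj₁ (proj₂ aff)))) (≡.sym (toℚ-* (X W) δ))))))
        where
        shuffle : ∀ (R : CommutativeRing 0ℓ 0ℓ) (let open CommutativeRing R renaming (_*_ to _⊗_; _≈_ to _≃_)) a b c → (a ⊗ b) ⊗ c ≃ (c ⊗ a) ⊗ b
        shuffle R a b c = IntSolver.solve R 3 (λ a b c → (a :* b) :* c := (c :* a) :* b) (CommutativeRing.refl R) a b c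
      κ-unit : + p ∣ℤ X W → + p ∣ℤ Z W → ¬ + p ∣ℤ κ
      κ-unit dX dZ dκ = prim S (dX , [ (λ h → h) , (λ h → h) ]′ (prime-∣* pr (Y W) (Y W) (ZD.∣m+n∣n⇒∣m {m = Y W Z.* Y W} dκ (ZD.∣m∣n⇒∣m+n (ZD.∣m⇒∣m*n _ dX) (ZD.∣m⇒∣m*n _ dZ)))) , dZ)
      X≢0 : ¬ + p ∣ℤ κ → X W ≢ + 0
      X≢0 nκ e = [ Z≢0 , (λ h → nκ (≡.subst (+ p ∣ℤ_) (≡.sym h) (divides (+ 0) ≡.refl))) ]′ (ZP.i*j≡0⇒i≡0∨j≡0 (Z W) (≡.trans eq₁ (≡.cong (λ a → a Z.* a Z.* a) e)))
      eq₃ : ¬ + p ∣ℤ κ → δ Z.* κ ≡ ν Z.* (X W Z.* X W)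
      eq₃ nκ = ZP.*-cancelˡ-≡ (X W) _ _ {{Z.≢-nonZero (X≢0 nκ)}} (≡.trans (≡.sym (ZP.*-assoc (X W) δ κ)) (≡.trans (≡.cong (Z._* κ) (≡.sym eq₂))
        (≡.trans (ZP.*-assoc ν (Z W) κ) (≡.trans (≡.cong (ν Z.*_) eq₁) (solve 2 (λ n x → n :* (x :* x :* x) := x :* (n :* (x :* x))) ≡.refl ν (X W))))))
      square∣ : ∀ {a b} → a ∣ℤ b → a Z.* a ∣ℤ b Z.* b
      square∣ {a} {b} (divides q e) = divides (q Z.* q) (≡.trans (≡.cong₂ Z._*_ e e) (solve 2 (λ q a → q :* a :* (q :* a) := q :* q :* (a :* a)) ≡.refl q a))
      p^p^ : ∀ k → + (p N.^ k) Z.* + (p N.^ k) ≡ + (p N.^ (k N.+ k))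
      p^p^ k = ≡.trans (≡.sym (ZP.pos-* (p N.^ k) (p N.^ k))) (≡.cong +_ (≡.sym (NP.^-distribˡ-+-* p k k)))

    near⇒∣ : ∀ k → + (p N.^ k) ∣ℤ X W → + p ∣ℤ X W → + p ∣ℤ Z W → p N.^ k ND.∣ d
    near⇒∣ k dk dX dZ = ZD.∣⇒∣ᵤ (square-root k {+ d} (≡.subst₂ _∣ℤ_ (≡.sym (p^p^ k)) (ZP.pos-* d d) (unit-cancel (k N.+ k) {κ} {δ} nκ
      (≡.subst₂ _∣ℤ_ (p^p^ k) (≡.trans (≡.sym (eq₃ nκ)) (ZP.*-comm δ κ)) (ZD.∣n⇒∣m*n ν {X W Z.* X W} (square∣ {+ (p N.^ k)} {X W} dk))))))
      where nκ = κ-unit dX dZ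

    ∣⇒near : ∀ k → p N.^ suc k ND.∣ d → Near k W
    ∣⇒near k dk = X∣ , unit-cancel (suc k) {κ} nκ (≡.subst (_ ∣ℤ_) (≡.trans (≡.sym eq₁) (ZP.*-comm (Z W) κ)) (ZD.∣n⇒∣m*n (X W Z.* X W) X∣))
      where
      p∣d : + p ∣ℤ + d
      p∣d = ZD.∣-trans (p∣p^suc k) (ZD.∣ᵤ⇒∣ dk)
      p∣δ : + p ∣ℤ δ
      p∣δ = ≡.subst (+ p ∣ℤ_) (≡.sym (ZP.pos-* d d)) (ZD.∣m⇒∣m*n (+ d) p∣d)
      nν : ¬ + p ∣ℤ ν
      nν dν = ∤1 pr (ZD.∣ᵤ⇒∣ (ND.∣-reflexive (coprime x′ den dν p∣δ)))
        where
        coprime : ∀ x′ → ℚ.denominatorℕ x′ ≡ d N.* d → + p ∣ℤ ℚ.numerator x′ → + p ∣ℤ δ → p ≡ 1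
        coprime (mkℚ n d-1 c) e dn dδ = NC.recompute c (ZD.∣⇒∣ᵤ dn , ≡.subst (p ND.∣_) (≡.sym e) (ZD.∣⇒∣ᵤ dδ))
      Z∣ : + p ∣ℤ Z W
      Z∣ = [ (λ h → ⊥-elim (nν h)) , (λ h → h) ]′ (prime-∣* pr ν (Z W) (≡.subst (+ p ∣ℤ_) (≡.sym eq₂) (ZD.∣n⇒∣m*n (X W) p∣δ)))
      X∣p = proj₁ (infinite S Z∣)
      nκ = κ-unit X∣p Z∣
      X∣ : + (p N.^ suc k) ∣ℤ X W
      X∣ = square-root (suc k) (≡.subst (_∣ℤ X W Z.* X W) (≡.sym (p^p^ (suc k))) (unit-cancel (suc k N.+ suc k) nν
        (≡.subst₂ _∣ℤ_ (p^p^ (suc k)) (eq₃ nκ) (ZD.∣m⇒∣m*n {m = δ} κ (≡.subst (+ (p N.^ suc k) Z.* + (p N.^ suc k) ∣ℤ_) (≡.sym (ZP.pos-* d d)) (square∣ {+ (p N.^ suc k)} {+ d} (ZD.∣ᵤ⇒∣ dk)))))))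

-- Completing the square modulo an odd prime

module QuarticModel (𝔽 : Field) (2≉0 : TwoNonzero (Field.commutativeRing 𝔽)) (a₁ a₂ a₃ a₄ a₆ : CommutativeRing.Carrier (Field.commutativeRing 𝔽)) where
  open Field 𝔽 using (integral) renaming (commutativeRing to R)
  open CommutativeRing R
  open Formulas _+_ _*_ -_ 1# a₁ a₂ a₃ a₄ a₆ using (F)
  open IntSolver R using (solve)
  open import Relation.Binary.Reasoning.Setoid setoid

  b₂ b₄ b₆ b₈ : Carrier
  b₂ = a₁ * a₁ + (1# + 1#) * (1# + 1#) * a₂
  b₄ = (1# + 1#) * a₄ + a₁ * a₃
  b₆ = a₃ * a₃ + (1# + 1#) * (1# + 1#) * a₆
  b₈ = a₁ * a₁ * a₆ + (1# + 1#) * (1# + 1#) * a₂ * a₆ - a₁ * a₃ * a₄ + a₂ * a₃ * a₃ - a₄ * a₄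

  b-relation : b₄ * b₄ + (1# + 1#) * (1# + 1#) * b₈ ≈ b₂ * b₆
  b-relation = solve 5 (λ a₁ a₂ a₃ a₄ a₆ → let t = con (+ 1) :+ con (+ 1) in
    (t :* a₄ :+ a₁ :* a₃) :* (t :* a₄ :+ a₁ :* a₃) :+ t :* t :* (a₁ :* a₁ :* a₆ :+ t :* t :* a₂ :* a₆ :- a₁ :* a₃ :* a₄ :+ a₂ :* a₃ :* a₃ :- a₄ :* a₄)
    := (a₁ :* a₁ :+ t :* t :* a₂) :* (a₃ :* a₃ :+ t :* t :* a₆)) refl a₁ a₂ a₃ a₄ a₆

  -- The affine coordinates x and 2y + a₁x + a₃; the argument i stands for 1/Z.
  tau eta : V3 Carrier → Carrier → Carrier
  tau v i = X v * i
  eta v i = ((1# + 1#) * Y v + a₁ * X v + a₃ * Z v) * i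

  on-quartic : ∀ v i → F v ≈ 0# → Z v * i ≈ 1# → let τ = tau v i in
    eta v i * eta v i ≈ (1# + 1#) * (1# + 1#) * (τ * τ * τ) + b₂ * (τ * τ) + (1# + 1#) * b₄ * τ + b₆
  on-quartic v@(vec x y z) i Fv zi = begin
    η * η ≈⟨ *-identityʳ _ ⟨
    η * η * 1# ≈⟨ *-congˡ zi ⟨
    -- Every use of zi = 1 is kept as a factor zi, which turns the claim into an identity for the
    -- solver.
    η * η * (z * i) ≈⟨ solve 9 (λ a₁ a₂ a₃ a₄ a₆ x y z i → let t = con (+ 1) :+ con (+ 1) ; τ = x :* i ; η = (t :* y :+ a₁ :* x :+ a₃ :* z) :* i in
        η :* η :* (z :* i) := t :* t :* (Formulas.F _:+_ _:*_ :-_ (con (+ 1)) a₁ a₂ a₃ a₄ a₆ (vec x y z)) :* (i :* i :* i)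
          :+ (t :* t :* (τ :* τ :* τ) :+ (a₁ :* a₁ :+ t :* t :* a₂) :* (τ :* τ) :* (z :* i) :+ t :* (t :* a₄ :+ a₁ :* a₃) :* τ :* (z :* i) :* (z :* i) :+ (a₃ :* a₃ :+ t :* t :* a₆) :* (z :* i) :* (z :* i) :* (z :* i))) refl a₁ a₂ a₃ a₄ a₆ x y z i ⟩
    (1# + 1#) * (1# + 1#) * F v * (i * i * i) + (q (z * i)) ≈⟨ +-cong (*-congʳ (*-congˡ Fv)) (q-cong zi) ⟩
    (1# + 1#) * (1# + 1#) * 0# * (i * i * i) + q 1# ≈⟨ solve 7 (λ i τ b₂ b₄ b₆ k l → let t = con (+ 1) :+ con (+ 1) in t :* t :* con (+ 0) :* (i :* i :* i) :+ (t :* t :* (τ :* τ :* τ) :+ b₂ :* (τ :* τ) :* con (+ 1) :+ t :* b₄ :* τ :* con (+ 1) :* con (+ 1) :+ b₆ :* con (+ 1) :* con (+ 1) :* con (+ 1))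
       := t :* t :* (τ :* τ :* τ) :+ b₂ :* (τ :* τ) :+ t :* b₄ :* τ :+ b₆) refl i τ b₂ b₄ b₆ 0# 0# ⟩
    (1# + 1#) * (1# + 1#) * (τ * τ * τ) + b₂ * (τ * τ) + (1# + 1#) * b₄ * τ + b₆ ∎
    where
    τ = tau v i
    η = eta v i
    q : Carrier → Carrier
    q k = (1# + 1#) * (1# + 1#) * (τ * τ * τ) + b₂ * (τ * τ) * k + (1# + 1#) * b₄ * τ * k * k + b₆ * k * k * k
    q-cong : ∀ {k l} → k ≈ l → q k ≈ q l
    q-cong e = +-cong (+-cong (+-congˡ (*-congˡ e)) (*-cong (*-congˡ e) e)) (*-cong (*-cong (*-congˡ e) e) e)

  private
    scaled : ∀ {z i z′ i′} a b → z * i ≈ 1# → z′ * i′ ≈ 1# → a * i ≈ b * i′ → z′ * a ≈ z * b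
    scaled {z} {i} {z′} {i′} a b zi zi′ e = begin
      z′ * a ≈⟨ trans (*-congʳ zi) (*-identityˡ _) ⟨
      z * i * (z′ * a) ≈⟨ solve 4 (λ z i w a → z :* i :* (w :* a) := z :* w :* (a :* i)) refl z i z′ a ⟩
      z * z′ * (a * i) ≈⟨ *-congˡ e ⟩
      z * z′ * (b * i′) ≈⟨ solve 4 (λ z w b i → z :* w :* (b :* i) := w :* i :* (z :* b)) refl z z′ b i′ ⟩
      z′ * i′ * (z * b) ≈⟨ trans (*-congʳ zi′) (*-identityˡ _) ⟩
      z * b ∎

  same-point : ∀ v v′ i i′ → Z v * i ≈ 1# → Z v′ * i′ ≈ 1# → tau v i ≈ tau v′ i′ → eta v i ≈ eta v′ i′ →
    Z v′ * X v ≈ Z v * X v′ × Z v′ * Y v ≈ Z v * Y v′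
  same-point v v′ i i′ zi zi′ eτ eη = x≈ , y≈
    where
    x≈ : Z v′ * X v ≈ Z v * X v′
    x≈ = scaled (X v) (X v′) zi zi′ eτ
    t = 1# + 1#
    e : Z v′ * (t * Y v + a₁ * X v + a₃ * Z v) ≈ Z v * (t * Y v′ + a₁ * X v′ + a₃ * Z v′)
    e = scaled _ _ zi zi′ eη
    diff : t * (Z v′ * Y v - Z v * Y v′) ≈ 0#
    diff = begin
      t * (Z v′ * Y v - Z v * Y v′) ≈⟨ solve 9 (λ t a₁ a₃ x y z x′ y′ z′ → t :* (z′ :* y :- z :* y′) := (z′ :* (t :* y :+ a₁ :* x :+ a₃ :* z) :- z :* (t :* y′ :+ a₁ :* x′ :+ a₃ :* z′)) :- a₁ :* (z′ :* x :- z :* x′)) refl t a₁ a₃ (X v) (Y v) (Z v) (X v′) (Y v′) (Z v′) ⟩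
      (Z v′ * (t * Y v + a₁ * X v + a₃ * Z v) - Z v * (t * Y v′ + a₁ * X v′ + a₃ * Z v′)) - a₁ * (Z v′ * X v - Z v * X v′) ≈⟨ +-cong (trans (+-congʳ e) (-‿inverseʳ _)) (-‿cong (*-congˡ (trans (+-congʳ x≈) (-‿inverseʳ _)))) ⟩
      0# - a₁ * 0# ≈⟨ solve 1 (λ a → con (+ 0) :- a :* con (+ 0) := con (+ 0)) refl a₁ ⟩
      0# ∎
    y≈ : Z v′ * Y v ≈ Z v * Y v′
    y≈ = [ (λ z → ⊥-elim (2≉0 z)) , (λ z → trans (solve 2 (λ a b → a := (a :- b) :+ b) refl _ _) (trans (+-congʳ z) (+-identityˡ _))) ]′ (integral t _ diff)

-- Periodicity, lifting and the rank bound for the sequence D at one prime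

record SequenceData : Set₁ where
  field
    local : LocalData
  open LocalData local public
  field
    inf : InfiniteOrder E (just (x , y))
    D : ℕ → ℕ
    eds : IsEDS E (just (x , y)) D

module Sequence (sequence : SequenceData) where
  open SequenceData sequence
  private
    module Fp = Residue res
  open Local local
  open Iteration local
  open RationalCurve E using (module Cℚ; ⊖_; rep-negate; _Represents_; at∞; represents)

  private
    is-affine : ∀ (s : Point) → s ≢ nothing → ∃[ x′ ] ∃[ y′ ] s ≡ just (x′ , y′)
    is-affine nothing ne = ⊥-elim (ne ≡.refl)
    is-affine (just (x′ , y′)) ne = x′ , y′ , ≡.refl

    at-affine : ∀ {n s x′ y′} → 1 ≤ n → mulPt E n P ≡ s → s ≡ just (x′ , y′) → ∀ k (S : LocalRep s) →
      (p N.^ suc k ND.∣ D n → Near k (V S)) × (+ (p N.^ k) ∣ℤ X (V S) → + p ∣ℤ X (V S) → + p ∣ℤ Z (V S) → p N.^ k ND.∣ D n)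
    at-affine {n} {s} {x′} {y′} 1≤n e ≡.refl k S = Denominator.∣⇒near S (D n) (eds n x′ y′ 1≤n e) k , Denominator.near⇒∣ S (D n) (eds n x′ y′ 1≤n e) k

  ∣D⇒near : ∀ k {n} → 1 ≤ n → (S : LocalRep (mulPt E n P)) → p N.^ suc k ND.∣ D n → Near k (V S)
  ∣D⇒near k {n} 1≤n S = proj₁ (at-affine 1≤n ≡.refl (proj₂ (proj₂ (is-affine (mulPt E n P) (inf n 1≤n)))) k S)

  near⇒∣D : ∀ k {n} → 1 ≤ n → (S : LocalRep (mulPt E n P)) → + (p N.^ k) ∣ℤ X (V S) → + p ∣ℤ X (V S) → + p ∣ℤ Z (V S) → p N.^ k ND.∣ D n
  near⇒∣D k {n} 1≤n S = proj₂ (at-affine 1≤n ≡.refl (proj₂ (proj₂ (is-affine (mulPt E n P) (inf n 1≤n)))) k S)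

  near⇒∣D′ : ∀ k {n} → 1 ≤ n → (S : LocalRep (mulPt E n P)) → Near k (V S) → p N.^ suc k ND.∣ D n
  near⇒∣D′ k 1≤n S nr = near⇒∣D (suc k) 1≤n S (proj₁ nr) (proj₁ (near-p {k} {V S} nr)) (proj₂ (near-p {k} {V S} nr))

  period : ∀ k r n → 1 ≤ r → 1 ≤ n → p N.^ suc k ND.∣ D r →
    (p N.^ suc k ND.∣ D n → p N.^ suc k ND.∣ D (n N.+ r)) × (p N.^ suc k ND.∣ D (n N.+ r) → p N.^ suc k ND.∣ D n)
  period k r n 1≤r 1≤n d = up c , down c
    where
    M = + (p N.^ suc k)
    S = mul-rep r
    c : Congruent M (mulPt E (n N.+ r) P) (mulPt E n P)
    c = ≡.subst (λ i → Congruent M (mulPt E (n N.+ r) P) (mulPt E i P)) (NP.+-identityʳ n)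
      (congruent-mul {M} {r} {0} (p∣p^suc k) (S , origin , sim-origin {k} S (∣D⇒near k 1≤r S d)) n)
    up : Congruent M (mulPt E (n N.+ r) P) (mulPt E n P) → p N.^ suc k ND.∣ D n → p N.^ suc k ND.∣ D (n N.+ r)
    up (T , U , sim) h = near⇒∣D′ k (NP.≤-trans 1≤n (NP.m≤m+n n r)) T (near-sim {k} {V T} {V U} sim (∣D⇒near k 1≤n U h))
    down : Congruent M (mulPt E (n N.+ r) P) (mulPt E n P) → p N.^ suc k ND.∣ D (n N.+ r) → p N.^ suc k ND.∣ D n
    down (T , U , sim) h = near⇒∣D′ k 1≤n U (near-sim {k} {V U} {V T} (sim-sym {M} {V T} {V U} sim) (∣D⇒near k (NP.≤-trans 1≤n (NP.m≤m+n n r)) T h))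

  multiples : ∀ k n j → 1 ≤ n → p N.^ suc k ND.∣ D n → p N.^ suc k ND.∣ D (suc j N.* n)
  multiples k n zero 1≤n d = ≡.subst (λ i → p N.^ suc k ND.∣ D i) (≡.sym (NP.+-identityʳ n)) d
  multiples k n (suc j) 1≤n d = ≡.subst (λ i → p N.^ suc k ND.∣ D i) (NP.+-comm (suc j N.* n) n)
    (proj₁ (period k n (suc j N.* n) 1≤n (NP.≤-trans 1≤n (NP.m≤m+n n (j N.* n))) d) (multiples k n j 1≤n d))

  module Lift (k n : ℕ) (1≤n : 1 ≤ n) (d : p N.^ suc k ND.∣ D n) where
    open IntSolver ZP.+-*-commutativeRing using (solve)
    private
      M M′ : ℤ
      M = + (p N.^ suc k)
      M′ = + (p N.^ suc (suc k))
      R = mul-rep n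
      R-near = ∣D⇒near k 1≤n R d
      x* = X (V R)
      y* = Y (V R)
      y*∤ : ¬ + p ∣ℤ y*
      y*∤ h = prim R (proj₁ (near-p {k} {V R} R-near) , h , proj₂ (near-p {k} {V R} R-near))

    negated-rep : LocalRep (⊖ mulPt E n P)
    negated-rep = record { V = vec x* ȳ (Z (V R)) ; prim = pm ; isRep = ≡.subst (_Represents (⊖ mulPt E n P)) eq (represents-negate (isRep R)) ; near = near R }
      where
      ȳ = Z.- (y* Z.+ (a₁ E Z.* x* Z.+ a₃ E Z.* Z (V R)))
      pm : ¬ (+ p ∣ℤ x* × + p ∣ℤ ȳ × + p ∣ℤ Z (V R))
      pm (dx , dy , dz) = prim R (dx , ≡.subst (+ p ∣ℤ_) (solve 5 (λ a b x y z → (:- (:- (y :+ (a :* x :+ b :* z)))) :- (a :* x :+ b :* z) := y) ≡.refl (a₁ E) (a₃ E) x* y* (Z (V R)))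
        (ZD.∣m∣n⇒∣m-n (ZD.∣m⇒∣-m dy) (ZD.∣m∣n⇒∣m+n (ZD.∣n⇒∣m*n (a₁ E) dx) (ZD.∣n⇒∣m*n (a₃ E) dz))) , dz)
      represents-negate : ∀ {v s} → v Represents s → Cℚ.negate v Represents (⊖ s)
      represents-negate {v} (represents r Fv) = represents (rep-negate r) (≡.trans (Cℚ.F-negate v) Fv)
      eq : Cℚ.negate (toℚ³ (V R)) ≡ toℚ³ (vec x* ȳ (Z (V R)))
      eq = ≡.cong (λ u → vec (toℚ x*) u (toℚ (Z (V R)))) (≡.sym (toℚ-eval (neg (add varY (add (mul (par (a₁ E)) varX) (mul (par (a₃ E)) varZ)))) (V R)))

    -- The scales y*, y*ȳ and ȳ give all three vectors the same Y. In X and Z the second difference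
    -- is (y* + ȳ)a = -(a₁x + a₃z)a, a product of two multiples of p^(k+1).
    base : Progressions k (⊖ mulPt E n P) nothing (mulPt E n P)
    base = negated-rep , origin , R , y* , y* Z.* ȳ , ȳ , y*∤ , ∤* y*∤ ȳ∤ , ȳ∤ , prog x* (proj₁ R-near) , progY , prog (Z (V R)) (proj₂ R-near)
      where
      ȳ = Y (V negated-rep)
      ȳ∤ : ¬ + p ∣ℤ ȳ
      ȳ∤ h = prim negated-rep (proj₁ (near-p {k} {V R} R-near) , h , proj₂ (near-p {k} {V R} R-near))
      prog : ∀ a → M ∣ℤ a → Progression M M′ (y* Z.* a) (y* Z.* ȳ Z.* + 0) (ȳ Z.* a)
      prog a da = progression
        (≡.subst (M ∣ℤ_) (solve 3 (λ y z a → :- (y :* a) := y :* z :* con (+ 0) :- y :* a) ≡.refl y* ȳ a) (ZD.∣m⇒∣-m (ZD.∣n⇒∣m*n y* da)))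
        (≡.subst (M ∣ℤ_) (solve 3 (λ y z a → z :* a := z :* a :- y :* z :* con (+ 0)) ≡.refl y* ȳ a) (ZD.∣n⇒∣m*n ȳ da))
        (≡.subst (M′ ∣ℤ_) (solve 6 (λ b c y x z a → let w = :- (y :+ (b :* x :+ c :* z)) in :- (b :* x :+ c :* z) :* a := (w :* a :- y :* w :* con (+ 0)) :- (y :* w :* con (+ 0) :- y :* a)) ≡.refl (a₁ E) (a₃ E) y* x* (Z (V R)) a)
          (k²∣ (p^∣square k) (ZD.∣m⇒∣-m (ZD.∣m∣n⇒∣m+n (ZD.∣n⇒∣m*n (a₁ E) (proj₁ R-near)) (ZD.∣n⇒∣m*n (a₃ E) (proj₂ R-near)))) da))
      progY : Progression M M′ (y* Z.* ȳ) (y* Z.* ȳ Z.* + 1) (ȳ Z.* y*)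
      progY = progression
        (≡.subst (M ∣ℤ_) (solve 2 (λ y z → con (+ 0) := y :* z :* con (+ 1) :- y :* z) ≡.refl y* ȳ) (divides (+ 0) ≡.refl))
        (≡.subst (M ∣ℤ_) (solve 2 (λ y z → con (+ 0) := z :* y :- y :* z :* con (+ 1)) ≡.refl y* ȳ) (divides (+ 0) ≡.refl))
        (≡.subst (M′ ∣ℤ_) (solve 2 (λ y z → con (+ 0) := (z :* y :- y :* z :* con (+ 1)) :- (y :* z :* con (+ 1) :- y :* z)) ≡.refl y* ȳ) (divides (+ 0) ≡.refl))

    progressions : ∀ j → Progressions k (mulPt E (j N.* n) P) (mulPt E (suc j N.* n) P) (mulPt E (suc (suc j) N.* n) P)
    progressions zero = convert (iter-⊖ n) (iter-mul n 0) (≡.trans (iter-mul n n) (≡.cong (λ i → mulPt E (n N.+ i) P) (≡.sym (NP.+-identityʳ n))))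
      (progressions-iter n {k} {⊖ mulPt E n P} {nothing} {mulPt E n P} base)
      where
      convert : ∀ {s₀ s₁ s₂ t₀ t₁ t₂} → s₀ ≡ t₀ → s₁ ≡ t₁ → s₂ ≡ t₂ → Progressions k s₀ s₁ s₂ → Progressions k t₀ t₁ t₂
      convert ≡.refl ≡.refl ≡.refl h = h
    progressions (suc j) = convert (iter-mul n (j N.* n)) (iter-mul n (suc j N.* n)) (iter-mul n (suc (suc j) N.* n))
      (progressions-iter n {k} {mulPt E (j N.* n) P} {mulPt E (suc j N.* n) P} {mulPt E (suc (suc j) N.* n) P} (progressions j))
      where
      convert : ∀ {s₀ s₁ s₂ t₀ t₁ t₂} → s₀ ≡ t₀ → s₁ ≡ t₁ → s₂ ≡ t₂ → Progressions k s₀ s₁ s₂ → Progressions k t₀ t₁ t₂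
      convert ≡.refl ≡.refl ≡.refl h = h

    multiple-near : ∀ j (S : LocalRep (mulPt E (j N.* n) P)) → Near k (V S)
    multiple-near zero S = origin-near k S
    multiple-near (suc j) S = ∣D⇒near k (NP.≤-trans 1≤n (NP.m≤m+n n (j N.* n))) S (multiples k n j 1≤n d)

    -- X/Y at jnP is j times X/Y at nP modulo p^(k+2), with denominators cleared: the additive
    -- behaviour of the formal group to first order.
    Linear : ℤ → V3 ℤ → Set
    Linear j W = M′ ∣ℤ y* Z.* X W Z.- j Z.* x* Z.* Y W

    linear-any : ∀ {j s} (S S′ : LocalRep s) → Near k (V S) → Linear j (V S) → Linear j (V S′)
    linear-any {j} S S′ nr h = unit-cancel (suc (suc k)) {Y (V S)} (λ e → prim S (proj₁ (near-p {k} {V S} nr) , e , proj₂ (near-p {k} {V S} nr)))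
      (≡.subst (M′ ∣ℤ_) (≡.trans (solve 6 (λ a b c e f g → c :* (a :* e :- f :* b :* g) := a :* (e :* c) :- f :* b :* (g :* c)) ≡.refl y* x* (Y (V S′)) (X (V S)) j (Y (V S)))
        (≡.trans (≡.cong (λ u → y* Z.* u Z.- j Z.* x* Z.* (Y (V S) Z.* Y (V S′))) (cross S S′))
          (solve 6 (λ a b c e f g → a :* (e :* g) :- f :* b :* (g :* c) := g :* (a :* e :- f :* b :* c)) ≡.refl y* x* (Y (V S′)) (X (V S′)) j (Y (V S)))))
        (ZD.∣n⇒∣m*n (Y (V S′)) h))

    linear-next : ∀ j → (∀ (S : LocalRep (mulPt E (j N.* n) P)) → Linear (+ j) (V S)) → (∀ (S : LocalRep (mulPt E (suc j N.* n) P)) → Linear (+ suc j) (V S)) →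
      ∀ (S : LocalRep (mulPt E (suc (suc j) N.* n) P)) → Linear (+ suc (suc j)) (V S)
    linear-next j linear₀ linear₁ S = next (progressions j)
      where
      next : Progressions k (mulPt E (j N.* n) P) (mulPt E (suc j N.* n) P) (mulPt E (suc (suc j) N.* n) P) → Linear (+ suc (suc j)) (V S)
      next (S₀ , S₁ , S₂ , u₀ , u₁ , u₂ , n₀ , n₁ , n₂ , pX , pY , pZ) = linear-any {+ suc (suc j)} S₂ S (multiple-near (suc (suc j)) S₂)
        (unit-cancel (suc (suc k)) {u₂} n₂ (≡.subst (M′ ∣ℤ_) (≡.trans (unscale u₂ (X (V S₂)) (Y (V S₂)) (+ j Z.+ + 2)) (≡.cong (λ i → u₂ Z.* (y* Z.* X (V S₂) Z.- + i Z.* x* Z.* Y (V S₂))) (NP.+-comm j 2)))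
          (progression-next x* y* _ _ _ _ _ _ (+ j) (p^∣square k) (proj₁ R-near) pX pY
            (≡.subst (M′ ∣ℤ_) (≡.sym (unscale u₀ (X (V S₀)) (Y (V S₀)) (+ j))) (ZD.∣n⇒∣m*n u₀ (linear₀ S₀)))
            (≡.subst (M′ ∣ℤ_) (≡.sym (unscale u₁ (X (V S₁)) (Y (V S₁)) (+ j Z.+ + 1))) (ZD.∣n⇒∣m*n u₁ (≡.subst (λ i → Linear (+ i) (V S₁)) (NP.+-comm 1 j) (linear₁ S₁)))))))
        where
        unscale : ∀ u a b i → y* Z.* (u Z.* a) Z.- i Z.* x* Z.* (u Z.* b) ≡ u Z.* (y* Z.* a Z.- i Z.* x* Z.* b)
        unscale u a b i = solve 6 (λ y x u a b i → y :* (u :* a) :- i :* x :* (u :* b) := u :* (y :* a :- i :* x :* b)) ≡.refl y* x* u a b i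

    linear : ∀ j (S : LocalRep (mulPt E (j N.* n) P)) → Linear (+ j) (V S)
    linear zero S = zeros (isRep S)
      where
      zeros : toℚ³ (V S) Represents nothing → Linear (+ 0) (V S)
      zeros (represents (at∞ x0 _ _) _) = ≡.subst (M′ ∣ℤ_) (≡.trans (solve 3 (λ a b c → con (+ 0) := a :* con (+ 0) :- con (+ 0) :* b :* c) ≡.refl y* x* (Y (V S)))
        (≡.cong (λ u → y* Z.* u Z.- + 0 Z.* x* Z.* Y (V S)) (≡.sym (toℚ-zero x0)))) (divides (+ 0) ≡.refl)
    linear (suc zero) S = linear-any {+ 1} R′ S (multiple-near 1 R′) (from (mul-rep-≡ (NP.+-identityʳ n)))
      where
      R′ = mul-rep (1 N.* n)
      mul-rep-≡ : ∀ {i} → i ≡ n → V (mul-rep i) ≡ V R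
      mul-rep-≡ ≡.refl = ≡.refl
      from : V R′ ≡ V R → Linear (+ 1) (V R′)
      from e = ≡.subst (Linear (+ 1)) (≡.sym e) (≡.subst (M′ ∣ℤ_) (solve 2 (λ a b → con (+ 0) := a :* b :- con (+ 1) :* b :* a) ≡.refl y* x*) (divides (+ 0) ≡.refl))
    linear (suc (suc j)) = linear-next j (linear j) (linear (suc j))

    lift : p N.^ suc (suc k) ND.∣ D (p N.* n)
    lift = near⇒∣D (suc (suc k)) 1≤pn S X∣ (proj₁ (near-p {k} {V S} nr)) (proj₂ (near-p {k} {V S} nr))
      where
      1≤p : 1 ≤ p
      1≤p = N.>-nonZero⁻¹ p {{prime⇒nonZero pr}}
      1≤pn : 1 ≤ p N.* n
      1≤pn = NP.*-mono-≤ 1≤p 1≤n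
      S = mul-rep (p N.* n)
      nr = multiple-near p S
      X∣ : M′ ∣ℤ X (V S)
      -- For j = p the right side contains p · x*, and the factor p supplies the extra power.
      X∣ = unit-cancel (suc (suc k)) {y*} y*∤ (ZD.∣m+n∣n⇒∣m {m = y* Z.* X (V S)} (linear p S)
        (ZD.∣m⇒∣-m (ZD.∣m⇒∣m*n (Y (V S)) (≡.subst (_∣ℤ + p Z.* x*) (≡.sym (p^suc (suc k))) (ZD.*-monoʳ-∣ (+ p) (proj₁ R-near))))))

  -- The rank is r + 1, so P, ..., rP reduce to r distinct affine points; these are the points fed
  -- into the count.
  module Hasse {m : ℕ} (p+1≡m+m : suc p ≡ m N.+ m) (2∤ : ¬ + p ∣ℤ + 2) (r : ℕ) (rank : IsRank D p (suc r)) where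
    open Fp using (π; π³; _≈_; _*_; _+_; 1#; 0#; ring)
    private
      1≤ = λ {i} → s≤s (z≤n {i})
      p^1 : ∀ {i} → p ND.∣ i → p N.^ 1 ND.∣ i
      p^1 {i} = ≡.subst (ND._∣ i) (≡.sym (NP.*-identityʳ p))
      p^1⁻ : ∀ {i} → p N.^ 1 ND.∣ i → p ND.∣ i
      p^1⁻ {i} = ≡.subst (ND._∣ i) (NP.*-identityʳ p)

    2≉0 : ¬ 1# + 1# ≈ 0#
    2≉0 e = 2∤ (Fp.π-0 (Fp.trans (Fp.π-+ (+ 1) (+ 1)) (Fp.trans (Fp.+-cong Fp.π-1 Fp.π-1) e)))

    open QuarticModel Fp.𝔽 2≉0 (π (a₁ E)) (π (a₂ E)) (π (a₃ E)) (π (a₄ E)) (π (a₆ E))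

    quartic-data : QuarticData
    quartic-data = record { 𝔽 = Fp.𝔽 ; p = p ; m = m ; p-prime = pr ; p+1≡m+m = p+1≡m+m ; char = Fp.char ; fermat = Fp.fermat ; 2≉0 = 2≉0
      ; b₂ = b₂ ; b₄ = b₄ ; b₆ = b₆ ; b₈ = b₈ ; b-relation = b-relation }
    module M = Manin quartic-data

    recip : Fp.Carrier → Fp.Carrier
    recip a with a Fp.≟0
    ... | yes _ = 0#
    ... | no n = proj₁ (Fp.inverse a n)

    recip-inverse : ∀ a → ¬ a ≈ 0# → a * recip a ≈ 1#
    recip-inverse a ne with a Fp.≟0
    ... | yes e = ⊥-elim (ne e)
    ... | no n = proj₂ (Fp.inverse a n)

    W : ℕ → V3 Fp.Carrier
    W i = π³ (V (mul-rep i))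

    point : ℕ → Fp.Carrier × Fp.Carrier
    point i = tau (W i) (recip (Z (W i))) , eta (W i) (recip (Z (W i)))

    finite : ∀ i → 1 ≤ i → i < suc r → ¬ Z (W i) ≈ 0#
    finite i 1≤i i<r e = proj₂ (proj₂ rank) i 1≤i i<r (p^1⁻ (near⇒∣D 1 1≤i S (≡.subst (λ j → + j ∣ℤ X (V S)) (≡.sym (NP.*-identityʳ p)) dX) dX dZ))
      where
      S = mul-rep i
      dZ = Fp.π-0 e
      dX = proj₁ (infinite S dZ)

    inverse-at : ∀ i → 1 ≤ i → i < suc r → Z (W i) * recip (Z (W i)) ≈ 1#
    inverse-at i 1≤i i<r = recip-inverse (Z (W i)) (finite i 1≤i i<r)

    on-curve : ∀ i → 1 ≤ i → i < suc r → M.OnQuartic (point i)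
    on-curve i 1≤i i<r = on-quartic (W i) (recip (Z (W i))) (F≈0 {V (mul-rep i)} (isRep (mul-rep i))) (inverse-at i 1≤i i<r)

    -- The first return of the orbit to the origin is at the rank, so the points before it are distinct.
    apart : ∀ i j → 1 ≤ i → i < j → j < suc r → M.Apart (point j) (point i)
    apart i j 1≤i i<j j<r (eτ , eη) = proj₂ (proj₂ rank) l 1≤l l<r (p^1⁻ (conclude c))
      where
      1≤j = NP.≤-trans 1≤i (NP.<⇒≤ i<j)
      same = same-point (W j) (W i) (recip (Z (W j))) (recip (Z (W i))) (inverse-at j 1≤j j<r) (inverse-at i 1≤i (NP.<-trans i<j j<r)) eτ eη
      Vi = V (mul-rep i)
      Vj = V (mul-rep j)
      to : ∀ {a b c d} → π a * π b ≈ π c * π d → a Z.* b ≡ c Z.* d [ + p ]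
      to {a} {b} {c} {d} e = Fp.π-inj (Fp.trans (Fp.π-* a b) (Fp.trans e (Fp.sym (Fp.π-* c d))))
      sim : Sim (+ p) Vi Vj
      sim = Z Vj , Z Vi , (λ h → finite j 1≤j j<r (Fp.π-∣ h)) , (λ h → finite i 1≤i (NP.<-trans i<j j<r) (Fp.π-∣ h)) ,
        to (Fp.sym (proj₁ same)) , to (Fp.sym (proj₂ same)) , CommutativeRing.reflexive (cong-ring (+ p)) (ZP.*-comm (Z Vj) (Z Vi))
      -- If iP ≡ jP, then g more translations bring jP to the origin and iP to lP with 1 ≤ l < r +
      -- 1, an earlier return.
      g = suc r N.∸ j
      l = g N.+ i
      g+j≡r : g N.+ j ≡ suc r
      g+j≡r = NP.m∸n+n≡m (NP.<⇒≤ j<r)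
      1≤l : 1 ≤ l
      1≤l = NP.≤-trans 1≤i (NP.m≤n+m i g)
      l<r : l < suc r
      l<r = ≡.subst (l <_) g+j≡r (NP.+-monoʳ-< g i<j)
      c : Congruent (+ p) (mulPt E l P) (mulPt E (suc r) P)
      c = ≡.subst (λ n → Congruent (+ p) (mulPt E l P) (mulPt E n P)) g+j≡r (congruent-mul {+ p} {i} {j} ZD.∣-refl (mul-rep i , mul-rep j , sim) g)
      conclude : Congruent (+ p) (mulPt E l P) (mulPt E (suc r) P) → p N.^ 1 ND.∣ D l
      conclude (S , T , s) = near⇒∣D′ 0 1≤l S (near-sim {0} {V S} {V T} (≡.subst (λ q → Sim (+ q) (V S) (V T)) (≡.sym (NP.*-identityʳ p)) s) (∣D⇒near 0 1≤ T (p^1 (proj₁ (proj₂ rank)))))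

    points : ℕ → List (Fp.Carrier × Fp.Carrier)
    points zero = []
    points (suc n) = point (suc n) ∷ points n

    points-length : ∀ n → length (points n) ≡ n
    points-length zero = ≡.refl
    points-length (suc n) = ≡.cong suc (points-length n)

    points-all : ∀ {Q : Fp.Carrier × Fp.Carrier → Set} n → (∀ i → 1 ≤ i → i ≤ n → Q (point i)) → All Q (points n)
    points-all zero h = []
    points-all (suc n) h = h (suc n) 1≤ NP.≤-refl ∷ points-all n (λ i 1≤i i≤n → h i 1≤i (NP.m≤n⇒m≤1+n i≤n))

    points-apart : ∀ n → n < suc r → AllPairs M.Apart (points n)
    points-apart zero _ = []
    points-apart (suc n) n<r = points-all n (λ i 1≤i i≤n → apart i (suc n) 1≤i (s≤s i≤n) n<r) ∷ points-apart n (NP.<-trans (NP.n<1+n n) n<r)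

    hasse : ∀ n → n N.* r ≤ p N.+ n N.* p N.+ n N.* n
    hasse n = ≡.subst (λ l → n N.* l ≤ p N.+ n N.* p N.+ n N.* n) (points-length r)
      (M.point-count (points r) (points-apart r NP.≤-refl) (points-all r (λ i 1≤i i≤r → on-curve i 1≤i (s≤s i≤r))) n)

-- Primitive coordinates of P and its nonsingular reduction at every prime

module ReducedDiscriminant (E : Weierstrass) {p : ℕ} (res : Residue p) where
  open Residue res
  private
    module FS = IntSolver ring
    module Disc′ = Discriminant 𝔽 (π (a₁ E)) (π (a₂ E)) (π (a₃ E)) (π (a₄ E)) (π (a₆ E))
    module C = OverField.Cubic 𝔽 (π (a₁ E)) (π (a₂ E)) (π (a₃ E)) (π (a₄ E)) (π (a₆ E)) using (F; FX; FY; _•_; _≈ᵛ_; FX-cong; FY-cong; F-cong; F-scale; veq)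
  open RationalCurve E using (disc-expr)

  π-fromℤ : ∀ n → π (+ n) ≈ FS.fromℤ (+ n)
  π-fromℤ zero = π-∣ (divides (+ 0) ≡.refl)
  π-fromℤ (suc n) = trans (π-+ (+ 1) (+ n)) (trans (+-cong π-1 (trans (π-fromℤ n) (FS.fromℤ-pos n))) (sym (FS.fromℤ-pos (suc n))))

  π-disc : π (disc E) ≈ Disc′.D Disc′.b₂ Disc′.b₄ Disc′.b₆ Disc′.b₈
  π-disc = trans (π-eval disc-expr (vec (+ 0) (+ 0) (+ 0)))
    (+-cong (+-cong (+-cong (-‿cong (*-cong (*-cong b₂ b₂) b₈)) (-‿cong (*-cong (*-cong (*-cong (π-fromℤ 8) b₄) b₄) b₄))) (-‿cong (*-cong (*-cong (π-fromℤ 27) b₆) b₆))) (*-cong (*-cong (*-cong (π-fromℤ 9) b₂) b₄) b₆))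
    where
    b₂ = +-congˡ (*-congʳ (π-fromℤ 4))
    b₄ = +-congʳ (*-congʳ (π-fromℤ 2))
    b₆ = +-congˡ (*-congʳ (π-fromℤ 4))
    b₈ = +-congʳ (+-congʳ (+-congʳ (+-congˡ (*-congʳ (*-congʳ (π-fromℤ 4))))))

  good-smooth : GoodReduction E p → ∀ v → ¬ Z v ≈ 0# → C.F v ≈ 0# → ¬ (C.FX v ≈ 0# × C.FY v ≈ 0#)
  good-smooth good v z≉ Fv (FX0 , FY0) with inverse (Z v) z≉
  ... | i , zi = good (ZD.∣⇒∣ᵤ (π-0 (trans π-disc (Disc′.singular⇒D≈0 (X v * i) (Y v * i)
        (trans (C.F-cong n≈) (trans (C.F-scale i v) (trans (*-congˡ Fv) (zeroʳ _))))
        (trans (C.FX-cong n≈) (trans (FX-scale (π (a₁ E)) (π (a₂ E)) (π (a₄ E)) i v) (trans (*-congˡ FX0) (zeroʳ _))))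
        (trans (C.FY-cong n≈) (trans (FY-scale (π (a₁ E)) (π (a₃ E)) i v) (trans (*-congˡ FY0) (zeroʳ _))))))))
    where
    open FS using (solve)
    n≈ : C._≈ᵛ_ (vec (X v * i) (Y v * i) 1#) (C._•_ i v)
    n≈ = C.veq (*-comm _ _) (*-comm _ _) (trans (sym zi) (*-comm _ _))
    FX-scale : ∀ b₁ b₂ b₄ c v → _
    FX-scale b₁ b₂ b₄ c (vec x y z) = solve 7 (λ b₁ b₂ b₄ c x y z → b₁ :* (c :* y :* (c :* z)) :- (con (+ 1) :+ (con (+ 1) :+ con (+ 1))) :* (c :* x :* (c :* x)) :- (con (+ 1) :+ con (+ 1)) :* (b₂ :* (c :* x :* (c :* z))) :- b₄ :* (c :* z :* (c :* z))
      := c :* c :* (b₁ :* (y :* z) :- (con (+ 1) :+ (con (+ 1) :+ con (+ 1))) :* (x :* x) :- (con (+ 1) :+ con (+ 1)) :* (b₂ :* (x :* z)) :- b₄ :* (z :* z))) refl b₁ b₂ b₄ c x y z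
    FY-scale : ∀ b₁ b₃ c v → _
    FY-scale b₁ b₃ c (vec x y z) = solve 6 (λ b₁ b₃ c x y z → (con (+ 1) :+ con (+ 1)) :* (c :* y :* (c :* z)) :+ b₁ :* (c :* x :* (c :* z)) :+ b₃ :* (c :* z :* (c :* z))
      := c :* c :* ((con (+ 1) :+ con (+ 1)) :* (y :* z) :+ b₁ :* (x :* z) :+ b₃ :* (z :* z))) refl b₁ b₃ c x y z

module Gradients (𝔽 : Field) (a₁ a₂ a₃ a₄ a₆ : CommutativeRing.Carrier (Field.commutativeRing 𝔽)) where
  open Field 𝔽 using () renaming (commutativeRing to R)
  open CommutativeRing R
  open OverField.Cubic 𝔽 a₁ a₂ a₃ a₄ a₆ using (FX; FY; 2#; 3#; FX-cong; FY-cong; veq)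
  open IntSolver R using (solve)
  FX-gradient : ∀ v x y → X v ≈ Z v * x → Y v ≈ Z v * y → FX v ≈ (a₁ * y - 3# * x * x - 2# * a₂ * x - a₄) * (Z v * Z v)
  FX-gradient (vec u w z) x y hx hy = trans (FX-cong {vec u w z} {vec (z * x) (z * y) z} (veq hx hy refl))
    (solve 6 (λ b₁ b₂ b₄ x y z → b₁ :* (z :* y :* z) :- (con (+ 1) :+ (con (+ 1) :+ con (+ 1))) :* (z :* x :* (z :* x)) :- (con (+ 1) :+ con (+ 1)) :* (b₂ :* (z :* x :* z)) :- b₄ :* (z :* z)
      := (b₁ :* y :- (con (+ 1) :+ (con (+ 1) :+ con (+ 1))) :* x :* x :- (con (+ 1) :+ con (+ 1)) :* b₂ :* x :- b₄) :* (z :* z)) refl a₁ a₂ a₄ x y z)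
  FY-gradient : ∀ v x y → X v ≈ Z v * x → Y v ≈ Z v * y → FY v ≈ (2# * y + a₁ * x + a₃) * (Z v * Z v)
  FY-gradient (vec u w z) x y hx hy = trans (FY-cong {vec u w z} {vec (z * x) (z * y) z} (veq hx hy refl))
    (solve 5 (λ b₁ b₃ x y z → (con (+ 1) :+ con (+ 1)) :* (z :* y :* z) :+ b₁ :* (z :* x :* z) :+ b₃ :* (z :* z)
      := ((con (+ 1) :+ con (+ 1)) :* y :+ b₁ :* x :+ b₃) :* (z :* z)) refl a₁ a₃ x y z)

numerator-cross : ∀ q z m → q Q.* toℚ z ≡ toℚ m → ℚ.numerator q Z.* z ≡ m Z.* ℚ.denominator q
numerator-cross q z m h = toℚ-injective (≡.trans (toℚ-* (ℚ.numerator q) z) (≡.trans (≡.cong (Q._* toℚ z) (≡.sym (num-den q)))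
  (≡.trans (QP.*-assoc q _ _) (≡.trans (≡.cong (q Q.*_) (QP.*-comm (toℚ (ℚ.denominator q)) (toℚ z))) (≡.trans (≡.sym (QP.*-assoc q _ _)) (≡.trans (≡.cong (Q._* toℚ (ℚ.denominator q)) h) (≡.sym (toℚ-* m (ℚ.denominator q)))))))))

module PrimitiveVectors (x y : ℚ) {p : ℕ} (pr : Prime p) where
  record Coordinates (v : V3 ℤ) : Set where
    field
      Z≢0 : Z v ≢ + 0
      X≡ : toℚ (X v) ≡ toℚ (Z v) Q.* x
      Y≡ : toℚ (Y v) ≡ toℚ (Z v) Q.* y
  open Coordinates public

  some-coordinates : ∃[ v ] Coordinates v
  some-coordinates = vec (n₁ Z.* d₂) (n₂ Z.* d₁) (d₁ Z.* d₂) , record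
    { Z≢0 = λ e → [ nz x , nz y ]′ (ZP.i*j≡0⇒i≡0∨j≡0 d₁ e)
    ; X≡ = ≡.trans (toℚ-* n₁ d₂) (≡.trans (≡.cong (Q._* toℚ d₂) (≡.sym (num-den x))) (≡.trans (s₁ ℚ-ring x (toℚ d₁) (toℚ d₂)) (≡.cong (Q._* x) (≡.sym (toℚ-* d₁ d₂)))))
    ; Y≡ = ≡.trans (toℚ-* n₂ d₁) (≡.trans (≡.cong (Q._* toℚ d₁) (≡.sym (num-den y))) (≡.trans (s₂ ℚ-ring y (toℚ d₁) (toℚ d₂)) (≡.cong (Q._* y) (≡.sym (toℚ-* d₁ d₂))))) }
    where
    n₁ = ℚ.numerator x
    d₁ = ℚ.denominator x
    n₂ = ℚ.numerator y
    d₂ = ℚ.denominator y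
    nz : ∀ q → ℚ.denominator q ≢ + 0
    nz q ()
    s₁ : ∀ (R : CommutativeRing 0ℓ 0ℓ) (let open CommutativeRing R) x d e → (x * d) * e ≈ (d * e) * x
    s₁ R x d e = solve 3 (λ x d e → (x :* d) :* e := (d :* e) :* x) (CommutativeRing.refl R) x d e
      where open IntSolver R using (solve)
    s₂ : ∀ (R : CommutativeRing 0ℓ 0ℓ) (let open CommutativeRing R) x d e → (x * e) * d ≈ (d * e) * x
    s₂ R x d e = solve 3 (λ x d e → (x :* e) :* d := (d :* e) :* x) (CommutativeRing.refl R) x d e
      where open IntSolver R using (solve)

  Primitiveᵥ : V3 ℤ → Set
  Primitiveᵥ v = ¬ (+ p ∣ℤ X v × + p ∣ℤ Y v × + p ∣ℤ Z v)

  private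
    p>1 : 1 < p
    p>1 = N.nonTrivial⇒n>1 p {{prime⇒nonTrivial pr}}

  -- Common factors p are removed one at a time; each removal shrinks the nonzero integer Z, whose
  -- size n bounds the recursion.
  primitive-coordinates : ∀ n v → Z.∣ Z v ∣ ≤ n → Coordinates v → ∃[ w ] Coordinates w × Primitiveᵥ w
  primitive-coordinates n v le c with (+ p ZD.∣? X v) ×-dec ((+ p ZD.∣? Y v) ×-dec (+ p ZD.∣? Z v))
  ... | no np = v , c , np
  primitive-coordinates zero v le c | yes _ = ⊥-elim (Z≢0 c (ZP.∣i∣≡0⇒i≡0 (NP.n≤0⇒n≡0 le)))
  primitive-coordinates (suc n) v le c | yes (divides a ea , divides b eb , divides e ee) = primitive-coordinates n (vec a b e) smaller record
      { Z≢0 = λ z → Z≢0 c (≡.trans ee (≡.cong (Z._* + p) z)) ; X≡ = descend {X v} {a} {x} ea (X≡ c) ; Y≡ = descend {Y v} {b} {y} eb (Y≡ c) }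
    where
    e≢0 : Z.∣ e ∣ ≢ 0
    e≢0 z = Z≢0 c (≡.trans ee (≡.cong (Z._* + p) {e} {+ 0} (ZP.∣i∣≡0⇒i≡0 z)))
    smaller : Z.∣ e ∣ ≤ n
    smaller = N.s≤s⁻¹ (NP.≤-trans (NP.≤-trans (NP.m<m*n Z.∣ e ∣ p {{N.≢-nonZero e≢0}} p>1) (NP.≤-reflexive (≡.trans (≡.sym (ZP.abs-* e (+ p))) (≡.cong Z.∣_∣ (≡.sym ee))))) le)
    p≢0 : toℚ (+ p) ≢ 0ℚ
    p≢0 h = N.≢-nonZero⁻¹ p {{prime⇒nonZero pr}} (ZP.+-injective (toℚ-injective {+ p} {+ 0} h))
    descend : ∀ {s a q} → s ≡ a Z.* + p → toℚ s ≡ toℚ (Z v) Q.* q → toℚ a ≡ toℚ e Q.* q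
    descend {s} {a} {q} es h = OverField.Cubic.cancel-* ℚ-field 0ℚ 0ℚ 0ℚ 0ℚ 0ℚ {toℚ (+ p)} {toℚ a} {toℚ e Q.* q} p≢0
      (≡.trans (QP.*-comm (toℚ (+ p)) (toℚ a)) (≡.trans (≡.sym (toℚ-* a (+ p))) (≡.trans (≡.cong toℚ (≡.sym es)) (≡.trans h (≡.trans (≡.cong (λ i → toℚ i Q.* q) ee)
        (≡.trans (≡.cong (Q._* q) (≡.trans (toℚ-* e (+ p)) (QP.*-comm (toℚ e) (toℚ (+ p))))) (QP.*-assoc (toℚ (+ p)) (toℚ e) q)))))))

module Global (E : Weierstrass) (ell : IsElliptic E) (x y : ℚ) (on : OnCurve E x y) (inf : InfiniteOrder E (just (x , y)))
  (D : ℕ → ℕ) (eds : IsEDS E (just (x , y)) D) (reg : ∀ p → Prime p → p ND.∣ Z.∣ disc E ∣ → NonsingularMod E p (just (x , y))) where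
  open RationalCurve E using (A₁; A₂; A₃; A₄; A₆; module Cℚ; affine-F; normal; _Represents_; affine; represents; onCurve)

  module AtPrime {p : ℕ} (pr : Prime p) (res : Residue p) where
    open PrimitiveVectors x y pr
    private
      module Fp = Residue res
      module Cₚ = OverField.Cubic Fp.𝔽 (Fp.π (a₁ E)) (Fp.π (a₂ E)) (Fp.π (a₃ E)) (Fp.π (a₄ E)) (Fp.π (a₆ E)) using (F; FX; FY)
      prim-coords = primitive-coordinates Z.∣ Z (proj₁ some-coordinates) ∣ (proj₁ some-coordinates) NP.≤-refl (proj₂ some-coordinates)
      A = proj₁ prim-coords
      A-coords = proj₁ (proj₂ prim-coords)
      A-prim = proj₂ (proj₂ prim-coords)
      Z≢0ℚ : ¬ toℚ (Z A) ≡ 0ℚ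
      Z≢0ℚ e = Z≢0 A-coords (toℚ-injective {Z A} {+ 0} e)
      z³ = toℚ (Z A) Q.* toℚ (Z A) Q.* toℚ (Z A)
      A-rep : toℚ³ A Represents just (x , y)
      A-rep = represents (affine Z≢0ℚ (X≡ A-coords) (Y≡ A-coords))
        (≡.trans (Cℚ.F-cong (normal {toℚ³ A} {x} {y} (X≡ A-coords) (Y≡ A-coords))) (≡.trans (Cℚ.F-scale (toℚ (Z A)) (vec x y 1ℚ)) (≡.trans (≡.cong (z³ Q.*_) (affine-F {x} {y} on)) (QP.*-zeroʳ z³))))
      open Laws E A using (module Fᴱ; Sᴱ; module LawValues)
      module G = Gradients ℚ-field A₁ A₂ A₃ A₄ A₆
      module Fℚ = LawValues ℚ-ring toℚ

      numerator∣ : ∀ q m → ¬ + p ∣ℤ Z A → q Q.* (toℚ (Z A) Q.* toℚ (Z A)) ≡ toℚ m → + p ∣ℤ m → p ∣ℚ q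
      numerator∣ q m nz h dm = ZD.∣⇒∣ᵤ ([ (λ d → d) , (λ d → ⊥-elim ([ nz , nz ]′ (prime-∣* pr (Z A) (Z A) d))) ]′
        (prime-∣* pr (ℚ.numerator q) (Z A Z.* Z A) (≡.subst (+ p ∣ℤ_) (≡.sym (numerator-cross q (Z A Z.* Z A) m (≡.trans (≡.cong (q Q.*_) (toℚ-* (Z A) (Z A))) h))) (ZD.∣m⇒∣m*n (ℚ.denominator q) dm))))

      denominator∤ : ¬ + p ∣ℤ Z A → ¬ p ND.∣ ℚ.denominatorℕ x
      denominator∤ nz dd = contra x (X≡ A-coords) dd
        where
        contra : ∀ q → toℚ (X A) ≡ toℚ (Z A) Q.* q → ¬ p ND.∣ ℚ.denominatorℕ q
        contra q@(mkℚ n d-1 c) h dd = [ (λ dn → ∤1 pr (ZD.∣ᵤ⇒∣ (ND.∣-reflexive (NC.recompute c (ZD.∣⇒∣ᵤ dn , dd))))) , nz ]′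
          (prime-∣* pr n (Z A) (≡.subst (+ p ∣ℤ_) (≡.sym (numerator-cross q (Z A) (X A) (≡.trans (QP.*-comm q (toℚ (Z A))) (≡.sym h)))) (ZD.∣n⇒∣m*n (X A) (ZD.∣ᵤ⇒∣ dd))))

      fx : ℚ → ℚ → ℚ
      fx t u = A₁ Q.* y Q.- u Q.* x Q.* x Q.- t Q.* A₂ Q.* x Q.- A₄
      Fx≡ : Fx E x y ≡ fx Cℚ.2# Cℚ.3#
      Fx≡ = ≡.cong₂ fx {toℚ (+ 2)} {Cℚ.2#} {toℚ (+ 3)} {Cℚ.3#} ≡.refl ≡.refl
      fy : ℚ → ℚ
      fy t = t Q.* y Q.+ A₁ Q.* x Q.+ A₃
      Fy≡ : Fy E x y ≡ fy Cℚ.2#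
      Fy≡ = ≡.cong fy {toℚ (+ 2)} {Cℚ.2#} ≡.refl

      -- At primes dividing the discriminant this is the regularity assumption, whose affine
      -- derivatives differ from the homogeneous ones by the unit Z². At the other primes a singular
      -- point would make the discriminant vanish modulo p.
      smoothₚ : ¬ + p ∣ℤ Z A → ¬ (Cₚ.FX (Fp.π³ A) Fp.≈ Fp.0# × Cₚ.FY (Fp.π³ A) Fp.≈ Fp.0#)
      smoothₚ nz (FX0 , FY0) = cases (p ND.∣? Z.∣ disc E ∣)
        where
        mX = evalℤ (Fᴱ.FX Sᴱ) A
        mY = evalℤ (Fᴱ.FY Sᴱ) A
        dX : + p ∣ℤ mX
        dX = Fp.π-0 (Fp.trans (Fp.π-eval (Fᴱ.FX Sᴱ) A) FX0)
        dY : + p ∣ℤ mY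
        dY = Fp.π-0 (Fp.trans (Fp.π-eval (Fᴱ.FY Sᴱ) A) FY0)
        hX : Fx E x y Q.* (toℚ (Z A) Q.* toℚ (Z A)) ≡ toℚ mX
        hX = ≡.trans (≡.cong (Q._* (toℚ (Z A) Q.* toℚ (Z A))) Fx≡) (≡.trans (≡.sym (G.FX-gradient (toℚ³ A) x y (X≡ A-coords) (Y≡ A-coords))) (≡.sym (toℚ-eval (Fᴱ.FX Sᴱ) A)))
        hY : Fy E x y Q.* (toℚ (Z A) Q.* toℚ (Z A)) ≡ toℚ mY
        hY = ≡.trans (≡.cong (Q._* (toℚ (Z A) Q.* toℚ (Z A))) Fy≡) (≡.trans (≡.sym (G.FY-gradient (toℚ³ A) x y (X≡ A-coords) (Y≡ A-coords))) (≡.sym (toℚ-eval (Fᴱ.FY Sᴱ) A)))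
        F0 : Cₚ.F (Fp.π³ A) Fp.≈ Fp.0#
        F0 = Fp.trans (Fp.sym (Fp.π-eval (Fᴱ.F Sᴱ) A)) (Fp.π-∣ (≡.subst (+ p ∣ℤ_) (≡.sym (toℚ-injective {evalℤ (Fᴱ.F Sᴱ) A} {+ 0} (≡.trans (toℚ-eval (Fᴱ.F Sᴱ) A) (≡.trans (Fℚ.value-F (toℚ³ A)) (onCurve A-rep))))) (divides (+ 0) ≡.refl)))
        cases : Dec (p ND.∣ Z.∣ disc E ∣) → ⊥
        cases (yes bad) = [ denominator∤ nz , (λ ns → ns (numerator∣ (Fx E x y) mX nz hX dX , numerator∣ (Fy E x y) mY nz hY dY)) ]′ (reg p pr bad)
        cases (no good) = ReducedDiscriminant.good-smooth E res good (Fp.π³ A) (λ e → nz (Fp.π-0 e)) F0 (FX0 , FY0)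

    private
      sequence-data : SequenceData
      sequence-data = record
        { local = record { E = E ; ell = ell ; x = x ; y = y ; on = on ; pr = pr ; res = res ; A = A ; A-prim = A-prim ; A-rep = A-rep ; smoothₚ = smoothₚ }
        ; inf = inf ; D = D ; eds = eds }
    open Sequence sequence-data public using (period; multiples; module Lift; module Hasse)

-- Divisibility tested on prime powers, and products of distinct primes

open N using (_+_; _*_; _^_; _∸_; NonZero)
open NC using (Coprime; coprime-divisor)
open ND using (_∣_; _∣?_; divides)
open ≡ using (refl; sym; trans; cong; subst)

prime>1 : ∀ {p} → Prime p → 1 < p
prime>1 {p} pr = N.nonTrivial⇒n>1 p {{prime⇒nonTrivial pr}}

1≤prime : ∀ {p} → Prime p → 1 ≤ p
1≤prime pr = NP.<⇒≤ (prime>1 pr)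

nonZero : ∀ {n} → 1 ≤ n → NonZero n
nonZero = N.>-nonZero

prime∤1 : ∀ {p} → Prime p → ¬ p ∣ 1
prime∤1 pr d = NP.<⇒≱ (prime>1 pr) (ND.∣⇒≤ d)

prime∣prime : ∀ {p q} → Prime p → Prime q → p ∣ q → p ≡ q
prime∣prime pp pq d with prime⇒irreducible pq d
... | inj₁ e = ⊥-elim (prime∤1 pp (ND.∣-reflexive e))
... | inj₂ e = e

prime-coprime : ∀ {p n} → Prime p → ¬ p ∣ n → Coprime p n
prime-coprime pr n∤ (d∣p , d∣n) with prime⇒irreducible pr d∣p
... | inj₁ e = e
... | inj₂ refl = ⊥-elim (n∤ d∣n)

coprime-power : ∀ {p n} → Prime p → ¬ p ∣ n → ∀ k → Coprime (p ^ k) n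
coprime-power pr n∤ zero (d∣1 , _) = ND.∣1⇒≡1 d∣1
coprime-power {p} {n} pr n∤ (suc k) {d} (d∣ , d∣n) = coprime-power pr n∤ k (coprime-divisor (λ (e∣d , e∣p) → prime-coprime pr n∤ (e∣p , ND.∣-trans e∣d d∣n)) d∣ , d∣n)

PrimePowersDivide : ℕ → ℕ → Set
PrimePowersDivide a b = ∀ p → Prime p → ∀ k → p ^ k ∣ a → p ^ k ∣ b

product-∣ : ∀ ps → All Prime ps → ∀ b → PrimePowersDivide (product ps) b → product ps ∣ b
product-∣ [] _ b _ = ND.1∣ b
product-∣ (p ∷ ps) (pr ∷ prs) b h with h p pr 1 (subst (_∣ p * product ps) (sym (NP.*-identityʳ p)) (ND.m∣m*n (product ps)))
... | d with subst (_∣ b) (NP.*-identityʳ p) d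
...   | divides b′ b≡ = subst (p * product ps ∣_) (trans (NP.*-comm p b′) (sym b≡)) (ND.*-monoʳ-∣ p (product-∣ ps prs b′ h′))
  where
  instance _ = prime⇒nonZero pr
  h′ : PrimePowersDivide (product ps) b′
  h′ q qr k dk with q N.≟ p
  ... | yes refl = ND.*-cancelˡ-∣ p (subst (p ^ suc k ∣_) (trans b≡ (NP.*-comm b′ p)) (h p pr (suc k) (ND.*-monoʳ-∣ p dk)))
  ... | no q≢p = coprime-divisor (coprime-power qr (λ q∣p → q≢p (prime∣prime qr pr q∣p)) k) (subst (q ^ k ∣_) (trans b≡ (NP.*-comm b′ p)) (h q qr k (ND.∣n⇒∣m*n p dk)))

prime-powers-∣ : ∀ a b → 1 ≤ a → PrimePowersDivide a b → a ∣ b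
prime-powers-∣ a b 1≤a h = subst (_∣ b) (sym e) (product-∣ (PrimeFactorisation.factors f) (PrimeFactorisation.factorsPrime f) b (subst (λ a → PrimePowersDivide a b) e h))
  where
  f = factorise a {{nonZero 1≤a}}
  e = PrimeFactorisation.isFactorisation f

prime-factor : ∀ n → 1 ≤ n → n ≢ 1 → ∃[ p ] Prime p × p ∣ n
prime-factor n 1≤n n≢1 = go (PrimeFactorisation.factors f) (PrimeFactorisation.isFactorisation f) (PrimeFactorisation.factorsPrime f)
  where
  f = factorise n {{nonZero 1≤n}}
  go : ∀ ps → n ≡ product ps → All Prime ps → ∃[ p ] Prime p × p ∣ n
  go [] e _ = ⊥-elim (n≢1 e)
  go (p ∷ ps) e (pr ∷ _) = p , pr , subst (p ∣_) (sym e) (ND.m∣m*n (product ps))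

coprime-product-∣ : ∀ {a b m} → Coprime a b → a ∣ m → b ∣ m → a * b ∣ m
coprime-product-∣ {a} {b} {m} c (divides q m≡) b∣m = subst (a * b ∣_) (trans (NP.*-comm a q) (sym m≡)) (ND.*-monoʳ-∣ a (coprime-divisor (NC.sym c) (subst (b ∣_) (trans m≡ (NP.*-comm q a)) b∣m)))

prodFin-∣ : ∀ {ℓ} (f : Fin ℓ → ℕ) i → f i ∣ prodFin f
prodFin-∣ f Fin.zero = ND.m∣m*n _
prodFin-∣ f (Fin.suc i) = ND.∣n⇒∣m*n (f Fin.zero) (prodFin-∣ (λ j → f (Fin.suc j)) i)

prodFin-prime : ∀ {ℓ} (f : Fin ℓ → ℕ) → (∀ i → Prime (f i)) → ∀ {q} → Prime q → q ∣ prodFin f → ∃[ i ] q ≡ f i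
prodFin-prime {zero} f prs qr d = ⊥-elim (prime∤1 qr d)
prodFin-prime {suc ℓ} f prs qr d with euclidsLemma (f Fin.zero) _ qr d
... | inj₁ x = Fin.zero , prime∣prime qr (prs Fin.zero) x
... | inj₂ x with prodFin-prime (λ j → f (Fin.suc j)) (λ j → prs (Fin.suc j)) qr x
...   | i , e = Fin.suc i , e

prodFin-distinct-∣ : ∀ {ℓ} (f : Fin ℓ → ℕ) → Injective _≡_ _≡_ f → (∀ i → Prime (f i)) → ∀ e → (∀ i → f i ∣ e) → prodFin f ∣ e
prodFin-distinct-∣ {zero} f inj prs e h = ND.1∣ e
prodFin-distinct-∣ {suc ℓ} f inj prs e h with h Fin.zero
... | divides e′ e≡ = subst (prodFin f ∣_) (trans (NP.*-comm (f Fin.zero) e′) (sym e≡)) (ND.*-monoʳ-∣ (f Fin.zero)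
    (prodFin-distinct-∣ (λ j → f (Fin.suc j)) (λ eq → FP.suc-injective (inj eq)) (λ j → prs (Fin.suc j)) e′ h′))
  where
  h′ : ∀ i → f (Fin.suc i) ∣ e′
  h′ i with euclidsLemma (f Fin.zero) e′ (prs (Fin.suc i)) (subst (f (Fin.suc i) ∣_) (trans e≡ (NP.*-comm e′ (f Fin.zero))) (h (Fin.suc i)))
  ... | inj₁ x = ⊥-elim (FP.0≢1+n (sym (inj (prime∣prime (prs (Fin.suc i)) (prs Fin.zero) x))))
  ... | inj₂ x = x

prodFin≥1 : ∀ {ℓ} (f : Fin ℓ → ℕ) → (∀ i → Prime (f i)) → 1 ≤ prodFin f
prodFin≥1 {zero} f prs = s≤s z≤n
prodFin≥1 {suc ℓ} f prs = NP.*-mono-≤ (1≤prime (prs Fin.zero)) (prodFin≥1 (λ j → f (Fin.suc j)) (λ j → prs (Fin.suc j)))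

strip-primes : ∀ {ℓ} (f : Fin ℓ → ℕ) → (∀ i → Prime (f i)) → ∀ r n → (∀ i → ¬ f i ∣ r) → r ∣ n * prodFin f → r ∣ n
strip-primes {zero} f prs r n h d = subst (r ∣_) (NP.*-identityʳ n) d
strip-primes {suc ℓ} f prs r n h d = strip-primes (λ j → f (Fin.suc j)) (λ j → prs (Fin.suc j)) r n (λ j → h (Fin.suc j))
  (coprime-divisor (NC.sym (prime-coprime (prs Fin.zero) (h Fin.zero))) (subst (r ∣_) (swap n (f Fin.zero) _) d))
  where
  swap : ∀ n a b → n * (a * b) ≡ a * (n * b)
  swap = solve-∀

least : ∀ {Q : ℕ → Set} → (∀ n → Dec (Q n)) → ∀ m → 1 ≤ m → Q m → ∃[ t ] 1 ≤ t × Q t × (∀ k → 1 ≤ k → k < t → ¬ Q k)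
least {Q} Q? m 1≤m Qm = search (m ∸ 1) 1 (s≤s z≤n) (NP.m∸n+n≡m 1≤m) (λ { (suc k) _ (s≤s ()) })
  where
  search : ∀ fuel k → 1 ≤ k → fuel + k ≡ m → (∀ j → 1 ≤ j → j < k → ¬ Q j) → ∃[ t ] 1 ≤ t × Q t × (∀ k → 1 ≤ k → k < t → ¬ Q k)
  search zero k 1≤k refl none = k , 1≤k , Qm , none
  search (suc fuel) k 1≤k e none with Q? k
  ... | yes Qk = k , 1≤k , Qk , none
  ... | no ¬Qk = search fuel (suc k) (s≤s z≤n) (trans (NP.+-suc fuel k) e) none′
    where
    none′ : ∀ j → 1 ≤ j → j < suc k → ¬ Q j
    none′ j 1≤j (s≤s j≤k) with NP.m≤n⇒m<n∨m≡n j≤k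
    ... | inj₁ j<k = none j 1≤j j<k
    ... | inj₂ refl = ¬Qk

-- Cyclic orders, orbits, and the numerical estimates for (d)

cnext-suc : ∀ {k} (i : Fin (suc k)) → toℕ i < k → toℕ (cnext i) ≡ suc (toℕ i)
cnext-suc {k} i lt with toℕ i N.<? k
... | yes i<k = FP.toℕ-fromℕ< (s≤s i<k)
... | no ¬lt = ⊥-elim (¬lt lt)

cnext-last : ∀ {k} (i : Fin (suc k)) → ¬ toℕ i < k → cnext i ≡ Fin.zero
cnext-last {k} i ¬lt with toℕ i N.<? k
... | yes i<k = ⊥-elim (¬lt i<k)
... | no _ = refl

-- Climb from i to the last index, wrap around to 0, then climb from 0 to j.
cycle-closed : ∀ {k} (Q : Fin (suc k) → Set) → (∀ i → Q i → Q (cnext i)) → ∀ i → Q i → ∀ j → Q j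
cycle-closed {k} Q step i Qi j = from-zero (toℕ j) j refl
  where
  At : ℕ → Set
  At t = ∀ j → toℕ j ≡ t → Q j
  up : ∀ t → t < k → At t → At (suc t)
  up t t<k h j e = subst Q (FP.toℕ-injective (trans (cnext-suc i′ (subst (_< k) (sym i′≡) t<k)) (trans (cong suc i′≡) (sym e)))) (step i′ (h i′ i′≡))
    where
    i′ = fromℕ< (NP.m<n⇒m<1+n t<k)
    i′≡ : toℕ i′ ≡ t
    i′≡ = FP.toℕ-fromℕ< (NP.m<n⇒m<1+n t<k)
  climb : ∀ g t → g + t ≡ k → At t → At k
  climb zero t refl h = h
  climb (suc g) t e h = climb g (suc t) (trans (NP.+-suc g t) e) (up t (NP.≤-trans (s≤s (NP.m≤n+m t g)) (NP.≤-reflexive e)) h)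
  i≤k : toℕ i ≤ k
  i≤k = N.s≤s⁻¹ (FP.toℕ<n i)
  At-i : At (toℕ i)
  At-i j e = subst Q (FP.toℕ-injective (sym e)) Qi
  At-k : At k
  At-k = climb (k ∸ toℕ i) (toℕ i) (NP.m∸n+n≡m i≤k) At-i
  last = Fin.fromℕ k
  At-0 : At 0
  At-0 j e = subst Q (trans (cnext-last last (λ lt → NP.n≮n k (subst (_< k) (FP.toℕ-fromℕ k) lt))) (FP.toℕ-injective (sym e))) (step last (At-k last (FP.toℕ-fromℕ k)))
  from-zero : ∀ t → At t
  from-zero zero = At-0
  from-zero (suc t) j e = up t t<k (from-zero t) j e
    where
    t<k : t < k
    t<k = N.s≤s⁻¹ (subst (_< suc k) e (FP.toℕ<n j))

module Orbits {S : Set} (σ : S → S) where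
  σ^ : ℕ → S → S
  σ^ zero x = x
  σ^ (suc n) x = σ (σ^ n x)

  σ^-+ : ∀ m n x → σ^ (m + n) x ≡ σ^ m (σ^ n x)
  σ^-+ zero n x = refl
  σ^-+ (suc m) n x = cong σ (σ^-+ m n x)

  -- Applying σ another t - b times to a coincidence σ^a x = σ^b x would return to x at time t - b +
  -- a < t.
  first-return-distinct : ∀ x t → σ^ t x ≡ x → (∀ k → 1 ≤ k → k < t → σ^ k x ≢ x) → ∀ a b → a < b → b < t → σ^ a x ≢ σ^ b x
  first-return-distinct x t ret none a b a<b b<t e = none (t ∸ b + a) (NP.≤-trans (NP.m<n⇒0<n∸m b<t) (NP.m≤m+n (t ∸ b) a))
    (NP.<-≤-trans (NP.+-monoʳ-< (t ∸ b) a<b) (NP.≤-reflexive tb))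
    (trans (σ^-+ (t ∸ b) a x) (trans (cong (σ^ (t ∸ b)) e) (trans (sym (σ^-+ (t ∸ b) b x)) (trans (cong (λ n → σ^ n x) tb) ret))))
    where
    tb : t ∸ b + b ≡ t
    tb = NP.m∸n+n≡m (NP.<⇒≤ b<t)

  record FirstReturn (bound : ℕ) : Set where
    field
      start : S
      length-1 : ℕ
      returns : σ^ (suc length-1) start ≡ start
      distinct : ∀ a b → a < b → b < suc length-1 → σ^ a start ≢ σ^ b start
      length≤ : suc length-1 ≤ bound

  module Weights (w m : S → ℕ) (A C : ℕ) (w≥1 : ∀ i → 1 ≤ w i) (m≥1 : ∀ i → 1 ≤ m i) (bound : ∀ i → m i * w (σ i) * C ≤ w i * A) (x : S) where
    M : ℕ → ℕ
    M zero = 1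
    M (suc s) = m (σ^ s x) * M s

    -- When the bounds are multiplied along the orbit, the weights w telescope.
    around : ∀ s → w (σ^ s x) * M s * C ^ s ≤ w x * A ^ s
    around zero = NP.≤-reflexive (NP.*-identityʳ _)
    around (suc s) = begin
      w⁺ * (mₛ * M s) * (C * C ^ s) ≡⟨ ar₁ w⁺ mₛ (M s) C (C ^ s) ⟩
      (mₛ * w⁺) * C * (M s * C ^ s) ≤⟨ NP.*-monoˡ-≤ (M s * C ^ s) (bound (σ^ s x)) ⟩
      wₛ * A * (M s * C ^ s) ≡⟨ ar₂ wₛ A (M s) (C ^ s) ⟩
      wₛ * M s * C ^ s * A ≤⟨ NP.*-monoˡ-≤ A (around s) ⟩
      w x * A ^ s * A ≡⟨ ar₃ (w x) A (A ^ s) ⟩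
      w x * (A * A ^ s) ∎
      where
      open NP.≤-Reasoning
      mₛ = m (σ^ s x)
      wₛ = w (σ^ s x)
      w⁺ = w (σ^ (suc s) x)
      ar₁ : ∀ w m M C P → w * (m * M) * (C * P) ≡ (m * w) * C * (M * P)
      ar₁ = solve-∀
      ar₂ : ∀ w A M P → w * A * (M * P) ≡ w * M * P * A
      ar₂ = solve-∀
      ar₃ : ∀ w A P → w * P * A ≡ w * (A * P)
      ar₃ = solve-∀

    M≥1 : ∀ s → 1 ≤ M s
    M≥1 zero = s≤s z≤n
    M≥1 (suc s) = NP.*-mono-≤ (m≥1 (σ^ s x)) (M≥1 s)

    m≤M : ∀ s u → s < u → m (σ^ s x) ≤ M u
    m≤M s (suc u) (s≤s s≤u) = [ (λ s<u → NP.≤-trans (m≤M s u s<u) (NP.m≤n*m (M u) (m (σ^ u x)) {{nonZero (m≥1 (σ^ u x))}})) ,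
      (λ { refl → NP.m≤m*n (m (σ^ s x)) (M s) {{nonZero (M≥1 s)}} }) ]′ (NP.m≤n⇒m<n∨m≡n s≤u)

    -- Going once around a cycle multiplies the m's; the bounds make their product less than 2.
    weights≡1 : ∀ t → σ^ t x ≡ x → A ^ t < 2 * C ^ t → ∀ s → s < t → m (σ^ s x) ≡ 1
    weights≡1 t returns A<2C s s<t = NP.≤-antisym (N.s≤s⁻¹ (NP.≤-<-trans (m≤M s t s<t) M<2)) (m≥1 (σ^ s x))
      where
      M-bound : M t * C ^ t ≤ A ^ t
      M-bound = NP.*-cancelˡ-≤ (w x) {{nonZero (w≥1 x)}} (NP.≤-trans (NP.≤-reflexive (trans (sym (NP.*-assoc (w x) (M t) (C ^ t))) (cong (λ i → w i * M t * C ^ t) (sym returns)))) (around t))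
      M<2 : M t < 2
      M<2 = NP.*-cancelʳ-< (C ^ t) (M t) 2 (NP.≤-<-trans M-bound A<2C)

-- Pigeonhole on the iterates of 0 finds a point that returns to itself. The orbit up to its least
-- return time is injective, which bounds that time.
first-return : ∀ {ℓ} (σ : Fin (suc ℓ) → Fin (suc ℓ)) → Orbits.FirstReturn σ (suc ℓ)
first-return {ℓ} σ with FP.pigeonhole (NP.n<1+n (suc ℓ)) (λ i → Orbits.σ^ σ (toℕ i) Fin.zero)
... | u , v , u<v , e = from (σ^ (toℕ u) Fin.zero) (least (λ t → σ^ t (σ^ (toℕ u) Fin.zero) Fin.≟ σ^ (toℕ u) Fin.zero) (toℕ v ∸ toℕ u) (NP.m<n⇒0<n∸m u<v)
    (trans (sym (σ^-+ (toℕ v ∸ toℕ u) (toℕ u) Fin.zero)) (trans (cong (λ m → σ^ m Fin.zero) (NP.m∸n+n≡m (NP.<⇒≤ u<v))) (sym e))))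
  where
  open Orbits σ
  from : ∀ x → (∃[ t ] 1 ≤ t × σ^ t x ≡ x × (∀ k → 1 ≤ k → k < t → σ^ k x ≢ x)) → FirstReturn (suc ℓ)
  from x (suc t , _ , returns , none) = record { start = x ; length-1 = t ; returns = returns ; distinct = distinct ; length≤ = FP.injective⇒≤ orbit-injective }
    where
    distinct = first-return-distinct x (suc t) returns none
    orbit : Fin (suc t) → Fin (suc ℓ)
    orbit s = σ^ (toℕ s) x
    orbit-injective : Injective _≡_ _≡_ orbit
    orbit-injective {a} {b} e with NP.<-cmp (toℕ a) (toℕ b)
    ... | tri< lt _ _ = ⊥-elim (distinct _ _ lt (FP.toℕ<n b) e)
    ... | tri≈ _ eq _ = FP.toℕ-injective eq
    ... | tri> _ _ gt = ⊥-elim (distinct _ _ gt (FP.toℕ<n a) (sym e))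

square-^ : ∀ u s → (u * u) ^ s ≡ u ^ (2 * s)
square-^ u s = trans (cong (_^ s) (cong (u *_) (sym (NP.*-identityʳ u)))) (NP.^-*-assoc u 2 s)

-- The hypothesis of (d) has exponent 2ℓ, while the cycle found may have length t < ℓ. As a/c ≥ 1,
-- lowering the exponent preserves (a/c)^(2ℓ) < 2.
<-double-^ : ∀ {a c t ℓ} → c ≤ a → t ≤ ℓ → a ^ (2 * ℓ) < 2 * c ^ (2 * ℓ) → (a * a) ^ t < 2 * (c * c) ^ t
<-double-^ {a} {c} {t} {ℓ} c≤a t≤ℓ lt = NP.≰⇒> λ 2C≤A → NP.<⇒≱ lt (begin
    2 * c ^ (2 * ℓ) ≡⟨ cong (2 *_) (square-^ c ℓ) ⟨
    2 * C ^ ℓ ≡⟨ cong (λ e → 2 * C ^ e) (NP.m+[n∸m]≡n t≤ℓ) ⟨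
    2 * C ^ (t + g) ≡⟨ cong (2 *_) (NP.^-distribˡ-+-* C t g) ⟩
    2 * (C ^ t * C ^ g) ≡⟨ NP.*-assoc 2 (C ^ t) (C ^ g) ⟨
    2 * C ^ t * C ^ g ≤⟨ NP.*-mono-≤ 2C≤A (NP.^-monoˡ-≤ g (NP.*-mono-≤ c≤a c≤a)) ⟩
    A ^ t * A ^ g ≡⟨ NP.^-distribˡ-+-* A t g ⟨
    A ^ (t + g) ≡⟨ cong (A ^_) (NP.m+[n∸m]≡n t≤ℓ) ⟩
    A ^ ℓ ≡⟨ square-^ a ℓ ⟩
    a ^ (2 * ℓ) ∎)
  where
  open NP.≤-Reasoning
  A = a * a
  C = c * c
  g = ℓ ∸ t

isqrt : ∀ p → ∃[ n ] n * n ≤ p × p < suc n * suc n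
isqrt zero = 0 , z≤n , s≤s z≤n
isqrt (suc p) with isqrt p
... | n , lo , hi with suc n * suc n N.≤? suc p
...   | yes le = suc n , le , NP.<-≤-trans (s≤s hi) (NP.*-mono-< (NP.n<1+n (suc n)) (NP.n<1+n (suc n)))
...   | no ≰ = n , NP.m≤n⇒m≤1+n lo , NP.≰⇒> ≰

argmin : ∀ {ℓ} (f : Fin (suc ℓ) → ℕ) → ∃[ i ] ∀ j → f i ≤ f j
argmin {zero} f = Fin.zero , λ { Fin.zero → NP.≤-refl }
argmin {suc ℓ} f with argmin (λ j → f (Fin.suc j))
... | i , h with f Fin.zero N.≤? f (Fin.suc i)
...   | yes le = Fin.zero , λ { Fin.zero → NP.≤-refl ; (Fin.suc j) → NP.≤-trans le (h j) }
...   | no ≰ = Fin.suc i , λ { Fin.zero → NP.<⇒≤ (NP.≰⇒> ≰) ; (Fin.suc j) → h j }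

-- With n = ⌊√p⌋, both r/p ≤ ((n+1)/n)² and (n+1)/n ≤ a/(a−b).
rank-bound : ∀ p r a b → (∀ n → n * r ≤ p + n * p + n * n) → b < a → a * a ≤ p * (b * b) → suc r * ((a ∸ b) * (a ∸ b)) ≤ p * (a * a)
rank-bound p r a b h b<a a²≤ with isqrt p
... | n , lo , hi = NP.*-cancelˡ-≤ (N₁ * N₁) (begin
    N₁ * N₁ * (suc r * (c * c)) ≡⟨ ar₁ N₁ (suc r) c ⟩
    suc r * ((N₁ * c) * (N₁ * c)) ≤⟨ NP.*-monoʳ-≤ (suc r) (NP.*-mono-≤ N₁c≤ N₁c≤) ⟩
    suc r * ((n * a) * (n * a)) ≡⟨ ar₂ (suc r) n a ⟩
    (suc r * n * n) * (a * a) ≤⟨ NP.*-monoˡ-≤ (a * a) rn² ⟩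
    p * (N₁ * N₁) * (a * a) ≡⟨ ar₃ p N₁ a ⟩
    N₁ * N₁ * (p * (a * a)) ∎)
  where
  open NP.≤-Reasoning
  N₁ = suc n
  c = a ∸ b
  ar₁ : ∀ N r c → N * N * (r * (c * c)) ≡ r * ((N * c) * (N * c))
  ar₁ = solve-∀
  ar₂ : ∀ r n a → r * ((n * a) * (n * a)) ≡ (r * n * n) * (a * a)
  ar₂ = solve-∀
  ar₃ : ∀ p N a → p * (N * N) * (a * a) ≡ N * N * (p * (a * a))
  ar₃ = solve-∀
  a<N₁b : a < N₁ * b
  a<N₁b = NP.≰⇒> λ N₁b≤a → NP.<-irrefl refl (begin-strict
    a * a ≤⟨ a²≤ ⟩
    p * (b * b) <⟨ NP.*-monoˡ-< (b * b) {{b²≢0}} hi ⟩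
    N₁ * N₁ * (b * b) ≡⟨ ar₄ N₁ b ⟩
    (N₁ * b) * (N₁ * b) ≤⟨ NP.*-mono-≤ N₁b≤a N₁b≤a ⟩
    a * a ∎)
    where
    ar₄ : ∀ N b → N * N * (b * b) ≡ (N * b) * (N * b)
    ar₄ = solve-∀
    b≢0 : b ≢ 0
    b≢0 refl = NP.<⇒≱ b<a (NP.≤-trans (NP.m≤m*n a a {{nonZero b<a}}) (NP.≤-trans a²≤ (NP.≤-reflexive (NP.*-zeroʳ p))))
    b²≢0 : NonZero (b * b)
    b²≢0 = NP.m*n≢0 b b {{N.≢-nonZero b≢0}} {{N.≢-nonZero b≢0}}
  N₁c≤ : N₁ * c ≤ n * a
  N₁c≤ = NP.+-cancelʳ-≤ (N₁ * b) (N₁ * c) (n * a) (begin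
    N₁ * c + N₁ * b ≡⟨ NP.*-distribˡ-+ N₁ c b ⟨
    N₁ * (c + b) ≡⟨ cong (N₁ *_) (NP.m∸n+n≡m (NP.<⇒≤ b<a)) ⟩
    a + n * a ≡⟨ NP.+-comm a (n * a) ⟩
    n * a + a ≤⟨ NP.+-monoʳ-≤ (n * a) (NP.<⇒≤ a<N₁b) ⟩
    n * a + N₁ * b ∎)
  -- The assumed bound at n = ⌊√p⌋; n² ≤ p absorbs the square term, which leaves p(n + 1)².
  rn² : suc r * n * n ≤ p * (N₁ * N₁)
  rn² = begin
    suc r * n * n ≡⟨ cong (_* n) (ar₅ r n) ⟩
    (n * r + n) * n ≤⟨ NP.*-monoˡ-≤ n (NP.+-monoˡ-≤ n (h n)) ⟩
    (p + n * p + n * n + n) * n ≡⟨ ar₆ p n ⟩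
    (n * n + n * p) * N₁ ≤⟨ NP.*-monoˡ-≤ N₁ (NP.+-monoˡ-≤ (n * p) lo) ⟩
    (p + n * p) * N₁ ≡⟨ ar₇ p n ⟩
    p * (N₁ * N₁) ∎
    where
    ar₅ : ∀ r n → suc r * n ≡ n * r + n
    ar₅ = solve-∀
    ar₆ : ∀ p n → (p + n * p + n * n + n) * n ≡ (n * n + n * p) * suc n
    ar₆ = solve-∀
    ar₇ : ∀ p n → (p + n * p) * suc n ≡ p * (suc n * suc n)
    ar₇ = solve-∀

^-distribʳ-* : ∀ n a b → (a * b) ^ n ≡ a ^ n * b ^ n
^-distribʳ-* zero a b = refl
^-distribʳ-* (suc n) a b = trans (cong (a * b *_) (^-distribʳ-* n a b)) (swap a b (a ^ n) (b ^ n))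
  where
  swap : ∀ a b c d → a * b * (c * d) ≡ a * c * (b * d)
  swap = solve-∀

-- For p = 2 the witness satisfies a/b ≤ √2 < 2, so 2(a - b) ≤ a and 2(a - b)^e ≤ (2(a - b))^e ≤
-- a^e. This makes the Hasse bound, proved for odd primes, available in (d).
above-bound⇒≢2 : ∀ ℓ p → AboveBound (suc ℓ) p → p ≢ 2
above-bound⇒≢2 ℓ p (a , b , b<a , a²≤ , lt) refl = NP.<⇒≱ lt (begin
    2 * c ^ e ≤⟨ NP.*-monoˡ-≤ (c ^ e) 2≤ ⟩
    2 ^ e * c ^ e ≡⟨ ^-distribʳ-* e 2 c ⟨
    (2 * c) ^ e ≤⟨ NP.^-monoˡ-≤ e 2c≤a ⟩
    a ^ e ∎)
  where
  open NP.≤-Reasoning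
  e = 2 * suc ℓ
  c = a ∸ b
  2≤ : 2 ≤ 2 ^ e
  2≤ = NP.≤-trans (NP.≤-reflexive refl) (NP.^-monoʳ-≤ 2 {1} {e} (s≤s z≤n))
  a≤2b : a ≤ 2 * b
  a≤2b = NP.≮⇒≥ λ 2b<a → NP.<-irrefl refl (begin-strict
    a * a ≤⟨ a²≤ ⟩
    2 * (b * b) ≤⟨ NP.m≤m+n (2 * (b * b)) (2 * (b * b)) ⟩
    2 * (b * b) + 2 * (b * b) ≡⟨ ar b ⟩
    (2 * b) * (2 * b) <⟨ NP.*-mono-< 2b<a 2b<a ⟩
    a * a ∎)
    where
    ar : ∀ b → 2 * (b * b) + 2 * (b * b) ≡ (2 * b) * (2 * b)
    ar = solve-∀
  2c≤a : 2 * c ≤ a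
  2c≤a = NP.+-cancelʳ-≤ (2 * b) (2 * c) a (begin
    2 * c + 2 * b ≡⟨ NP.*-distribˡ-+ 2 c b ⟨
    2 * (c + b) ≡⟨ cong (2 *_) (NP.m∸n+n≡m (NP.<⇒≤ b<a)) ⟩
    2 * a ≡⟨ cong (λ u → a + u) (NP.+-identityʳ a) ⟩
    a + a ≤⟨ NP.+-monoʳ-≤ a a≤2b ⟩
    a + 2 * b ∎)

-- The index divisibility graph, from four properties of D at each prime

module IndexDivisibility (E : Weierstrass) (D : ℕ → ℕ)
  (period : ∀ {p} → Prime p → ∀ r n → 1 ≤ r → 1 ≤ n → p ∣ D r → p ∣ D (n + r) → p ∣ D n)
  (multiples : ∀ {p} → Prime p → ∀ k n j → 1 ≤ n → p ^ suc k ∣ D n → p ^ suc k ∣ D (suc j * n))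
  (lift : ∀ {p} → Prime p → ∀ k n → 1 ≤ n → p ^ suc k ∣ D n → p ^ suc (suc k) ∣ D (p * n))
  (hasse : ∀ {p} → Prime p → p ≢ 2 → ∀ r → IsRank D p (suc r) → ∀ n → n * r ≤ p + n * p + n * n) where

  ∣D-* : ∀ {a n} m → 1 ≤ a → 1 ≤ n → 1 ≤ m → a ∣ D n → a ∣ D (n * m)
  ∣D-* {a} {n} (suc j) 1≤a 1≤n _ d = prime-powers-∣ a _ 1≤a λ where
    p pr zero _ → ND.1∣ _
    p pr (suc k) dk → subst (λ i → p ^ suc k ∣ D i) (NP.*-comm (suc j) n) (multiples pr k n j 1≤n (ND.∣-trans dk d))

  ∣D-∣ : ∀ {a m n} → 1 ≤ a → 1 ≤ m → 1 ≤ n → m ∣ n → a ∣ D m → a ∣ D n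
  ∣D-∣ {a} {m} {n} 1≤a 1≤m 1≤n (divides q e) d = subst (λ i → a ∣ D i) (trans (NP.*-comm m q) (sym e)) (∣D-* q 1≤a 1≤m 1≤q d)
    where
    positive : ∀ q → n ≡ q * m → 1 ≤ q
    positive zero e = ⊥-elim (NP.<⇒≢ 1≤n (sym e))
    positive (suc _) _ = s≤s z≤n
    1≤q : 1 ≤ q
    1≤q = positive q e

  -- Periodicity removes multiples of r from m; a nonzero remainder would contradict the minimality
  -- of r.
  rank-∣ : ∀ {p r m} → Prime p → IsRank D p r → 1 ≤ m → p ∣ D m → r ∣ m
  rank-∣ {p} {r} {m} pr (1≤r , dr , least-r) 1≤m dm = divides (m / r) (trans m≡ (cong (_+ m / r * r) s≡0))
    where
    instance _ = nonZero 1≤r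
    m≡ : m ≡ m % r + m / r * r
    m≡ = m≡m%n+[m/n]*n m r
    down : ∀ q s → 1 ≤ s → p ∣ D (s + q * r) → p ∣ D s
    down zero s 1≤s d = subst (λ i → p ∣ D i) (NP.+-identityʳ s) d
    down (suc q) s 1≤s d = down q s 1≤s (period pr r (s + q * r) 1≤r (NP.≤-trans 1≤s (NP.m≤m+n s _)) dr (subst (λ i → p ∣ D i) (shift s r (q * r)) d))
      where
      shift : ∀ s r t → s + (r + t) ≡ s + t + r
      shift = solve-∀
    s≡0 : m % r ≡ 0
    s≡0 = small (m % r) (m%n<n m r) (subst (λ i → p ∣ D i) m≡ dm)
      where
      small : ∀ s → s < r → p ∣ D (s + m / r * r) → s ≡ 0
      small zero _ _ = refl
      small (suc s) s<r d = ⊥-elim (least-r (suc s) (s≤s z≤n) s<r (down (m / r) (suc s) (s≤s z≤n) d))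

  rank-exists : ∀ p m → 1 ≤ m → p ∣ D m → ∃[ r ] IsRank D p r
  rank-exists p m = least (λ n → p ∣? D n) m

  rank∤ : ∀ {p r n} → Prime p → IsRank D p r → 1 ≤ n → ¬ p ∣ D n → ¬ r ∣ n
  rank∤ pr (1≤r , dr , _) 1≤n ¬d r∣n = ¬d (∣D-∣ (1≤prime pr) 1≤r 1≤n r∣n dr)

  -- Only the power of p in np is new. If p divides n, lifting raises the exponent by one along with
  -- the index; if not, p ∣ D n is what is needed. Powers of other primes already divide n and hence
  -- D n.
  part-a : ∀ n p → InS D n → Prime p → p ∣ D n → Arrow D n (n * p)
  part-a n p (1≤n , n∣) pr d = (1≤n , n∣) , (1≤np , np∣) , ND.m∣m*n p , n≢np , between
    where
    instance _ = nonZero 1≤n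
    1≤np : 1 ≤ n * p
    1≤np = NP.*-mono-≤ 1≤n (1≤prime pr)
    at-p : ∀ k → p ^ k ∣ n * p → p ^ k ∣ D (n * p)
    at-p zero _ = ND.1∣ _
    at-p (suc k) dk = go k (ND.*-cancelˡ-∣ p {{prime⇒nonZero pr}} (subst (p ^ suc k ∣_) (NP.*-comm n p) dk))
      where
      go : ∀ k → p ^ k ∣ n → p ^ suc k ∣ D (n * p)
      go zero _ = subst (_∣ D (n * p)) (sym (NP.*-identityʳ p)) (∣D-* p (1≤prime pr) 1≤n (1≤prime pr) d)
      go (suc j) dj = subst (λ i → p ^ suc (suc j) ∣ D i) (NP.*-comm p n) (lift pr j n 1≤n (ND.∣-trans dj n∣))
    np∣ : n * p ∣ D (n * p)
    np∣ = prime-powers-∣ (n * p) _ 1≤np each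
      where
      each : PrimePowersDivide (n * p) (D (n * p))
      each q qr k dk with q N.≟ p
      ... | yes refl = at-p k dk
      ... | no q≢p = ND.∣-trans (coprime-divisor (coprime-power qr (λ q∣p → q≢p (prime∣prime qr pr q∣p)) k) (subst (q ^ k ∣_) (NP.*-comm n p) dk)) (∣D-* p 1≤n 1≤n (1≤prime pr) n∣)
    n≢np : n ≢ n * p
    n≢np e = NP.<⇒≢ (prime>1 pr) (NP.*-cancelˡ-≡ 1 p n (trans (NP.*-identityʳ n) e))
    between : ∀ k → InS D k → n ∣ k → k ∣ n * p → k ≡ n ⊎ k ≡ n * p
    between k _ (divides e refl) k∣ with prime⇒irreducible pr (ND.*-cancelˡ-∣ n (subst (_∣ n * p) (NP.*-comm e n) k∣))
    ... | inj₁ refl = inj₁ (NP.+-identityʳ n)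
    ... | inj₂ refl = inj₂ (NP.*-comm p n)

  -- The rank of each p i is the next prime of the cycle and divides nd, so p i divides D (n * d).
  -- For an intermediate j = en with e ≠ 1, a prime p i of e forces its rank to divide j, hence e;
  -- going around the cycle, all of d divides e.
  part-b : ∀ n d → InS D n → AliquotNumber E D d → gcd n d ≡ 1 → Arrow D n (n * d)
  part-b n d (1≤n , n∣) (k , p , (inj , prs , good , ranks) , refl) gcd≡1 = (1≤n , n∣) , (1≤nd , nd∣) , ND.m∣m*n d , n≢nd , between
    where
    instance _ = nonZero 1≤n
    cop : Coprime n d
    cop = NC.gcd≡1⇒coprime gcd≡1
    1≤d : 1 ≤ d
    1≤d = prodFin≥1 p prs
    1≤nd : 1 ≤ n * d
    1≤nd = NP.*-mono-≤ 1≤n 1≤d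
    p∤n : ∀ i → ¬ p i ∣ n
    p∤n i h = prime∤1 (prs i) (ND.∣-reflexive (cop (h , prodFin-∣ p i)))
    p∣D : ∀ i → p i ∣ D (n * d)
    p∣D i = ∣D-∣ (1≤prime (prs i)) (1≤prime (prs (cnext i))) 1≤nd (ND.∣-trans (prodFin-∣ p (cnext i)) (ND.∣n⇒∣m*n n ND.∣-refl)) (proj₁ (proj₂ (ranks i)))
    nd∣ : n * d ∣ D (n * d)
    nd∣ = coprime-product-∣ cop (∣D-* d 1≤n 1≤n 1≤d n∣) (prodFin-distinct-∣ p inj prs _ p∣D)
    n≢nd : n ≢ n * d
    n≢nd e = prime∤1 (prs Fin.zero) (subst (p Fin.zero ∣_) (sym (NP.*-cancelˡ-≡ 1 d n (trans (NP.*-identityʳ n) e))) (prodFin-∣ p Fin.zero))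
    between : ∀ j → InS D j → n ∣ j → j ∣ n * d → j ≡ n ⊎ j ≡ n * d
    between j (1≤j , j∣) (divides e refl) j∣nd with e N.≟ 1
    ... | yes refl = inj₁ (NP.+-identityʳ n)
    ... | no e≢1 = inj₂ (trans (NP.*-comm e n) (cong (n *_) (ND.∣-antisym e∣d d∣e)))
      where
      e∣d : e ∣ d
      e∣d = ND.*-cancelˡ-∣ n (subst (_∣ n * d) (NP.*-comm e n) j∣nd)
      1≤e : 1 ≤ e
      1≤e = N.>-nonZero⁻¹ e {{NP.m*n≢0⇒m≢0 e {{nonZero 1≤j}}}}
      factor = prime-factor e 1≤e e≢1
      index = prodFin-prime p prs (proj₁ (proj₂ factor)) (ND.∣-trans (proj₂ (proj₂ factor)) e∣d)
      closed : ∀ i → p i ∣ e → p (cnext i) ∣ e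
      closed i h with euclidsLemma e n (prs (cnext i)) (rank-∣ (prs i) (ranks i) 1≤j (ND.∣-trans (ND.∣-trans h (ND.m∣m*n n)) j∣))
      ... | inj₁ x = x
      ... | inj₂ x = ⊥-elim (p∤n (cnext i) x)
      d∣e : d ∣ e
      d∣e = prodFin-distinct-∣ p inj prs e (cycle-closed (λ i → p i ∣ e) closed (proj₁ index) (subst (_∣ e) (proj₂ index) (proj₂ (proj₂ factor))))

  -- If p does not divide D n, the rank r divides np but not n, so p ∣ r; with r < 2p this leaves r
  -- = p, an aliquot cycle of length one.
  part-c : ∀ n p → 7 ≤ p → Prime p → GoodReduction E p → Arrow D n (n * p) → (p ∣ D n) ⊎ AliquotNumber E D p
  part-c n p 7≤p pr good ((1≤n , n∣) , (1≤np , np∣) , _ , _ , _) with p ∣? D n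
  ... | yes d = inj₁ d
  ... | no ¬d = inj₂ (0 , (λ _ → p) , ((λ { {Fin.zero} {Fin.zero} _ → refl }) , (λ _ → pr) , (λ _ → good) , (λ _ → rank-p)) , sym (NP.*-identityʳ p))
    where
    some-rank = rank-exists p (n * p) 1≤np (ND.∣-trans (ND.n∣m*n n) np∣)
    r = proj₁ some-rank
    rank = proj₂ some-rank
    r∤n : ¬ r ∣ n
    r∤n = rank∤ pr rank 1≤n ¬d
    p∣r : p ∣ r
    p∣r with p ∣? r
    ... | yes h = h
    ... | no h = ⊥-elim (r∤n (coprime-divisor (NC.sym (prime-coprime pr h)) (subst (r ∣_) (NP.*-comm n p) (rank-∣ pr rank 1≤np (ND.∣-trans (ND.n∣m*n n) np∣)))))
    p≢2 : p ≢ 2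
    p≢2 refl = NP.<⇒≱ 7≤p (s≤s (s≤s z≤n))
    -- The Hasse bound at n = 2 gives 2r ≤ 3p + 6 for the rank r; this lies below 4p exactly when p
    -- > 6.
    r<2p : r < 2 * p
    r<2p = bound r rank
      where
      open NP.≤-Reasoning
      bound : ∀ r → IsRank D p r → r < 2 * p
      bound zero (() , _)
      bound (suc r) rk = NP.≰⇒> λ 2p≤ → NP.<⇒≱ 7≤p (NP.+-cancelˡ-≤ (3 * p) p 6 (begin
        3 * p + p ≡⟨ ar₁ p ⟩
        2 * (2 * p) ≤⟨ NP.*-monoʳ-≤ 2 2p≤ ⟩
        2 * suc r ≡⟨ ar₂ r ⟩
        2 * r + 2 ≤⟨ NP.+-monoˡ-≤ 2 (hasse pr p≢2 r rk 2) ⟩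
        p + 2 * p + 4 + 2 ≡⟨ ar₃ p ⟩
        3 * p + 6 ∎))
        where
        ar₁ : ∀ p → 3 * p + p ≡ 2 * (2 * p)
        ar₁ = solve-∀
        ar₂ : ∀ r → 2 * suc r ≡ 2 * r + 2
        ar₂ = solve-∀
        ar₃ : ∀ p → p + 2 * p + 4 + 2 ≡ 3 * p + 6
        ar₃ = solve-∀
    r≡p : r ≡ p
    r≡p = only p∣r
      where
      only : p ∣ r → r ≡ p
      only (divides zero e) = ⊥-elim (NP.<⇒≢ (proj₁ rank) (sym e))
      only (divides (suc zero) e) = trans e (NP.+-identityʳ p)
      only (divides (suc (suc s)) e) = ⊥-elim (NP.<⇒≱ r<2p (NP.≤-trans (NP.*-monoˡ-≤ p (s≤s (s≤s (z≤n {s})))) (NP.≤-reflexive (sym e))))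
    rank-p : IsRank D p p
    rank-p = subst (IsRank D p) r≡p rank

  module PartD (n d k : ℕ) (p : Fin (suc (suc k)) → ℕ) (inj : Injective _≡_ _≡_ p) (prs : ∀ i → Prime (p i)) (good : ∀ i → GoodReduction E (p i))
    (d≡ : d ≡ prodFin p) (gcd≡1 : gcd n d ≡ 1) (arrow : Arrow D n (n * d)) (above : ∀ i → AboveBound (suc (suc k)) (p i)) where
    private
      ℓ = suc (suc k)
      n∈S = proj₁ arrow
      1≤n = proj₁ n∈S
      1≤nd = proj₁ (proj₁ (proj₂ arrow))
      nd∣ = proj₂ (proj₁ (proj₂ arrow))
      minimal = proj₂ (proj₂ (proj₂ (proj₂ arrow)))
      instance _ = nonZero 1≤n
      cop : Coprime n d
      cop = NC.gcd≡1⇒coprime gcd≡1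
      p∣d : ∀ i → p i ∣ d
      p∣d i = subst (p i ∣_) (sym d≡) (prodFin-∣ p i)

    -- Otherwise (a) puts n · p i into the graph, strictly between n and nd because there is a
    -- second prime.
    p∤Dn : ∀ i → ¬ p i ∣ D n
    p∤Dn i h with minimal (n * p i) (proj₁ (proj₂ (part-a n (p i) n∈S (prs i) h))) (ND.m∣m*n (p i)) (ND.*-monoʳ-∣ n (p∣d i))
    ... | inj₁ e = proj₁ (proj₂ (proj₂ (proj₂ (part-a n (p i) n∈S (prs i) h)))) (sym e)
    ... | inj₂ e = other≢ (inj (prime∣prime (prs other) (prs i) (subst (p other ∣_) (sym (NP.*-cancelˡ-≡ (p i) d n e)) (p∣d other))))
      where
      pick : ∀ (i : Fin ℓ) → ∃[ j ] j ≢ i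
      pick Fin.zero = Fin.suc Fin.zero , λ ()
      pick (Fin.suc i) = Fin.zero , λ ()
      other = proj₁ (pick i)
      other≢ = proj₂ (pick i)

    p∣Dnd : ∀ i → p i ∣ D (n * d)
    p∣Dnd i = ND.∣-trans (ND.∣-trans (p∣d i) (ND.n∣m*n n)) nd∣

    r : Fin ℓ → ℕ
    r i = proj₁ (rank-exists (p i) (n * d) 1≤nd (p∣Dnd i))

    rank : ∀ i → IsRank D (p i) (r i)
    rank i = proj₂ (rank-exists (p i) (n * d) 1≤nd (p∣Dnd i))

    -- The rank divides nd but not n, and stripping primes that do not divide it from nd would leave
    -- n.
    some-prime : ∀ i → ∃[ j ] p j ∣ r i
    some-prime i with FP.any? (λ j → p j ∣? r i)
    ... | yes h = h
    ... | no none = ⊥-elim (rank∤ (prs i) (rank i) 1≤n (p∤Dn i) (strip-primes p prs (r i) n (λ j h → none (j , h))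
        (subst (λ e → r i ∣ n * e) d≡ (rank-∣ (prs i) (rank i) 1≤nd (p∣Dnd i)))))

    module Cycle (σ : Fin ℓ → Fin ℓ) (cofactor : Fin ℓ → ℕ) (rank-σ : ∀ i → IsRank D (p i) (cofactor i * p (σ i)))
      (a b : ℕ) (b<a : b < a) (a²≤ : ∀ i → a * a ≤ p i * (b * b)) (a^<2c^ : a ^ (2 * ℓ) < 2 * (a ∸ b) ^ (2 * ℓ)) (return : Orbits.FirstReturn σ ℓ) where
      open Orbits σ
      open FirstReturn return renaming (start to x; length-1 to t)

      cofactor≥1 : ∀ i → 1 ≤ cofactor i
      cofactor≥1 i = N.>-nonZero⁻¹ (cofactor i) {{NP.m*n≢0⇒m≢0 (cofactor i) {{nonZero (proj₁ (rank-σ i))}}}}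

      r-bound : ∀ i r → IsRank D (p i) r → r * ((a ∸ b) * (a ∸ b)) ≤ p i * (a * a)
      r-bound i zero (() , _)
      r-bound i (suc r) rk = rank-bound (p i) r a b (hasse (prs i) (above-bound⇒≢2 (suc k) (p i) (above i)) r rk) b<a (a²≤ i)

      cofactor≡1 : ∀ s → s < suc t → cofactor (σ^ s x) ≡ 1
      cofactor≡1 = Weights.weights≡1 p cofactor (a * a) ((a ∸ b) * (a ∸ b)) (λ i → 1≤prime (prs i)) cofactor≥1
        (λ i → r-bound i _ (rank-σ i)) x (suc t) returns (<-double-^ (NP.m∸n≤m a b) length≤ a^<2c^)

      rank-on-cycle : ∀ s → s < suc t → IsRank D (p (σ^ s x)) (p (σ^ (suc s) x))
      rank-on-cycle s s<t = subst (IsRank D (p (σ^ s x))) (trans (cong (_* p (σ^ (suc s) x)) (cofactor≡1 s s<t)) (NP.*-identityˡ _)) (rank-σ (σ^ s x))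

      at : Fin (suc t) → Fin ℓ
      at i = σ^ (toℕ i) x

      q : Fin (suc t) → ℕ
      q i = p (at i)

      q-injective : Injective _≡_ _≡_ q
      q-injective {a} {b} e with NP.<-cmp (toℕ a) (toℕ b)
      ... | tri< lt _ _ = ⊥-elim (distinct _ _ lt (FP.toℕ<n b) (inj e))
      ... | tri≈ _ eq _ = FP.toℕ-injective eq
      ... | tri> _ _ gt = ⊥-elim (distinct _ _ gt (FP.toℕ<n a) (sym (inj e)))

      at-next : ∀ i → σ^ (suc (toℕ i)) x ≡ at (cnext i)
      at-next i with toℕ i N.<? t
      ... | yes lt = cong (λ s → σ^ s x) (sym (FP.toℕ-fromℕ< (s≤s lt)))
      ... | no ¬lt = trans (cong (λ s → σ^ (suc s) x) (NP.≤-antisym (N.s≤s⁻¹ (FP.toℕ<n i)) (NP.≮⇒≥ ¬lt))) returns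

      q-cycle : AliquotCycle E D q
      q-cycle = q-injective , (λ i → prs (at i)) , (λ i → good (at i)) , λ i → subst (λ j → IsRank D (q i) (p j)) (at-next i) (rank-on-cycle (toℕ i) (FP.toℕ<n i))

      q-aliquot : AliquotNumber E D (prodFin q)
      q-aliquot = t , q , q-cycle , refl

      prodFin-q∣d : prodFin q ∣ d
      prodFin-q∣d = prodFin-distinct-∣ q q-injective (λ i → prs (at i)) d (λ i → p∣d (at i))

      d-aliquot : AliquotNumber E D d
      d-aliquot = subst (AliquotNumber E D) q≡d q-aliquot
        where
        arrow′ : Arrow D n (n * prodFin q)
        arrow′ = part-b n (prodFin q) n∈S q-aliquot (NC.coprime⇒gcd≡1 (λ (y∣n , y∣f) → cop (y∣n , ND.∣-trans y∣f prodFin-q∣d)))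
        q≡d : prodFin q ≡ d
        q≡d = [ (λ h → ⊥-elim (proj₁ (proj₂ (proj₂ (proj₂ arrow′))) (sym h))) , NP.*-cancelˡ-≡ (prodFin q) d n ]′
          (minimal (n * prodFin q) (proj₁ (proj₂ arrow′)) (ND.m∣m*n (prodFin q)) (ND.*-monoʳ-∣ n prodFin-q∣d))

    part-d : AliquotNumber E D d
    part-d = conclude (argmin p)
      where
      conclude : (∃[ i ] ∀ j → p i ≤ p j) → AliquotNumber E D d
      -- The fraction a/b that witnesses the bound at the least prime serves them all, since a/b ≤
      -- √p only weakens as p grows.
      conclude (i , least-i) = Cycle.d-aliquot (λ i → proj₁ (some-prime i)) (λ i → ND.quotient (proj₂ (some-prime i)))
        (λ i → subst (IsRank D (p i)) (ND._∣_.equality (proj₂ (some-prime i))) (rank i))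
        (proj₁ (above i)) (proj₁ (proj₂ (above i))) (proj₁ (proj₂ (proj₂ (above i))))
        (λ j → NP.≤-trans (proj₁ (proj₂ (proj₂ (proj₂ (above i))))) (NP.*-monoˡ-≤ _ (least-i j))) (proj₂ (proj₂ (proj₂ (proj₂ (above i))))) (first-return _)

-- Assembly of the local results at all primes

even-or-odd : ∀ n → ∃[ m ] (n ≡ m + m ⊎ suc n ≡ m + m)
even-or-odd zero = 0 , inj₁ refl
even-or-odd (suc n) with even-or-odd n
... | m , inj₁ e = suc m , inj₂ (trans (cong (λ i → suc (suc i)) e) (cong suc (sym (NP.+-suc m m))))
... | m , inj₂ e = m , inj₁ e

odd-prime : ∀ {p} → Prime p → p ≢ 2 → ∃[ m ] suc p ≡ m + m
odd-prime {p} pr p≢2 with even-or-odd p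
... | m , inj₂ e = m , e
... | m , inj₁ e = ⊥-elim (p≢2 (sym (prime∣prime prime[2] pr (ND.divides m (trans e (trans (cong (λ i → m + i) (sym (NP.+-identityʳ m))) (NP.*-comm 2 m)))))))

theorem3 : (E : Weierstrass) → IsElliptic E → IsGlobalMinimal E →
    (x y : ℚ) → OnCurve E x y → InfiniteOrder E (just (x , y)) →
    (D : ℕ → ℕ) → IsEDS E (just (x , y)) D → Regular E (just (x , y)) D →
    -- (a)
    (∀ n p → InS D n → Prime p → p ∣ D n → Arrow D n (n * p)) ×
    -- (b)
    (∀ n d → InS D n → AliquotNumber E D d → gcd n d ≡ 1 → Arrow D n (n * d)) ×
    -- (c)
    (∀ n p → 7 ≤ p → Prime p → GoodReduction E p → Arrow D n (n * p) →
      (p ∣ D n) ⊎ AliquotNumber E D p) ×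
    -- (d)  d = p₀ ⋯ p_{k+1}, i.e. ℓ = k + 2 ≥ 2 distinct primes
    (∀ n d k (p : Fin (suc (suc k)) → ℕ) → Injective _≡_ _≡_ p →
      (∀ i → Prime (p i)) → (∀ i → GoodReduction E (p i)) →
      d ≡ prodFin p → gcd n d ≡ 1 → Arrow D n (n * d) →
      (∀ i → AboveBound (suc (suc k)) (p i)) →
      AliquotNumber E D d)
theorem3 E ell _ x y on inf D eds (_ , reg) = part-a , part-b , part-c , λ n d k p inj prs good d≡ gcd≡1 arrow above → PartD.part-d n d k p inj prs good d≡ gcd≡1 arrow above
  where
  module G {p} (pr : Prime p) = Global.AtPrime E ell x y on inf D eds reg pr (residue-field pr)

  period : ∀ {p} → Prime p → ∀ r n → 1 ≤ r → 1 ≤ n → p ∣ D r → p ∣ D (n + r) → p ∣ D n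
  period {p} pr r n 1≤r 1≤n d h = subst (_∣ D n) (NP.*-identityʳ p) (proj₂ (G.period pr 0 r n 1≤r 1≤n (p^1∣ (D r) d)) (p^1∣ (D (n + r)) h))
    where
    p^1∣ : ∀ m → p ∣ m → p ^ 1 ∣ m
    p^1∣ m = subst (_∣ m) (sym (NP.*-identityʳ p))

  hasse : ∀ {p} → Prime p → p ≢ 2 → ∀ r → IsRank D p (suc r) → ∀ n → n * r ≤ p + n * p + n * n
  hasse {p} pr p≢2 r rank = G.Hasse.hasse pr {proj₁ (odd-prime pr p≢2)} (proj₂ (odd-prime pr p≢2)) (λ d → p≢2 (prime∣2 (ZD.∣⇒∣ᵤ d))) r rank
    where
    prime∣2 : p ∣ 2 → p ≡ 2
    prime∣2 = prime∣prime pr prime[2]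

  open IndexDivisibility E D period (λ pr → G.multiples pr) (λ pr → G.Lift.lift pr) hasse
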